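{- Let $k$ be a field. If $P$ is a Gorenstein* (over $k$) simplicial poset of rank $d$ and $h_i(P)=0$ for some $i$ between $0$ and $d$, then $\sum_{i=0}^d h_i(P)$ is even. Equivalently, the number of facets $f_{d-1}(P)$ is even, since $f_{d-1}=\sum_{i=0}^d h_i$.
   Context: A simplicial poset $P$ is a finite poset with a smallest element $\hat 0$ such that every interval $[\hat 0,y]$ for $y\in P$ is a boolean algebra. An element $y$ has rank $i$ if $[\hat 0,y]$ is isomorphic to the boolean algebra of rank $i$. The rank $d$ of $P$ is the maximum rank of its elements. The $f$-vector is $(f_0,\dots,f_{d-1})$ with $f_i=\#\{y\in P\mid \operatorname{rank} y=i+1\}$ and $f_{ -1}=1$. The $h$-vector $(h_0,\dots,h_d)$ is defined by $\sum_{i=0}^d f_{i-1}(t-1)^{d-i}=\sum_{i=0}^d h_i t^{d-i}$; in particular $h_0=1$ and $f_{d-1}=\sum_i h_i$. $P$ is Gorenstein* over a field $k$ if the order complex $\Delta(\overline P)$ of $\overline P=P\setminus\{\hat 0\}$ (the simplicial complex whose faces are the chains of $\overline P$) is Gorenstein* over $k$. For example, this holds if the associated CW-complex $\Gamma(P)$ is homeomorphic to a $(d-1)$-sphere. -}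

module Defs where

open import Level using (Level; _⊔_) renaming (suc to lsuc)
open import Data.Bool using (Bool; true; false; _∧_; _∨_; not; if_then_else_)
open import Data.Nat using (ℕ; zero; suc; _≡ᵇ_; _<ᵇ_; _∸_; _≤_)
  renaming (_+_ to _+ℕ_; _⊔_ to _⊔ℕ_)
open import Data.Nat.Combinatorics using (_C_)
open import Data.Fin using (Fin; toℕ)
open import Data.Fin.Subset using (Subset; _⊆_; ∣_∣; _∪_; ⁅_⁆)
open import Data.Vec using (Vec; []; _∷_; lookup)
open import Data.List using (List; []; _∷_; map; foldr; allFin; _++_)
open import Data.Integer using (ℤ; +_) renaming (_+_ to _+ℤ_; _*_ to _*ℤ_; -_ to -ℤ_)
open import Data.Product using (Σ; ∃; _×_; proj₁)
open import Relation.Binary.PropositionalEquality using (_≡_)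
open import Relation.Nullary using (¬_)
open import Algebra.Bundles using (CommutativeRing)

record Field (c ℓ : Level) : Set (lsuc (c ⊔ ℓ)) where
  field
    commutativeRing : CommutativeRing c ℓ
  open CommutativeRing commutativeRing public
  field
    0≉1     : ¬ (0# ≈ 1#)
    inverse : ∀ x → ¬ (x ≈ 0#) → ∃ λ y → x * y ≈ 1#

record FinPoset : Set where
  field
    n       : ℕ
    le      : Fin n → Fin n → Bool
    le-refl : ∀ x → le x x ≡ true
    le-anti : ∀ x y → le x y ≡ true → le y x ≡ true → x ≡ y
    le-trans : ∀ x y z → le x y ≡ true → le y z ≡ true → le x z ≡ true

-- An order isomorphism between the lower interval [bot , y] of P
-- (bot being the least element) and the boolean algebra of subsets of
-- Fin i ordered by inclusion.  Since bot is least, [bot , y] = {x | x ≤ y}.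
record IsBooleanInterval (P : FinPoset) (y : Fin (FinPoset.n P)) (i : ℕ) : Set where
  open FinPoset P
  field
    φ       : Fin n → Subset i
    ψ       : Subset i → Fin n
    ψ-below : ∀ s → le (ψ s) y ≡ true
    φψ      : ∀ s → φ (ψ s) ≡ s
    ψφ      : ∀ x → le x y ≡ true → ψ (φ x) ≡ x
    φ-mono  : ∀ x x' → le x y ≡ true → le x' y ≡ true →
              le x x' ≡ true → φ x ⊆ φ x'
    φ-refl  : ∀ x x' → le x y ≡ true → le x' y ≡ true →
              φ x ⊆ φ x' → le x x' ≡ true

record SimplicialPoset : Set where
  field
    poset     : FinPoset
  open FinPoset poset public
  field
    bot       : Fin n
    bot-least : ∀ x → le bot x ≡ true
    boolean   : ∀ y → Σ ℕ (IsBooleanInterval poset y)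

  -- rank of y: the i with [bot , y] ≅ B_i (unique, as B_i has 2^i elements)
  rank : Fin n → ℕ
  rank y = proj₁ (boolean y)

IsRank : SimplicialPoset → ℕ → Set
IsRank P d = (∃ λ y → rank y ≡ d) × (∀ y → rank y ≤ d)
  where open SimplicialPoset P

countℕ : ∀ {n} → (Fin n → Bool) → ℕ
countℕ {n} p = foldr (λ x acc → if p x then suc acc else acc) 0 (allFin n)

-- fvec P j = f_{j-1}(P) = number of elements of rank j  (fvec P 0 = 1)
fvec : SimplicialPoset → ℕ → ℕ
fvec P j = countℕ (λ y → rank y ≡ᵇ j)
  where open SimplicialPoset P

signℤ : ℕ → ℤ
signℤ zero    = + 1
signℤ (suc k) = -ℤ (signℤ k)

sumℤ : ℕ → (ℕ → ℤ) → ℤ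
sumℤ zero    g = + 0
sumℤ (suc m) g = sumℤ m g +ℤ g m

-- h_i, the coefficient of t^(d-i) in  Σ_{j=0}^{d} f_{j-1} (t-1)^(d-j),
-- i.e. h_i = Σ_{j=0}^{i} (-1)^(i-j) binom(d-j, i-j) f_{j-1}.
hvec : SimplicialPoset → ℕ → ℕ → ℤ
hvec P d i = sumℤ (suc i) (λ j → signℤ (i ∸ j) *ℤ (+ ((d ∸ j) C (i ∸ j))) *ℤ (+ fvec P j))

_∈ᵇ_ : ∀ {n} → Fin n → Subset n → Bool
x ∈ᵇ S = lookup S x

allSubsets : ∀ n → List (Subset n)
allSubsets zero    = [] ∷ []
allSubsets (suc n) = map (false ∷_) (allSubsets n) ++ map (true ∷_) (allSubsets n)

allᵇ : ∀ {A : Set} → (A → Bool) → List A → Bool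
allᵇ p = foldr (λ a b → p a ∧ b) true

-- The order complex Δ(P̄) of P̄ = P ∖ {bot}: faces are the chains of P̄,
-- encoded as subsets of the carrier Fin n.

isOrderFace : (P : SimplicialPoset) → Subset (SimplicialPoset.n P) → Bool
isOrderFace P S =
  not (bot ∈ᵇ S) ∧
  allᵇ (λ x → allᵇ (λ y → not (x ∈ᵇ S ∧ y ∈ᵇ S) ∨ le x y ∨ le y x) (allFin n)) (allFin n)
  where open SimplicialPoset P

inLink : ∀ {n} → (Subset n → Bool) → Subset n → Subset n → Bool
inLink {n} face F G = face (F ∪ G) ∧ allᵇ (λ x → not (x ∈ᵇ F ∧ x ∈ᵇ G)) (allFin n)

-- maximal cardinality of a face (= dimension + 1; 0 for the complex {∅})
maxFaceSize : ∀ {n} → (Subset n → Bool) → ℕ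
maxFaceSize {n} face =
  foldr (λ G acc → if face G then ∣ G ∣ ⊔ℕ acc else acc) 0 (allSubsets n)

-- Reduced simplicial homology over a field K, of a complex on vertex set
-- Fin n given by a face predicate.  A chain is a function Subset n → K;
-- an m-chain is supported on faces with m vertices (homological degree
-- m - 1; m = 0 is the augmentation degree -1 spanned by the empty face).
-- Vertices are oriented by the order of Fin n.

module Homology {c ℓ : Level} (K : Field c ℓ) {n : ℕ} (face : Subset n → Bool) where
  open Field K

  sumK : List (Fin n) → (Fin n → Carrier) → Carrier
  sumK xs g = foldr (λ x acc → g x + acc) 0# xs

  signK : ℕ → Carrier
  signK zero    = 1#
  signK (suc k) = - signK k

  ∂ : (Subset n → Carrier) → Subset n → Carrier
  ∂ ch T = sumK (allFin n) (λ x →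
    if x ∈ᵇ T then 0#
    else signK (countℕ (λ t → t ∈ᵇ T ∧ (toℕ t <ᵇ toℕ x))) * ch (T ∪ ⁅ x ⁆))

  IsChain : ℕ → (Subset n → Carrier) → Set ℓ
  IsChain m ch = ∀ S → ¬ (face S ≡ true × ∣ S ∣ ≡ m) → ch S ≈ 0#

  IsCycle : (Subset n → Carrier) → Set ℓ
  IsCycle ch = ∀ T → ∂ ch T ≈ 0#

  IsBoundary : ℕ → (Subset n → Carrier) → Set (c ⊔ ℓ)
  IsBoundary m ch = ∃ λ b → IsChain (suc m) b × (∀ T → ∂ b T ≈ ch T)

  -- H̃_{m-1} = 0
  HomologyVanishes : ℕ → Set (c ⊔ ℓ)
  HomologyVanishes m = ∀ ch → IsChain m ch → IsCycle ch → IsBoundary m ch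

  -- H̃_{m-1} ≅ K  (one-dimensional)
  HomologyIsField : ℕ → Set (c ⊔ ℓ)
  HomologyIsField m =
    ∃ λ z → IsChain m z × IsCycle z × ¬ IsBoundary m z ×
      (∀ ch → IsChain m ch → IsCycle ch →
         ∃ λ a → IsBoundary m (λ T → ch T + - (a * z T)))

-- Gorenstein* over K (Stanley's homological characterization): for every
-- face F (including ∅), H̃_i(lk F; K) ≅ K if i = dim lk F, and 0 otherwise.
IsGorensteinStar : ∀ {c ℓ} → Field c ℓ → ∀ {n} → (Subset n → Bool) → Set (c ⊔ ℓ)
IsGorensteinStar K {n} face =
  ∀ F → face F ≡ true → ∀ m →
    (m ≡ maxFaceSize (inLink face F) → HomologyIsField (inLink face F) m) ×
    (¬ (m ≡ maxFaceSize (inLink face F)) → HomologyVanishes (inLink face F) m)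
  where open Homology K

IsGorensteinStarPoset : ∀ {c ℓ} → Field c ℓ → SimplicialPoset → Set (c ⊔ ℓ)
IsGorensteinStarPoset K P = IsGorensteinStar K (isOrderFace P)

{-# OPTIONS --safe #-}

-- Let h_e = 0 and i = d − e.  Homology of links in the order complex shows that the cellular cohomology of P relative
-- to the faces not containing a given vertex set vanishes below the top degree, first over the given field, then over ℤ
-- up to torsion and hence over ℚ, and that P carries an integral top cycle ε with coefficient ±1 on every facet.
--
-- Over ℚ take i + 1 linear forms in general position.  Cellular cochains of total degree e with divided-power
-- coefficients in i + 1 variables form a complex that is exact below its top degree e, and its Euler characteristic is
-- ±h_e = 0.  So it is also exact at the top, which says dually that a chain on the faces of rank e is zero as soon as
-- the boundary weighted by each of the i + 1 forms kills it.  Weighted boundaries anticommute, so starting from ε (which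
-- is killed by the form 1) and applying the boundaries of the i other forms gives such a chain.  It therefore vanishes.
--
-- The forms can be chosen integral, in general position modulo an odd number, but congruent modulo 2 to the indicators
-- of arbitrary vertices w₁, …, wᵢ.  Modulo 2 the vanishing then says that the number of facets T arising from a face H
-- by adjoining w₁, …, wᵢ is even, and every facet is counted exactly once if the wⱼ run over its i largest vertices.

module Submission where

open import Defs
open import Level using (Level; _⊔_; 0ℓ)
import Level
open import Algebra.Bundles using (CommutativeRing)
open import Data.Bool using (Bool; true; false; _∧_; _∨_; not; if_then_else_)
import Data.Bool.Properties as Bₚ
open import Data.Nat using (ℕ; zero; suc; _≤_; _<_; z≤n; s≤s; _∸_; _≡ᵇ_; _<ᵇ_; _!)
import Data.Nat as ℕ
import Data.Nat.Properties as ℕₚ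
import Data.Nat.GCD as GCD
import Data.Nat.Divisibility as ℕᵈ
open import Data.Nat.Combinatorics using (_C_; nCk+nC[k+1]≡[n+1]C[k+1]; k>n⇒nCk≡0)
open import Data.Integer using (ℤ; +_; -[1+_])
import Data.Integer as ℤ
import Data.Integer.Properties as ℤₚ
open import Data.Integer.Divisibility using (_∣_)
open import Data.Rational using (ℚ)
import Data.Rational as ℚ
import Data.Rational.Properties as ℚₚ
import Data.Rational.Unnormalised as ℚᵘ
import Data.Rational.Unnormalised.Properties as ℚᵘₚ
open import Data.Fin using (Fin; zero; suc; toℕ; fromℕ<)
import Data.Fin.Properties as Fₚ
open import Data.Fin.Subset using (Subset; ∣_∣; _∪_; ⁅_⁆; ⊥)
import Data.Fin.Subset as Sub
import Data.Fin.Subset.Properties as Subₚ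
open import Data.Vec using (Vec; []; _∷_; lookup; tabulate; _[_]≔_)
import Data.Vec.Properties as Vₚ
open import Data.List using (List; []; _∷_; map; foldr; allFin; _++_; length)
import Data.List as L
import Data.List.Properties as Lₚ
open import Data.List.Membership.Propositional using () renaming (_∈_ to _∈ˡ_)
open import Data.List.Membership.Propositional.Properties using (∈-++⁺ˡ; ∈-++⁺ʳ; ∈-++⁻; ∈-map⁺; ∈-map⁻; ∈-concat⁺′; ∈-concat⁻′; ∈-tabulate⁺; ∈-tabulate⁻; ∈-lookup)
open import Data.List.Relation.Unary.Unique.Propositional using (Unique)
import Data.List.Relation.Unary.Unique.Propositional.Properties as Uniqueₚ
open import Data.List.Relation.Unary.AllPairs using ([]; _∷_)
import Data.List.Relation.Unary.AllPairs.Properties as AllPairsₚ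
import Data.List.Relation.Unary.All.Properties as Allₚ
import Data.List.Relation.Unary.Any as Any
import Data.List.Relation.Unary.Any.Properties as Anyₚ
open import Data.List.Relation.Unary.Any using (here; there)
open import Data.List.Relation.Unary.All using ([]; _∷_)
import Data.List.Relation.Unary.All as All
open import Data.Product using (∃; _×_; _,_; proj₁; proj₂)
open import Data.Sum using (_⊎_; inj₁; inj₂)
open import Data.Empty using () renaming (⊥ to Void; ⊥-elim to absurd)
open import Data.Unit using (⊤; tt)
open import Data.Maybe using (Maybe; just; nothing)
open import Function using (_∘_; id; _$_)
open import Relation.Nullary using (¬_; Dec; yes; no; does)
open import Relation.Nullary.Decidable using (decidable-stable; dec-true; dec-false; _×-dec_; ¬?)
open import Relation.Binary.PropositionalEquality using (_≡_; _≢_; refl; sym; trans; cong; cong₂; subst; module ≡-Reasoning)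
open import Relation.Binary using (tri<; tri≈; tri>)
import Relation.Binary.Reasoning.Setoid as SetoidReasoning
import Algebra.Solver.Ring as RingSolver
open import Algebra.Solver.Ring.AlmostCommutativeRing using (fromCommutativeRing; _-Raw-AlmostCommutative⟶_)

-- The given field may have any characteristic and its equality is not decidable, so it is left as
-- early as possible. Exactness over it yields, for each integral cocycle, a multiple that is an
-- integral coboundary, the factor being an integer that is nonzero in the field. This takes pivots,
-- whose existence is settled only under double negation; the conclusion, divisibility by 2, is
-- decidable and escapes it. Over `ℚ` equality is decidable and a sum of squares vanishes only
-- trivially, so the Euler characteristic can be exploited by counting linear equations for a
-- harmonic cochain, without dimensions of homology groups. The number i + 1 of forms is forced from
-- two sides: there are binom(d - r, e - r) monomials of degree e - r in i + 1 variables, up to sign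
-- the coefficient of the faces of rank r in h_e; and exactness at rank j asks for j + (i + 1) ≤ d,
-- which is the condition j < e. The indicators alone are far from general position. The odd modulus
-- gives the room that is missing: general position is tested modulo it, while the residues modulo 2
-- stay free.

variable
  N : ℕ
  ℓ₁ ℓ₂ : Level
  𝒜 : Set ℓ₁
  ℬ : Set ℓ₂

-- Double negation and Boolean preliminaries

infixl 1 _>>=_

_>>=_ : ¬ ¬ 𝒜 → (𝒜 → ¬ ¬ ℬ) → ¬ ¬ ℬ
(m >>= f) k = m λ x → f x k

return : 𝒜 → ¬ ¬ 𝒜
return x k = k x

¬¬-lem : ¬ ¬ (𝒜 ⊎ ¬ 𝒜)
¬¬-lem k = k (inj₂ λ x → k (inj₁ x))

-- Finiteness of the index set makes this work; it settles finitely many undecidable questions about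
-- the field at once.
¬¬-∀ : ∀ {N} {P : Fin N → Set ℓ₁} → (∀ i → ¬ ¬ P i) → ¬ ¬ (∀ i → P i)
¬¬-∀ {N = zero}  h = return λ ()
¬¬-∀ {N = suc N} h = h zero >>= λ p₀ → ¬¬-∀ (λ i → h (suc i)) >>= λ p →
  return λ { zero → p₀ ; (suc i) → p i }

true≢false : ∀ {x} → x ≡ true → x ≡ false → Void
true≢false refl ()

∧-true : ∀ {x y} → x ∧ y ≡ true → x ≡ true × y ≡ true
∧-true {true} {true} _ = refl , refl

∧-intro : ∀ {x y} → x ≡ true → y ≡ true → x ∧ y ≡ true
∧-intro refl refl = refl

not-true : ∀ {x} → not x ≡ true → x ≡ false
not-true {false} _ = refl

bool-ext : ∀ {x y} → (x ≡ true → y ≡ true) → (y ≡ true → x ≡ true) → x ≡ y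
bool-ext {true}  {true}  f g = refl
bool-ext {false} {false} f g = refl
bool-ext {true}  {false} f g = sym (f refl)
bool-ext {false} {true}  f g = g refl

does-true : {P : Set ℓ₁} (p? : Dec P) → does p? ≡ true → P
does-true (yes p) _ = p

<ᵇ-true : ∀ {m N} → m < N → (m <ᵇ N) ≡ true
<ᵇ-true {m} {N} p with m <ᵇ N in eq | ℕₚ.<⇒<ᵇ p
... | true | _ = refl

<ᵇ-false : ∀ {m N} → ¬ m < N → (m <ᵇ N) ≡ false
<ᵇ-false {m} {N} p with m <ᵇ N in eq
... | false = refl
... | true = absurd (p (ℕₚ.<ᵇ⇒< m N (subst Data.Bool.T (sym eq) tt)))

<ᵇ⇒< : ∀ {m N} → (m <ᵇ N) ≡ true → m < N
<ᵇ⇒< {m} {N} p = ℕₚ.<ᵇ⇒< m N (subst Data.Bool.T (sym p) tt)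

≡ᵇ-true : ∀ {m N} → m ≡ N → (m ≡ᵇ N) ≡ true
≡ᵇ-true {zero} refl = refl
≡ᵇ-true {suc m} refl = ≡ᵇ-true {m} refl

≡ᵇ⇒≡ : ∀ {m N} → (m ≡ᵇ N) ≡ true → m ≡ N
≡ᵇ⇒≡ {m} {N} p = ℕₚ.≡ᵇ⇒≡ m N (subst Data.Bool.T (sym p) tt)

-- Subsets and counting

infix 4 _∈_ _∉_ _⊆_

_∈_ _∉_ : Fin N → Subset N → Set
x ∈ S = lookup S x ≡ true
x ∉ S = lookup S x ≡ false

-- The record, unlike the bare function type, lets both subsets be inferred from a proof of
-- inclusion.
record _⊆_ {N} (S T : Subset N) : Set where
  constructor incl
  field into : ∀ {x} → x ∈ S → x ∈ T
open _⊆_ public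

⊆⇒lib : {S T : Subset N} → S ⊆ T → S Sub.⊆ T
⊆⇒lib {T = T} h {x} p = Vₚ.lookup⇒[]= x T (into h (Vₚ.[]=⇒lookup p))

lib⇒⊆ : {S T : Subset N} → S Sub.⊆ T → S ⊆ T
lib⇒⊆ {S = S} h = incl λ {x} p → Vₚ.[]=⇒lookup (h (Vₚ.lookup⇒[]= x S p))

∈-or-∉ : (x : Fin N) (S : Subset N) → x ∈ S ⊎ x ∉ S
∈-or-∉ x S with lookup S x
... | true = inj₁ refl
... | false = inj₂ refl

subset-ext : {S T : Subset N} → (∀ x → lookup S x ≡ lookup T x) → S ≡ T
subset-ext {S = S} {T} h = trans (sym (Vₚ.tabulate∘lookup S)) (trans (Vₚ.tabulate-cong h) (Vₚ.tabulate∘lookup T))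

⊆-antisym : {S T : Subset N} → S ⊆ T → T ⊆ S → S ≡ T
⊆-antisym h k = subset-ext λ x → bool-ext (into h) (into k)

subset? : (S T : Subset N) → Dec (S ≡ T)
subset? = Vₚ.≡-dec Bₚ._≟_

lookup-⊥ : (y : Fin N) → lookup ⊥ y ≡ false
lookup-⊥ zero = refl
lookup-⊥ (suc y) = lookup-⊥ y

lookup-⁅⁆ : (x : Fin N) → lookup ⁅ x ⁆ x ≡ true
lookup-⁅⁆ zero = refl
lookup-⁅⁆ (suc x) = lookup-⁅⁆ x

lookup-⁅⁆′ : {x y : Fin N} → y ≢ x → lookup ⁅ x ⁆ y ≡ false
lookup-⁅⁆′ {x = zero} {zero} h = absurd (h refl)
lookup-⁅⁆′ {x = zero} {suc y} h = lookup-⊥ y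
lookup-⁅⁆′ {x = suc x} {zero} h = refl
lookup-⁅⁆′ {x = suc x} {suc y} h = lookup-⁅⁆′ (h ∘ cong suc)

ins rem : Subset N → Fin N → Subset N
ins S x = S ∪ ⁅ x ⁆
rem S x = S [ x ]≔ false

∈-ins : (S : Subset N) (x : Fin N) → x ∈ ins S x
∈-ins S x = trans (Vₚ.lookup-zipWith _∨_ x S ⁅ x ⁆) (trans (cong (lookup S x ∨_) (lookup-⁅⁆ x)) (Bₚ.∨-zeroʳ _))

lookup-ins : (S : Subset N) {x y : Fin N} → y ≢ x → lookup (ins S x) y ≡ lookup S y
lookup-ins S {x} {y} h = trans (Vₚ.lookup-zipWith _∨_ y S ⁅ x ⁆) (trans (cong (lookup S y ∨_) (lookup-⁅⁆′ h)) (Bₚ.∨-identityʳ _))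

∉-rem : (S : Subset N) (x : Fin N) → x ∉ rem S x
∉-rem S x = Vₚ.lookup∘update x S false

lookup-rem : (S : Subset N) {x y : Fin N} → y ≢ x → lookup (rem S x) y ≡ lookup S y
lookup-rem S h = Vₚ.lookup∘update′ h S false

⊆-refl : {S : Subset N} → S ⊆ S
⊆-refl = incl id

⊆-trans : {S T U : Subset N} → S ⊆ T → T ⊆ U → S ⊆ U
⊆-trans h k = incl λ p → into k (into h p)

⊆-reflexive : {S T : Subset N} → S ≡ T → S ⊆ T
⊆-reflexive refl = ⊆-refl

⊥-⊆ : {S : Subset N} → ⊥ ⊆ S
⊥-⊆ = incl λ {x} p → absurd (true≢false p (lookup-⊥ x))

⁅⁆-⊆ : {S : Subset N} {k : Fin N} → k ∈ S → ⁅ k ⁆ ⊆ S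
⁅⁆-⊆ {S = S} {k} q = incl λ {z} → case z
  where
  case : ∀ z → z ∈ ⁅ k ⁆ → z ∈ S
  case z r with z Fₚ.≟ k
  ... | yes refl = q
  ... | no e = absurd (true≢false r (lookup-⁅⁆′ e))

∈-≢ : {S : Subset N} {x y : Fin N} → x ∈ S → y ∉ S → x ≢ y
∈-≢ p q refl = true≢false p q

⊆-ins : (S : Subset N) (x : Fin N) → S ⊆ ins S x
⊆-ins S x = incl λ {y} → case y
  where
  case : ∀ y → y ∈ S → y ∈ ins S x
  case y p with y Fₚ.≟ x
  ... | yes refl = ∈-ins S x
  ... | no h = trans (lookup-ins S h) p

ins-⊆ : {S T : Subset N} {x : Fin N} → S ⊆ T → x ∈ T → ins S x ⊆ T
ins-⊆ {S = S} {T} {x} h q = incl λ {y} → case y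
  where
  case : ∀ y → y ∈ ins S x → y ∈ T
  case y p with y Fₚ.≟ x
  ... | yes refl = q
  ... | no e = into h (trans (sym (lookup-ins S e)) p)

rem-⊆ : (S : Subset N) (x : Fin N) → rem S x ⊆ S
rem-⊆ S x = incl λ {y} → case y
  where
  case : ∀ y → y ∈ rem S x → y ∈ S
  case y p with y Fₚ.≟ x
  ... | yes refl = absurd (true≢false p (∉-rem S x))
  ... | no h = trans (sym (lookup-rem S h)) p

∈-rem : (S : Subset N) {x y : Fin N} → y ∈ S → y ≢ x → y ∈ rem S x
∈-rem S p h = trans (lookup-rem S h) p

⊆-rem : {S T : Subset N} {x : Fin N} → S ⊆ T → x ∉ S → S ⊆ rem T x
⊆-rem {S = S} {T} h q = incl λ p → ∈-rem T (into h p) (∈-≢ {S = S} p q)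

private
  by-cases : {S T : Subset N} (x : Fin N) → lookup S x ≡ lookup T x → (∀ y → y ≢ x → lookup S y ≡ lookup T y) → S ≡ T
  by-cases x p q = subset-ext λ y → case y
    where
    case : ∀ y → _
    case y with y Fₚ.≟ x
    ... | yes refl = p
    ... | no h = q y h

ins-rem : (S : Subset N) {x : Fin N} → x ∈ S → ins (rem S x) x ≡ S
ins-rem S {x} p = by-cases x (trans (∈-ins (rem S x) x) (sym p)) λ y h → trans (lookup-ins (rem S x) h) (lookup-rem S h)

rem-ins : (S : Subset N) {x : Fin N} → x ∉ S → rem (ins S x) x ≡ S
rem-ins S {x} p = by-cases x (trans (∉-rem (ins S x) x) (sym p)) λ y h → trans (lookup-rem (ins S x) h) (lookup-ins S h)

ins-comm : (S : Subset N) (x y : Fin N) → ins (ins S x) y ≡ ins (ins S y) x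
ins-comm S x y = by-cases x (trans lemma (sym (∈-ins (ins S y) x))) λ z h → other z h
  where
  lemma : x ∈ ins (ins S x) y
  lemma = into (⊆-ins (ins S x) y) (∈-ins S x)
  other : ∀ z → z ≢ x → _
  other z h with z Fₚ.≟ y
  ... | yes refl = trans (∈-ins (ins S x) z) (sym (into (⊆-ins (ins S z) x) (∈-ins S z)))
  ... | no k = trans (lookup-ins (ins S x) k) (trans (lookup-ins S h) (sym (trans (lookup-ins (ins S y) h) (lookup-ins S k))))

rem-comm : (S : Subset N) (x y : Fin N) → rem (rem S x) y ≡ rem (rem S y) x
rem-comm S x y with x Fₚ.≟ y
... | yes refl = refl
... | no h = Vₚ.[]≔-commutes S x y h

rem-ins-comm : (S : Subset N) {x y : Fin N} → x ≢ y → rem (ins S x) y ≡ ins (rem S y) x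
rem-ins-comm S {x} {y} h = by-cases y (trans (∉-rem (ins S x) y) (sym (trans (lookup-ins (rem S y) (h ∘ sym)) (∉-rem S y))))
  λ z k → trans (lookup-rem (ins S x) k) (other z k)
  where
  other : ∀ z → z ≢ y → lookup (ins S x) z ≡ lookup (ins (rem S y) x) z
  other z k with z Fₚ.≟ x
  ... | yes refl = trans (∈-ins S z) (sym (∈-ins (rem S y) z))
  ... | no l = trans (lookup-ins S l) (sym (trans (lookup-ins (rem S y) l) (lookup-rem S k)))

b2n : Bool → ℕ
b2n true = 1
b2n false = 0

# : (Fin N → Bool) → ℕ
# {N = zero} p = 0
# {N = suc N} p = b2n (p zero) ℕ.+ # (p ∘ suc)

#-cong : {p q : Fin N → Bool} → (∀ x → p x ≡ q x) → # p ≡ # q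
#-cong {N = zero} h = refl
#-cong {N = suc N} h = cong₂ ℕ._+_ (cong b2n (h zero)) (#-cong (h ∘ suc))

#-upd : {p q : Fin N → Bool} (x : Fin N) → p x ≡ false → q x ≡ true → (∀ y → y ≢ x → p y ≡ q y) → # q ≡ suc (# p)
#-upd {p = p} {q} zero px qx h rewrite px | qx = cong suc (sym (#-cong λ y → h (suc y) λ ()))
#-upd {p = p} {q} (suc x) px qx h rewrite h zero (λ ()) =
  trans (cong (b2n (q zero) ℕ.+_) (#-upd x px qx λ y k → h (suc y) λ e → k (Fₚ.suc-injective e))) (ℕₚ.+-suc _ _)

#-mono : {p q : Fin N → Bool} → (∀ x → p x ≡ true → q x ≡ true) → # p ≤ # q
#-mono {N = zero} h = z≤n
#-mono {N = suc N} {p} {q} h = ℕₚ.+-mono-≤ (lemma (p zero) (q zero) (h zero)) (#-mono (h ∘ suc))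
  where
  lemma : ∀ x y → (x ≡ true → y ≡ true) → b2n x ≤ b2n y
  lemma false y _ = z≤n
  lemma true y h rewrite h refl = s≤s z≤n

#-none : {p : Fin N → Bool} → (∀ x → p x ≡ false) → # p ≡ 0
#-none {N = zero} h = refl
#-none {N = suc N} {p} h rewrite h zero = #-none (h ∘ suc)

#-bij : ∀ {r} (p : Fin N → Bool) (g : Fin r → Fin N) → (∀ i j → g i ≡ g j → i ≡ j) →
        (∀ i → p (g i) ≡ true) → (∀ x → p x ≡ true → ∃ λ i → g i ≡ x) → # p ≡ r
#-bij {r = zero} p g inj hit sur = #-none λ x → case x (p x) refl
  where
  case : ∀ x v → p x ≡ v → v ≡ false
  case x true e with sur x e
  ... | () , _
  case x false e = refl
#-bij {r = suc r} p g inj hit sur =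
  trans (#-upd (g zero) atzero (hit zero) off) (cong suc (#-bij p′ (g ∘ suc) (λ i j e → Fₚ.suc-injective (inj _ _ e)) hit′ sur′))
  where
  p′ : _ → Bool
  p′ x = not (does (x Fₚ.≟ g zero)) ∧ p x
  atzero : p′ (g zero) ≡ false
  atzero rewrite dec-true (g zero Fₚ.≟ g zero) refl = refl
  off : ∀ y → y ≢ g zero → p′ y ≡ p y
  off y h rewrite dec-false (y Fₚ.≟ g zero) h = refl
  hit′ : ∀ i → p′ (g (suc i)) ≡ true
  hit′ i = trans (off _ λ e → case (inj _ _ e)) (hit (suc i))
    where
    case : suc i ≡ zero → Void
    case ()
  sur′ : ∀ x → p′ x ≡ true → ∃ λ i → g (suc i) ≡ x
  sur′ x e with x Fₚ.≟ g zero
  sur′ x () | yes _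
  sur′ x e | no h with sur x e
  ... | zero , q = absurd (h (sym q))
  ... | suc i , q = i , q

∣∣≡# : (S : Subset N) → ∣ S ∣ ≡ # (lookup S)
∣∣≡# [] = refl
∣∣≡# (true ∷ S) = cong suc (∣∣≡# S)
∣∣≡# (false ∷ S) = ∣∣≡# S

countℕ≡# : (p : Fin N → Bool) → countℕ p ≡ # p
countℕ≡# {N} p = go N id
  where
  go : ∀ m (f : Fin m → Fin N) → foldr (λ x acc → if p x then suc acc else acc) 0 (L.tabulate f) ≡ # (p ∘ f)
  go zero f = refl
  go (suc m) f with p (f zero)
  ... | true = cong suc (go m (f ∘ suc))
  ... | false = go m (f ∘ suc)

∣ins∣ : (S : Subset N) {x : Fin N} → x ∉ S → ∣ ins S x ∣ ≡ suc ∣ S ∣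
∣ins∣ S {x} h = trans (∣∣≡# (ins S x)) (trans (#-upd x h (∈-ins S x) λ y k → sym (lookup-ins S k)) (cong suc (sym (∣∣≡# S))))

∣rem∣ : (S : Subset N) {x : Fin N} → x ∈ S → ∣ S ∣ ≡ suc ∣ rem S x ∣
∣rem∣ S {x} h = trans (cong ∣_∣ (sym (ins-rem S h))) (∣ins∣ (rem S x) (∉-rem S x))

⊆-size : {S T : Subset N} → S ⊆ T → ∣ S ∣ ≤ ∣ T ∣
⊆-size {S = S} {T} h = ℕₚ.≤-trans (ℕₚ.≤-reflexive (∣∣≡# S)) (ℕₚ.≤-trans (#-mono {p = lookup S} {lookup T} λ x → into h) (ℕₚ.≤-reflexive (sym (∣∣≡# T))))

missing : (S T : Subset N) → (∃ λ x → x ∈ T × x ∉ S) ⊎ T ⊆ S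
missing S T with Fₚ.any? (λ x → (lookup T x Bₚ.≟ true) ×-dec (lookup S x Bₚ.≟ false))
... | yes (x , p) = inj₁ (x , p)
... | no h = inj₂ (incl λ {x} p → case x p)
  where
  case : ∀ x → x ∈ T → x ∈ S
  case x p with ∈-or-∉ x S
  ... | inj₁ q = q
  ... | inj₂ q = absurd (h (x , p , q))

⊆-size-≡ : {S T : Subset N} → S ⊆ T → ∣ T ∣ ≤ ∣ S ∣ → S ≡ T
⊆-size-≡ {S = S} {T} h k with missing S T
... | inj₂ q = ⊆-antisym h q
... | inj₁ (x , p , q) = absurd (ℕₚ.<⇒≱ (ℕₚ.≤-trans (s≤s (⊆-size (⊆-rem {T = T} h q))) (ℕₚ.≤-reflexive (sym (∣rem∣ T p)))) k)

cnt : Fin N → Subset N → ℕ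
cnt v S = # (λ t → lookup S t ∧ (toℕ t <ᵇ toℕ v))

cnt-ins : (v : Fin N) (S : Subset N) {x : Fin N} → x ∉ S → cnt v (ins S x) ≡ b2n (toℕ x <ᵇ toℕ v) ℕ.+ cnt v S
cnt-ins v S {x} h with toℕ x <ᵇ toℕ v in eq
... | true = #-upd x (cong (_∧ _) h) (∧-intro (∈-ins S x) eq) λ y k → cong (_∧ _) (sym (lookup-ins S k))
... | false = #-cong λ y → case y
  where
  case : ∀ y → lookup (ins S x) y ∧ (toℕ y <ᵇ toℕ v) ≡ lookup S y ∧ (toℕ y <ᵇ toℕ v)
  case y with y Fₚ.≟ x
  ... | yes refl = trans (cong (lookup (ins S y) y ∧_) eq) (trans (Bₚ.∧-zeroʳ _) (sym (trans (cong (lookup S y ∧_) eq) (Bₚ.∧-zeroʳ _))))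
  ... | no k = cong (_∧ _) (lookup-ins S k)

-- Faces of a simplicial poset

module Faces (P : SimplicialPoset) where
  open SimplicialPoset P public

  infix 4 _≼_
  _≼_ : Fin n → Fin n → Set
  x ≼ y = le x y ≡ true

  ≼-trans : ∀ {x y z} → x ≼ y → y ≼ z → x ≼ z
  ≼-trans = le-trans _ _ _

  ≼-antisym : ∀ {x y} → x ≼ y → y ≼ x → x ≡ y
  ≼-antisym = le-anti _ _

  private module I y = IsBooleanInterval (proj₂ (boolean y))

  ψ : ∀ y → Subset (rank y) → Fin n
  ψ y = I.ψ y

  φ : ∀ y → Fin n → Subset (rank y)
  φ y = I.φ y

  ψ≼ : ∀ y s → ψ y s ≼ y
  ψ≼ y = I.ψ-below y

  ψφ : ∀ {y x} → x ≼ y → ψ y (φ y x) ≡ x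
  ψφ {y} {x} = I.ψφ y x

  φ-mono : ∀ {y x x'} → x' ≼ y → x ≼ x' → φ y x ⊆ φ y x'
  φ-mono {y} {x} {x'} p q = lib⇒⊆ (I.φ-mono y x x' (≼-trans q p) p q)

  ψ-mono : ∀ {y s s'} → s ⊆ s' → ψ y s ≼ ψ y s'
  ψ-mono {y} {s} {s'} h = I.φ-refl y _ _ (ψ≼ y s) (ψ≼ y s')
    (⊆⇒lib (⊆-trans (⊆-reflexive (I.φψ y s)) (⊆-trans h (⊆-reflexive (sym (I.φψ y s'))))))

  ψ-reflect : ∀ {y s s'} → ψ y s ≼ ψ y s' → s ⊆ s'
  ψ-reflect {y} {s} {s'} h = ⊆-trans (⊆-reflexive (sym (I.φψ y s))) (⊆-trans (φ-mono (ψ≼ y s') h) (⊆-reflexive (I.φψ y s')))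

  ψ-inj : ∀ {y s s'} → ψ y s ≡ ψ y s' → s ≡ s'
  ψ-inj {y} {s} {s'} e = trans (sym (I.φψ y s)) (trans (cong (φ y) e) (I.φψ y s'))

  ψ-⊥ : ∀ y → ψ y ⊥ ≡ bot
  ψ-⊥ y = ≼-antisym (subst (ψ y ⊥ ≼_) (ψφ (bot-least y)) (ψ-mono {y} ⊥-⊆)) (bot-least _)

  IsAtom : Fin n → Set
  IsAtom x = x ≢ bot × (∀ z → z ≼ x → z ≡ bot ⊎ z ≡ x)

  atom-single : ∀ {y x} → x ≼ y → IsAtom x → ∃ λ k → ψ y ⁅ k ⁆ ≡ x
  atom-single {y} {x} p (x≢ , h) with missing ⊥ (φ y x)
  ... | inj₂ q = absurd (x≢ (trans (sym (ψφ p)) (trans (cong (ψ y) (⊆-antisym q ⊥-⊆)) (ψ-⊥ y))))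
  ... | inj₁ (k , q , _) with h (ψ y ⁅ k ⁆) (subst (ψ y ⁅ k ⁆ ≼_) (ψφ p) (ψ-mono {y} (⁅⁆-⊆ q)))
  ... | inj₂ e = k , e
  ... | inj₁ e = absurd (true≢false (lookup-⁅⁆ k) (trans (cong (λ s → lookup s k) (ψ-inj {y} (trans e (sym (ψ-⊥ y))))) (lookup-⊥ k)))

  single-atom : ∀ y k → IsAtom (ψ y ⁅ k ⁆)
  single-atom y k = (λ e → true≢false (lookup-⁅⁆ k) (trans (cong (λ s → lookup s k) (ψ-inj {y} (trans e (sym (ψ-⊥ y))))) (lookup-⊥ k)))
    , λ z p → case z p (∈-or-∉ k (φ y z))
    where
    case : ∀ z → z ≼ ψ y ⁅ k ⁆ → k ∈ φ y z ⊎ k ∉ φ y z → z ≡ bot ⊎ z ≡ ψ y ⁅ k ⁆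
    case z p q = go q
      where
      z≼y : z ≼ y
      z≼y = ≼-trans p (ψ≼ y _)
      sub : φ y z ⊆ ⁅ k ⁆
      sub = ψ-reflect {y} (subst (_≼ ψ y ⁅ k ⁆) (sym (ψφ z≼y)) p)
      go : k ∈ φ y z ⊎ k ∉ φ y z → z ≡ bot ⊎ z ≡ ψ y ⁅ k ⁆
      go (inj₁ r) = inj₂ (trans (sym (ψφ z≼y)) (cong (ψ y) (⊆-antisym sub (⁅⁆-⊆ r))))
      go (inj₂ r) = inj₁ (trans (sym (ψφ z≼y)) (trans (cong (ψ y) (⊆-antisym (incl λ {t} → below t) ⊥-⊆)) (ψ-⊥ y)))
        where
        below : ∀ t → t ∈ φ y z → t ∈ ⊥
        below t u with t Fₚ.≟ k
        ... | yes refl = absurd (true≢false u r)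
        ... | no e = absurd (true≢false (into sub u) (lookup-⁅⁆′ e))

  single-inj : ∀ {y k l} → ψ y ⁅ k ⁆ ≡ ψ y ⁅ l ⁆ → k ≡ l
  single-inj {y} {k} {l} e with k Fₚ.≟ l
  ... | yes p = p
  ... | no p = absurd (true≢false (lookup-⁅⁆ k) (trans (cong (λ s → lookup s k) (ψ-inj {y} e)) (lookup-⁅⁆′ p)))

  -- The atom is the image of a singleton, yet it is also the top of its own interval; so the full
  -- set is a singleton.
  IsAtom⇒rank1 : ∀ {x} → IsAtom x → rank x ≡ 1
  IsAtom⇒rank1 {x} at@(x≢ , h) = case (atom-single (le-refl x) at)
    where
    case : (∃ λ k → ψ x ⁅ k ⁆ ≡ x) → rank x ≡ 1
    case (k , e) = trans (sym (trans (cong ∣_∣ full) (Subₚ.∣⊤∣≡n _))) (Subₚ.∣⁅x⁆∣≡1 k)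
      where
      full : ⁅ k ⁆ ≡ Sub.⊤
      full = ⊆-antisym (incl λ {z} _ → Vₚ.[]=⇒lookup (Subₚ.∈⊤ {x = z}))
        (ψ-reflect {x} (subst (ψ x Sub.⊤ ≼_) (sym e) (ψ≼ x _)))

  rank1⇒IsAtom : ∀ {x} → rank x ≡ 1 → IsAtom x
  rank1⇒IsAtom {x} e = subst IsAtom (trans (cong (ψ x) (single e (φ x x) k k∈)) (ψφ (le-refl x))) (single-atom x k)
    where
    k : Fin (rank x)
    k = subst Fin (sym e) zero
    single : ∀ {m} → m ≡ 1 → (s : Subset m) (k : Fin m) → k ∈ s → ⁅ k ⁆ ≡ s
    single refl (true ∷ []) zero _ = refl
    k∈ : k ∈ φ x x
    k∈ = into (φ-mono {x} {ψ x Sub.⊤} {x} (le-refl x) (ψ≼ x _)) (subst (λ s → k ∈ s) (sym (I.φψ x Sub.⊤)) (Vₚ.[]=⇒lookup (Subₚ.∈⊤ {x = k})))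

  abstract
    -- Vertices are elements of rank 1, so vertex sets are subsets of the carrier, the same type as
    -- chains of the order complex.
    vt : Fin n → Subset n
    vt T = tabulate λ v → (rank v ≡ᵇ 1) ∧ le v T

    vt⇒ : ∀ {v T} → v ∈ vt T → rank v ≡ 1 × v ≼ T
    vt⇒ {v} {T} p with ∧-true (trans (sym (Vₚ.lookup∘tabulate _ v)) p)
    ... | q , r = ≡ᵇ⇒≡ q , r

    ⇒vt : ∀ {v T} → rank v ≡ 1 → v ≼ T → v ∈ vt T
    ⇒vt {v} p q = trans (Vₚ.lookup∘tabulate _ v) (∧-intro (≡ᵇ-true p) q)

  vt-mono : ∀ {x y} → x ≼ y → vt x ⊆ vt y
  vt-mono {x} {y} p = incl λ q → ⇒vt (proj₁ (vt⇒ {T = x} q)) (≼-trans (proj₂ (vt⇒ {T = x} q)) p)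

  single-vt : ∀ {y} k {x} → x ≼ y → k ∈ φ y x → ψ y ⁅ k ⁆ ∈ vt x
  single-vt {y} k {x} p q = ⇒vt (IsAtom⇒rank1 (single-atom y k)) (subst (ψ y ⁅ k ⁆ ≼_) (ψφ p) (ψ-mono {y} (⁅⁆-⊆ q)))

  vt-single : ∀ {y} k {x} → x ≼ y → ψ y ⁅ k ⁆ ∈ vt x → k ∈ φ y x
  vt-single {y} k {x} p q = into (ψ-reflect {y} (subst (ψ y ⁅ k ⁆ ≼_) (sym (ψφ p)) (proj₂ (vt⇒ q)))) (lookup-⁅⁆ k)

  -- The common upper bound `y` is essential: in a simplicial poset different faces may have the
  -- same vertices. Below `y` everything is decided by singletons.
  vt-reflect : ∀ {x x' y} → x ≼ y → x' ≼ y → vt x ⊆ vt x' → x ≼ x'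
  vt-reflect {x} {x'} {y} p q h = subst (_≼ x') (ψφ p) (subst (ψ y (φ y x) ≼_) (ψφ q)
    (ψ-mono {y} (incl λ {k} r → vt-single k q (into h (single-vt k p r)))))

  vt-inj : ∀ {x x' y} → x ≼ y → x' ≼ y → vt x ≡ vt x' → x ≡ x'
  vt-inj {x} {x'} p q e = ≼-antisym (vt-reflect p q (⊆-reflexive e)) (vt-reflect q p (⊆-reflexive (sym e)))

  face : ∀ {y} (S : Subset n) → S ⊆ vt y → ∃ λ x → x ≼ y × vt x ≡ S
  face {y} S h = x , ψ≼ y s , ⊆-antisym (incl λ {v} → to v) (incl λ {v} → from v)
    where
    s : Subset (rank y)
    s = tabulate λ k → lookup S (ψ y ⁅ k ⁆)
    x = ψ y s
    to : ∀ v → v ∈ vt x → v ∈ S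
    to v p with vt⇒ {T = x} p
    ... | r , q with atom-single (≼-trans q (ψ≼ y s)) (rank1⇒IsAtom r)
    ... | k , refl = trans (sym (Vₚ.lookup∘tabulate _ k)) (into (ψ-reflect {y} q) (lookup-⁅⁆ k))
    from : ∀ v → v ∈ S → v ∈ vt x
    from v p with vt⇒ {T = y} (into h p)
    ... | r , q with atom-single q (rank1⇒IsAtom r)
    ... | k , refl = ⇒vt r (ψ-mono {y} (⁅⁆-⊆ (trans (Vₚ.lookup∘tabulate _ k) p)))

  rank≡ : ∀ x → rank x ≡ ∣ vt x ∣
  rank≡ x = sym (trans (∣∣≡# (vt x)) (#-bij (lookup (vt x)) (λ k → ψ x ⁅ k ⁆) (λ k l → single-inj {x})
    (λ k → ⇒vt (IsAtom⇒rank1 (single-atom x k)) (ψ≼ x _)) λ v p → atom-single (proj₂ (vt⇒ p)) (rank1⇒IsAtom (proj₁ (vt⇒ p)))))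

  vt-bot : vt bot ≡ ⊥
  vt-bot = ⊆-antisym (incl λ {v} p → absurd (proj₁ (rank1⇒IsAtom (proj₁ (vt⇒ {T = bot} p))) (≼-antisym (proj₂ (vt⇒ p)) (bot-least v))))
    ⊥-⊆

  rank-mono : ∀ {x y} → x ≼ y → rank x ≤ rank y
  rank-mono {x} {y} p = ℕₚ.≤-trans (ℕₚ.≤-reflexive (rank≡ x)) (ℕₚ.≤-trans (⊆-size (vt-mono p)) (ℕₚ.≤-reflexive (sym (rank≡ y))))

  ≼-rank : ∀ {x y} → x ≼ y → rank y ≤ rank x → x ≡ y
  ≼-rank {x} {y} p h = vt-inj p (le-refl y) (⊆-size-≡ (vt-mono p) (ℕₚ.≤-trans (ℕₚ.≤-reflexive (sym (rank≡ y))) (ℕₚ.≤-trans h (ℕₚ.≤-reflexive (rank≡ x)))))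

  abstract
    -- Outside its intended range, fc and del return an arbitrary element.
    fc : Fin n → Subset n → Fin n
    fc y S with Fₚ.any? (λ x → (le x y Bₚ.≟ true) ×-dec subset? (vt x) S)
    ... | yes (x , _) = x
    ... | no _ = y

    fc-spec : ∀ {y S} → S ⊆ vt y → fc y S ≼ y × vt (fc y S) ≡ S
    fc-spec {y} {S} h with Fₚ.any? (λ x → (le x y Bₚ.≟ true) ×-dec subset? (vt x) S)
    ... | yes (x , p) = p
    ... | no k = absurd (k (face S h))

  fc-vt : ∀ {x y} → x ≼ y → fc y (vt x) ≡ x
  fc-vt {x} {y} p = vt-inj (proj₁ s) p (proj₂ s)
    where s = fc-spec {y} (vt-mono p)

  del : Fin n → Fin n → Fin n
  del T v = fc T (rem (vt T) v)

  del≼ : ∀ T v → del T v ≼ T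
  del≼ T v = proj₁ (fc-spec {T} (rem-⊆ (vt T) v))

  vt-del : ∀ T v → vt (del T v) ≡ rem (vt T) v
  vt-del T v = proj₂ (fc-spec {T} (rem-⊆ (vt T) v))

  rank-del : ∀ {T v} → v ∈ vt T → rank T ≡ suc (rank (del T v))
  rank-del {T} {v} p = trans (rank≡ T) (trans (∣rem∣ (vt T) p) (cong suc (sym (trans (rank≡ (del T v)) (cong ∣_∣ (vt-del T v))))))

  del-unique : ∀ {T H v} → H ≼ T → vt H ≡ rem (vt T) v → del T v ≡ H
  del-unique {T} {H} {v} p e = vt-inj (del≼ T v) p (trans (vt-del T v) (sym e))

  del-comm : ∀ T u v → del (del T u) v ≡ del (del T v) u
  del-comm T u v = vt-inj (≼-trans (del≼ _ v) (del≼ T u)) (≼-trans (del≼ _ u) (del≼ T v))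
    (trans (vt-del _ v) (trans (cong (λ S → rem S v) (vt-del T u)) (trans (rem-comm (vt T) u v)
      (trans (cong (λ S → rem S u) (sym (vt-del T v))) (sym (vt-del _ u))))))

  abstract
    -- `T` arises from `H` by adjoining `v`. Given `T` and `v` there is one `H`, namely `del T v`,
    -- but given `H` and `v` there may be many `T`; hence boundaries sum over `T` and coboundaries
    -- use `del`.
    cov : Fin n → Fin n → Fin n → Bool
    cov v H T = lookup (vt T) v ∧ does (del T v Fₚ.≟ H)

    cov⇒ : ∀ {v H T} → cov v H T ≡ true → v ∈ vt T × del T v ≡ H
    cov⇒ {v} {H} {T} p with ∧-true p
    ... | q , r = q , does-true (del T v Fₚ.≟ H) r

    ⇒cov : ∀ {v H T} → v ∈ vt T → del T v ≡ H → cov v H T ≡ true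
    ⇒cov {v} {H} {T} p q = ∧-intro p (dec-true (del T v Fₚ.≟ H) q)

    cov-off : ∀ {v H T} → H ≢ del T v → cov v H T ≡ false
    cov-off {v} {H} {T} k = trans (cong (lookup (vt T) v ∧_) (dec-false (del T v Fₚ.≟ H) (k ∘ sym))) (Bₚ.∧-zeroʳ _)

    cov-on : ∀ {v T} → cov v (del T v) T ≡ lookup (vt T) v
    cov-on {v} {T} = trans (cong (lookup (vt T) v ∧_) (dec-true (del T v Fₚ.≟ del T v) refl)) (Bₚ.∧-identityʳ _)

  cov-ins : ∀ {v H T} → v ∉ vt H → H ≼ T → vt T ≡ ins (vt H) v → cov v H T ≡ true
  cov-ins {v} {H} {T} p q e = ⇒cov (subst (v ∈_) (sym e) (∈-ins (vt H) v))
    (del-unique q (sym (trans (cong (λ S → rem S v) e) (rem-ins (vt H) p))))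

  record Cover (v H T : Fin n) : Set where
    field
      v∈T : v ∈ vt T
      v∉H : v ∉ vt H
      H≼T : H ≼ T
      vtT : vt T ≡ ins (vt H) v
      vtH : vt H ≡ rem (vt T) v
      rankT : rank T ≡ suc (rank H)

  cover : ∀ {v H T} → cov v H T ≡ true → Cover v H T
  cover {v} {H} {T} p with cov⇒ p
  ... | q , refl = record
    { v∈T = q
    ; v∉H = trans (cong (λ S → lookup S v) (vt-del T v)) (∉-rem (vt T) v)
    ; H≼T = del≼ T v
    ; vtT = trans (sym (ins-rem (vt T) q)) (cong (λ S → ins S v) (sym (vt-del T v)))
    ; vtH = vt-del T v
    ; rankT = rank-del q
    }

-- Finite sums, integer coefficients and signs in a commutative ring

module RingTools {c ℓ} (R : CommutativeRing c ℓ) where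
  open CommutativeRing R public
    hiding (zero)
    renaming (refl to ≈-refl; sym to ≈-sym; trans to ≈-trans; reflexive to ≈-reflexive)
  open import Algebra.Properties.Ring ring public using (-‿distribˡ-*; -‿distribʳ-*; -0#≈0#; x[y-z]≈xy-xz)
  open import Algebra.Properties.Group +-group public using () renaming (⁻¹-involutive to -‿involutive; x∙y⁻¹≈ε⇒x≈y to x-y≈0⇒x≈y; x≈y⇒x∙y⁻¹≈ε to x≈y⇒x-y≈0)
  open import Algebra.Properties.AbelianGroup +-abelianGroup public using () renaming (⁻¹-∙-comm to -‿+-comm)
  import Algebra.Properties.Semiring.Sum semiring as Sum
  open import Algebra.Properties.Semiring.Mult semiring using (×-homo-+) renaming (_×_ to _·_)
  open SetoidReasoning setoid public

  -- The canonical ring homomorphism from the integers. It also supplies the ring solver with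
  -- integer constants in every commutative ring.
  ι : ℤ → Carrier
  ι (+ m) = m · 1#
  ι -[1+ m ] = - (suc m · 1#)

  ι-neg : ∀ i → ι (ℤ.- i) ≈ - ι i
  ι-neg (+ zero) = ≈-sym -0#≈0#
  ι-neg (+ suc m) = ≈-refl
  ι-neg -[1+ m ] = ≈-sym (-‿involutive _)

  private
    cancel : ∀ x y z → (x + y) - (x + z) ≈ y - z
    cancel x y z = begin
      (x + y) - (x + z)       ≈⟨ +-cong (+-comm x y) (≈-sym (-‿+-comm x z)) ⟩
      (y + x) + (- x + - z)   ≈⟨ +-assoc y x _ ⟩
      y + (x + (- x + - z))   ≈⟨ +-congˡ (≈-sym (+-assoc x _ _)) ⟩
      y + ((x + - x) + - z)   ≈⟨ +-congˡ (≈-trans (+-congʳ (-‿inverseʳ x)) (+-identityˡ _)) ⟩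
      y - z ∎

  ι-⊖ : ∀ m k → ι (m ℤ.⊖ k) ≈ m · 1# - k · 1#
  ι-⊖ m zero = ≈-sym (≈-trans (+-congˡ -0#≈0#) (+-identityʳ _))
  ι-⊖ zero (suc k) = ≈-sym (+-identityˡ _)
  ι-⊖ (suc m) (suc k) = begin
    ι (suc m ℤ.⊖ suc k)                 ≡⟨ cong ι (ℤₚ.[1+m]⊖[1+n]≡m⊖n m k) ⟩
    ι (m ℤ.⊖ k)                         ≈⟨ ι-⊖ m k ⟩
    m · 1# - k · 1#                     ≈⟨ ≈-sym (cancel 1# _ _) ⟩
    (1# + m · 1#) - (1# + k · 1#) ∎

  ι-+ : ∀ i j → ι (i ℤ.+ j) ≈ ι i + ι j
  ι-+ (+ m) (+ k) = ×-homo-+ 1# m k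
  ι-+ (+ m) -[1+ k ] = ι-⊖ m (suc k)
  ι-+ -[1+ m ] (+ k) = ≈-trans (ι-⊖ k (suc m)) (+-comm _ _)
  ι-+ -[1+ m ] -[1+ k ] = ≈-trans (-‿cong (≈-trans (≈-reflexive (cong (_· 1#) (cong suc (sym (ℕₚ.+-suc m k))))) (×-homo-+ 1# (suc m) (suc k)))) (≈-sym (-‿+-comm _ _))

  ι-1 : ι (+ 1) ≈ 1#
  ι-1 = +-identityʳ 1#

  private
    ι-*⁺ : ∀ m j → ι (+ m ℤ.* j) ≈ m · 1# * ι j
    ι-*⁺ zero j = ≈-trans (≈-reflexive (cong ι (ℤₚ.*-zeroˡ j))) (≈-sym (zeroˡ _))
    ι-*⁺ (suc m) j = begin
      ι (+ suc m ℤ.* j)           ≡⟨ cong ι (ℤₚ.suc-* (+ m) j) ⟩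
      ι (j ℤ.+ + m ℤ.* j)         ≈⟨ ι-+ j _ ⟩
      ι j + ι (+ m ℤ.* j)         ≈⟨ +-cong (≈-sym (*-identityˡ _)) (ι-*⁺ m j) ⟩
      1# * ι j + m · 1# * ι j     ≈⟨ ≈-sym (distribʳ _ _ _) ⟩
      (1# + m · 1#) * ι j ∎

  ι-* : ∀ i j → ι (i ℤ.* j) ≈ ι i * ι j
  ι-* (+ m) j = ι-*⁺ m j
  ι-* -[1+ m ] j = begin
    ι (-[1+ m ] ℤ.* j)           ≡⟨ cong ι (sym (ℤₚ.neg-distribˡ-* (+ suc m) j)) ⟩
    ι (ℤ.- (+ suc m ℤ.* j))      ≈⟨ ι-neg (+ suc m ℤ.* j) ⟩
    - ι (+ suc m ℤ.* j)          ≈⟨ -‿cong (ι-*⁺ (suc m) j) ⟩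
    - (suc m · 1# * ι j)         ≈⟨ -‿distribˡ-* _ _ ⟩
    - (suc m · 1#) * ι j ∎

  private
    morphism : CommutativeRing.rawRing ℤₚ.+-*-commutativeRing -Raw-AlmostCommutative⟶ fromCommutativeRing R
    morphism = record { ⟦_⟧ = ι ; +-homo = ι-+ ; *-homo = ι-* ; -‿homo = ι-neg ; 0-homo = ≈-refl ; 1-homo = ι-1 }
    weakDec : ∀ i j → Maybe (ι i ≈ ι j)
    weakDec i j with i ℤ.≟ j
    ... | yes e = just (≈-reflexive (cong ι e))
    ... | no _ = nothing
  module Solver = RingSolver (CommutativeRing.rawRing ℤₚ.+-*-commutativeRing) (fromCommutativeRing R) morphism weakDec
  open Solver public using (solve; _:=_; _:+_; _:*_; :-_; _:-_; con)

  -- The sum is made abstract so that the summand can be inferred from it.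
  abstract
    ∑ : ∀ {m} → (Fin m → Carrier) → Carrier
    ∑ = Sum.sum

    ∑-[] : (f : Fin 0 → Carrier) → ∑ f ≈ 0#
    ∑-[] f = ≈-refl

    ∑-∷ : ∀ {m} (f : Fin (suc m) → Carrier) → ∑ f ≈ f zero + ∑ (f ∘ suc)
    ∑-∷ f = ≈-refl

    ∑-cong : ∀ {m} {f g : Fin m → Carrier} → (∀ i → f i ≈ g i) → ∑ f ≈ ∑ g
    ∑-cong h = Sum.sum-cong-≋ h

    ∑-0 : ∀ {m} {f : Fin m → Carrier} → (∀ i → f i ≈ 0#) → ∑ f ≈ 0#
    ∑-0 {m} h = ≈-trans (∑-cong h) (Sum.sum-replicate-zero m)

    ∑-+ : ∀ {m} (f g : Fin m → Carrier) → ∑ (λ i → f i + g i) ≈ ∑ f + ∑ g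
    ∑-+ = Sum.∑-distrib-+

    ∑-swap : ∀ {m k} (f : Fin m → Fin k → Carrier) → ∑ (λ i → ∑ (f i)) ≈ ∑ (λ j → ∑ (λ i → f i j))
    ∑-swap = Sum.∑-comm

    ∑-*ˡ : ∀ {m} x (f : Fin m → Carrier) → x * ∑ f ≈ ∑ (λ i → x * f i)
    ∑-*ˡ = Sum.*-distribˡ-sum

    ∑-*ʳ : ∀ {m} x (f : Fin m → Carrier) → ∑ f * x ≈ ∑ (λ i → f i * x)
    ∑-*ʳ = Sum.*-distribʳ-sum

  ∑-neg : ∀ {m} (f : Fin m → Carrier) → ∑ (λ i → - f i) ≈ - ∑ f
  ∑-neg f = ≈-trans (∑-cong λ i → solve 1 (λ x → :- x := con (ℤ.- + 1) :* x) ≈-refl (f i)) (≈-trans (≈-sym (∑-*ˡ _ f)) (solve 1 (λ x → con (ℤ.- + 1) :* x := :- x) ≈-refl _))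

  ∑-single : ∀ {m} {f : Fin m → Carrier} i → (∀ j → j ≢ i → f j ≈ 0#) → ∑ f ≈ f i
  ∑-single zero h = ≈-trans (∑-∷ _) $ ≈-trans (+-congˡ (∑-0 λ j → h (suc j) λ ())) (+-identityʳ _)
  ∑-single (suc i) h = ≈-trans (∑-∷ _) $ ≈-trans (+-cong (h zero λ ()) (∑-single i λ j k → h (suc j) λ e → k (Fₚ.suc-injective e))) (+-identityˡ _)

  -- The diagonal is a separate hypothesis because antisymmetry only gives `2 f i i = 0`, which says
  -- nothing in characteristic 2.
  ∑∑-anti : ∀ {m} (f : Fin m → Fin m → Carrier) → (∀ i j → f i j ≈ - f j i) → (∀ i → f i i ≈ 0#) → ∑ (λ i → ∑ (f i)) ≈ 0#
  ∑∑-anti {zero} f h d = ∑-[] _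
  ∑∑-anti {suc m} f h d = begin
    ∑ (λ i → ∑ (f i)) ≈⟨ ≈-trans (∑-∷ _) (+-cong (∑-∷ _) (∑-cong λ i → ∑-∷ _)) ⟩
    (f zero zero + ∑ (λ j → f zero (suc j))) + ∑ (λ i → f (suc i) zero + ∑ (λ j → f (suc i) (suc j)))
      ≈⟨ +-cong (≈-trans (+-congʳ (d zero)) (+-identityˡ _)) (∑-+ (λ i → f (suc i) zero) _) ⟩
    ∑ (λ j → f zero (suc j)) + (∑ (λ i → f (suc i) zero) + ∑ (λ i → ∑ (λ j → f (suc i) (suc j))))
      ≈⟨ +-cong (≈-trans (∑-cong λ j → h zero (suc j)) (∑-neg _)) (≈-trans (+-congˡ (∑∑-anti (λ i j → f (suc i) (suc j)) (λ i j → h _ _) λ i → d _)) (+-identityʳ _)) ⟩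
    - ∑ (λ i → f (suc i) zero) + ∑ (λ i → f (suc i) zero) ≈⟨ -‿inverseˡ _ ⟩
    0# ∎

  infixr 5 _▹_
  _▹_ : Bool → Carrier → Carrier
  true ▹ x = x
  false ▹ x = 0#

  ▹-cong : ∀ b {x y} → (b ≡ true → x ≈ y) → b ▹ x ≈ b ▹ y
  ▹-cong true h = h refl
  ▹-cong false h = ≈-refl

  ▹-≡ : ∀ {b b' x} → b ≡ b' → b ▹ x ≈ b' ▹ x
  ▹-≡ refl = ≈-refl

  ▹-0 : ∀ b {x} → (b ≡ true → x ≈ 0#) → b ▹ x ≈ 0#
  ▹-0 true h = h refl
  ▹-0 false h = ≈-refl

  ▹-true : ∀ {b x} → b ≡ true → b ▹ x ≈ x
  ▹-true refl = ≈-refl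

  ▹-false : ∀ {b x} → b ≡ false → b ▹ x ≈ 0#
  ▹-false refl = ≈-refl

  ▹-*ˡ : ∀ b x y → x * (b ▹ y) ≈ b ▹ x * y
  ▹-*ˡ true x y = ≈-refl
  ▹-*ˡ false x y = zeroʳ x

  ▹-*ʳ : ∀ b x y → (b ▹ x) * y ≈ b ▹ x * y
  ▹-*ʳ true x y = ≈-refl
  ▹-*ʳ false x y = zeroˡ y

  ▹-+ : ∀ b x y → b ▹ (x + y) ≈ (b ▹ x) + (b ▹ y)
  ▹-+ true x y = ≈-refl
  ▹-+ false x y = ≈-sym (+-identityˡ 0#)

  ▹-neg : ∀ b x → b ▹ (- x) ≈ - (b ▹ x)
  ▹-neg true x = ≈-refl
  ▹-neg false x = ≈-sym -0#≈0#

  ▹-∑ : ∀ {m} b (f : Fin m → Carrier) → b ▹ ∑ f ≈ ∑ (λ i → b ▹ f i)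
  ▹-∑ true f = ≈-refl
  ▹-∑ false f = ≈-sym (∑-0 {f = λ _ → 0#} λ _ → ≈-refl)

  ▹-∧ : ∀ b b' {x} → b ∧ b' ▹ x ≈ b ▹ (b' ▹ x)
  ▹-∧ true b' = ≈-refl
  ▹-∧ false b' = ≈-refl

  sgn : ℕ → Carrier
  sgn zero = 1#
  sgn (suc k) = - sgn k

  sgn-+ : ∀ m k → sgn (m ℕ.+ k) ≈ sgn m * sgn k
  sgn-+ zero k = ≈-sym (*-identityˡ _)
  sgn-+ (suc m) k = ≈-trans (-‿cong (sgn-+ m k)) (-‿distribˡ-* _ _)

  sgn² : ∀ k → sgn k * sgn k ≈ 1#
  sgn² zero = *-identityˡ 1#
  sgn² (suc k) = ≈-trans (solve 1 (λ x → (:- x) :* (:- x) := x :* x) ≈-refl (sgn k)) (sgn² k)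

  σ : Fin N → Subset N → Carrier
  σ v S = sgn (cnt v S)

  σ² : (v : Fin N) (S : Subset N) → σ v S * σ v S ≈ 1#
  σ² v S = sgn² (cnt v S)

  σ-ins : (v : Fin N) (S : Subset N) {x : Fin N} → x ∉ S → σ v (ins S x) ≈ sgn (b2n (toℕ x <ᵇ toℕ v)) * σ v S
  σ-ins v S {x} h = ≈-trans (≈-reflexive (cong sgn (cnt-ins v S h))) (sgn-+ (b2n (toℕ x <ᵇ toℕ v)) (cnt v S))

  -- Exactly one of `u`, `v` precedes the other, so exactly one of the two signs changes on
  -- insertion.
  σ-anti : (S : Subset N) {u v : Fin N} → u ≢ v → u ∉ S → v ∉ S → σ v S * σ u (ins S v) ≈ - (σ u S * σ v (ins S u))
  σ-anti S {u} {v} h p q = begin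
    σ v S * σ u (ins S v)                                        ≈⟨ *-congˡ (σ-ins u S q) ⟩
    σ v S * (sgn (b2n (toℕ v <ᵇ toℕ u)) * σ u S)                 ≈⟨ *-congˡ (*-congʳ swap) ⟩
    σ v S * (- sgn (b2n (toℕ u <ᵇ toℕ v)) * σ u S)               ≈⟨ solve 3 (λ a b c → a :* ((:- b) :* c) := :- (c :* (b :* a))) ≈-refl _ _ _ ⟩
    - (σ u S * (sgn (b2n (toℕ u <ᵇ toℕ v)) * σ v S))             ≈⟨ -‿cong (*-congˡ (≈-sym (σ-ins v S p))) ⟩
    - (σ u S * σ v (ins S u)) ∎
    where
    swap : sgn (b2n (toℕ v <ᵇ toℕ u)) ≈ - sgn (b2n (toℕ u <ᵇ toℕ v))
    swap with ℕₚ.<-cmp (toℕ u) (toℕ v)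
    ... | tri< a ¬b ¬c rewrite <ᵇ-true a | <ᵇ-false ¬c = ≈-sym (-‿involutive 1#)
    ... | tri≈ ¬a b ¬c = absurd (h (Fₚ.toℕ-injective b))
    ... | tri> ¬a ¬b c rewrite <ᵇ-true c | <ᵇ-false ¬a = ≈-refl

  -- The simplicial boundary of a chain, read off at `S`: it collects the coefficients of the sets
  -- with one more element.
  dS : (Subset N → Carrier) → Subset N → Carrier
  dS c S = ∑ λ x → not (lookup S x) ▹ σ x S * c (ins S x)

  -- The cone operator with apex `v`.
  hS : Fin N → (Subset N → Carrier) → Subset N → Carrier
  hS v c S = lookup S v ▹ σ v (rem S v) * c (rem S v)

  -- The homotopy formula of the cone, `d h + h d = id`. The hypothesis removes the term `h d`,
  -- which is present only at sets containing `v`.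
  dS-hS : (v : Fin N) (c : Subset N → Carrier) (S : Subset N) → (v ∈ S → dS c (rem S v) ≈ 0#) → dS (hS v c) S ≈ c S
  dS-hS {N} v c S h with ∈-or-∉ v S
  ... | inj₂ q = begin
    dS (hS v c) S                                              ≈⟨ ∑-single v (λ x k → ▹-0 (not (lookup S x)) λ _ → ≈-trans (*-congˡ (▹-false (trans (lookup-ins S (k ∘ sym)) q))) (zeroʳ _)) ⟩
    (not (lookup S v) ▹ σ v S * hS v c (ins S v))              ≈⟨ ▹-true (cong not q) ⟩
    σ v S * (lookup (ins S v) v ▹ σ v (rem (ins S v) v) * c (rem (ins S v) v)) ≈⟨ *-congˡ (≈-trans (▹-true (∈-ins S v)) (≈-reflexive (cong (λ U → σ v U * c U) (rem-ins S q)))) ⟩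
    σ v S * (σ v S * c S)                                      ≈⟨ ≈-trans (≈-sym (*-assoc _ _ _)) (≈-trans (*-congʳ (σ² v S)) (*-identityˡ _)) ⟩
    c S ∎
  ... | inj₁ p = begin
    dS (hS v c) S                                              ≈⟨ ∑-cong term ⟩
    ∑ (λ x → - (σ v S′ * g x) + (does (x Fₚ.≟ v) ▹ c S))         ≈⟨ ∑-+ (λ x → - (σ v S′ * g x)) (λ x → does (x Fₚ.≟ v) ▹ c S) ⟩
    ∑ (λ x → - (σ v S′ * g x)) + ∑ (λ x → does (x Fₚ.≟ v) ▹ c S)   ≈⟨ +-cong (≈-trans (∑-neg _) (-‿cong (≈-sym (∑-*ˡ (σ v S′) g)))) (≈-trans (∑-single v λ x k → ▹-false (dec-false (x Fₚ.≟ v) k)) (▹-true (dec-true (v Fₚ.≟ v) refl))) ⟩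
    - (σ v S′ * ∑ g) + c S                                      ≈⟨ +-congʳ (≈-trans (-‿cong (≈-trans (*-congˡ (h p)) (zeroʳ _))) -0#≈0#) ⟩
    0# + c S                                                   ≈⟨ +-identityˡ _ ⟩
    c S ∎
    where
    S′ = rem S v
    g : Fin N → Carrier
    g x = not (lookup S′ x) ▹ σ x S′ * c (ins S′ x)
    -- On the left the summand `x = v` is absent; on the right it reads `- c S + c S`.
    term : ∀ x → (not (lookup S x) ▹ σ x S * hS v c (ins S x)) ≈ - (σ v S′ * g x) + (does (x Fₚ.≟ v) ▹ c S)
    term x with x Fₚ.≟ v
    ... | yes refl = ≈-trans (▹-false (cong not p)) (≈-sym (≈-trans (+-congʳ (-‿cong (≈-trans (*-congˡ (▹-true (cong not (∉-rem S v)))) (≈-trans (≈-sym (*-assoc _ _ _)) (≈-trans (*-cong (σ² v S′) (≈-reflexive (cong c (ins-rem S p)))) (*-identityˡ _)))))) (-‿inverseˡ _)))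
    ... | no k = ≈-trans (eq (∈-or-∉ x S)) (≈-sym (+-identityʳ _))
      where
      eq : x ∈ S ⊎ x ∉ S → (not (lookup S x) ▹ σ x S * hS v c (ins S x)) ≈ - (σ v S′ * g x)
      eq (inj₁ q) = ≈-trans (▹-false (cong not q)) (≈-sym (≈-trans (-‿cong (≈-trans (*-congˡ (▹-false (cong not (trans (lookup-rem S k) q)))) (zeroʳ _))) -0#≈0#))
      eq (inj₂ q) = begin
        (not (lookup S x) ▹ σ x S * hS v c (ins S x)) ≈⟨ ▹-true (cong not q) ⟩
        σ x S * hS v c (ins S x)                    ≈⟨ *-congˡ (≈-trans (▹-true (into (⊆-ins S x) p)) (≈-reflexive (cong (λ U → σ v U * c U) (rem-ins-comm S k)))) ⟩
        σ x S * (σ v (ins S′ x) * c (ins S′ x))     ≈⟨ ≈-sym (*-assoc _ _ _) ⟩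
        (σ x S * σ v (ins S′ x)) * c (ins S′ x)     ≈⟨ *-congʳ sign ⟩
        - (σ v S′ * σ x S′) * c (ins S′ x)          ≈⟨ solve 3 (λ a b c → (:- (a :* b)) :* c := :- (a :* (b :* c))) ≈-refl _ _ _ ⟩
        - (σ v S′ * (σ x S′ * c (ins S′ x)))        ≈⟨ -‿cong (*-congˡ (≈-sym (▹-true (cong not q′)))) ⟩
        - (σ v S′ * g x) ∎
        where
        q′ : x ∉ S′
        q′ = trans (lookup-rem S k) q
        sign : σ x S * σ v (ins S′ x) ≈ - (σ v S′ * σ x S′)
        sign = begin
          σ x S * σ v (ins S′ x)                        ≈⟨ *-congʳ (≈-reflexive (cong (σ x) (sym (ins-rem S p)))) ⟩
          σ x (ins S′ v) * σ v (ins S′ x)               ≈⟨ ≈-sym (≈-trans (*-congʳ (*-congˡ ≈-refl)) (≈-trans (solve 3 (λ a b c → (a :* b) :* (a :* c) := (a :* a) :* (b :* c)) ≈-refl (σ v S′) _ _) (≈-trans (*-congʳ (σ² v S′)) (*-identityˡ _)))) ⟩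
          (σ v S′ * σ x (ins S′ v)) * (σ v S′ * σ v (ins S′ x)) ≈⟨ *-congʳ (σ-anti S′ k q′ (∉-rem S v)) ⟩
          - (σ x S′ * σ v (ins S′ x)) * (σ v S′ * σ v (ins S′ x)) ≈⟨ solve 3 (λ a b c → (:- (a :* b)) :* (c :* b) := (:- (c :* a)) :* (b :* b)) ≈-refl _ _ _ ⟩
          - (σ v S′ * σ x S′) * (σ v (ins S′ x) * σ v (ins S′ x)) ≈⟨ ≈-trans (*-congˡ (σ² v (ins S′ x))) (*-identityʳ _) ⟩
          - (σ v S′ * σ x S′) ∎

  dS-dS : (c : Subset N → Carrier) (S : Subset N) → dS (dS c) S ≈ 0#
  dS-dS {N} c S = ≈-trans (∑-cong λ x → ≈-trans (▹-cong (not (lookup S x)) λ _ → ∑-*ˡ (σ x S) _) (▹-∑ (not (lookup S x)) _))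
    (∑∑-anti f anti diag)
    where
    f : Fin N → Fin N → Carrier
    f x y = not (lookup S x) ▹ σ x S * (not (lookup (ins S x) y) ▹ σ y (ins S x) * c (ins (ins S x) y))
    zer : ∀ x y → x ∈ S ⊎ y ∈ S ⊎ x ≡ y → f x y ≈ 0#
    zer x y (inj₁ p) = ▹-false (cong not p)
    zer x y (inj₂ (inj₁ p)) = ▹-0 (not (lookup S x)) λ _ → ≈-trans (*-congˡ (▹-false (cong not (into (⊆-ins S x) p)))) (zeroʳ _)
    zer x y (inj₂ (inj₂ refl)) = ▹-0 (not (lookup S x)) λ _ → ≈-trans (*-congˡ (▹-false (cong not (∈-ins S x)))) (zeroʳ _)
    diag : ∀ x → f x x ≈ 0#
    diag x = zer x x (inj₂ (inj₂ refl))
    val : ∀ {x y} → x ≢ y → x ∉ S → y ∉ S → f x y ≈ (σ x S * σ y (ins S x)) * c (ins (ins S x) y)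
    val {x} {y} h p q = ≈-trans (▹-true (cong not p)) (≈-trans (*-congˡ (▹-true (cong not (trans (lookup-ins S (h ∘ sym)) q)))) (≈-sym (*-assoc _ _ _)))
    both0 : ∀ {x y} → f x y ≈ 0# → f y x ≈ 0# → f x y ≈ - f y x
    both0 p q = ≈-trans p (≈-sym (≈-trans (-‿cong q) -0#≈0#))
    anti : ∀ x y → f x y ≈ - f y x
    anti x y with x Fₚ.≟ y | ∈-or-∉ x S | ∈-or-∉ y S
    ... | yes e | _ | _ = both0 (zer x y (inj₂ (inj₂ e))) (zer y x (inj₂ (inj₂ (sym e))))
    ... | no h | inj₁ p | _ = both0 (zer x y (inj₁ p)) (zer y x (inj₂ (inj₁ p)))
    ... | no h | inj₂ p | inj₁ q = both0 (zer x y (inj₂ (inj₁ q))) (zer y x (inj₁ q))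
    ... | no h | inj₂ p | inj₂ q = begin
      f x y                                              ≈⟨ val h p q ⟩
      (σ x S * σ y (ins S x)) * c (ins (ins S x) y)      ≈⟨ *-cong (σ-anti S (h ∘ sym) q p) (≈-reflexive (cong c (ins-comm S x y))) ⟩
      - (σ y S * σ x (ins S y)) * c (ins (ins S y) x)    ≈⟨ ≈-sym (-‿distribˡ-* _ _) ⟩
      - ((σ y S * σ x (ins S y)) * c (ins (ins S y) x))  ≈⟨ -‿cong (≈-sym (val (h ∘ sym) q p)) ⟩
      - f y x ∎

-- Cellular chains and cochains with weighted incidences

module Cells {c ℓ} (R : CommutativeRing c ℓ) (P : SimplicialPoset) where
  open RingTools R public
  open Faces P public

  -- Boundary of cellular chains, the incidence of T with its facet opposite to v being weighted by p v.
  ∂ : (Fin n → Carrier) → (Fin n → Carrier) → Fin n → Carrier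
  ∂ p c H = ∑ λ v → ∑ λ T → cov v H T ▹ σ v (vt H) * (p v * c T)

  -- The transpose of `∂ p`, see `adjoint`. A face and one of its vertices determine the opposite
  -- facet, so a single sum suffices.
  δ : (Fin n → Carrier) → (Fin n → Carrier) → Fin n → Carrier
  δ p c T = ∑ λ v → lookup (vt T) v ▹ σ v (rem (vt T) v) * (p v * c (del T v))

  ∂-cong : ∀ {p p' c c'} → (∀ v → p v ≈ p' v) → (∀ T → c T ≈ c' T) → ∀ H → ∂ p c H ≈ ∂ p' c' H
  ∂-cong h k H = ∑-cong λ v → ∑-cong λ T → ▹-cong (cov v H T) λ _ → *-congˡ (*-cong (h v) (k T))

  ∂-+ : ∀ p c c' H → ∂ p (λ T → c T + c' T) H ≈ ∂ p c H + ∂ p c' H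
  ∂-+ p c c' H = ≈-trans (∑-cong λ v → ≈-trans (∑-cong λ T → ≈-trans (▹-cong (cov v H T) λ _ →
    solve 4 (λ s p x y → s :* (p :* (x :+ y)) := s :* (p :* x) :+ s :* (p :* y)) ≈-refl _ _ _ _) (▹-+ (cov v H T) _ _)) (∑-+ _ _)) (∑-+ _ _)

  ∂-* : ∀ p a c H → ∂ p (λ T → a * c T) H ≈ a * ∂ p c H
  ∂-* p a c H = ≈-sym (≈-trans (∑-*ˡ a _) (∑-cong λ v → ≈-trans (∑-*ˡ a _) (∑-cong λ T → ≈-trans (▹-*ˡ (cov v H T) a _) (▹-cong (cov v H T) λ _ →
    solve 4 (λ a s p x → a :* (s :* (p :* x)) := s :* (p :* (a :* x))) ≈-refl _ _ _ _))))

  ∂-0 : ∀ {p c H} → (∀ v T → cov v H T ≡ true → p v * c T ≈ 0#) → ∂ p c H ≈ 0#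
  ∂-0 {p} {c} {H} h = ∑-0 λ v → ∑-0 λ T → ▹-0 (cov v H T) λ e → ≈-trans (*-congˡ (h v T e)) (zeroʳ _)

  -- The intermediate face is `del U u`, so the composite is a sum over two vertices and the large
  -- face `U` only.
  ∂∂-expand : ∀ p q c H → ∂ p (∂ q c) H ≈ ∑ (λ v → ∑ (λ u → (p v * q u) *
    ∑ (λ U → lookup (vt U) u ∧ cov v H (del U u) ▹ (σ v (vt H) * σ u (ins (vt H) v)) * c U)))
  ∂∂-expand p q c H = ∑-cong λ v → begin
    ∑ (λ T → cov v H T ▹ σ v (vt H) * (p v * ∂ q c T))
      ≈⟨ (∑-cong λ T → ≈-trans (▹-cong (cov v H T) λ _ → ≈-trans (*-congˡ (∑-*ˡ (p v) _)) (∑-*ˡ (σ v (vt H)) _)) (▹-∑ (cov v H T) _)) ⟩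
    ∑ (λ T → ∑ (λ u → cov v H T ▹ σ v (vt H) * (p v * ∑ (λ U → cov u T U ▹ σ u (vt T) * (q u * c U)))))
      ≈⟨ ∑-swap _ ⟩
    ∑ (λ u → ∑ (λ T → cov v H T ▹ σ v (vt H) * (p v * ∑ (λ U → cov u T U ▹ σ u (vt T) * (q u * c U)))))
      ≈⟨ (∑-cong λ u → ≈-trans (∑-cong λ T → ≈-trans (▹-cong (cov v H T) λ _ → ≈-trans (*-congˡ (∑-*ˡ (p v) _)) (∑-*ˡ (σ v (vt H)) _)) (▹-∑ (cov v H T) _)) (∑-swap _)) ⟩
    ∑ (λ u → ∑ (λ U → ∑ (λ T → cov v H T ▹ σ v (vt H) * (p v * (cov u T U ▹ σ u (vt T) * (q u * c U))))))
      ≈⟨ (∑-cong λ u → ≈-trans (∑-cong λ U → one v u U) (≈-sym (∑-*ˡ (p v * q u) _))) ⟩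
    ∑ (λ u → (p v * q u) * ∑ (λ U → lookup (vt U) u ∧ cov v H (del U u) ▹ (σ v (vt H) * σ u (ins (vt H) v)) * c U)) ∎
    where
    one : ∀ v u U → ∑ (λ T → cov v H T ▹ σ v (vt H) * (p v * (cov u T U ▹ σ u (vt T) * (q u * c U)))) ≈
          (p v * q u) * (lookup (vt U) u ∧ cov v H (del U u) ▹ (σ v (vt H) * σ u (ins (vt H) v)) * c U)
    one v u U = begin
      ∑ (λ T → cov v H T ▹ σ v (vt H) * (p v * (cov u T U ▹ σ u (vt T) * (q u * c U))))
        ≈⟨ ∑-single (del U u) (λ T k → ▹-0 (cov v H T) λ _ → ≈-trans (*-congˡ (≈-trans (*-congˡ (▹-false (cov-off k))) (zeroʳ _))) (zeroʳ _)) ⟩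
      (cov v H (del U u) ▹ σ v (vt H) * (p v * (cov u (del U u) U ▹ σ u (vt (del U u)) * (q u * c U))))
        ≈⟨ ▹-cong (cov v H (del U u)) (λ e → ≈-trans (*-congˡ (≈-trans (*-congˡ (≈-trans (▹-≡ cov-on) (▹-cong (lookup (vt U) u) λ _ → *-congʳ (≈-reflexive (cong (σ u) (Cover.vtT (cover e))))))) (▹-*ˡ (lookup (vt U) u) _ _))) (▹-*ˡ (lookup (vt U) u) _ _)) ⟩
      (cov v H (del U u) ▹ (lookup (vt U) u ▹ σ v (vt H) * (p v * (σ u (ins (vt H) v) * (q u * c U)))))
        ≈⟨ ≈-trans (≈-sym (▹-∧ (cov v H (del U u)) (lookup (vt U) u))) (▹-≡ (Bₚ.∧-comm (cov v H (del U u)) (lookup (vt U) u))) ⟩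
      (lookup (vt U) u ∧ cov v H (del U u) ▹ σ v (vt H) * (p v * (σ u (ins (vt H) v) * (q u * c U))))
        ≈⟨ ▹-cong (lookup (vt U) u ∧ cov v H (del U u)) (λ _ → solve 5 (λ s p t q c → s :* (p :* (t :* (q :* c))) := (p :* q) :* ((s :* t) :* c)) ≈-refl _ _ _ _ _) ⟩
      (lookup (vt U) u ∧ cov v H (del U u) ▹ (p v * q u) * ((σ v (vt H) * σ u (ins (vt H) v)) * c U))
        ≈⟨ ≈-sym (▹-*ˡ (lookup (vt U) u ∧ cov v H (del U u)) _ _) ⟩
      (p v * q u) * (lookup (vt U) u ∧ cov v H (del U u) ▹ (σ v (vt H) * σ u (ins (vt H) v)) * c U) ∎

  private
    κ : (Fin n → Carrier) → Fin n → Fin n → Fin n → Carrier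
    κ c H v u = ∑ (λ U → lookup (vt U) u ∧ cov v H (del U u) ▹ (σ v (vt H) * σ u (ins (vt H) v)) * c U)

    swap⇒ : ∀ {v u U H} → lookup (vt U) u ∧ cov v H (del U u) ≡ true → lookup (vt U) v ∧ cov u H (del U v) ≡ true
    swap⇒ {v} {u} {U} {H} e with ∧-true {lookup (vt U) u} {cov v H (del U u)} e
    ... | u∈ , f with cov⇒ f
    ... | v∈ , refl = ∧-intro (into (rem-⊆ (vt U) u) v∈′) (⇒cov (subst (u ∈_) (sym (vt-del U v)) (∈-rem (vt U) u∈ λ { refl → true≢false v∈′ (∉-rem (vt U) u) })) (del-comm U v u))
      where
      v∈′ : v ∈ rem (vt U) u
      v∈′ = subst (v ∈_) (vt-del U u) v∈

    -- Deleting `u` and `v` from `U` in either order ends at the same face, with opposite signs.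
    κ-anti : ∀ c H v u → κ c H v u ≈ - κ c H u v
    κ-anti c H v u = ≈-trans (∑-cong λ U → ≈-trans (▹-≡ (bool-ext (swap⇒ {v} {u} {U} {H}) (swap⇒ {u} {v} {U} {H}))) (≈-trans (▹-cong (lookup (vt U) v ∧ cov u H (del U v)) (λ e → ≈-trans (*-congʳ (sign U e)) (≈-sym (-‿distribˡ-* _ _)))) (▹-neg (lookup (vt U) v ∧ cov u H (del U v)) _))) (∑-neg _)
      where
      sign : ∀ U → lookup (vt U) v ∧ cov u H (del U v) ≡ true → σ v (vt H) * σ u (ins (vt H) v) ≈ - (σ u (vt H) * σ v (ins (vt H) u))
      sign U e = σ-anti (vt H) u≢v (Cover.v∉H cv) (Cover.v∉H (cover (proj₂ (∧-true {lookup (vt U) u} (swap⇒ {u} {v} {U} {H} e)))))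
        where
        cv = cover (proj₂ (∧-true {lookup (vt U) v} e))
        u≢v : u ≢ v
        u≢v refl = true≢false (Cover.v∈T cv) (trans (cong (λ S → lookup S u) (vt-del U u)) (∉-rem (vt U) u))

    κ-diag : ∀ c H v → κ c H v v ≈ 0#
    κ-diag c H v = ∑-0 λ U → ▹-0 (lookup (vt U) v ∧ cov v H (del U v)) λ e →
      absurd (true≢false (Cover.v∈T (cover (proj₂ (∧-true {lookup (vt U) v} e)))) (trans (cong (λ S → lookup S v) (vt-del U v)) (∉-rem (vt U) v)))

  ∂∂ : ∀ p c H → ∂ p (∂ p c) H ≈ 0#
  ∂∂ p c H = ≈-trans (∂∂-expand p p c H) (∑∑-anti (λ v u → (p v * p u) * κ c H v u)
    (λ v u → ≈-trans (*-cong (*-comm _ _) (κ-anti c H v u)) (≈-sym (-‿distribʳ-* _ _)))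
    λ v → ≈-trans (*-congˡ (κ-diag c H v)) (zeroʳ _))

  -- The weight symmetrised in `p` and `q` is paired with the antisymmetric `κ`.
  ∂-anticomm : ∀ p q c H → ∂ p (∂ q c) H + ∂ q (∂ p c) H ≈ 0#
  ∂-anticomm p q c H = ≈-trans (+-cong (∂∂-expand p q c H) (∂∂-expand q p c H)) (≈-trans (≈-sym (≈-trans (∑-cong λ v → ∑-+ _ _) (∑-+ _ _)))
    (∑∑-anti (λ v u → (p v * q u) * κ c H v u + (q v * p u) * κ c H v u)
      (λ v u → ≈-trans (+-cong (*-congˡ (κ-anti c H v u)) (*-congˡ (κ-anti c H v u))) (solve 5 (λ a b c d k → (a :* b) :* (:- k) :+ (c :* d) :* (:- k) := :- ((d :* c) :* k :+ (b :* a) :* k)) ≈-refl _ _ _ _ _))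
      λ v → ≈-trans (+-cong (≈-trans (*-congˡ (κ-diag c H v)) (zeroʳ _)) (≈-trans (*-congˡ (κ-diag c H v)) (zeroʳ _))) (+-identityˡ _)))

  ⟨_,_⟩ : (Fin n → Carrier) → (Fin n → Carrier) → Carrier
  ⟨ f , g ⟩ = ∑ λ T → f T * g T

  adjoint : ∀ p a b → ⟨ ∂ p a , b ⟩ ≈ ⟨ a , δ p b ⟩
  adjoint p a b = begin
    ∑ (λ H → ∂ p a H * b H)
      ≈⟨ (∑-cong λ H → ≈-trans (∑-*ʳ (b H) _) (∑-cong λ v → ≈-trans (∑-*ʳ (b H) _) (∑-cong λ T → ▹-*ʳ (cov v H T) _ _))) ⟩
    ∑ (λ H → ∑ (λ v → ∑ (λ T → cov v H T ▹ (σ v (vt H) * (p v * a T)) * b H)))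
      ≈⟨ ≈-trans (∑-cong λ H → ∑-swap _) (≈-trans (∑-swap _) (∑-cong λ T → ∑-swap _)) ⟩
    ∑ (λ T → ∑ (λ v → ∑ (λ H → cov v H T ▹ (σ v (vt H) * (p v * a T)) * b H)))
      ≈⟨ (∑-cong λ T → ≈-trans (∑-cong λ v → one T v) (≈-sym (∑-*ˡ (a T) _))) ⟩
    ∑ (λ T → a T * δ p b T) ∎
    where
    one : ∀ T v → ∑ (λ H → cov v H T ▹ (σ v (vt H) * (p v * a T)) * b H) ≈ a T * (lookup (vt T) v ▹ σ v (rem (vt T) v) * (p v * b (del T v)))
    one T v = begin
      ∑ (λ H → cov v H T ▹ (σ v (vt H) * (p v * a T)) * b H) ≈⟨ ∑-single (del T v) (λ H k → ▹-false (cov-off k)) ⟩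
      (cov v (del T v) T ▹ (σ v (vt (del T v)) * (p v * a T)) * b (del T v)) ≈⟨ ▹-≡ cov-on ⟩
      (lookup (vt T) v ▹ (σ v (vt (del T v)) * (p v * a T)) * b (del T v)) ≈⟨ ▹-cong (lookup (vt T) v) (λ _ → ≈-trans (*-congʳ (*-congʳ (≈-reflexive (cong (σ v) (vt-del T v))))) (solve 4 (λ s p a b → (s :* (p :* a)) :* b := a :* (s :* (p :* b))) ≈-refl _ _ _ _)) ⟩
      (lookup (vt T) v ▹ a T * (σ v (rem (vt T) v) * (p v * b (del T v)))) ≈⟨ ≈-sym (▹-*ˡ (lookup (vt T) v) _ _) ⟩
      a T * (lookup (vt T) v ▹ σ v (rem (vt T) v) * (p v * b (del T v))) ∎

  -- Inside the interval below y the cellular boundary is the simplicial boundary on vertex sets.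
  ∂-below : ∀ {p c y H} (ĉ : Subset n → Carrier) → H ≼ y → (∀ v → v ∉ vt H → p v ≈ 1#) →
            (∀ T → ¬ T ≼ y → c T ≈ 0#) → (∀ T → T ≼ y → c T ≈ ĉ (vt T)) → (∀ S → ¬ S ⊆ vt y → ĉ S ≈ 0#) →
            ∂ p c H ≈ dS ĉ (vt H)
  ∂-below {p} {c} {y} {H} ĉ H≼y p1 out agree out̂ = ∑-cong λ v → term v (∈-or-∉ v (vt H))
    where
    term : ∀ v → v ∈ vt H ⊎ v ∉ vt H → ∑ (λ T → cov v H T ▹ σ v (vt H) * (p v * c T)) ≈ (not (lookup (vt H) v) ▹ σ v (vt H) * ĉ (ins (vt H) v))
    term v (inj₁ q) = ≈-trans (∑-0 λ T → ▹-0 (cov v H T) λ e → absurd (true≢false q (Cover.v∉H (cover e)))) (≈-sym (▹-false (cong not q)))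
    term v (inj₂ q) = ≈-trans (go (∈-or-∉ v (vt y))) (≈-sym (▹-true (cong not q)))
      where
      go : v ∈ vt y ⊎ v ∉ vt y → ∑ (λ T → cov v H T ▹ σ v (vt H) * (p v * c T)) ≈ σ v (vt H) * ĉ (ins (vt H) v)
      go (inj₂ v∉) = ≈-trans (∑-0 λ T → ▹-0 (cov v H T) λ e → ≈-trans (*-congˡ (≈-trans (*-congˡ (out T λ T≼y →
          true≢false (into (vt-mono T≼y) (Cover.v∈T (cover e))) v∉)) (zeroʳ _))) (zeroʳ _))
        (≈-sym (≈-trans (*-congˡ (out̂ (ins (vt H) v) λ s → true≢false (into s (∈-ins (vt H) v)) v∉)) (zeroʳ _)))
      go (inj₁ v∈) = begin
        ∑ (λ T → cov v H T ▹ σ v (vt H) * (p v * c T)) ≈⟨ ∑-single T₀ (λ T k → ▹-0 (cov v H T) λ e → off T k (cover e)) ⟩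
        (cov v H T₀ ▹ σ v (vt H) * (p v * c T₀))         ≈⟨ ▹-true (cov-ins q (vt-reflect H≼y (proj₁ spec) (⊆-trans (⊆-ins (vt H) v) (⊆-reflexive (sym (proj₂ spec))))) (proj₂ spec)) ⟩
        σ v (vt H) * (p v * c T₀)                      ≈⟨ *-congˡ (≈-trans (*-congʳ (p1 v q)) (≈-trans (*-identityˡ _) (≈-trans (agree T₀ (proj₁ spec)) (≈-reflexive (cong ĉ (proj₂ spec)))))) ⟩
        σ v (vt H) * ĉ (ins (vt H) v) ∎
        where
        T₀ = fc y (ins (vt H) v)
        spec = fc-spec {y} {ins (vt H) v} (ins-⊆ (vt-mono H≼y) v∈)
        off : ∀ T → T ≢ T₀ → Cover v H T → σ v (vt H) * (p v * c T) ≈ 0#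
        off T k cv = ≈-trans (*-congˡ (≈-trans (*-congˡ (out T λ T≼y → k (vt-inj T≼y (proj₁ spec) (trans (Cover.vtT cv) (sym (proj₂ spec)))))) (zeroʳ _))) (zeroʳ _)

  unit : Fin n → Carrier → Fin n → Carrier
  unit A x Y = does (Y Fₚ.≟ A) ▹ x

  unit-on : ∀ A {x} → unit A x A ≈ x
  unit-on A = ▹-true (dec-true (A Fₚ.≟ A) refl)

  unit-off : ∀ {A x Y} → Y ≢ A → unit A x Y ≈ 0#
  unit-off {A} {Y = Y} k = ▹-false (dec-false (Y Fₚ.≟ A) k)

  ⟨⟩-cong : ∀ {f f' g g'} → (∀ T → f T ≈ f' T) → (∀ T → g T ≈ g' T) → ⟨ f , g ⟩ ≈ ⟨ f' , g' ⟩
  ⟨⟩-cong h k = ∑-cong λ T → *-cong (h T) (k T)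

  ⟨unit,⟩ : ∀ A g → ⟨ unit A 1# , g ⟩ ≈ g A
  ⟨unit,⟩ A g = ≈-trans (∑-single A λ T k → ≈-trans (*-congʳ (unit-off {A} {1#} k)) (zeroˡ _)) (≈-trans (*-congʳ (unit-on A)) (*-identityˡ _))

  ⟨,unit⟩ : ∀ f A → ⟨ f , unit A 1# ⟩ ≈ f A
  ⟨,unit⟩ f A = ≈-trans (∑-cong λ T → *-comm _ _) (⟨unit,⟩ A f)

  -- The matrix of `∂ p`, computed on basis chains; integral elimination needs explicit rows.
  inc : (Fin n → Carrier) → Fin n → Fin n → Carrier
  inc p T H = ∂ p (unit T 1#) H

  δ-inc : ∀ p b T → δ p b T ≈ ∑ (λ H → inc p T H * b H)
  δ-inc p b T = ≈-trans (≈-sym (⟨unit,⟩ T (δ p b))) (≈-sym (adjoint p (unit T 1#) b))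

  ∂-inc : ∀ p c H → ∂ p c H ≈ ∑ (λ T → c T * inc p T H)
  ∂-inc p c H = ≈-trans (≈-sym (⟨,unit⟩ (∂ p c) H)) (≈-trans (adjoint p c (unit H 1#)) (∑-cong λ T → *-congˡ (≈-trans (δ-inc p (unit H 1#) T) (⟨,unit⟩ (inc p T) H))))

  inc-0 : ∀ {p T H} → (∀ v → cov v H T ≡ true → p v ≈ 0#) → inc p T H ≈ 0#
  inc-0 {p} {T} {H} h = ∂-0 λ v U e → case v U e
    where
    case : ∀ v U → cov v H U ≡ true → p v * unit T 1# U ≈ 0#
    case v U e with U Fₚ.≟ T
    ... | yes refl = ≈-trans (*-congʳ (h v e)) (zeroˡ _)
    ... | no _ = zeroʳ _

  δδ : ∀ p c T → δ p (δ p c) T ≈ 0#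
  δδ p c T = ≈-trans (≈-sym (⟨unit,⟩ T (δ p (δ p c)))) (≈-trans (≈-sym (adjoint p (unit T 1#) (δ p c))) (≈-trans (≈-sym (adjoint p (∂ p (unit T 1#)) c))
    (∑-0 λ H → ≈-trans (*-congʳ (∂∂ p (unit T 1#) H)) (zeroˡ _))))

  δ-combine : ∀ p a b c c' T → δ p (λ U → a * c U + b * c' U) T ≈ a * δ p c T + b * δ p c' T
  δ-combine p a b c c' T = ≈-trans (∑-cong λ v → ≈-trans (▹-cong (lookup (vt T) v) λ _ → solve 6 (λ s p a x b y → s :* (p :* (a :* x :+ b :* y)) := a :* (s :* (p :* x)) :+ b :* (s :* (p :* y))) ≈-refl _ _ _ _ _ _)
    (≈-trans (▹-+ (lookup (vt T) v) _ _) (+-cong (≈-sym (▹-*ˡ (lookup (vt T) v) a _)) (≈-sym (▹-*ˡ (lookup (vt T) v) b _))))) (≈-trans (∑-+ _ _) (+-cong (≈-sym (∑-*ˡ a _)) (≈-sym (∑-*ˡ b _))))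

  δ-cong : ∀ {p p' c c'} → (∀ v → p v ≈ p' v) → (∀ T → c T ≈ c' T) → ∀ T → δ p c T ≈ δ p' c' T
  δ-cong h k T = ∑-cong λ v → ▹-cong (lookup (vt T) v) λ _ → *-congˡ (*-cong (h v) (k _))

  δ-* : ∀ p a c T → δ p (λ U → a * c U) T ≈ a * δ p c T
  δ-* p a c T = ≈-sym (≈-trans (∑-*ˡ a _) (∑-cong λ v → ≈-trans (▹-*ˡ (lookup (vt T) v) a _) (▹-cong (lookup (vt T) v) λ _ →
    solve 4 (λ a s p x → a :* (s :* (p :* x)) := s :* (p :* (a :* x))) ≈-refl _ _ _ _)))

-- Comparison of cellular chains with chains of the order complex

module Chains (P : SimplicialPoset) where
  open Faces P

  Chain : Subset n → Set
  Chain σ = ∀ x y → x ∈ σ → y ∈ σ → x ≼ y ⊎ y ≼ x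

  Chain-⊆ : ∀ {σ τ} → τ ⊆ σ → Chain σ → Chain τ
  Chain-⊆ h c x y p q = c x y (into h p) (into h q)

  Chain-ins : ∀ {σ z} → (∀ y → y ∈ σ → z ≼ y ⊎ y ≼ z) → Chain σ → Chain (ins σ z)
  Chain-ins {σ} {z} h c x y p q with x Fₚ.≟ z | y Fₚ.≟ z
  ... | yes refl | yes refl = inj₁ (le-refl x)
  ... | yes refl | no b = h y (trans (sym (lookup-ins σ b)) q)
  ... | no a | no b = c x y (trans (sym (lookup-ins σ a)) p) (trans (sym (lookup-ins σ b)) q)
  ... | no a | yes refl with h x (trans (sym (lookup-ins σ a)) p)
  ... | inj₁ r = inj₂ r
  ... | inj₂ r = inj₁ r

  chain-min : ∀ {σ} → Chain σ → ∀ k y → rank y ≤ k → y ∈ σ → ∃ λ y₀ → y₀ ∈ σ × (∀ z → z ∈ σ → y₀ ≼ z)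
  chain-min {σ} c k y h y∈ with Fₚ.any? (λ z → (lookup σ z Bₚ.≟ true) ×-dec (le y z Bₚ.≟ false))
  ... | no none = y , y∈ , below
    where
    below : ∀ z → z ∈ σ → y ≼ z
    below z z∈ with le y z in eq
    ... | true = refl
    ... | false = absurd (none (z , z∈ , eq))
  chain-min {σ} c zero y h y∈ | yes (z , z∈ , e) with c y z y∈ z∈
  ... | inj₁ r = absurd (true≢false r e)
  ... | inj₂ r = absurd (true≢false (subst (_≼ z) (≼-rank r (ℕₚ.≤-trans h z≤n)) (le-refl z)) e)
  chain-min {σ} c (suc k) y h y∈ | yes (z , z∈ , e) with c y z y∈ z∈
  ... | inj₁ r = absurd (true≢false r e)
  ... | inj₂ r = chain-min {σ} c k z (ℕₚ.≮⇒≥ λ k< → true≢false (subst (_≼ z) (≼-rank r (ℕₚ.≤-trans h k<)) (le-refl z)) e) z∈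

  nonempty : ∀ {σ : Subset n} {k} → ∣ σ ∣ ≡ suc k → ∃ λ y → y ∈ σ
  nonempty {σ} e with missing ⊥ σ
  ... | inj₁ (y , p , _) = y , p
  ... | inj₂ s = absurd (case (ℕₚ.≤-trans (ℕₚ.≤-reflexive (sym e)) (ℕₚ.≤-trans (⊆-size s) (ℕₚ.≤-reflexive (Subₚ.∣⊥∣≡0 n)))))
    where
    case : ∀ {k} → suc k ≤ 0 → Void
    case ()

  minimum : ∀ {σ k} → Chain σ → ∣ σ ∣ ≡ suc k → ∃ λ y₀ → y₀ ∈ σ × (∀ z → z ∈ σ → y₀ ≼ z)
  minimum {σ} c e = chain-min {σ} c (rank (proj₁ ne)) (proj₁ ne) ℕₚ.≤-refl (proj₂ ne)
    where ne = nonempty {σ} e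

  -- Removing the minimum of a chain raises the lower bound on the ranks by one.
  chain-height : ∀ k r {σ} → Chain σ → (∀ y → y ∈ σ → r ≤ rank y) → ∣ σ ∣ ≡ suc k → ∃ λ y → y ∈ σ × r ℕ.+ k ≤ rank y
  chain-height zero r {σ} c h e with nonempty {σ} e
  ... | y , y∈ = y , y∈ , ℕₚ.≤-trans (ℕₚ.≤-reflexive (ℕₚ.+-identityʳ r)) (h y y∈)
  chain-height (suc k) r {σ} c h e with minimum {σ} c e
  ... | y₀ , y₀∈ , low with chain-height k (suc r) {rem σ y₀} (Chain-⊆ (rem-⊆ σ y₀) c) above (ℕₚ.suc-injective (trans (sym (∣rem∣ σ y₀∈)) e))
    where
    above : ∀ y → y ∈ rem σ y₀ → suc r ≤ rank y
    above y p = ℕₚ.≤-trans (s≤s (h y₀ y₀∈)) (ℕₚ.≰⇒> λ q → true≢false (subst (_∈ rem σ y₀) (sym (≼-rank (low y (into (rem-⊆ σ y₀) p)) q)) p) (∉-rem σ y₀))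
  ... | y , p , q = y , into (rem-⊆ σ y₀) p , ℕₚ.≤-trans (ℕₚ.≤-reflexive (ℕₚ.+-suc r k)) q

  -- Chains strictly above `G`: these turn out to be the faces of the link of a saturated flag from
  -- `bot` to `G`.
  Above : Fin n → Subset n → Set
  Above G σ = (∀ y → y ∈ σ → G ≼ y × y ≢ G) × Chain σ

-- A double complex of cells and chains above them interpolates between cellular homology and the
-- homology of links. `Q` selects the cells: either those above one face `G`, with `Z = vt G`, or
-- all whose vertex set contains `Z`.
module Compare {c ℓ} (K : Field c ℓ) (P : SimplicialPoset) (Q : Fin (SimplicialPoset.n P) → Bool) (Z : Subset (SimplicialPoset.n P)) where
  open Cells (Field.commutativeRing K) P
  open Chains P

  OrderChain : Fin n → ℕ → (Subset n → Carrier) → Set ℓ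
  OrderChain G q ch = ∀ S → ¬ (Above G S × ∣ S ∣ ≡ q) → ch S ≈ 0#

  -- `T` itself may belong to the chain exactly when it has a vertex outside `Z`. So the chains
  -- attached to a cell with `vt T = Z` are those strictly above it, while all larger cells carry
  -- cones with apex `T`.
  Good : Fin n → Subset n → Set
  Good T σ = (∀ y → y ∈ σ → T ≼ y × ¬ vt y ⊆ Z) × Chain σ

  X : ℕ → ℕ → (Fin n → Subset n → Carrier) → Set ℓ
  X p q f = ∀ T σ → ¬ (Q T ≡ true × rank T ≡ p × ∣ σ ∣ ≡ q × Good T σ) → f T σ ≈ 0#

  pZ : Fin n → Carrier
  pZ v = not (lookup Z v) ▹ 1#

  -- `b` is the differential on cells, `d` the one on chains, and `h` contracts `d` with the cell as
  -- apex.
  b d h : (Fin n → Subset n → Carrier) → Fin n → Subset n → Carrier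
  b f T σ = ∂ pZ (λ T' → f T' σ) T
  d f T σ = dS (f T) σ
  h f T σ = hS T (f T) σ

  pZ-0 : ∀ {v x} → (v ∉ Z → x ≈ 0#) → pZ v * x ≈ 0#
  pZ-0 {v} k with ∈-or-∉ v Z
  ... | inj₁ p = ≈-trans (*-congʳ (▹-false (cong not p))) (zeroˡ _)
  ... | inj₂ p = ≈-trans (*-congˡ (k p)) (zeroʳ _)

  dS-cong : ∀ {c c' : Subset n → Carrier} → (∀ S → c S ≈ c' S) → ∀ S → dS c S ≈ dS c' S
  dS-cong k S = ∑-cong λ x → ▹-cong (not (lookup S x)) λ _ → *-congˡ (k _)

  b-cong : ∀ {f g} → (∀ T σ → f T σ ≈ g T σ) → ∀ T σ → b f T σ ≈ b g T σ
  b-cong k T σ = ∂-cong (λ _ → ≈-refl) (λ T' → k T' σ) T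

  dS-sub : ∀ (c c' : Subset n → Carrier) S → dS (λ U → c U - c' U) S ≈ dS c S - dS c' S
  dS-sub c c' S = ≈-trans (∑-cong λ x → ≈-trans (▹-cong (not (lookup S x)) λ _ → solve 3 (λ s x y → s :* (x :- y) := s :* x :+ (:- (s :* y))) ≈-refl _ _ _) (≈-trans (▹-+ (not (lookup S x)) _ _) (+-congˡ (▹-neg (not (lookup S x)) _)))) (≈-trans (∑-+ _ _) (+-congˡ (∑-neg _)))

  b-sub : ∀ f g T σ → b (λ T' τ → f T' τ - g T' τ) T σ ≈ b f T σ - b g T σ
  b-sub f g T σ = ≈-trans (∂-cong (λ _ → ≈-refl) (λ T' → +-congˡ (solve 1 (λ x → :- x := con (ℤ.- + 1) :* x) ≈-refl (g T' σ))) T)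
    (≈-trans (∂-+ pZ _ _ T) (+-congˡ (≈-trans (∂-* pZ _ _ T) (solve 1 (λ x → con (ℤ.- + 1) :* x := :- x) ≈-refl _))))

  X-sub : ∀ {p q f g} → X p q f → X p q g → X p q (λ T σ → f T σ - g T σ)
  X-sub xf xg T σ k = ≈-trans (+-cong (xf T σ k) (-‿cong (xg T σ k))) (-‿inverseʳ 0#)

  d-b : ∀ f T σ → d (b f) T σ ≈ b (d f) T σ
  d-b f T σ = begin
    ∑ (λ x → not (lookup σ x) ▹ s x * ∂ pZ (λ T' → f T' (ins σ x)) T)
      ≈⟨ (∑-cong λ x → ≈-trans (▹-cong (not (lookup σ x)) λ _ → ≈-trans (∑-*ˡ (s x) _) (∑-cong λ v → ∑-*ˡ (s x) _)) (≈-trans (▹-∑ (not (lookup σ x)) _) (∑-cong λ v → ▹-∑ (not (lookup σ x)) _))) ⟩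
    ∑ (λ x → ∑ (λ v → ∑ (λ T' → not (lookup σ x) ▹ s x * (cov v T T' ▹ σ' v * (pZ v * f T' (ins σ x))))))
      ≈⟨ ≈-trans (∑-swap _) (∑-cong λ v → ∑-swap _) ⟩
    ∑ (λ v → ∑ (λ T' → ∑ (λ x → not (lookup σ x) ▹ s x * (cov v T T' ▹ σ' v * (pZ v * f T' (ins σ x))))))
      ≈⟨ (∑-cong λ v → ∑-cong λ T' → ≈-trans (∑-cong λ x → shuffle (not (lookup σ x)) (cov v T T') _ _ _ _)
          (≈-sym (≈-trans (▹-cong (cov v T T') λ _ → ≈-trans (*-congˡ (∑-*ˡ (pZ v) _)) (∑-*ˡ (σ' v) _)) (▹-∑ (cov v T T') _)))) ⟩
    ∑ (λ v → ∑ (λ T' → cov v T T' ▹ σ' v * (pZ v * dS (f T') σ))) ∎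
    where
    s : Fin n → Carrier
    s x = RingTools.σ (Field.commutativeRing K) x σ
    σ' : Fin n → Carrier
    σ' v = RingTools.σ (Field.commutativeRing K) v (vt T)
    shuffle : ∀ b b' s t p x → (b ▹ s * (b' ▹ t * (p * x))) ≈ (b' ▹ t * (p * (b ▹ s * x)))
    shuffle true true s t p x = solve 4 (λ s t p x → s :* (t :* (p :* x)) := t :* (p :* (s :* x))) ≈-refl s t p x
    shuffle true false s t p x = zeroʳ s
    shuffle false true s t p x = ≈-sym (≈-trans (*-congˡ (zeroʳ p)) (zeroʳ t))
    shuffle false false s t p x = ≈-refl

  Good-⊆ : ∀ {T σ τ} → τ ⊆ σ → Good T σ → Good T τ
  Good-⊆ s (g , ch) = (λ y p → g y (into s p)) , Chain-⊆ s ch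

  X-d : ∀ {p q f} → X p (suc q) f → X p q (d f)
  X-d {p} {q} {f} xf T σ k = ∑-0 λ x → ▹-0 (not (lookup σ x)) λ x∉ → ≈-trans (*-congˡ (xf T (ins σ x)
    λ { (a , r , s , g) → k (a , r , ℕₚ.suc-injective (trans (sym (∣ins∣ σ (not-true x∉))) s) , Good-⊆ (⊆-ins σ x) g) })) (zeroʳ _)

  -- A cell of rank greater than the size of `Z` has a vertex outside `Z`, so it is allowed in the
  -- chain above it.
  X-h : ∀ {p q f} → ∣ Z ∣ < p → X p q f → X p (suc q) (h f)
  X-h {p} {q} {f} z<p xf T σ k = ▹-0 (lookup σ T) λ T∈ → ≈-trans (*-congˡ (xf T (rem σ T)
    λ { (a , r , s , g , ch) → k (a , r , trans (∣rem∣ σ T∈) (cong suc s) , good r g , subst Chain (ins-rem σ T∈) (Chain-ins {rem σ T} (λ y p → inj₁ (proj₁ (g y p))) ch)) })) (zeroʳ _)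
    where
    good : rank T ≡ p → (∀ y → y ∈ rem σ T → T ≼ y × ¬ vt y ⊆ Z) → ∀ y → y ∈ σ → T ≼ y × ¬ vt y ⊆ Z
    good r g y p with y Fₚ.≟ T
    ... | no e = g y (∈-rem σ p e)
    ... | yes refl = le-refl y , λ s → ℕₚ.<⇒≱ z<p (ℕₚ.≤-trans (ℕₚ.≤-reflexive (trans (sym r) (rank≡ y))) (⊆-size s))

  d-h : ∀ {f} → (∀ T σ → d f T σ ≈ 0#) → ∀ T σ → d (h f) T σ ≈ f T σ
  d-h {f} k T σ = dS-hS T (f T) σ λ _ → k T (rem σ T)

  module Acyclic (Q⊇Z : ∀ {T} → Q T ≡ true → Z ⊆ vt T)
                 (Q-up : ∀ {H T} → Q H ≡ true → H ≼ T → Q T ≡ true)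
                 (Q-down : ∀ {H T} → Q T ≡ true → H ≼ T → Z ⊆ vt H → Q H ≡ true) where

    ∂-support : ∀ {p q σ f} → (∀ T → ¬ (Q T ≡ true × rank T ≡ suc p × ∣ σ ∣ ≡ q × Good T σ) → f T ≈ 0#) →
                ∀ T → ¬ (Q T ≡ true × rank T ≡ p × ∣ σ ∣ ≡ q × Good T σ) → ∂ pZ f T ≈ 0#
    ∂-support xf T k = ∂-0 λ v T' e → pZ-0 λ v∉ → xf T' λ { (a , r , s , g , ch) →
      k ( Q-down a (Cover.H≼T (cover e)) (incl λ {x} x∈ → subst (x ∈_) (sym (Cover.vtH (cover e))) (∈-rem (vt T') (into (Q⊇Z a) x∈) (∈-≢ {S = Z} x∈ v∉)))
        , ℕₚ.suc-injective (trans (sym (Cover.rankT (cover e))) r) , s , (λ y p → ≼-trans (Cover.H≼T (cover e)) (proj₁ (g y p)) , proj₂ (g y p)) , ch) }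

    X-b : ∀ {p q f} → X (suc p) q f → X p q (b f)
    X-b {p} {q} xf T σ k = ∂-support {p} {q} {σ} (λ T → xf T σ) T k

    -- What is needed to contract the cells below a fixed chain: the minimum of the chain, and a
    -- vertex of it outside `Z` as apex.
    record Base (σ : Subset n) : Set where
      field
        y₀ v : Fin n
        y₀∈ : y₀ ∈ σ
        low : ∀ y → y ∈ σ → y₀ ≼ y
        v∈ : v ∈ vt y₀
        v∉ : v ∉ Z

    base? : ∀ σ → Base σ ⊎ (∀ {T k} → ∣ σ ∣ ≡ suc k → ¬ Good T σ)
    base? σ with Fₚ.any? (λ y → (lookup σ y Bₚ.≟ true) ×-dec Fₚ.all? (λ z → le?? (lookup σ z) (le y z)))
      where
      le?? : ∀ b b' → Dec (b ≡ true → b' ≡ true)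
      le?? false b' = yes λ ()
      le?? true b' with b' Bₚ.≟ true
      ... | yes e = yes λ _ → e
      ... | no e = no λ k → e (k refl)
    ... | no none = inj₂ λ { {T} e (g , ch) → none (minimum {σ} ch e) }
    ... | yes (y , y∈ , l) with missing Z (vt y)
    ... | inj₁ (v , p , q) = inj₁ record { y₀ = y ; v = v ; y₀∈ = y∈ ; low = l ; v∈ = p ; v∉ = q }
    ... | inj₂ s = inj₂ λ { _ (g , _) → proj₂ (g y y∈) s }

    module Contract {p q f} (xf : X p (suc q) f) (σ : Subset n) (B : Base σ) where
      open Base B
      -- Cells below `y₀` are replaced by their vertex sets; the guard makes `ĉ` vanish on subsets
      -- that are not of this kind.
      guard : Subset n → Bool
      guard S = le (fc y₀ S) y₀ ∧ does (subset? (vt (fc y₀ S)) S)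
      ĉ : Subset n → Carrier
      ĉ S = guard S ▹ f (fc y₀ S) σ
      w : Fin n → Carrier
      w T = le T y₀ ▹ hS v ĉ (vt T)

      guard-true : ∀ {S} → S ⊆ vt y₀ → guard S ≡ true
      guard-true {S} s = ∧-intro (proj₁ (fc-spec s)) (dec-true (subset? (vt (fc y₀ S)) S) (proj₂ (fc-spec s)))

      out̂ : ∀ S → ¬ S ⊆ vt y₀ → ĉ S ≈ 0#
      out̂ S k = ▹-0 (guard S) λ e → absurd (k (⊆-trans (⊆-reflexive (sym (does-true (subset? (vt (fc y₀ S)) S) (proj₂ (∧-true {le (fc y₀ S) y₀} e))))) (vt-mono (proj₁ (∧-true {le (fc y₀ S) y₀} e)))))

      agree : ∀ T → T ≼ y₀ → f T σ ≈ ĉ (vt T)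
      agree T l = ≈-sym (≈-trans (▹-true (guard-true (vt-mono l))) (≈-reflexive (cong (λ T' → f T' σ) (fc-vt l))))

      out : ∀ T → ¬ T ≼ y₀ → f T σ ≈ 0#
      out T k = xf T σ λ { (_ , _ , _ , g , _) → k (proj₁ (g y₀ y₀∈)) }

      w-support : ∀ T → ¬ (Q T ≡ true × rank T ≡ suc p × ∣ σ ∣ ≡ suc q × Good T σ) → w T ≈ 0#
      w-support T k = ▹-0 (le T y₀) λ l → ▹-0 (lookup (vt T) v) λ v∈T → ≈-trans (*-congˡ (≈-trans (≈-reflexive (cong ĉ (sym (vt-del T v)))) (≈-trans (≈-sym (agree (del T v) (≼-trans (del≼ T v) l)))
        (xf (del T v) σ λ { (a , r , s , g , ch) → k (Q-up a (del≼ T v) , trans (rank-del v∈T) (cong suc r) , s , (λ y y∈ → ≼-trans l (low y y∈) , proj₂ (g y y∈)) , ch) })))) (zeroʳ _)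

      -- Below `y₀` the cellular boundary is simplicial, and adjoining `v` is a cone. The weights
      -- are 1 on the vertices missing from `H`, because `H` contains `Z`.
      exact : (∀ H → b f H σ ≈ 0#) → ∀ H → Q H ≡ true → H ≼ y₀ → ∂ pZ w H ≈ f H σ
      exact bf0 H qH l = begin
        ∂ pZ w H            ≈⟨ ∂-below {c = w} {y₀} (hS v ĉ) l (λ u u∉ → ▹-true (cong not (∉Z H qH u∉))) (λ T k → ▹-0 (le T y₀) λ e → absurd (k e)) (λ T e → ▹-true e) outh ⟩
        dS (hS v ĉ) (vt H)  ≈⟨ dS-hS v ĉ (vt H) (λ v∈H → ≈-trans (≈-reflexive (cong (dS ĉ) (sym (vt-del H v)))) (≈-trans (≈-sym (∂-below {c = λ T → f T σ} {y₀} ĉ (≼-trans (del≼ H v) l)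
                               (λ u u∉ → ▹-true (cong not (∉Z (del H v) (qdel v∈H) u∉))) out agree out̂)) (bf0 (del H v)))) ⟩
        ĉ (vt H)            ≈⟨ ≈-sym (agree H l) ⟩
        f H σ ∎
        where
        ∉Z : ∀ H {u} → Q H ≡ true → u ∉ vt H → u ∉ Z
        ∉Z H {u} e u∉ with ∈-or-∉ u Z
        ... | inj₂ z = z
        ... | inj₁ z = absurd (true≢false (into (Q⊇Z e) z) u∉)
        qdel : v ∈ vt H → Q (del H v) ≡ true
        qdel _ = Q-down qH (del≼ H v) (⊆-trans (⊆-rem (Q⊇Z qH) v∉) (⊆-reflexive (sym (vt-del H v))))
        outh : ∀ S → ¬ S ⊆ vt y₀ → hS v ĉ S ≈ 0#
        outh S k = ▹-0 (lookup S v) λ v∈S → ≈-trans (*-congˡ (out̂ (rem S v) λ s → k (⊆-trans (⊆-reflexive (sym (ins-rem S v∈S))) (ins-⊆ s v∈)))) (zeroʳ _)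

    -- For each nonempty chain separately the cells are the sets between `Z` and the vertex set of
    -- the minimum of the chain, and these form a cone. Whether a minimum as required exists is
    -- decidable, even where the field is not.
    b-exact : ∀ {p q f} → X p (suc q) f → (∀ T σ → b f T σ ≈ 0#) → ∃ λ w → X (suc p) (suc q) w × (∀ T σ → b w T σ ≈ f T σ)
    b-exact {p} {q} {f} xf bf0 = (λ T σ → pick (base? σ) T) , (λ T σ → support (base? σ) T) , λ T σ → eq (base? σ) T
      where
      module _ {σ : Subset n} where
        Case : Set
        Case = Base σ ⊎ (∀ {T k} → ∣ σ ∣ ≡ suc k → ¬ Good T σ)
        pick : Case → Fin n → Carrier
        pick (inj₁ B) T = Contract.w xf σ B T
        pick (inj₂ _) T = 0#
        support : ∀ cs T → ¬ (Q T ≡ true × rank T ≡ suc p × ∣ σ ∣ ≡ suc q × Good T σ) → pick cs T ≈ 0#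
        support (inj₁ B) T k = Contract.w-support xf σ B T k
        support (inj₂ _) T k = ≈-refl
        zer : ∀ cs H → ¬ (Q H ≡ true × rank H ≡ p × ∣ σ ∣ ≡ suc q × Good H σ) → ∂ pZ (pick cs) H ≈ f H σ
        zer cs H k = ≈-trans (∂-support {p} {suc q} {σ} (support cs) H k) (≈-sym (xf H σ k))
        eq : ∀ cs H → ∂ pZ (pick cs) H ≈ f H σ
        eq cs@(inj₂ k) H = zer cs H λ { (_ , _ , s , g) → k s g }
        eq cs@(inj₁ B) H with Q H in qH | le H (Base.y₀ B) in l
        ... | false | _ = zer cs H λ { (a , _) → true≢false a qH }
        ... | true | false = zer cs H λ { (_ , _ , _ , g , _) → true≢false (proj₁ (g _ (Base.y₀∈ B))) l }
        ... | true | true = Contract.exact xf σ B (λ H' → bf0 H' σ) H qH l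

    bottom-b : ∀ {q f} → X ∣ Z ∣ q f → ∀ T σ → b f T σ ≈ 0#
    bottom-b xf T σ = ∂-0 λ v T' e → pZ-0 λ v∉ → xf T' σ λ { (a , r , _) →
      true≢false (into (⊆-reflexive (sym (⊆-size-≡ (Q⊇Z a) (ℕₚ.≤-reflexive (trans (sym (rank≡ T')) r))))) (Cover.v∈T (cover e))) v∉ }

    bottom-vt : ∀ {T} → Q T ≡ true → rank T ≡ ∣ Z ∣ → vt T ≡ Z
    bottom-vt {T} a r = sym (⊆-size-≡ (Q⊇Z a) (ℕₚ.≤-reflexive (trans (sym (rank≡ T)) r)))

    good⇒above : ∀ {T σ} → vt T ≡ Z → Good T σ → Above T σ
    good⇒above {T} {σ} e (g , ch) = (λ y p → proj₁ (g y p) , λ { refl → proj₂ (g y p) (⊆-reflexive e) }) , ch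

    above⇒good : ∀ {T σ} → vt T ≡ Z → Above T σ → Good T σ
    above⇒good {T} e (g , ch) = (λ y p → proj₁ (g y p) , λ s → proj₂ (g y p) (≼-antisym (vt-reflect (le-refl y) (proj₁ (g y p)) (⊆-trans s (⊆-reflexive (sym e)))) (proj₁ (g y p)))) , ch

    module Lower (m : ℕ)
      (vanish : ∀ G q → Q G ≡ true → vt G ≡ Z → q < m → ∀ ch → OrderChain G q ch → (∀ S → dS ch S ≈ 0#) →
                ∃ λ b → OrderChain G (suc q) b × (∀ S → dS b S ≈ ch S)) where

      -- Induction on the excess `k` of the cell rank over the size of `Z`. The cone lifts `y` along
      -- `d`; a solution one rank lower and one chain element longer corrects the lift to a
      -- `b`-cycle, which is then filled by `b`. For `k = 0` there is no cone, and the lift comes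
      -- from the vanishing homology of links.
      zigzag : ∀ k q {y} → k ℕ.+ q < m → X (k ℕ.+ ∣ Z ∣) q y → (∀ T σ → d y T σ ≈ 0#) → (∀ T σ → b y T σ ≈ 0#) →
               ∃ λ w → X (suc (k ℕ.+ ∣ Z ∣)) (suc q) w × (∀ T σ → b (d w) T σ ≈ y T σ)
      zigzag zero q {y} lt xy dy by = proj₁ ex , proj₁ (proj₂ ex) , λ T σ → ≈-trans (≈-sym (d-b (proj₁ ex) T σ)) (≈-trans (dS-cong (λ τ → proj₂ (proj₂ ex) T τ) σ) (proj₂ (proj₂ (lift T)) σ))
        where
        lift : ∀ T → ∃ λ (x : Subset n → Carrier) → (∀ σ → ¬ (Q T ≡ true × rank T ≡ ∣ Z ∣ × ∣ σ ∣ ≡ suc q × Good T σ) → x σ ≈ 0#) × (∀ σ → dS x σ ≈ y T σ)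
        lift T with Q T in qT | rank T ℕₚ.≟ ∣ Z ∣
        ... | true | yes r = let (x , ox , dx) = vanish T q qT vtT lt (y T) (λ σ k → xy T σ λ { (_ , _ , s , g) → k (good⇒above {T} {σ} vtT g , s) }) (dy T)
                       in x , (λ σ k → ox σ λ { (a , s) → k (refl , r , s , above⇒good {T} {σ} vtT a) }) , dx
          where
          vtT = bottom-vt qT r
        ... | true | no r = (λ _ → 0#) , (λ _ _ → ≈-refl) , λ σ → ≈-trans (∑-0 λ x → ▹-0 (not (lookup σ x)) λ _ → zeroʳ _) (≈-sym (xy T σ λ { (_ , r' , _) → r r' }))
        ... | false | _ = (λ _ → 0#) , (λ _ _ → ≈-refl) , λ σ → ≈-trans (∑-0 λ x → ▹-0 (not (lookup σ x)) λ _ → zeroʳ _) (≈-sym (xy T σ λ { (a , _) → true≢false a qT }))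
        xx : X ∣ Z ∣ (suc q) (λ T → proj₁ (lift T))
        xx T = proj₁ (proj₂ (lift T))
        ex = b-exact xx (bottom-b xx)
      zigzag (suc k) q {y} lt xy dy by = proj₁ ex , proj₁ (proj₂ ex) , λ T σ → ≈-trans (≈-sym (d-b (proj₁ ex) T σ)) (≈-trans (dS-cong (λ τ → proj₂ (proj₂ ex) T τ) σ)
          (≈-trans (dS-sub (x T) (d w' T) σ) (≈-trans (+-cong (d-h dy T σ) (≈-trans (-‿cong (dS-dS (w' T) σ)) -0#≈0#)) (+-identityʳ _))))
        where
        x = h y
        xx : X (suc k ℕ.+ ∣ Z ∣) (suc q) x
        xx = X-h (s≤s (ℕₚ.m≤n+m ∣ Z ∣ k)) xy
        rec = zigzag k (suc q) {b x} (ℕₚ.≤-trans (ℕₚ.≤-reflexive (cong suc (ℕₚ.+-suc k q))) lt) (X-b xx)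
          (λ T σ → ≈-trans (d-b x T σ) (≈-trans (b-cong (d-h dy) T σ) (by T σ))) (λ T σ → ∂∂ pZ (λ T' → x T' σ) T)
        w' = proj₁ rec
        ex = b-exact (X-sub xx (X-d (proj₁ (proj₂ rec)))) (λ T σ → ≈-trans (b-sub x (d w') T σ) (x≈y⇒x-y≈0 (≈-sym (proj₂ (proj₂ rec) T σ))))

      -- The cycle is put at the empty chain. The zigzag yields chains of size 1, and their `d`,
      -- again at the empty chain, is the filling.
      cell-exact : ∀ k → k < m → (z : Fin n → Carrier) → (∀ T → ¬ (Q T ≡ true × rank T ≡ k ℕ.+ ∣ Z ∣) → z T ≈ 0#) → (∀ H → ∂ pZ z H ≈ 0#) →
                   ∃ λ y → (∀ T → ¬ (Q T ≡ true × rank T ≡ suc k ℕ.+ ∣ Z ∣) → y T ≈ 0#) × (∀ H → ∂ pZ y H ≈ z H)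
      cell-exact k lt z sz ∂z = (λ T → d w T ⊥) , (λ T j → X-d xw T ⊥ λ { (a , r , _) → j (a , r) }) , λ H → ≈-trans (eq H ⊥) (▹-true refl′)
        where
        y : Fin n → Subset n → Carrier
        y T σ = does (subset? σ ⊥) ▹ z T
        refl′ : does (subset? {n} ⊥ ⊥) ≡ true
        refl′ = dec-true (subset? {n} ⊥ ⊥) refl
        zig = zigzag k 0 {y} (ℕₚ.≤-trans (ℕₚ.≤-reflexive (cong suc (ℕₚ.+-identityʳ k))) lt)
          (λ T σ j → ▹-0 (does (subset? σ ⊥)) λ e → sz T λ { (a , r) → j (a , r , trans (cong ∣_∣ (does-true (subset? σ ⊥) e)) (Subₚ.∣⊥∣≡0 n) , empty {T} {σ} (does-true (subset? σ ⊥) e)) })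
          (λ T σ → ∑-0 λ x → ▹-0 (not (lookup σ x)) λ _ → ≈-trans (*-congˡ (▹-false (dec-false (subset? (ins σ x) ⊥) λ e → true≢false (trans (cong (λ S → lookup S x) (sym e)) (∈-ins σ x)) (lookup-⊥ x)))) (zeroʳ _))
          (λ T σ → bz T (does (subset? σ ⊥)))
          where
          empty : ∀ {T σ} → σ ≡ ⊥ → Good T σ
          empty refl = (λ y p → absurd (true≢false p (lookup-⊥ y))) , λ x y p → absurd (true≢false p (lookup-⊥ x))
          bz : ∀ T b → ∂ pZ (λ T' → b ▹ z T') T ≈ 0#
          bz T true = ∂z T
          bz T false = ∂-0 λ _ _ _ → zeroʳ _
        w = proj₁ zig
        xw = proj₁ (proj₂ zig)
        eq = proj₂ (proj₂ zig)

    module Top (m : ℕ) (height : ∀ {T} → Q T ≡ true → rank T ≤ ∣ Z ∣ ℕ.+ m) where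

      TopCycle : Set (c ⊔ ℓ) → Set (c ⊔ ℓ)
      TopCycle A = ∃ λ (z : Fin n → Carrier) → (∀ T → ¬ (Q T ≡ true × rank T ≡ ∣ Z ∣ ℕ.+ m) → z T ≈ 0#) × (∀ H → ∂ pZ z H ≈ 0#) × ((∀ T → z T ≈ 0#) → A)

      -- The opposite zigzag: fill by `b`, apply `d`, until no chain is left. Nonvanishing is
      -- carried along contrapositively: if `d w` vanishes then `w = d (h w)`, and `h w` would live
      -- on chains longer than the height permits.
      descend : ∀ q p {y} → p ℕ.+ q ≡ ∣ Z ∣ ℕ.+ m → ∣ Z ∣ ≤ p → X p q y → (∀ T σ → d y T σ ≈ 0#) → (∀ T σ → b y T σ ≈ 0#) → TopCycle (Level.Lift c (∀ T σ → y T σ ≈ 0#))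
      descend zero p {y} e le xy dy by = (λ T → y T ⊥) , (λ T' k → xy T' ⊥ λ { (a , r , _) → k (a , trans r (trans (sym (ℕₚ.+-identityʳ p)) e)) }) , (λ H → by H ⊥) , λ z → Level.lift (all z)
        where
        all : (∀ T → y T ⊥ ≈ 0#) → ∀ T σ → y T σ ≈ 0#
        all z T σ with subset? σ ⊥
        ... | yes refl = z T
        ... | no k = xy T σ λ { (_ , _ , s , _) → k (sym (⊆-size-≡ ⊥-⊆ (ℕₚ.≤-reflexive (trans s (sym (Subₚ.∣⊥∣≡0 n)))))) }
      descend (suc q) p {y} e le xy dy by = proj₁ rec , proj₁ (proj₂ rec) , proj₁ (proj₂ (proj₂ rec)) , λ z → Level.lift λ T σ →
          ≈-trans (≈-sym (proj₂ (proj₂ ex) T σ)) (≈-trans (b-cong (w0 (Level.lower (proj₂ (proj₂ (proj₂ rec)) z))) T σ) (∂-0 λ _ _ _ → zeroʳ _))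
        where
        ex = b-exact xy by
        w = proj₁ ex
        xw = proj₁ (proj₂ ex)
        rec = descend q (suc p) (trans (sym (ℕₚ.+-suc p q)) e) (ℕₚ.m≤n⇒m≤1+n le) (X-d xw) (λ T σ → dS-dS (w T) σ)
          (λ T σ → ≈-trans (≈-sym (d-b w T σ)) (≈-trans (dS-cong (λ τ → proj₂ (proj₂ ex) T τ) σ) (dy T σ)))
        too-high : ∀ T σ → h w T σ ≈ 0#
        too-high T σ = X-h (s≤s le) xw T σ λ { (a , r , s , g , ch) →
          let (z , z∈ , hi) = chain-height (suc q) (suc p) {σ} ch (λ y y∈ → ℕₚ.≤-trans (ℕₚ.≤-reflexive (sym r)) (rank-mono (proj₁ (g y y∈)))) s
          in ℕₚ.<⇒≱ (ℕₚ.≤-trans (ℕₚ.≤-reflexive (cong suc (sym e))) hi) (height (Q-up a (proj₁ (g z z∈)))) }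
        w0 : (∀ T σ → d w T σ ≈ 0#) → ∀ T σ → w T σ ≈ 0#
        w0 dw0 T σ = ≈-trans (≈-sym (d-h dw0 T σ)) (≈-trans (dS-cong (too-high T) σ) (∑-0 λ x → ▹-0 (not (lookup σ x)) λ _ → zeroʳ _))

      abstract
        cell-cycle : ∀ G → Q G ≡ true → vt G ≡ Z → ∀ ch → OrderChain G m ch → (∀ S → dS ch S ≈ 0#) → 
          ∃ λ (z : Fin n → Carrier) → (∀ T → ¬ (Q T ≡ true × rank T ≡ ∣ Z ∣ ℕ.+ m) → z T ≈ 0#) × (∀ H → ∂ pZ z H ≈ 0#) × ((∀ T → z T ≈ 0#) → ∀ S → ch S ≈ 0#)
        cell-cycle G qG vtG ch oc dch with descend m ∣ Z ∣ {y} refl ℕₚ.≤-refl xy dy (bottom-b xy)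
          where
          y : Fin n → Subset n → Carrier
          y T σ = does (T Fₚ.≟ G) ▹ ch σ
          xy : X ∣ Z ∣ m y
          xy T σ k with T Fₚ.≟ G
          ... | no _ = ≈-refl
          ... | yes refl = oc σ λ { (a , s) → k (qG , trans (rank≡ G) (cong ∣_∣ vtG) , s , above⇒good {G} {σ} vtG a) }
          dy : ∀ T σ → d y T σ ≈ 0#
          dy T σ with T Fₚ.≟ G
          ... | yes refl = dch σ
          ... | no _ = ∑-0 λ x → ▹-0 (not (lookup σ x)) λ _ → zeroʳ _
        ... | z , sz , ∂z , z0 = z , sz , ∂z , λ k S → ≈-trans (≈-sym (▹-true (dec-true (G Fₚ.≟ G) refl))) (Level.lower (z0 k) G S)

-- Links of saturated flags in the order complex

allᵇ⇒ : (p : Fin N → Bool) → allᵇ p (allFin N) ≡ true → ∀ x → p x ≡ true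
allᵇ⇒ {N} p = go N id
  where
  go : ∀ m (f : Fin m → Fin N) → allᵇ p (L.tabulate f) ≡ true → ∀ x → p (f x) ≡ true
  go (suc m) f e zero = proj₁ (∧-true e)
  go (suc m) f e (suc x) = go m (f ∘ suc) (proj₂ (∧-true {p (f zero)} e)) x

⇒allᵇ : (p : Fin N → Bool) → (∀ x → p x ≡ true) → allᵇ p (allFin N) ≡ true
⇒allᵇ {N} p h = go N id
  where
  go : ∀ m (f : Fin m → Fin N) → allᵇ p (L.tabulate f) ≡ true
  go zero f = refl
  go (suc m) f = ∧-intro (h (f zero)) (go m (f ∘ suc))

allSubsets-complete : (S : Subset N) → S ∈ˡ allSubsets N
allSubsets-complete [] = here refl
allSubsets-complete (false ∷ S) = ∈-++⁺ˡ (∈-map⁺ (false ∷_) (allSubsets-complete S))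
allSubsets-complete (true ∷ S) = ∈-++⁺ʳ (map (false ∷_) (allSubsets _)) (∈-map⁺ (true ∷_) (allSubsets-complete S))

maxFaceSize-≥ : (face : Subset N → Bool) (S : Subset N) → face S ≡ true → ∣ S ∣ ≤ maxFaceSize face
maxFaceSize-≥ face S e = go (allSubsets _) (allSubsets-complete S)
  where
  acc : List (Subset _) → ℕ
  acc = foldr (λ G a → if face G then ∣ G ∣ ℕ.⊔ a else a) 0
  go : ∀ Ss → S ∈ˡ Ss → ∣ S ∣ ≤ acc Ss
  go (_ ∷ Ss) (here refl) rewrite e = ℕₚ.m≤m⊔n ∣ S ∣ _
  go (U ∷ Ss) (there p) with face U
  ... | true = ℕₚ.≤-trans (go Ss p) (ℕₚ.m≤n⊔m ∣ U ∣ _)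
  ... | false = go Ss p

module Flags (P : SimplicialPoset) where
  open Faces P
  open Chains P

  orderFace⇒ : ∀ {S} → isOrderFace P S ≡ true → bot ∉ S × Chain S
  orderFace⇒ {S} e = not-true (proj₁ (∧-true {not (lookup S bot)} e)) , chain
    where
    chain : Chain S
    chain x y p q with allᵇ⇒ _ (allᵇ⇒ _ (proj₂ (∧-true {not (lookup S bot)} e)) x) y
    ... | f rewrite p | q with le x y
    ... | true = inj₁ refl
    ... | false = inj₂ f

  ⇒orderFace : ∀ {S} → bot ∉ S → Chain S → isOrderFace P S ≡ true
  ⇒orderFace {S} b c = ∧-intro (cong not b) (⇒allᵇ _ λ x → ⇒allᵇ _ λ y → comparable x y)
    where
    comparable : ∀ x y → not (lookup S x ∧ lookup S y) ∨ le x y ∨ le y x ≡ true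
    comparable x y with ∈-or-∉ x S | ∈-or-∉ y S
    ... | inj₂ p | _ rewrite p = refl
    ... | inj₁ p | inj₂ q rewrite p | q = refl
    ... | inj₁ p | inj₁ q rewrite p | q with c x y p q
    ... | inj₁ r rewrite r = refl
    ... | inj₂ r rewrite r = Bₚ.∨-zeroʳ _

  -- A maximal chain of the half-open interval from `G`, excluded, to `T`, included. The field
  -- `saturated` is what identifies links.
  record Flag (G T : Fin n) : Set where
    field
      set : Subset n
      between : ∀ x → x ∈ set → G ≼ x × x ≢ G × x ≼ T
      chain : Chain set
      size : ∣ set ∣ ℕ.+ rank G ≡ rank T
      saturated : ∀ x → G ≼ x → x ≢ G → x ≼ T → (∀ y → y ∈ set → x ≼ y ⊎ y ≼ x) → x ∈ set

  module Extend {G T v : Fin n} (G≼T : G ≼ T) (G≢T : G ≢ T) (v∈ : v ∈ vt T) (v∉ : v ∉ vt G) where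
    T' : Fin n
    T' = del T v

    G≼T' : G ≼ T'
    G≼T' = vt-reflect G≼T (del≼ T v) (⊆-trans (⊆-rem (vt-mono G≼T) v∉) (⊆-reflexive (sym (vt-del T v))))

    module _ (F' : Flag G T') where
      private module F = Flag F'

      T∉ : T ∉ F.set
      T∉ with ∈-or-∉ T F.set
      ... | inj₂ p = p
      ... | inj₁ p = absurd (ℕₚ.<⇒≱ (ℕₚ.≤-reflexive (sym (rank-del v∈))) (rank-mono (proj₂ (proj₂ (F.between T p)))))

      btw : ∀ x → x ∈ ins F.set T → G ≼ x × x ≢ G × x ≼ T
      btw x p with x Fₚ.≟ T
      ... | yes refl = G≼T , (λ e → G≢T (sym e)) , le-refl T
      ... | no e with F.between x (trans (sym (lookup-ins F.set e)) p)
      ... | a , b , c = a , b , ≼-trans c (del≼ T v)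

      T'∈ : T' ≢ G → T' ∈ F.set
      T'∈ e = F.saturated T' G≼T' e (le-refl T') λ y p → inj₂ (proj₂ (proj₂ (F.between y p)))

      sat : ∀ x → G ≼ x → x ≢ G → x ≼ T → (∀ y → y ∈ ins F.set T → x ≼ y ⊎ y ≼ x) → x ∈ ins F.set T
      sat x G≼x x≢G x≼T comp with x Fₚ.≟ T
      ... | yes refl = ∈-ins F.set x
      ... | no x≢T = into (⊆-ins F.set T) (case (T' Fₚ.≟ G))
        where
        small : rank x ≤ rank T'
        small = ℕₚ.≤-pred (ℕₚ.≤-trans (ℕₚ.≰⇒> (λ q → x≢T (≼-rank x≼T q))) (ℕₚ.≤-reflexive (rank-del v∈)))
        next : T' ∈ F.set → x ≼ T' ⊎ T' ≼ x → x ∈ F.set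
        next t (inj₁ q) = F.saturated x G≼x x≢G q λ y p → comp y (into (⊆-ins F.set T) p)
        next t (inj₂ q) = subst (_∈ F.set) (≼-rank q small) t
        case : Dec (T' ≡ G) → x ∈ F.set
        case (yes e) = absurd (x≢G (sym (≼-rank G≼x (subst (λ t → rank x ≤ rank t) e small))))
        case (no e) = next (T'∈ e) (comp T' (into (⊆-ins F.set T) (T'∈ e)))

      extend : Flag G T
      extend = record
        { set = ins F.set T
        ; between = btw
        ; chain = Chain-ins {F.set} (λ y p → inj₂ (≼-trans (proj₂ (proj₂ (F.between y p))) (del≼ T v))) F.chain
        ; size = trans (cong (ℕ._+ rank G) (∣ins∣ F.set T∉)) (trans (cong suc F.size) (sym (rank-del v∈)))
        ; saturated = sat
        }

  trivial : ∀ G → Flag G G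
  trivial G = record
    { set = ⊥
    ; between = λ x p → absurd (true≢false p (lookup-⊥ x))
    ; chain = λ x y p → absurd (true≢false p (lookup-⊥ x))
    ; size = cong (ℕ._+ rank G) (Subₚ.∣⊥∣≡0 n)
    ; saturated = λ x p q r _ → absurd (q (≼-antisym r p))
    }

  flag : ∀ k {G T} → G ≼ T → rank T ≤ k ℕ.+ rank G → Flag G T
  flag k {G} {T} G≼T h with G Fₚ.≟ T
  ... | yes refl = trivial G
  flag zero {G} {T} G≼T h | no G≢T = absurd (G≢T (≼-rank G≼T h))
  flag (suc k) {G} {T} G≼T h | no G≢T with missing (vt G) (vt T)
  ... | inj₂ s = absurd (G≢T (vt-inj G≼T (le-refl T) (⊆-antisym (vt-mono G≼T) s)))
  ... | inj₁ (v , v∈ , v∉) = Extend.extend G≼T G≢T v∈ v∉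
    (flag k (Extend.G≼T' G≼T G≢T v∈ v∉) (ℕₚ.≤-pred (ℕₚ.≤-trans (ℕₚ.≤-reflexive (sym (rank-del v∈))) h)))

  abstract
    flagOf : ∀ G → Flag bot G
    flagOf G = flag (rank G) (bot-least G) (ℕₚ.m≤m+n (rank G) (rank bot))

  -- Anything compatible with a saturated flag and disjoint from it lies strictly above `G`, see
  -- `link⇒` and `⇒link`. For `G = bot` the flag is empty and the link is the whole order complex.
  link : Fin n → Subset n → Bool
  link G = inLink (isOrderFace P) (Flag.set (flagOf G))

  private
    lookup-∪ : ∀ F (S : Subset n) x → lookup (F ∪ S) x ≡ lookup F x ∨ lookup S x
    lookup-∪ F S x = Vₚ.lookup-zipWith _∨_ x F S

    ∪ˡ : ∀ {F} {S : Subset n} {x} → x ∈ F → x ∈ F ∪ S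
    ∪ˡ {F} {S} {x} p = trans (lookup-∪ F S x) (cong (_∨ _) p)

    ∪ʳ : ∀ {F} {S : Subset n} {x} → x ∈ S → x ∈ F ∪ S
    ∪ʳ {F} {S} {x} p = trans (lookup-∪ F S x) (trans (cong (lookup F x ∨_) p) (Bₚ.∨-zeroʳ _))

    ∪⇒ : ∀ {F} {S : Subset n} {x} → x ∈ F ∪ S → x ∈ F ⊎ x ∈ S
    ∪⇒ {F} {S} {x} p with ∈-or-∉ x F
    ... | inj₁ q = inj₁ q
    ... | inj₂ q = inj₂ (trans (sym (trans (lookup-∪ F S x) (cong (_∨ _) q))) p)

  flag-face : ∀ G → isOrderFace P (Flag.set (flagOf G)) ≡ true
  flag-face G = ⇒orderFace {Flag.set (flagOf G)} bot∉ (Flag.chain (flagOf G))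
    where
    bot∉ : bot ∉ Flag.set (flagOf G)
    bot∉ with ∈-or-∉ bot (Flag.set (flagOf G))
    ... | inj₂ p = p
    ... | inj₁ p = absurd (proj₁ (proj₂ (Flag.between (flagOf G) bot p)) refl)

  link⇒ : ∀ {G S} → link G S ≡ true → Above G S
  link⇒ {G} {S} e = (λ y p → above y p) , λ x y p q → chainFS x y (∪ʳ {F.set} p) (∪ʳ {F.set} q)
    where
    module F = Flag (flagOf G)
    e₁ = proj₁ (∧-true {isOrderFace P (F.set ∪ S)} e)
    e₂ = proj₂ (∧-true {isOrderFace P (F.set ∪ S)} e)
    chainFS : Chain (F.set ∪ S)
    chainFS = proj₂ (orderFace⇒ {F.set ∪ S} e₁)
    disjoint : ∀ {x} → x ∈ F.set → x ∈ S → Void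
    disjoint {x} p q with allᵇ⇒ _ e₂ x
    ... | f rewrite p | q = true≢false f refl
    above : ∀ y → y ∈ S → G ≼ y × y ≢ G
    above y p with G Fₚ.≟ bot
    ... | yes refl = bot-least y , λ { refl → true≢false (∪ʳ {F.set} p) (proj₁ (orderFace⇒ {F.set ∪ S} e₁)) }
    ... | no G≢ = case (chainFS y G (∪ʳ {F.set} p) (∪ˡ {F.set} G∈))
      where
      G∈ : G ∈ F.set
      G∈ = F.saturated G (bot-least G) G≢ (le-refl G) λ z q → inj₂ (proj₂ (proj₂ (F.between z q)))
      y≢bot : y ≢ bot
      y≢bot refl = true≢false (∪ʳ {F.set} p) (proj₁ (orderFace⇒ {F.set ∪ S} e₁))
      case : y ≼ G ⊎ G ≼ y → G ≼ y × y ≢ G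
      case (inj₁ q) = absurd (disjoint (F.saturated y (bot-least y) y≢bot q λ z r → chainFS y z (∪ʳ {F.set} p) (∪ˡ {F.set} r)) p)
      case (inj₂ q) = q , λ { refl → disjoint G∈ p }

  ⇒link : ∀ {G S} → Above G S → link G S ≡ true
  ⇒link {G} {S} (above , ch) = ∧-intro (⇒orderFace {F.set ∪ S} bot∉ chain) (⇒allᵇ _ disjoint)
    where
    module F = Flag (flagOf G)
    bot∉ : bot ∉ F.set ∪ S
    bot∉ with ∈-or-∉ bot (F.set ∪ S)
    ... | inj₂ p = p
    ... | inj₁ p with ∪⇒ {F.set} p
    ... | inj₁ q = absurd (proj₁ (proj₂ (F.between bot q)) refl)
    ... | inj₂ q = absurd (proj₂ (above bot q) (≼-antisym (bot-least G) (proj₁ (above bot q))))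
    chain : Chain (F.set ∪ S)
    chain x y p q with ∪⇒ {F.set} p | ∪⇒ {F.set} q
    ... | inj₁ a | inj₁ b = F.chain x y a b
    ... | inj₂ a | inj₂ b = ch x y a b
    ... | inj₁ a | inj₂ b = inj₁ (≼-trans (proj₂ (proj₂ (F.between x a))) (proj₁ (above y b)))
    ... | inj₂ a | inj₁ b = inj₂ (≼-trans (proj₂ (proj₂ (F.between y b))) (proj₁ (above x a)))
    disjoint : ∀ x → not (lookup F.set x ∧ lookup S x) ≡ true
    disjoint x with ∈-or-∉ x F.set | ∈-or-∉ x S
    ... | inj₂ p | _ rewrite p = refl
    ... | inj₁ p | inj₂ q rewrite p | q = refl
    ... | inj₁ p | inj₁ q = absurd (proj₂ (above x q) (≼-antisym (proj₂ (proj₂ (F.between x p))) (proj₁ (above x q))))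

module Gorenstein {c ℓ} (K : Field c ℓ) (P : SimplicialPoset) (gor : IsGorensteinStarPoset K P) where
  open Cells (Field.commutativeRing K) P
  open Chains P
  open Flags P

  OrderChain : Fin n → ℕ → (Subset n → Carrier) → Set ℓ
  OrderChain G q ch = ∀ S → ¬ (Above G S × ∣ S ∣ ≡ q) → ch S ≈ 0#

  abstract
    m : Fin n → ℕ
    m G = maxFaceSize (link G)

    m≡ : ∀ G → m G ≡ maxFaceSize (link G)
    m≡ G = refl

  -- A flag from `G` to `T` is a face of the link of `G`, and its size is the difference of the
  -- ranks.
  height : ∀ {G T} → G ≼ T → rank T ≤ rank G ℕ.+ m G
  height {G} {T} p = ℕₚ.≤-trans (ℕₚ.≤-reflexive (trans (sym F.size) (ℕₚ.+-comm ∣ F.set ∣ (rank G))))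
    (ℕₚ.+-monoʳ-≤ (rank G) (subst (∣ F.set ∣ ≤_) (sym (m≡ G)) (maxFaceSize-≥ (link G) F.set (⇒link {G} ((λ y q → proj₁ (F.between y q) , proj₁ (proj₂ (F.between y q))) , F.chain)))))
    where
    module F = Flag (flag (rank T) p (ℕₚ.m≤m+n (rank T) (rank G)))

  module _ (G : Fin n) where
    private module H = Homology K (link G)

    hom∂ : ∀ ch S → H.∂ ch S ≈ dS ch S
    hom∂ ch S = ≈-trans (sumK≈ (λ x → if x ∈ᵇ S then 0# else H.signK (countℕ (λ t → t ∈ᵇ S ∧ (toℕ t <ᵇ toℕ x))) * ch (S ∪ ⁅ x ⁆)) n id) (∑-cong term)
      where
      sumK≈ : ∀ g k (f : Fin k → Fin n) → foldr (λ x acc → g x + acc) 0# (L.tabulate f) ≈ ∑ (g ∘ f)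
      sumK≈ g zero f = ≈-sym (∑-[] _)
      sumK≈ g (suc k) f = ≈-trans (+-congˡ (sumK≈ g k (f ∘ suc))) (≈-sym (∑-∷ _))
      signK≡ : ∀ k → H.signK k ≡ sgn k
      signK≡ zero = refl
      signK≡ (suc k) = cong -_ (signK≡ k)
      term : ∀ x → (if x ∈ᵇ S then 0# else H.signK (countℕ (λ t → t ∈ᵇ S ∧ (toℕ t <ᵇ toℕ x))) * ch (S ∪ ⁅ x ⁆)) ≈ (not (lookup S x) ▹ σ x S * ch (ins S x))
      term x with lookup S x
      ... | true = ≈-refl
      ... | false = *-congʳ (≈-reflexive (trans (signK≡ (countℕ (λ t → t ∈ᵇ S ∧ (toℕ t <ᵇ toℕ x)))) (cong sgn (countℕ≡# (λ t → t ∈ᵇ S ∧ (toℕ t <ᵇ toℕ x))))))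

    to-link : ∀ {q ch} → OrderChain G q ch → H.IsChain q ch
    to-link oc S k = oc S λ { (a , s) → k (⇒link a , s) }

    from-link : ∀ {q ch} → H.IsChain q ch → OrderChain G q ch
    from-link oc S k = oc S λ { (a , s) → k (link⇒ {G} a , s) }

    vanish : ∀ q → q ≢ m G → ∀ ch → OrderChain G q ch → (∀ S → dS ch S ≈ 0#) → ∃ λ b → OrderChain G (suc q) b × (∀ S → dS b S ≈ ch S)
    vanish q k ch oc dch with proj₂ (gor (Flag.set (flagOf G)) (flag-face G) q) (λ e → k (trans e (sym (m≡ G)))) ch (to-link oc) (λ T → ≈-trans (hom∂ ch T) (dch T))
    ... | b , ob , db = b , from-link ob , λ S → ≈-trans (≈-sym (hom∂ b S)) (db S)

    -- No chain is longer than `m G`, so all boundaries in this degree vanish: a nontrivial class is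
    -- a nonzero cycle, and generating modulo boundaries is generating.
    fundamental : ∃ λ z → OrderChain G (m G) z × (∀ S → dS z S ≈ 0#) × ¬ (∀ S → z S ≈ 0#) ×
      (∀ ch → OrderChain G (m G) ch → (∀ S → dS ch S ≈ 0#) → ∃ λ a → ∀ S → ch S ≈ a * z S)
    fundamental with proj₁ (gor (Flag.set (flagOf G)) (flag-face G) (m G)) (m≡ G)
    ... | z , oz , dz , nb , gen = z , from-link oz , (λ S → ≈-trans (≈-sym (hom∂ z S)) (dz S))
        , (λ z0 → nb ((λ _ → 0#) , (λ _ _ → ≈-refl) , λ T → ≈-trans (hom∂ _ T) (≈-trans (zero-∂ {T}) (≈-sym (z0 T)))))
        , λ ch oc dch → let (a , b , ob , db) = gen ch (to-link oc) (λ T → ≈-trans (hom∂ ch T) (dch T))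
                        in a , λ S → x-y≈0⇒x≈y _ _ (≈-trans (≈-sym (db S)) (≈-trans (hom∂ b S) (∑-0 λ x → ▹-0 (not (lookup S x)) λ _ → ≈-trans (*-congˡ (top0 b ob _)) (zeroʳ _))))
      where
      zero-∂ : ∀ {T} → dS (λ _ → 0#) T ≈ 0#
      zero-∂ {T} = ∑-0 λ x → ▹-0 (not (lookup T x)) λ _ → zeroʳ _
      top0 : ∀ b → H.IsChain (suc (m G)) b → ∀ S → b S ≈ 0#
      top0 b ob S = ob S λ { (a , s) → ℕₚ.1+n≰n (subst (_≤ m G) s (subst (∣ S ∣ ≤_) (sym (m≡ G)) (maxFaceSize-≥ (link G) S a))) }

-- Purity, ridges, and constancy along facets

module Structure {c ℓ} (K : Field c ℓ) (P : SimplicialPoset) (gor : IsGorensteinStarPoset K P)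
                 (dim : ℕ) (isRank : IsRank P dim) where
  open Cells (Field.commutativeRing K) P
  open Chains P
  open Gorenstein K P gor

  0≉1 : ¬ 0# ≈ 1#
  0≉1 = Field.0≉1 K

  rank≤ : ∀ T → rank T ≤ dim
  rank≤ = proj₂ isRank

  -- The weight that never deletes a vertex of `Z`: it gives the complex relative to the faces not
  -- containing `Z`.
  off : Subset n → Fin n → Carrier
  off Z v = not (lookup Z v) ▹ 1#

  module Star (G : Fin n) where
    open Compare K P (le G) (vt G) using (module Acyclic)
    open Acyclic vt-mono ≼-trans (λ G≼T H≼T s → vt-reflect G≼T H≼T s)

    only : ∀ {G'} → G ≼ G' → vt G' ≡ vt G → G ≡ G'
    only p e = vt-inj p (le-refl _) (sym e)

    exact : ∀ k → k < m G → (z : Fin n → Carrier) → (∀ T → ¬ (G ≼ T × rank T ≡ k ℕ.+ ∣ vt G ∣) → z T ≈ 0#) → (∀ H → ∂ (off (vt G)) z H ≈ 0#) →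
            ∃ λ y → (∀ T → ¬ (G ≼ T × rank T ≡ suc k ℕ.+ ∣ vt G ∣) → y T ≈ 0#) × (∀ H → ∂ (off (vt G)) y H ≈ z H)
    exact = Lower.cell-exact (m G) van
      where
      van : ∀ G' q → G ≼ G' → vt G' ≡ vt G → q < m G → ∀ ch → OrderChain G' q ch → (∀ S → dS ch S ≈ 0#) →
            ∃ λ b → OrderChain G' (suc q) b × (∀ S → dS b S ≈ ch S)
      van G' q p e lt ch oc dch with only p e
      ... | refl = vanish G q (ℕₚ.<⇒≢ lt) ch oc dch

    abstract
      top-cycle : ∃ λ (z : Fin n → Carrier) → (∀ T → ¬ (G ≼ T × rank T ≡ ∣ vt G ∣ ℕ.+ m G) → z T ≈ 0#) × (∀ H → ∂ (off (vt G)) z H ≈ 0#) × ¬ (∀ T → z T ≈ 0#)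
      top-cycle with fundamental G
      ... | z , oz , dz , nz , _ with Top.cell-cycle (m G) (λ p → ℕₚ.≤-trans (height p) (ℕₚ.≤-reflexive (cong (ℕ._+ m G) (rank≡ G)))) G (le-refl G) refl z oz dz
      ... | y , sy , ∂y , ny = y , sy , ∂y , λ y0 → nz (ny y0)

  Maximal : Fin n → Set
  Maximal T = ∀ {U} → T ≼ U → U ≡ T

  maximal-above : ∀ k Y → dim ≤ k ℕ.+ rank Y → ∃ λ M → Y ≼ M × Maximal M
  maximal-above k Y h with Fₚ.any? (λ U → (le Y U Bₚ.≟ true) ×-dec ¬? (U Fₚ.≟ Y))
  ... | no none = Y , le-refl Y , λ {U} p → case U p
    where
    case : ∀ U → Y ≼ U → U ≡ Y
    case U p with U Fₚ.≟ Y
    ... | yes e = e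
    ... | no e = absurd (none (U , p , e))
  maximal-above zero Y h | yes (U , p , e) = absurd (e (sym (≼-rank p (ℕₚ.≤-trans (rank≤ U) h))))
  maximal-above (suc k) Y h | yes (U , p , e) with maximal-above k U (ℕₚ.≤-trans h (ℕₚ.≤-trans (ℕₚ.≤-reflexive (sym (ℕₚ.+-suc k (rank Y)))) (ℕₚ.+-monoʳ-≤ k (ℕₚ.≰⇒> λ q → e (sym (≼-rank p q))))))
  ... | M , q , mx = M , ≼-trans p q , mx

  abstract
    top : Fin n → Fin n
    top Y = proj₁ (maximal-above dim Y (ℕₚ.m≤m+n dim (rank Y)))

    ≼top : ∀ Y → Y ≼ top Y
    ≼top Y = proj₁ (proj₂ (maximal-above dim Y (ℕₚ.m≤m+n dim (rank Y))))

    top-maximal : ∀ Y → Maximal (top Y)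
    top-maximal Y = proj₂ (proj₂ (maximal-above dim Y (ℕₚ.m≤m+n dim (rank Y))))

  ∂-unit : ∀ {G A v x} → Cover v G A → ∀ H → ∂ (off (vt G)) (unit A x) H ≈ (does (H Fₚ.≟ G) ▹ σ v (vt G) * x)
  ∂-unit {G} {A} {v} {x} cv H with H Fₚ.≟ G
  ... | no k = ∂-0 λ u T e → case u T e (∈-or-∉ u (vt G))
    where
    case : ∀ u T → cov u H T ≡ true → u ∈ vt G ⊎ u ∉ vt G → off (vt G) u * unit A x T ≈ 0#
    case u T e (inj₁ p) = ≈-trans (*-congʳ (▹-false (cong not p))) (zeroˡ _)
    case u T e (inj₂ p) with T Fₚ.≟ A
    ... | no _ = zeroʳ _
    ... | yes refl with u Fₚ.≟ v
    ... | yes refl = absurd (k (vt-inj (Cover.H≼T (cover e)) (Cover.H≼T cv) (trans (Cover.vtH (cover e)) (sym (Cover.vtH cv)))))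
    ... | no u≢v = absurd (true≢false (trans (sym (lookup-ins (vt G) u≢v)) (subst (u ∈_) (Cover.vtT cv) (Cover.v∈T (cover e)))) p)
  ... | yes refl = ≈-trans (∑-single v λ u k → ∑-0 λ T → ▹-0 (cov u H T) λ e → ≈-trans (*-congˡ (≈-trans (*-congˡ (unit-off {A} {x} {T} λ { refl → k (same u e) })) (zeroʳ _))) (zeroʳ _))
      (≈-trans (∑-single A λ T k → ▹-0 (cov v H T) λ _ → ≈-trans (*-congˡ (≈-trans (*-congˡ (unit-off k)) (zeroʳ _))) (zeroʳ _))
      (≈-trans (▹-true (cov-ins (Cover.v∉H cv) (Cover.H≼T cv) (Cover.vtT cv))) (*-congˡ (≈-trans (*-cong (▹-true (cong not (Cover.v∉H cv))) (unit-on A)) (*-identityˡ _)))))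
    where
    same : ∀ u → cov u H A ≡ true → u ≡ v
    same u e with u Fₚ.≟ v
    ... | yes p = p
    ... | no k = absurd (true≢false (trans (sym (lookup-ins (vt H) k)) (subst (u ∈_) (Cover.vtT cv) (Cover.v∈T (cover e)))) (Cover.v∉H (cover e)))

  ∂-local : ∀ {p c c' H} → (∀ v T → cov v H T ≡ true → c T ≈ c' T) → ∂ p c H ≈ ∂ p c' H
  ∂-local {H = H} k = ∑-cong λ v → ∑-cong λ T → ▹-cong (cov v H T) λ e → *-congˡ (*-congˡ (k v T e))

  atom-between : ∀ {G T} → G ≼ T → T ≢ G → ∃ λ v → ∃ λ A → Cover v G A × A ≼ T
  atom-between {G} {T} p k with missing (vt G) (vt T)
  ... | inj₂ s = absurd (k (sym (vt-inj p (le-refl T) (⊆-antisym (vt-mono p) s))))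
  ... | inj₁ (v , v∈ , v∉) = v , A , cover (cov-ins v∉ (vt-reflect p (proj₁ spec) (⊆-trans (⊆-ins (vt G) v) (⊆-reflexive (sym (proj₂ spec))))) (proj₂ spec)) , proj₁ spec
    where
    A = fc T (ins (vt G) v)
    spec = fc-spec {T} {ins (vt G) v} (ins-⊆ (vt-mono p) v∈)

  -- Used twice: with the rank for `ρ` it gives purity, with the absolute value of the coefficients
  -- of a top cycle it makes them equal up to sign.
  module Constancy (ρ : Fin n → ℕ) where

    Const : Fin n → Set
    Const G = ∀ {T U} → Maximal T → Maximal U → G ≼ T → G ≼ U → ρ T ≡ ρ U

    -- If ρ took two values above G, the part of a filling of a 0-cycle of the link lying under one value would again
    -- be a chain, and its boundary would be a single vertex.
    separate : ∀ {G} → 1 < m G → (∀ Y → G ≼ Y → Y ≢ G → Const Y) →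
               ∀ {v A v' A'} → Cover v G A → Cover v' G A' → ρ (top A') ≢ ρ (top A) → Void
    separate {G} 1<m const {v} {A} {v'} {A'} cv cv' ne = 0≉1 (≈-trans (≈-sym (∂∂ p (λ Y → ind Y ▹ y Y) G)) one)
      where
      p = off (vt G)
      ind : Fin n → Bool
      ind Y = ρ (top Y) ≡ᵇ ρ (top A)
      z : Fin n → Carrier
      z Y = unit A (σ v (vt G)) Y + unit A' (- σ v' (vt G)) Y
      supp : ∀ {v A x} → Cover v G A → ∀ T → ¬ (G ≼ T × rank T ≡ 1 ℕ.+ ∣ vt G ∣) → unit A x T ≈ 0#
      supp {A = A} {x} cv T k = unit-off {A} {x} {T} λ { refl → k (Cover.H≼T cv , trans (Cover.rankT cv) (cong suc (rank≡ G))) }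
      cyc : ∀ H → ∂ p z H ≈ 0#
      cyc H = ≈-trans (∂-+ p _ _ H) (≈-trans (+-cong (∂-unit cv H) (∂-unit cv' H)) (≈-trans (≈-sym (▹-+ (does (H Fₚ.≟ G)) _ _))
        (▹-0 (does (H Fₚ.≟ G)) λ _ → ≈-trans (+-cong (σ² v (vt G)) (≈-trans (≈-sym (-‿distribʳ-* _ _)) (-‿cong (σ² v' (vt G))))) (-‿inverseʳ 1#))))
      ex = Star.exact G 1 1<m z (λ T k → ≈-trans (+-cong (supp cv T k) (supp cv' T k)) (+-identityˡ 0#)) cyc
      y = proj₁ ex
      ∂y : ∀ H → ∂ p y H ≈ z H
      ∂y = proj₂ (proj₂ ex)
      ind-≡ : ∀ {Y U} → G ≼ Y → Y ≢ G → Y ≼ U → ind U ≡ ind Y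
      ind-≡ {Y} {U} q k r = cong (_≡ᵇ ρ (top A)) (const Y q k (top-maximal U) (top-maximal Y) (≼-trans r (≼top U)) (≼top Y))
      A≢G : ∀ {v A} → Cover v G A → A ≢ G
      A≢G cv refl = ℕₚ.1+n≢n (sym (Cover.rankT cv))
      ind-A : ind A ≡ true
      ind-A = ≡ᵇ-true {ρ (top A)} refl
      ind-A' : ind A' ≡ false
      ind-A' with ind A' in e
      ... | false = refl
      ... | true = absurd (ne (≡ᵇ⇒≡ e))
      select : ∀ Y → (ind Y ▹ z Y) ≈ unit A (σ v (vt G)) Y
      select Y with Y Fₚ.≟ A
      ... | yes refl = ≈-trans (▹-true ind-A) (≈-trans (+-congˡ (unit-off {A'} { - σ v' (vt G)} {Y} λ { refl → true≢false ind-A ind-A' })) (+-identityʳ _))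
      ... | no k with Y Fₚ.≟ A'
      ... | yes refl = ▹-false ind-A'
      ... | no k' = ▹-0 (ind Y) λ _ → +-identityˡ 0#
      part : ∀ u Y → cov u G Y ≡ true → ∂ p (λ U → ind U ▹ y U) Y ≈ unit A (σ v (vt G)) Y
      part u Y e = begin
        ∂ p (λ U → ind U ▹ y U) Y   ≈⟨ ∂-local (λ w U e' → ▹-≡ (ind-≡ (Cover.H≼T (cover e)) (A≢G (cover e)) (Cover.H≼T (cover e')))) ⟩
        ∂ p (λ U → ind Y ▹ y U) Y   ≈⟨ out (ind Y) ⟩
        (ind Y ▹ ∂ p y Y)           ≈⟨ ▹-cong (ind Y) (λ _ → ∂y Y) ⟩
        (ind Y ▹ z Y)               ≈⟨ select Y ⟩
        unit A (σ v (vt G)) Y ∎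
        where
        out : ∀ b → ∂ p (λ U → b ▹ y U) Y ≈ (b ▹ ∂ p y Y)
        out true = ≈-refl
        out false = ∂-0 λ _ _ _ → zeroʳ _
      one : ∂ p (∂ p (λ Y → ind Y ▹ y Y)) G ≈ 1#
      one = ≈-trans (∂-local part) (≈-trans (∂-unit cv G) (≈-trans (▹-true (dec-true (G Fₚ.≟ G) refl)) (σ² v (vt G))))

    -- Downward induction on the rank of `G`, with `k` bounding the corank. Links of positive
    -- dimension are connected, which is `separate`; only empty and zero-dimensional links are left
    -- to `small`.
    constant : (∀ G → m G ≤ 1 → Const G) → ∀ k G → dim ≤ k ℕ.+ rank G → Const G
    constant small k G h {T} {U} mT mU p q with m G ℕₚ.≤? 1
    ... | yes s = small G s mT mU p q
    ... | no big with T Fₚ.≟ G | U Fₚ.≟ G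
    ... | yes refl | _ = cong ρ (sym (mT q))
    ... | no _ | yes refl = cong ρ (mU p)
    constant small zero G h {T} mT mU p q | no big | no T≢ | no U≢ = absurd (T≢ (sym (≼-rank p (ℕₚ.≤-trans (rank≤ T) h))))
    constant small (suc k) G h {T} {U} mT mU p q | no big | no T≢ | no U≢ with ρ T ℕₚ.≟ ρ U
    ... | yes e = e
    ... | no ne = absurd (separate (ℕₚ.≰⇒> big) const cT cU λ e → ne (trans (sym (eqT)) (trans (sym e) eqU)))
      where
      const : ∀ Y → G ≼ Y → Y ≢ G → Const Y
      const Y r Y≢ = constant small k Y (ℕₚ.≤-trans h (ℕₚ.≤-trans (ℕₚ.≤-reflexive (sym (ℕₚ.+-suc k (rank G)))) (ℕₚ.+-monoʳ-≤ k (ℕₚ.≰⇒> λ t → Y≢ (sym (≼-rank r t))))))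
      aT = atom-between p T≢
      aU = atom-between q U≢
      A = proj₁ (proj₂ aT)
      B = proj₁ (proj₂ aU)
      cT = proj₁ (proj₂ (proj₂ aT))
      cU = proj₁ (proj₂ (proj₂ aU))
      A≢G : ∀ {v A} → Cover v G A → A ≢ G
      A≢G cv refl = ℕₚ.1+n≢n (sym (Cover.rankT cv))
      eqT : ρ (top A) ≡ ρ T
      eqT = const A (Cover.H≼T cT) (A≢G cT) (top-maximal A) mT (≼top A) (proj₂ (proj₂ (proj₂ aT)))
      eqU : ρ (top B) ≡ ρ U
      eqU = const B (Cover.H≼T cU) (A≢G cU) (top-maximal B) mU (≼top B) (proj₂ (proj₂ (proj₂ aU)))

  facet-maximal : ∀ {T} → rank T ≡ dim → Maximal T
  facet-maximal {T} e {U} p = sym (≼-rank p (ℕₚ.≤-trans (rank≤ U) (ℕₚ.≤-reflexive (sym e))))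

  -- The rank is constant on maximal faces: if the link of `G` has dimension at most 0, all faces
  -- properly above `G` have rank one more. Some maximal face has rank `dim` by hypothesis.
  pure : ∀ {T} → Maximal T → rank T ≡ dim
  pure {T} mT = trans (constant small dim bot (ℕₚ.m≤m+n dim (rank bot)) mT (facet-maximal (proj₂ (proj₁ isRank))) (bot-least _) (bot-least _)) (proj₂ (proj₁ isRank))
    where
    open Constancy rank
    above : ∀ {G T} → m G ≤ 1 → G ≼ T → T ≢ G → rank T ≡ suc (rank G)
    above {G} {T} s p k = ℕₚ.≤-antisym (ℕₚ.≤-trans (height p) (ℕₚ.≤-trans (ℕₚ.+-monoʳ-≤ (rank G) s) (ℕₚ.≤-reflexive (ℕₚ.+-comm (rank G) 1)))) (ℕₚ.≰⇒> λ q → k (sym (≼-rank p q)))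
    small : ∀ G → m G ≤ 1 → Const G
    small G s {T} {U} mT mU p q with T Fₚ.≟ G | U Fₚ.≟ G
    ... | yes refl | _ = cong rank (sym (mT q))
    ... | no _ | yes refl = cong rank (mU p)
    ... | no k | no l = trans (above s p k) (sym (above s q l))

  dim≤ : ∀ G → dim ≤ rank G ℕ.+ m G
  dim≤ G = ℕₚ.≤-trans (ℕₚ.≤-reflexive (sym (pure (top-maximal G)))) (height (≼top G))

  private
    point : Fin n → Subset n → Carrier
    point T S = does (subset? S ⁅ T ⁆) ▹ 1#

    dS-point : ∀ T S → dS (point T) S ≈ (does (subset? S ⊥) ▹ 1#)
    dS-point T S with subset? S ⊥
    ... | yes refl = ≈-trans (∑-single T λ x k → ▹-0 (not (lookup S x)) λ _ → ≈-trans (*-congˡ (▹-false (dec-false (subset? (ins ⊥ x) ⁅ T ⁆) λ e → true≢false (∈-ins ⊥ x) (trans (cong (λ S → lookup S x) e) (lookup-⁅⁆′ k))))) (zeroʳ _))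
      (≈-trans (▹-true (cong not (lookup-⊥ T))) (≈-trans (*-cong (≈-reflexive (cong sgn (#-none {p = λ (t : Fin n) → lookup ⊥ t ∧ (toℕ t <ᵇ toℕ T)} λ t → cong (_∧ (toℕ t <ᵇ toℕ T)) (lookup-⊥ t)))) (▹-true (dec-true (subset? (ins ⊥ T) ⁅ T ⁆) ins-⊥))) (*-identityˡ 1#)))
      where
      ins-⊥ : ins ⊥ T ≡ ⁅ T ⁆
      ins-⊥ = Subₚ.∪-identityˡ ⁅ T ⁆
    ... | no k = ∑-0 λ x → ▹-0 (not (lookup S x)) λ x∉ → ≈-trans (*-congˡ (▹-false (dec-false (subset? (ins S x) ⁅ T ⁆) λ e → k (empty (not-true x∉) e)))) (zeroʳ _)
      where
      empty : ∀ {x} → x ∉ S → ins S x ≡ ⁅ T ⁆ → S ≡ ⊥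
      empty {x} x∉ e = ⊆-antisym (incl λ {y} y∈ → absurd (∈-≢ {S = S} y∈ x∉ (trans (single (into (⊆-ins S x) y∈)) (sym (single (∈-ins S x)))))) ⊥-⊆
        where
        single : ∀ {y} → y ∈ ins S x → y ≡ T
        single {y} y∈ with y Fₚ.≟ T
        ... | yes p = p
        ... | no p = absurd (true≢false (subst (y ∈_) e y∈) (lookup-⁅⁆′ p))

  -- The reduced homology of a zero-dimensional link has dimension one, so it has no three points:
  -- `T - U` and `T - V` would be multiples of one cycle. Comparing them at `V` makes the first
  -- multiple zero, against its coefficient 1 at `T`.
  ridge : ∀ {G} → m G ≡ 1 → ∀ {T U V} → G ≼ T → T ≢ G → G ≼ U → U ≢ G → G ≼ V → V ≢ G → T ≢ U → T ≢ V → U ≢ V → Void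
  ridge {G} m1 {T} {U} {V} pT nT pU nU pV nV T≢U T≢V U≢V with fundamental G
  ... | z , oz , dz , _ , gen = 0≉1 (≈-trans (≈-sym (≈-trans (*-congʳ a₁0) (zeroˡ _))) (≈-trans (≈-sym (e₁ ⁅ T ⁆)) (val-T U T≢U)))
    where
    ch : Fin n → Subset n → Carrier
    ch U S = point T S - point U S
    is : ∀ {U} → G ≼ U → U ≢ G → OrderChain G (m G) (ch U)
    is {U} pU nU S k = ≈-trans (+-cong (out pT nT) (-‿cong (out pU nU))) (-‿inverseʳ 0#)
      where
      out : ∀ {U} → G ≼ U → U ≢ G → point U S ≈ 0#
      out {U} pU nU = ▹-false (dec-false (subset? S ⁅ U ⁆) λ { refl → k ((above , chain) , trans (Subₚ.∣⁅x⁆∣≡1 U) (sym m1)) })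
        where
        is-U : ∀ {y} → y ∈ ⁅ U ⁆ → y ≡ U
        is-U {y} q with y Fₚ.≟ U
        ... | yes e = e
        ... | no e = absurd (true≢false q (lookup-⁅⁆′ e))
        above : ∀ y → y ∈ ⁅ U ⁆ → G ≼ y × y ≢ G
        above y q with is-U q
        ... | refl = pU , nU
        chain : Chain ⁅ U ⁆
        chain x y p q = inj₁ (subst (x ≼_) (trans (is-U p) (sym (is-U q))) (le-refl x))
    cyc : ∀ U S → dS (ch U) S ≈ 0#
    cyc U S = ≈-trans (Compare.dS-sub K P (le G) (vt G) (point T) (point U) S) (x≈y⇒x-y≈0 (≈-trans (dS-point T S) (≈-sym (dS-point U S))))
    a₁ = proj₁ (gen (ch U) (is pU nU) (cyc U))
    e₁ = proj₂ (gen (ch U) (is pU nU) (cyc U))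
    a₂ = proj₁ (gen (ch V) (is pV nV) (cyc V))
    e₂ = proj₂ (gen (ch V) (is pV nV) (cyc V))
    ⁅⁆-inj : ∀ {x y : Fin n} → ⁅ x ⁆ ≡ ⁅ y ⁆ → x ≡ y
    ⁅⁆-inj {x} {y} e with x Fₚ.≟ y
    ... | yes p = p
    ... | no p = absurd (true≢false (lookup-⁅⁆ x) (trans (cong (λ S → lookup S x) e) (lookup-⁅⁆′ p)))
    pt : ∀ {x y} → y ≢ x → point x ⁅ y ⁆ ≈ 0#
    pt {x} {y} k = ▹-false (dec-false (subset? ⁅ y ⁆ ⁅ x ⁆) (k ∘ ⁅⁆-inj))
    pt1 : ∀ x → point x ⁅ x ⁆ ≈ 1#
    pt1 x = ▹-true (dec-true (subset? ⁅ x ⁆ ⁅ x ⁆) refl)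
    val-T : ∀ U → T ≢ U → ch U ⁅ T ⁆ ≈ 1#
    val-T U k = ≈-trans (+-cong (pt1 T) (≈-trans (-‿cong (pt k)) -0#≈0#)) (+-identityʳ _)
    a₁0 : a₁ ≈ 0#
    a₁0 = begin
      a₁                        ≈⟨ solve 1 (λ a → a := :- (a :* (:- con (+ 1)))) ≈-refl a₁ ⟩
      - (a₁ * - ι (+ 1))         ≈⟨ -‿cong (*-congˡ (≈-trans (-‿cong ι-1) (≈-sym chV))) ⟩
      - (a₁ * ch V ⁅ V ⁆)        ≈⟨ -‿cong (≈-trans (*-congˡ (e₂ ⁅ V ⁆)) (solve 3 (λ a b z → a :* (b :* z) := b :* (a :* z)) ≈-refl _ _ _)) ⟩
      - (a₂ * (a₁ * z ⁅ V ⁆))    ≈⟨ -‿cong (≈-trans (*-congˡ (≈-trans (≈-sym (e₁ ⁅ V ⁆)) chU)) (zeroʳ _)) ⟩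
      - 0#                      ≈⟨ -0#≈0# ⟩
      0# ∎
      where
      chV : ch V ⁅ V ⁆ ≈ - 1#
      chV = ≈-trans (+-cong (pt (T≢V ∘ sym)) (-‿cong (pt1 V))) (+-identityˡ _)
      chU : ch U ⁅ V ⁆ ≈ 0#
      chU = ≈-trans (+-cong (pt (T≢V ∘ sym)) (-‿cong (pt (U≢V ∘ sym)))) (-‿inverseʳ 0#)

-- Integral linear algebra over a field

module ℤr = RingTools ℤₚ.+-*-commutativeRing

record PairGCD (a b : ℤ) : Set where
  field
    g α β x y : ℤ
    a≡ : a ≡ α ℤ.* g
    b≡ : b ≡ β ℤ.* g
    combine : x ℤ.* a ℤ.+ y ℤ.* b ≡ g

abs-sign : ∀ a → ∃ λ s → a ≡ s ℤ.* + ℤ.∣ a ∣ × + ℤ.∣ a ∣ ≡ s ℤ.* a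
abs-sign (+ m) = + 1 , sym (ℤₚ.*-identityˡ (+ m)) , sym (ℤₚ.*-identityˡ (+ m))
abs-sign -[1+ m ] = ℤ.- + 1 , sym (ℤₚ.-1*i≡-i (+ suc m)) , sym (ℤₚ.-1*i≡-i -[1+ m ])

pair-gcd : ∀ a b → PairGCD a b
pair-gcd a b with GCD.Bézout.lemma ℤ.∣ a ∣ ℤ.∣ b ∣ | abs-sign a | abs-sign b
... | GCD.Bézout.result d gcd id | s , ea , ea' | t , eb , eb' with GCD.GCD.commonDivisor gcd
... | ℕᵈ.divides q q≡ , ℕᵈ.divides r r≡ with coefficients id
  where
  coefficients : GCD.Bézout.Identity.Identity d ℤ.∣ a ∣ ℤ.∣ b ∣ → ∃ λ x → ∃ λ y → x ℤ.* + ℤ.∣ a ∣ ℤ.+ y ℤ.* + ℤ.∣ b ∣ ≡ + d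
  coefficients (GCD.Bézout.Identity.+- x y e) = + x , ℤ.- + y , solved
    where
    e' : + d ℤ.+ + y ℤ.* + ℤ.∣ b ∣ ≡ + x ℤ.* + ℤ.∣ a ∣
    e' = trans (cong (λ t → (+ d) ℤ.+ t) (sym (ℤₚ.pos-* y ℤ.∣ b ∣))) (trans (sym (ℤₚ.pos-+ d _)) (trans (cong +_ e) (ℤₚ.pos-* x ℤ.∣ a ∣)))
    solved : + x ℤ.* + ℤ.∣ a ∣ ℤ.+ ℤ.- + y ℤ.* + ℤ.∣ b ∣ ≡ + d
    solved = trans (cong (λ t → t ℤ.+ (ℤ.- (+ y)) ℤ.* (+ ℤ.∣ b ∣)) (sym e')) (ℤr.solve 3 (λ d y b → d ℤr.:+ y ℤr.:* b ℤr.:+ (ℤr.:- y) ℤr.:* b ℤr.:= d) refl (+ d) (+ y) (+ ℤ.∣ b ∣))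
  coefficients (GCD.Bézout.Identity.-+ x y e) = ℤ.- + x , + y , solved
    where
    e' : + d ℤ.+ + x ℤ.* + ℤ.∣ a ∣ ≡ + y ℤ.* + ℤ.∣ b ∣
    e' = trans (cong (λ t → (+ d) ℤ.+ t) (sym (ℤₚ.pos-* x ℤ.∣ a ∣))) (trans (sym (ℤₚ.pos-+ d _)) (trans (cong +_ e) (ℤₚ.pos-* y ℤ.∣ b ∣)))
    solved : ℤ.- + x ℤ.* + ℤ.∣ a ∣ ℤ.+ + y ℤ.* + ℤ.∣ b ∣ ≡ + d
    solved = trans (cong (λ t → (ℤ.- (+ x)) ℤ.* (+ ℤ.∣ a ∣) ℤ.+ t) (sym e')) (ℤr.solve 3 (λ d x a → (ℤr.:- x) ℤr.:* a ℤr.:+ (d ℤr.:+ x ℤr.:* a) ℤr.:= d) refl (+ d) (+ x) (+ ℤ.∣ a ∣))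
... | x , y , e = record
  { g = + d ; α = s ℤ.* + q ; β = t ℤ.* + r ; x = x ℤ.* s ; y = y ℤ.* t
  ; a≡ = trans ea (trans (cong (s ℤ.*_) (trans (cong +_ q≡) (ℤₚ.pos-* q d))) (sym (ℤₚ.*-assoc s (+ q) (+ d))))
  ; b≡ = trans eb (trans (cong (t ℤ.*_) (trans (cong +_ r≡) (ℤₚ.pos-* r d))) (sym (ℤₚ.*-assoc t (+ r) (+ d))))
  ; combine = trans (cong₂ ℤ._+_ (trans (ℤₚ.*-assoc x s a) (cong (x ℤ.*_) (sym ea'))) (trans (ℤₚ.*-assoc y t b) (cong (y ℤ.*_) (sym eb')))) e
  }

vector-gcd : ∀ {k} (z : Fin k → ℤ) → ∃ λ g → ∃ λ (q : Fin k → ℤ) → ∃ λ (u : Fin k → ℤ) → (∀ p → z p ≡ q p ℤ.* g) × ℤr.∑ (λ p → u p ℤ.* z p) ≡ g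
vector-gcd {zero} z = + 0 , (λ ()) , (λ ()) , (λ ()) , ℤr.∑-[] _
vector-gcd {suc k} z with vector-gcd (z ∘ suc)
... | g' , q , u , z≡ , s = G.g , q' , u' , z≡' , trans (ℤr.∑-∷ _) (trans (cong (λ t → G.x ℤ.* z zero ℤ.+ t) tail) G.combine)
  where
  module G = PairGCD (pair-gcd (z zero) g')
  q' : Fin (suc k) → ℤ
  q' zero = G.α
  q' (suc p) = q p ℤ.* G.β
  u' : Fin (suc k) → ℤ
  u' zero = G.x
  u' (suc p) = G.y ℤ.* u p
  z≡' : ∀ p → z p ≡ q' p ℤ.* G.g
  z≡' zero = G.a≡
  z≡' (suc p) = trans (z≡ p) (trans (cong (q p ℤ.*_) G.b≡) (sym (ℤₚ.*-assoc (q p) G.β G.g)))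
  tail : ℤr.∑ (λ p → (G.y ℤ.* u p) ℤ.* z (suc p)) ≡ G.y ℤ.* g'
  tail = trans (ℤr.∑-cong λ p → ℤₚ.*-assoc G.y (u p) (z (suc p))) (trans (sym (ℤr.∑-*ˡ G.y _)) (cong (G.y ℤ.*_) s))

module Integral {c ℓ} (R : CommutativeRing c ℓ) where
  open RingTools R

  ι-∑ : ∀ {m} (f : Fin m → ℤ) → ι (ℤr.∑ f) ≈ ∑ (λ i → ι (f i))
  ι-∑ {zero} f = ≈-trans (≈-reflexive (cong ι (ℤr.∑-[] f))) (≈-sym (∑-[] _))
  ι-∑ {suc m} f = ≈-trans (≈-reflexive (cong ι (ℤr.∑-∷ f))) (≈-trans (ι-+ (f zero) _) (≈-trans (+-congˡ (ι-∑ (f ∘ suc))) (≈-sym (∑-∷ _))))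

  ι-sgn : ∀ k → ι (ℤr.sgn k) ≈ sgn k
  ι-sgn zero = ι-1
  ι-sgn (suc k) = ≈-trans (ι-neg (ℤr.sgn k)) (-‿cong (ι-sgn k))

  ι-▹ : ∀ b x → ι (b ℤr.▹ x) ≈ (b ▹ ι x)
  ι-▹ true x = ≈-refl
  ι-▹ false x = ≈-refl

  ι-∂ : ∀ P p c H → ι (Cells.∂ ℤₚ.+-*-commutativeRing P p c H) ≈ Cells.∂ R P (λ v → ι (p v)) (λ T → ι (c T)) H
  ι-∂ P p c H = ≈-trans (ι-∑ _) (∑-cong λ v → ≈-trans (ι-∑ _) (∑-cong λ T → ≈-trans (ι-▹ (cov v H T) _) (▹-cong (cov v H T) λ _ →
    ≈-trans (ι-* (ℤr.σ v (vt H)) _) (*-cong (ι-sgn (cnt v (vt H))) (ι-* (p v) (c T))))))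
    where open Faces P

  ι-δ : ∀ P p c T → ι (Cells.δ ℤₚ.+-*-commutativeRing P p c T) ≈ Cells.δ R P (λ v → ι (p v)) (λ U → ι (c U)) T
  ι-δ P p c T = ≈-trans (ι-∑ _) (∑-cong λ v → ≈-trans (ι-▹ (lookup (vt T) v) _) (▹-cong (lookup (vt T) v) λ _ →
    ≈-trans (ι-* (ℤr.σ v (rem (vt T) v)) _) (*-cong (ι-sgn (cnt v (rem (vt T) v))) (ι-* (p v) (c (del T v))))))
    where open Faces P

search : ∀ {k} {P Q : Fin k → Set ℓ₁} → (∀ i → P i ⊎ Q i) → (∀ i → P i) ⊎ (∃ λ i → Q i)
search {k = zero} f = inj₁ λ ()
search {k = suc k} f with f zero | search (λ i → f (suc i))
... | inj₂ q | _ = inj₂ (zero , q)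
... | inj₁ _ | inj₂ (i , q) = inj₂ (suc i , q)
... | inj₁ p | inj₁ ps = inj₁ λ { zero → p ; (suc i) → ps i }

module Elimination {c ℓ} (K : Field c ℓ) {k l : ℕ} where
  open RingTools (Field.commutativeRing K)
  open Integral (Field.commutativeRing K)

  cancelˡ : ∀ {u x} → ¬ u ≈ 0# → u * x ≈ 0# → x ≈ 0#
  cancelˡ {u} {x} u≢0 e with Field.inverse K u u≢0
  ... | w , uw = begin
    x            ≈⟨ ≈-sym (≈-trans (*-congʳ uw) (*-identityˡ x)) ⟩
    (u * w) * x  ≈⟨ solve 3 (λ u w x → (u :* w) :* x := w :* (u :* x)) ≈-refl u w x ⟩
    w * (u * x)  ≈⟨ ≈-trans (*-congˡ e) (zeroʳ w) ⟩
    0# ∎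

  -- The rows of A span, over the field, the reduction of the saturated lattice W; `kill` says so dually.
  record System (A : Fin l → Fin k → ℤ) : Set (Level.suc 0ℓ ⊔ c ⊔ ℓ) where
    field
      W : (Fin k → ℤ) → Set
      W-combine : ∀ a b {c c'} → W c → W c' → W (λ p → a ℤ.* c p ℤ.+ b ℤ.* c' p)
      W-row : ∀ i → W (A i)
      W-saturated : ∀ {g c} → g ≢ + 0 → W (λ p → c p ℤ.* g) → W c
      W-ext : ∀ {c c'} → (∀ p → c p ≡ c' p) → W c → W c'
      kill : ∀ {c} → W c → (x : Fin k → Carrier) → (∀ i → ∑ (λ p → ι (A i p) * x p) ≈ 0#) → ∑ (λ p → ι (c p) * x p) ≈ 0#

  -- Membership in the lattice of the rows up to a factor that is nonzero in the field, so up to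
  -- torsion prime to the characteristic.
  Spanned : (Fin l → Fin k → ℤ) → (Fin k → ℤ) → Set ℓ
  Spanned A c = ∃ λ s → ∃ λ (y : Fin l → ℤ) → ¬ ι s ≈ 0# × (∀ p → s ℤ.* c p ≡ ℤr.∑ (λ i → y i ℤ.* A i p))

  -- Either a pivot has cleared the column, and the remaining lattice vanishes there, or there was
  -- no pivot, and the rows vanish there in the field.
  Done : (A : Fin l → Fin k → ℤ) → System A → Fin k → Set ℓ
  Done A sys p = (∀ {c} → System.W sys c → c p ≡ + 0) ⊎ (∀ i → ι (A i p) ≈ 0#)

  -- With all columns done the lattice is zero. Otherwise, by saturation, a nonzero vector divided
  -- by its gcd is still in it; by `kill` its entries vanish in the field, but a Bézout combination
  -- of them is 1.
  finish : ∀ {A} (sys : System A) → (∀ p → Done A sys p) → ∀ c → System.W sys c → Spanned A c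
  finish {A} sys done c w = + 1 , (λ _ → + 0) , (λ e → Field.0≉1 K (≈-sym (≈-trans (≈-sym ι-1) e))) ,
    λ p → trans (ℤₚ.*-identityˡ (c p)) (trans (c0 p) (sym (ℤr.∑-0 λ i → ℤₚ.*-zeroˡ (A i p))))
    where
    open System sys
    ιc0 : ∀ {c} → W c → ∀ p → ι (c p) ≈ 0#
    ιc0 {c} w p with done p
    ... | inj₁ z = ≈-reflexive (cong ι (z w))
    ... | inj₂ z = ≈-trans (≈-sym (pair c)) (kill w (λ q → does (q Fₚ.≟ p) ▹ 1#) λ i → ≈-trans (pair (A i)) (z i))
      where
      pair : ∀ c → ∑ (λ q → ι (c q) * (does (q Fₚ.≟ p) ▹ 1#)) ≈ ι (c p)
      pair c = ≈-trans (∑-single p λ q k → ≈-trans (*-congˡ (▹-false (dec-false (q Fₚ.≟ p) k))) (zeroʳ _)) (≈-trans (*-congˡ (▹-true (dec-true (p Fₚ.≟ p) refl))) (*-identityʳ _))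
    c0 : ∀ p → c p ≡ + 0
    c0 p with vector-gcd c
    ... | g , q , u , c≡ , s with g ℤ.≟ + 0
    ... | yes refl = trans (c≡ p) (ℤₚ.*-zeroʳ (q p))
    ... | no g≢0 = absurd (Field.0≉1 K (≈-trans (≈-sym (∑-0 λ p → ≈-trans (ι-* (u p) (q p)) (≈-trans (*-congˡ (ιc0 wq p)) (zeroʳ _)))) (≈-trans (≈-sym (ι-∑ _)) (≈-trans (≈-reflexive (cong ι one)) ι-1))))
      where
      wq : W q
      wq = W-saturated g≢0 (W-ext c≡ w)
      one : ℤr.∑ (λ p → u p ℤ.* q p) ≡ + 1
      one = ℤₚ.*-cancelʳ-≡ _ _ g ⦃ ℤ.≢-nonZero g≢0 ⦄ (trans (ℤr.∑-*ʳ g _) (trans (ℤr.∑-cong λ p → trans (ℤₚ.*-assoc (u p) (q p) g) (cong (u p ℤ.*_) (sym (c≡ p)))) (trans s (sym (ℤₚ.*-identityˡ g)))))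

  module Pivot {A : Fin l → Fin k → ℤ} (sys : System A) (i₀ : Fin l) (p₀ : Fin k) (u≢0 : ¬ ι (A i₀ p₀) ≈ 0#) where
    open System sys
    u : ℤ
    u = A i₀ p₀
    -- Elimination without fractions. The pivot row becomes zero but is kept, so the rows keep their
    -- index set.
    A' : Fin l → Fin k → ℤ
    A' i q = u ℤ.* A i q ℤ.+ ℤ.- A i p₀ ℤ.* A i₀ q

    sys' : System A'
    sys' = record
      { W = λ c → W c × c p₀ ≡ + 0
      ; W-combine = λ { a b (w , e) (w' , e') → W-combine a b w w' , trans (cong₂ (λ s t → a ℤ.* s ℤ.+ b ℤ.* t) e e') (ℤr.solve 2 (λ a b → a ℤr.:* ℤr.con (+ 0) ℤr.:+ b ℤr.:* ℤr.con (+ 0) ℤr.:= ℤr.con (+ 0)) refl a b) }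
      ; W-row = λ i → W-combine u (ℤ.- A i p₀) (W-row i) (W-row i₀) , ℤr.solve 2 (λ u a → u ℤr.:* a ℤr.:+ (ℤr.:- a) ℤr.:* u ℤr.:= ℤr.con (+ 0)) refl u (A i p₀)
      ; W-saturated = λ { {g} {c} g≢0 (w , e) → W-saturated g≢0 w , ℤₚ.*-cancelʳ-≡ (c p₀) (+ 0) g ⦃ ℤ.≢-nonZero g≢0 ⦄ (trans e (sym (ℤₚ.*-zeroˡ g))) }
      ; W-ext = λ { h (w , e) → W-ext h w , trans (sym (h p₀)) e }
      ; kill = λ { {c} (w , e) x ker → kill' c w e x ker }
      }
      where
      kill' : ∀ c → W c → c p₀ ≡ + 0 → (x : Fin k → Carrier) → (∀ i → ∑ (λ p → ι (A' i p) * x p) ≈ 0#) → ∑ (λ p → ι (c p) * x p) ≈ 0#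
      kill' c w e x ker = begin
        dot c                          ≈⟨ ≈-sym (+-identityʳ _) ⟩
        dot c + 0#                     ≈⟨ +-congˡ (≈-sym (≈-trans (*-congʳ (≈-reflexive (cong ι e))) (zeroˡ t))) ⟩
        dot c + ι (c p₀) * t           ≈⟨ ≈-sym (dot-x̃ c) ⟩
        ∑ (λ p → ι (c p) * x̃ p)        ≈⟨ kill w x̃ (λ i → ≈-trans (dot-x̃ (A i)) (cancelˡ u≢0 (zero' i))) ⟩
        0# ∎
        where
        dot : (Fin k → ℤ) → Carrier
        dot c = ∑ (λ p → ι (c p) * x p)
        w' = proj₁ (Field.inverse K (ι u) u≢0)
        uw : ι u * w' ≈ 1#
        uw = proj₂ (Field.inverse K (ι u) u≢0)
        t : Carrier
        t = - (w' * dot (A i₀))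
        -- The functional is changed at the pivot column only, so as to kill the pivot row; `c` does
        -- not notice, since `c p₀ = 0`.
        x̃ : Fin k → Carrier
        x̃ p = x p + (does (p Fₚ.≟ p₀) ▹ t)
        dot-x̃ : ∀ c → ∑ (λ p → ι (c p) * x̃ p) ≈ dot c + ι (c p₀) * t
        dot-x̃ c = ≈-trans (∑-cong λ p → distribˡ _ _ _) (≈-trans (∑-+ _ _) (+-congˡ (≈-trans (∑-single p₀ λ p k → ≈-trans (*-congˡ (▹-false (dec-false (p Fₚ.≟ p₀) k))) (zeroʳ _)) (*-congˡ (▹-true (dec-true (p₀ Fₚ.≟ p₀) refl))))))
        dotA' : ∀ i → dot (A' i) ≈ ι u * dot (A i) - ι (A i p₀) * dot (A i₀)
        dotA' i = ≈-trans (∑-cong λ p → ≈-trans (*-congʳ (≈-trans (ι-+ (u ℤ.* A i p) (ℤ.- A i p₀ ℤ.* A i₀ p)) (+-cong (ι-* u (A i p)) (≈-trans (ι-* (ℤ.- A i p₀) (A i₀ p)) (*-congʳ (ι-neg (A i p₀)))))))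
            (solve 5 (λ u a b c x → (u :* a :+ (:- b) :* c) :* x := u :* (a :* x) :+ (:- b) :* (c :* x)) ≈-refl _ _ _ _ _))
          (≈-trans (∑-+ _ _) (+-cong (≈-sym (∑-*ˡ _ _)) (≈-trans (≈-sym (∑-*ˡ _ _)) (≈-sym (-‿distribˡ-* _ _)))))
        zero' : ∀ i → ι u * (dot (A i) + ι (A i p₀) * t) ≈ 0#
        zero' i = begin
          ι u * (dot (A i) + ι (A i p₀) * t)
            ≈⟨ solve 5 (λ u d a w e → u :* (d :+ a :* (:- (w :* e))) := (u :* d :+ (:- (a :* e))) :+ (a :* e) :* (con (+ 1) :+ (:- (u :* w)))) ≈-refl (ι u) (dot (A i)) (ι (A i p₀)) w' (dot (A i₀)) ⟩
          (ι u * dot (A i) - ι (A i p₀) * dot (A i₀)) + (ι (A i p₀) * dot (A i₀)) * (ι (+ 1) + - (ι u * w'))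
            ≈⟨ +-cong (≈-trans (≈-sym (dotA' i)) (ker i)) (≈-trans (*-congˡ (≈-trans (+-cong ι-1 (-‿cong uw)) (-‿inverseʳ 1#))) (zeroʳ _)) ⟩
          0# + 0# ≈⟨ +-identityˡ 0# ⟩
          0# ∎

    lift : (∀ c → System.W sys' c → Spanned A' c) → ∀ c → W c → Spanned A c
    lift span c w with span (λ q → u ℤ.* c q ℤ.+ ℤ.- c p₀ ℤ.* A i₀ q) (W-combine u (ℤ.- c p₀) w (W-row i₀) , ℤr.solve 2 (λ u a → u ℤr.:* a ℤr.:+ (ℤr.:- a) ℤr.:* u ℤr.:= ℤr.con (+ 0)) refl u (c p₀))
    ... | s , y , s≢0 , eq = s ℤ.* u , y' , (λ e → s≢0 (cancelˡ u≢0 (≈-trans (*-comm _ _) (≈-trans (≈-sym (ι-* s u)) e)))) , eq'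
      where
      Y : ℤ
      Y = ℤr.∑ (λ i → y i ℤ.* A i p₀)
      y' : Fin l → ℤ
      y' i = u ℤ.* y i ℤ.+ (does (i Fₚ.≟ i₀) ℤr.▹ s ℤ.* c p₀ ℤ.- Y)
      eq' : ∀ q → s ℤ.* u ℤ.* c q ≡ ℤr.∑ (λ i → y' i ℤ.* A i q)
      eq' q = total
        where
        expand : ℤr.∑ (λ i → y i ℤ.* A' i q) ≡ u ℤ.* ℤr.∑ (λ i → y i ℤ.* A i q) ℤ.+ ℤ.- (Y ℤ.* A i₀ q)
        expand = trans (ℤr.∑-cong λ i → ℤr.solve 5 (λ y u a b c → y ℤr.:* (u ℤr.:* a ℤr.:+ (ℤr.:- b) ℤr.:* c) ℤr.:= u ℤr.:* (y ℤr.:* a) ℤr.:+ (ℤr.:- ((y ℤr.:* b) ℤr.:* c))) refl (y i) u (A i q) (A i p₀) (A i₀ q))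
          (trans (ℤr.∑-+ _ _) (cong₂ ℤ._+_ (sym (ℤr.∑-*ˡ u _)) (trans (ℤr.∑-neg _) (cong ℤ.-_ (sym (ℤr.∑-*ʳ (A i₀ q) _))))))
        rhs : ℤr.∑ (λ i → y' i ℤ.* A i q) ≡ u ℤ.* ℤr.∑ (λ i → y i ℤ.* A i q) ℤ.+ (s ℤ.* c p₀ ℤ.- Y) ℤ.* A i₀ q
        rhs = trans (ℤr.∑-cong λ i → trans (ℤₚ.*-distribʳ-+ (A i q) (u ℤ.* y i) _) (cong (ℤ._+ (does (i Fₚ.≟ i₀) ℤr.▹ s ℤ.* c p₀ ℤ.- Y) ℤ.* A i q) (ℤₚ.*-assoc u (y i) (A i q))))
          (trans (ℤr.∑-+ _ _) (cong₂ ℤ._+_ (sym (ℤr.∑-*ˡ u _)) (trans (ℤr.∑-single i₀ λ i k → trans (cong (ℤ._* A i q) (ℤr.▹-false (dec-false (i Fₚ.≟ i₀) k))) (ℤₚ.*-zeroˡ (A i q))) (cong (ℤ._* A i₀ q) (ℤr.▹-true (dec-true (i₀ Fₚ.≟ i₀) refl))))))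
        total : s ℤ.* u ℤ.* c q ≡ ℤr.∑ (λ i → y' i ℤ.* A i q)
        total = trans (ℤr.solve 5 (λ s u c p a → s ℤr.:* u ℤr.:* c ℤr.:= s ℤr.:* (u ℤr.:* c ℤr.:+ (ℤr.:- p) ℤr.:* a) ℤr.:+ s ℤr.:* p ℤr.:* a) refl s u (c q) (c p₀) (A i₀ q))
          (trans (cong (λ t → t ℤ.+ s ℤ.* c p₀ ℤ.* A i₀ q) (trans (eq q) expand))
          (trans (ℤr.solve 5 (λ X Y a s p → X ℤr.:+ (ℤr.:- (Y ℤr.:* a)) ℤr.:+ s ℤr.:* p ℤr.:* a ℤr.:= X ℤr.:+ (s ℤr.:* p ℤr.:+ (ℤr.:- Y)) ℤr.:* a) refl (u ℤ.* ℤr.∑ (λ i → y i ℤ.* A i q)) Y (A i₀ q) s (c p₀))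
            (sym rhs)))

    keep : ∀ {p} → Done A sys p → Done A' sys' p
    keep (inj₁ h) = inj₁ λ { (w , _) → h w }
    keep {p} (inj₂ h) = inj₂ λ i → ≈-trans (ι-+ (u ℤ.* A i p) (ℤ.- A i p₀ ℤ.* A i₀ p)) (≈-trans (+-cong (≈-trans (ι-* u (A i p)) (≈-trans (*-congˡ (h i)) (zeroʳ _))) (≈-trans (ι-* (ℤ.- A i p₀) (A i₀ p)) (≈-trans (*-congˡ (h i₀)) (zeroʳ _)))) (+-identityˡ 0#))

  -- Column by column. Whether a column contains a pivot is undecidable in the field, hence the
  -- double negation.
  eliminate : ∀ r j → r ℕ.+ j ≡ k → ∀ {A} (sys : System A) → (∀ p → toℕ p < j → Done A sys p) → ¬ ¬ (∀ c → System.W sys c → Spanned A c)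
  eliminate zero j refl sys done = return (finish sys λ p → done p (Fₚ.toℕ<n p))
  eliminate (suc r) j e {A} sys done = ¬¬-∀ (λ i → ¬¬-lem {𝒜 = ι (A i p) ≈ 0#}) >>= λ dec → case (search dec)
    where
    j<k : j < k
    j<k = ℕₚ.≤-trans (s≤s (ℕₚ.m≤n+m j r)) (ℕₚ.≤-reflexive e)
    p : Fin k
    p = fromℕ< j<k
    split : ∀ {q} → toℕ q < suc j → toℕ q < j ⊎ q ≡ p
    split {q} (s≤s h) with toℕ q ℕₚ.≟ j
    ... | yes f = inj₂ (Fₚ.toℕ-injective (trans f (sym (Fₚ.toℕ-fromℕ< j<k))))
    ... | no f = inj₁ (ℕₚ.≤∧≢⇒< h f)
    case : (∀ i → ι (A i p) ≈ 0#) ⊎ (∃ λ i → ¬ ι (A i p) ≈ 0#) → ¬ ¬ (∀ c → System.W sys c → Spanned A c)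
    case (inj₁ z) = eliminate r (suc j) (trans (ℕₚ.+-suc r j) e) sys λ q h → done' (split h)
      where
      done' : ∀ {q} → toℕ q < j ⊎ q ≡ p → Done A sys q
      done' {q} (inj₁ h) = done q h
      done' (inj₂ refl) = inj₂ z
    case (inj₂ (i , nz)) = eliminate r (suc j) (trans (ℕₚ.+-suc r j) e) sys' (λ q h → done' (split h)) >>= λ span → return (lift span)
      where
      open Pivot sys i p nz
      done' : ∀ {q} → toℕ q < j ⊎ q ≡ p → Done A' sys' q
      done' {q} (inj₁ h) = keep (done q h)
      done' (inj₂ refl) = inj₁ proj₂

  span : ∀ {A} (sys : System A) → ¬ ¬ (∀ c → System.W sys c → Spanned A c)
  span sys = eliminate k 0 (ℕₚ.+-identityʳ k) sys λ p ()

-- From homology over the field to integral cohomology and an integral fundamental cycle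

abstract
  _⊆?_ : (S T : Subset N) → Dec (S ⊆ T)
  S ⊆? T with missing T S
  ... | inj₂ h = yes h
  ... | inj₁ (x , p , q) = no λ h → true≢false (into h p) q

¬¬-subsets : {P : Subset N → Set ℓ₁} → (∀ S → ¬ ¬ P S) → ¬ ¬ (∀ S → P S)
¬¬-subsets {N = zero} h = h [] >>= λ p → return λ { [] → p }
¬¬-subsets {N = suc N} h = ¬¬-subsets (λ S → h (true ∷ S)) >>= λ p → ¬¬-subsets (λ S → h (false ∷ S)) >>= λ q →
  return λ { (true ∷ S) → p S ; (false ∷ S) → q S }

module Transfer {c ℓ} (K : Field c ℓ) (P : SimplicialPoset) (gor : IsGorensteinStarPoset K P)
                (dim : ℕ) (isRank : IsRank P dim) where
  open Cells (Field.commutativeRing K) P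
  open Gorenstein K P gor using (m; vanish; OrderChain)
  open Structure K P gor dim isRank
  open Integral (Field.commutativeRing K)
  module Z = Cells ℤₚ.+-*-commutativeRing P

  offℤ : Subset n → Fin n → ℤ
  offℤ Z v = not (lookup Z v) Z.▹ + 1

  ι-off : ∀ Z v → ι (offℤ Z v) ≈ off Z v
  ι-off Z v with lookup Z v
  ... | true = ≈-refl
  ... | false = ι-1

  off-0 : ∀ {Z v} → v ∈ Z → offℤ Z v ≡ + 0
  off-0 p = Z.▹-false (cong not p)

  ι-inc : ∀ Z T H → ι (Z.inc (offℤ Z) T H) ≈ inc (off Z) T H
  ι-inc Z T H = ≈-trans (ι-∂ P (offℤ Z) (Z.unit T (+ 1)) H) (∂-cong (ι-off Z) (λ U → ≈-trans (ι-▹ (does (U Fₚ.≟ T)) (+ 1)) (▹-cong (does (U Fₚ.≟ T)) λ _ → ι-1)) H)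

  ι-≢ : ∀ {s} → ¬ ι s ≈ 0# → s ≢ + 0
  ι-≢ k refl = k ≈-refl

  Cell : Subset n → ℕ → Fin n → Set
  Cell Z j T = Z ⊆ vt T × rank T ≡ j

  abstract
    cell? : (Z : Subset n) (j : ℕ) (T : Fin n) → Dec (Cell Z j T)
    cell? Z j T = (Z ⊆? vt T) ×-dec (rank T ℕₚ.≟ j)

    low? : (Z : Subset n) (j : ℕ) (H : Fin n) → Dec (Z ⊆ vt H × suc (rank H) ≡ j)
    low? Z j H = (Z ⊆? vt H) ×-dec (suc (rank H) ℕₚ.≟ j)

  Cell-up : ∀ {Z j v H T} → v ∉ Z → Cover v H T → Cell Z j H → Cell Z (suc j) T
  Cell-up v∉ cv (s , r) = ⊆-trans s (vt-mono (Cover.H≼T cv)) , trans (Cover.rankT cv) (cong suc r)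

  Cell-down : ∀ {Z j v H T} → v ∉ Z → Cover v H T → Cell Z (suc j) T → Cell Z j H
  Cell-down v∉ cv (s , r) = ⊆-trans (⊆-rem s v∉) (⊆-reflexive (sym (Cover.vtH cv))) , ℕₚ.suc-injective (trans (sym (Cover.rankT cv)) r)

  module Containing (Z : Subset n) where
    open Compare K P (λ T → does (Z ⊆? vt T)) Z using (module Acyclic)

    has : ∀ {T} → does (Z ⊆? vt T) ≡ true → Z ⊆ vt T
    has {T} = does-true (Z ⊆? vt T)

    open Acyclic has (λ {H} {T} a p → dec-true (Z ⊆? vt T) (⊆-trans (has a) (vt-mono p))) (λ {H} {T} a p s → dec-true (Z ⊆? vt H) s)

    -- Purity enters here, as `dim ≤ rank G + m G`: one bound serves all faces whose vertex set is
    -- `Z`.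
    van : ∀ G q → does (Z ⊆? vt G) ≡ true → vt G ≡ Z → q < dim ∸ ∣ Z ∣ → ∀ ch → OrderChain G q ch → (∀ S → dS ch S ≈ 0#) →
          ∃ λ b → OrderChain G (suc q) b × (∀ S → dS b S ≈ ch S)
    van G q _ e lt = vanish G q (ℕₚ.<⇒≢ (ℕₚ.≤-trans lt (ℕₚ.m≤n+o⇒m∸n≤o dim ∣ Z ∣ (ℕₚ.≤-trans (dim≤ G) (ℕₚ.≤-reflexive (cong (ℕ._+ m G) (trans (rank≡ G) (cong ∣_∣ e))))))))

    exact : ∀ k → k < dim ∸ ∣ Z ∣ → (z : Fin n → Carrier) → (∀ T → ¬ (does (Z ⊆? vt T) ≡ true × rank T ≡ k ℕ.+ ∣ Z ∣) → z T ≈ 0#) → (∀ H → ∂ (off Z) z H ≈ 0#) →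
            ∃ λ y → (∀ T → ¬ (does (Z ⊆? vt T) ≡ true × rank T ≡ suc k ℕ.+ ∣ Z ∣) → y T ≈ 0#) × (∀ H → ∂ (off Z) y H ≈ z H)
    exact = Lower.cell-exact (dim ∸ ∣ Z ∣) van

  kexact : ∀ Z j → j < dim → (z : Fin n → Carrier) → (∀ T → ¬ Cell Z j T → z T ≈ 0#) → (∀ H → ∂ (off Z) z H ≈ 0#) →
           ∃ λ y → (∀ T → ¬ Cell Z (suc j) T → y T ≈ 0#) × (∀ H → ∂ (off Z) y H ≈ z H)
  kexact Z j lt z sz ∂z = case (∣ Z ∣ ℕₚ.≤? j)
    where
    Result : Set (c ⊔ ℓ)
    Result = ∃ λ y → (∀ T → ¬ Cell Z (suc j) T → y T ≈ 0#) × (∀ H → ∂ (off Z) y H ≈ z H)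
    restate : ∣ Z ∣ ≤ j → (∃ λ y → (∀ T → ¬ (does (Z ⊆? vt T) ≡ true × rank T ≡ suc (j ∸ ∣ Z ∣) ℕ.+ ∣ Z ∣) → y T ≈ 0#) × (∀ H → ∂ (off Z) y H ≈ z H)) → Result
    restate le (y , sy , ∂y) = y , (λ T k → sy T λ { (a , r) → k (does-true (Z ⊆? vt T) a , trans r (cong suc (ℕₚ.m∸n+n≡m le))) }) , ∂y
    case : Dec (∣ Z ∣ ≤ j) → Result
    case (no big) = (λ _ → 0#) , (λ _ _ → ≈-refl) , λ H → ≈-trans (∂-0 λ _ _ _ → zeroʳ _) (≈-sym (sz H λ { (s , r) → big (ℕₚ.≤-trans (⊆-size s) (ℕₚ.≤-reflexive (trans (sym (rank≡ H)) r))) }))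
    case (yes le) = restate le (Containing.exact Z (j ∸ ∣ Z ∣) (ℕₚ.∸-monoˡ-< lt le) z (λ T k → sz T λ { (s , r) → k (dec-true (Z ⊆? vt T) s , trans r (sym (ℕₚ.m∸n+n≡m le))) }) ∂z)

  -- Relative integral cohomology at rank `j` is torsion; the annihilating factor may depend on the
  -- cocycle.
  Cohomology : Subset n → ℕ → Set
  Cohomology Z j = ∀ (c : Fin n → ℤ) → (∀ T → ¬ Cell Z j T → c T ≡ + 0) → (∀ T → Z.δ (offℤ Z) c T ≡ + 0) →
    ∃ λ s → ∃ λ (b : Fin n → ℤ) → s ≢ + 0 × (∀ H → ¬ (Z ⊆ vt H × suc (rank H) ≡ j) → b H ≡ + 0) × (∀ T → Z.δ (offℤ Z) b T ≡ s ℤ.* c T)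

  -- Elimination in the lattice of integral cocycles, with the coboundaries of cells as rows. A
  -- functional killing the rows is a cycle over the field, hence a boundary there, and boundaries
  -- pair to zero with cocycles.
  cohomology : ∀ Z j → j < dim → ¬ ¬ Cohomology Z j
  cohomology Z j lt = Elimination.span K sys >>= λ span → return λ c sc δc → result c (span c (sc , δc))
    where
    A : Fin n → Fin n → ℤ
    A H T = does (low? Z j H) Z.▹ Z.inc (offℤ Z) T H
    inc-off : ∀ {T H} → does (low? Z j H) ≡ true → ¬ Cell Z j T → Z.inc (offℤ Z) T H ≡ + 0
    inc-off {T} {H} l k = Z.inc-0 λ v e → case v e (∈-or-∉ v Z)
      where
      case : ∀ v → cov v H T ≡ true → v ∈ Z ⊎ v ∉ Z → offℤ Z v ≡ + 0
      case v e (inj₁ p) = off-0 {Z} {v} p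
      case v e (inj₂ p) = absurd (k (subst (λ j → Cell Z j T) (proj₂ low) (Cell-up p (cover e) (proj₁ low , refl))))
        where
        low : Z ⊆ vt H × suc (rank H) ≡ j
        low = does-true (low? Z j H) l
    δunit : ∀ T H → Z.δ (offℤ Z) (Z.unit H (+ 1)) T ≡ Z.inc (offℤ Z) T H
    δunit T H = trans (Z.δ-inc (offℤ Z) (Z.unit H (+ 1)) T) (Z.⟨,unit⟩ (Z.inc (offℤ Z) T) H)
    kill : ∀ {c} → (∀ T → ¬ Cell Z j T → c T ≡ + 0) × (∀ T → Z.δ (offℤ Z) c T ≡ + 0) → (x : Fin n → Carrier) →
           (∀ H → ∑ (λ T → ι (A H T) * x T) ≈ 0#) → ∑ (λ T → ι (c T) * x T) ≈ 0#
    kill {c} (sc , δc) x ker = begin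
      ∑ (λ T → ι (c T) * x T)    ≈⟨ ∑-cong same ⟩
      ⟨ (λ T → ι (c T)) , x' ⟩    ≈⟨ ⟨⟩-cong (λ _ → ≈-refl) (λ T → ≈-sym (proj₂ (proj₂ ex) T)) ⟩
      ⟨ (λ T → ι (c T)) , ∂ (off Z) y ⟩ ≈⟨ ∑-cong (λ T → *-comm _ _) ⟩
      ⟨ ∂ (off Z) y , (λ T → ι (c T)) ⟩ ≈⟨ adjoint (off Z) y _ ⟩
      ⟨ y , δ (off Z) (λ T → ι (c T)) ⟩ ≈⟨ (∑-0 λ T → ≈-trans (*-congˡ (δι T)) (zeroʳ _)) ⟩
      0# ∎
      where
      -- Cocycles see `x` only on cells of rank `j`; cut down to these it becomes a chain.
      x' : Fin n → Carrier
      x' T = does (cell? Z j T) ▹ x T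
      same : ∀ T → ι (c T) * x T ≈ ι (c T) * x' T
      same T with cell? Z j T
      ... | yes _ = ≈-refl
      ... | no k = ≈-trans (*-congʳ (≈-reflexive (cong ι (sc T k)))) (≈-trans (zeroˡ _) (≈-sym (zeroʳ _)))
      δι : ∀ T → δ (off Z) (λ T → ι (c T)) T ≈ 0#
      δι T = ≈-trans (δ-inc (off Z) _ T) (≈-trans (∑-cong λ H → ≈-trans (*-congʳ (≈-sym (ι-inc Z T H))) (≈-sym (ι-* (Z.inc (offℤ Z) T H) (c H)))) (≈-trans (≈-sym (ι-∑ _)) (≈-reflexive (cong ι (trans (sym (Z.δ-inc (offℤ Z) c T)) (δc T))))))
      sx' : ∀ T → ¬ Cell Z j T → x' T ≈ 0#
      sx' T k = ▹-false (dec-false (cell? Z j T) k)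
      cyc : ∀ H → ∂ (off Z) x' H ≈ 0#
      cyc H with low? Z j H in e
      ... | no k = ∂-0 λ v T e' → case v T e' (∈-or-∉ v Z)
        where
        case : ∀ v T → cov v H T ≡ true → v ∈ Z ⊎ v ∉ Z → off Z v * x' T ≈ 0#
        case v T e' (inj₁ p) = ≈-trans (*-congʳ (▹-false (cong not p))) (zeroˡ _)
        case v T e' (inj₂ p) = ≈-trans (*-congˡ (sx' T λ { (s , r) → k (proj₁ (Cell-down p (cover e') (s , Cover.rankT (cover e'))) , trans (sym (Cover.rankT (cover e'))) r) })) (zeroʳ _)
      ... | yes l = ≈-trans (∂-inc (off Z) x' H) (≈-trans (∑-cong term) (ker H))
        where
        lt' : does (low? Z j H) ≡ true
        lt' = dec-true (low? Z j H) l
        term : ∀ T → x' T * inc (off Z) T H ≈ ι (A H T) * x T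
        term T with cell? Z j T
        ... | yes _ = ≈-trans (*-comm _ _) (*-congʳ (≈-sym (≈-trans (≈-reflexive (cong ι (Z.▹-true lt'))) (ι-inc Z T H))))
        ... | no k = ≈-trans (zeroˡ _) (≈-sym (≈-trans (*-congʳ (≈-reflexive (cong ι (trans (Z.▹-true lt') (inc-off lt' k))))) (zeroˡ _)))
      ex = kexact Z j lt x' sx' cyc
      y = proj₁ ex
    sys : Elimination.System K A
    sys = record
      { W = λ c → (∀ T → ¬ Cell Z j T → c T ≡ + 0) × (∀ T → Z.δ (offℤ Z) c T ≡ + 0)
      ; W-combine = λ { a b {c} {c'} (s , e) (s' , e') → (λ T k → trans (cong₂ (λ x y → a ℤ.* x ℤ.+ b ℤ.* y) (s T k) (s' T k)) (zz a b)) , λ T → trans (Z.δ-combine (offℤ Z) a b c c' T) (trans (cong₂ (λ x y → a ℤ.* x ℤ.+ b ℤ.* y) (e T) (e' T)) (zz a b)) }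
      ; W-row = λ H → (λ T k → Z.▹-0 (does (low? Z j H)) λ l → inc-off l k) , rowδ H
      ; W-saturated = λ { {g} {c} g≢0 (s , e) → (λ T k → cancel g≢0 (s T k)) , λ T → cancel g≢0 (trans (ℤₚ.*-comm (Z.δ (offℤ Z) c T) g) (trans (sym (Z.δ-* (offℤ Z) g c T)) (trans (Z.δ-cong {offℤ Z} {offℤ Z} (λ _ → refl) (λ U → ℤₚ.*-comm g (c U)) T) (e T)))) }
      ; W-ext = λ { h (s , e) → (λ T k → trans (sym (h T)) (s T k)) , λ T → trans (Z.δ-cong {offℤ Z} {offℤ Z} (λ _ → refl) (λ U → sym (h U)) T) (e T) }
      ; kill = kill
      }
      where
      zz : ∀ a b → a ℤ.* + 0 ℤ.+ b ℤ.* + 0 ≡ + 0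
      zz a b = cong₂ ℤ._+_ (ℤₚ.*-zeroʳ a) (ℤₚ.*-zeroʳ b)
      cancel : ∀ {g x} → g ≢ + 0 → x ℤ.* g ≡ + 0 → x ≡ + 0
      cancel {g} {x} k e = ℤₚ.*-cancelʳ-≡ x (+ 0) g ⦃ ℤ.≢-nonZero k ⦄ (trans e (sym (ℤₚ.*-zeroˡ g)))
      rowδ : ∀ H T → Z.δ (offℤ Z) (A H) T ≡ + 0
      rowδ H T with does (low? Z j H)
      ... | false = Z.∑-0 λ v → Z.▹-0 (lookup (vt T) v) λ _ → trans (cong (Z.σ v (rem (vt T) v) ℤ.*_) (ℤₚ.*-zeroʳ (offℤ Z v))) (ℤₚ.*-zeroʳ (Z.σ v (rem (vt T) v)))
      ... | true = trans (Z.δ-cong {offℤ Z} {offℤ Z} (λ _ → refl) (λ U → sym (δunit U H)) T) (Z.δδ (offℤ Z) (Z.unit H (+ 1)) T)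
    result : ∀ c → Elimination.Spanned K A c → ∃ λ s → ∃ λ (b : Fin n → ℤ) → s ≢ + 0 × (∀ H → ¬ (Z ⊆ vt H × suc (rank H) ≡ j) → b H ≡ + 0) × (∀ T → Z.δ (offℤ Z) b T ≡ s ℤ.* c T)
    result c (s , y , s≢0 , eq) = s , (λ H → does (low? Z j H) Z.▹ y H) , ι-≢ s≢0 , (λ H k → Z.▹-false (dec-false (low? Z j H) k)) ,
      λ T → trans (Z.δ-inc (offℤ Z) _ T) (trans (Z.∑-cong λ H → trans (Z.▹-*ˡ (does (low? Z j H)) (Z.inc (offℤ Z) T H) (y H)) (trans (Z.▹-cong (does (low? Z j H)) λ _ → ℤₚ.*-comm (Z.inc (offℤ Z) T H) (y H)) (sym (Z.▹-*ˡ (does (low? Z j H)) (y H) (Z.inc (offℤ Z) T H))))) (sym (eq T)))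

  cohomology-all : ¬ ¬ (∀ Z (j : Fin dim) → Cohomology Z (toℕ j))
  cohomology-all = ¬¬-subsets λ Z → ¬¬-∀ λ j → cohomology Z (toℕ j) (Fₚ.toℕ<n j)

-- The integral fundamental cycle

module FundamentalCycle {c ℓ} (K : Field c ℓ) (P : SimplicialPoset) (gor : IsGorensteinStarPoset K P)
                        (dim : ℕ) (isRank : IsRank P dim) where
  open Cells (Field.commutativeRing K) P
  open Gorenstein K P gor using (m)
  open Structure K P gor dim isRank
  open Integral (Field.commutativeRing K)
  open Transfer K P gor dim isRank

  abstract
    facet? : (T : Fin n) → Dec (rank T ≡ dim)
    facet? T = rank T ℕₚ.≟ dim

  all-weight : ∀ v → offℤ ⊥ v ≡ + 1
  all-weight v = Z.▹-true (cong not (lookup-⊥ v))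

  record FieldCycle : Set (c ⊔ ℓ) where
    field
      z : Fin n → Carrier
      support : ∀ T → rank T ≢ dim → z T ≈ 0#
      cycle : ∀ H → ∂ (off ⊥) z H ≈ 0#
      T₀ : Fin n
      T₀-facet : rank T₀ ≡ dim
      nonzero : ¬ z T₀ ≈ 0#

  -- The cycle comes from the star of `bot`, which is everything. A facet with nonzero coefficient
  -- can be named only classically.
  field-cycle : ¬ ¬ FieldCycle
  field-cycle = ¬¬-∀ (λ T → ¬¬-lem {𝒜 = z T ≈ 0#}) >>= λ dec → case (search dec)
    where
    z = proj₁ (Star.top-cycle bot)
    sz = proj₁ (proj₂ (Star.top-cycle bot))
    ∂z = proj₁ (proj₂ (proj₂ (Star.top-cycle bot)))
    case : (∀ T → z T ≈ 0#) ⊎ (∃ λ T → ¬ z T ≈ 0#) → ¬ ¬ FieldCycle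
    case (inj₁ all0) = absurd (proj₂ (proj₂ (proj₂ (Star.top-cycle bot))) all0)
    case (inj₂ (T₀ , nz)) = return record
      { z = z
      ; support = λ T k → sz T λ { (_ , r) → k (trans r top-dim) }
      ; cycle = λ H → ≈-trans (∂-cong (λ v → ≈-reflexive (cong (λ S → off S v) (sym vt-bot))) (λ _ → ≈-refl) H) (∂z H)
      ; T₀ = T₀
      ; T₀-facet = trans rank-T₀ top-dim
      ; nonzero = nz
      }
      where
      rank-T₀ : rank T₀ ≡ ∣ vt bot ∣ ℕ.+ m bot
      rank-T₀ = decidable-stable (rank T₀ ℕₚ.≟ ∣ vt bot ∣ ℕ.+ m bot) λ k → nz (sz T₀ λ { (_ , r) → k r })
      top-dim : ∣ vt bot ∣ ℕ.+ m bot ≡ dim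
      top-dim = ℕₚ.≤-antisym (ℕₚ.≤-trans (ℕₚ.≤-reflexive (sym rank-T₀)) (rank≤ T₀)) (ℕₚ.≤-trans (dim≤ bot) (ℕₚ.≤-reflexive (cong (ℕ._+ m bot) (rank≡ bot))))

  record IntegralCycle : Set where
    field
      ε : Fin n → ℤ
      support : ∀ T → rank T ≢ dim → ε T ≡ + 0
      cycle : ∀ H → Z.∂ (offℤ ⊥) ε H ≡ + 0
      T₀ : Fin n
      T₀-facet : rank T₀ ≡ dim
      nonzero : ε T₀ ≢ + 0

  module _ (fc : FieldCycle) where
    open FieldCycle fc

    private
      -- The rows are the boundaries of all facets except `T₀`. Expressing a multiple of the
      -- boundary of `T₀` through them is an integral cycle that is nonzero at `T₀`.
      row? : Fin n → Bool
      row? T = does (facet? T) ∧ not (does (T Fₚ.≟ T₀))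

      I : Fin n → Fin n → ℤ
      I = Z.inc (offℤ ⊥)

      A : Fin n → Fin n → ℤ
      A T H = row? T Z.▹ I T H

      I-off : ∀ {T H} → rank T ≡ dim → suc (rank H) ≢ dim → I T H ≡ + 0
      I-off {T} {H} r k = Z.inc-0 {offℤ ⊥} {T} {H} λ v e → absurd (k (trans (sym (Cover.rankT (cover e))) r))

      W : (Fin n → ℤ) → Set
      W c = (∀ H → suc (rank H) ≢ dim → c H ≡ + 0) × (∀ H → Z.∂ (offℤ ⊥) c H ≡ + 0)

      W-unit : ∀ {T} → rank T ≡ dim → W (I T)
      W-unit {T} r = (λ H k → I-off {T} {H} r k) , λ H → Z.∂∂ (offℤ ⊥) (Z.unit T (+ 1)) H

      row-facet : ∀ {T} → row? T ≡ true → rank T ≡ dim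
      row-facet {T} e = does-true (facet? T) (proj₁ (∧-true {does (facet? T)} e))

      zz : ∀ a b → a ℤ.* + 0 ℤ.+ b ℤ.* + 0 ≡ + 0
      zz a b = cong₂ ℤ._+_ (ℤₚ.*-zeroʳ a) (ℤₚ.*-zeroʳ b)

      ∂ℤ-combine : ∀ a b c c' H → Z.∂ (offℤ ⊥) (λ T → a ℤ.* c T ℤ.+ b ℤ.* c' T) H ≡ a ℤ.* Z.∂ (offℤ ⊥) c H ℤ.+ b ℤ.* Z.∂ (offℤ ⊥) c' H
      ∂ℤ-combine a b c c' H = trans (Z.∂-+ (offℤ ⊥) (λ T → a ℤ.* c T) (λ T → b ℤ.* c' T) H) (cong₂ ℤ._+_ (Z.∂-* (offℤ ⊥) a c H) (Z.∂-* (offℤ ⊥) b c' H))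

      cancel : ∀ {g x} → g ≢ + 0 → x ℤ.* g ≡ + 0 → x ≡ + 0
      cancel {g} {x} k e = ℤₚ.*-cancelʳ-≡ x (+ 0) g ⦃ ℤ.≢-nonZero k ⦄ (trans e (sym (ℤₚ.*-zeroˡ g)))

      inc-ι : ∀ T H → inc (off ⊥) T H ≈ ι (I T H)
      inc-ι T H = ≈-sym (ι-inc ⊥ T H)

      fill : ∀ {c} → W c → ∃ λ y → (∀ T → rank T ≢ dim → y T ≈ 0#) × (∀ H → ∂ (off ⊥) y H ≈ ι (c H))
      fill {c} (sc , ∂c) = go dim refl
        where
        go : ∀ d → d ≡ dim → ∃ λ y → (∀ T → rank T ≢ dim → y T ≈ 0#) × (∀ H → ∂ (off ⊥) y H ≈ ι (c H))
        go zero e = (λ _ → 0#) , (λ _ _ → ≈-refl) , λ H → ≈-trans (∂-0 λ _ _ _ → zeroʳ _) (≈-sym (≈-reflexive (cong ι (sc H λ q → ℕₚ.1+n≢0 (trans q (sym e))))))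
        go (suc d) e with kexact ⊥ d (ℕₚ.≤-reflexive e) (λ H → ι (c H)) (λ H k → ≈-reflexive (cong ι (sc H λ q → k (⊥-⊆ , ℕₚ.suc-injective (trans q (sym e))))))
          (λ H → ≈-trans (∂-cong (λ v → ≈-sym (ι-off ⊥ v)) (λ _ → ≈-refl) H) (≈-trans (≈-sym (ι-∂ P (offℤ ⊥) c H)) (≈-reflexive (cong ι (∂c H)))))
        ... | y , sy , ∂y = y , (λ T k → sy T λ { (_ , r) → k (trans r e) }) , ∂y

      kill : ∀ {c} → W c → (x : Fin n → Carrier) → (∀ T → ∑ (λ H → ι (A T H) * x H) ≈ 0#) → ∑ (λ H → ι (c H) * x H) ≈ 0#
      kill {c} w x ker = begin
        ⟨ (λ H → ι (c H)) , x ⟩   ≈⟨ ⟨⟩-cong (λ H → ≈-sym (proj₂ (proj₂ (fill w)) H)) (λ _ → ≈-refl) ⟩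
        ⟨ ∂ (off ⊥) y , x ⟩       ≈⟨ adjoint (off ⊥) y x ⟩
        ⟨ y , δ (off ⊥) x ⟩       ≈⟨ ∑-0 all ⟩
        0# ∎
        where
        y = proj₁ (fill w)
        other : ∀ T → T ≢ T₀ → rank T ≡ dim → δ (off ⊥) x T ≈ 0#
        other T k r = ≈-trans (δ-inc (off ⊥) x T) (≈-trans (∑-cong λ H → *-congʳ (≈-trans (inc-ι T H) (≈-reflexive (cong ι (sym (Z.▹-true {row? T} (∧-intro (dec-true (facet? T) r) (cong not (dec-false (T Fₚ.≟ T₀) k))))))))) (ker T))
        -- The cycle over the field is a relation between the boundaries of facets with nonzero
        -- coefficient at `T₀`, so a functional killing the other boundaries kills this one.
        at-T₀ : δ (off ⊥) x T₀ ≈ 0#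
        at-T₀ = Elimination.cancelˡ K {k = n} {l = n} nonzero (≈-trans (≈-sym (∑-single T₀ λ T k → term T k (rank T ℕₚ.≟ dim)))
          (≈-trans (≈-sym (adjoint (off ⊥) z x)) (∑-0 λ H → ≈-trans (*-congʳ (cycle H)) (zeroˡ _))))
          where
          term : ∀ T → T ≢ T₀ → Dec (rank T ≡ dim) → z T * δ (off ⊥) x T ≈ 0#
          term T k (yes r) = ≈-trans (*-congˡ (other T k r)) (zeroʳ _)
          term T k (no r) = ≈-trans (*-congʳ (support T r)) (zeroˡ _)
        all : ∀ T → y T * δ (off ⊥) x T ≈ 0#
        all T with T Fₚ.≟ T₀ | rank T ℕₚ.≟ dim
        ... | yes refl | _ = ≈-trans (*-congˡ at-T₀) (zeroʳ _)
        ... | no k | yes r = ≈-trans (*-congˡ (other T k r)) (zeroʳ _)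
        ... | no k | no r = ≈-trans (*-congʳ (proj₁ (proj₂ (fill w)) T r)) (zeroˡ _)

      sys : Elimination.System K A
      sys = record
        { W = W
        ; W-combine = λ { a b {c} {c'} (s , e) (s' , e') → (λ T k → trans (cong₂ (λ x y → a ℤ.* x ℤ.+ b ℤ.* y) (s T k) (s' T k)) (zz a b)) , λ H → trans (∂ℤ-combine a b c c' H) (trans (cong₂ (λ x y → a ℤ.* x ℤ.+ b ℤ.* y) (e H) (e' H)) (zz a b)) }
        ; W-row = row
        ; W-saturated = λ { {g} {c} g≢0 (s , e) → (λ T k → cancel g≢0 (s T k)) , λ H → cancel g≢0 (trans (ℤₚ.*-comm (Z.∂ (offℤ ⊥) c H) g) (trans (sym (Z.∂-* (offℤ ⊥) g c H)) (trans (Z.∂-cong {offℤ ⊥} {offℤ ⊥} (λ _ → refl) (λ U → ℤₚ.*-comm g (c U)) H) (e H)))) }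
        ; W-ext = λ { h (s , e) → (λ T k → trans (sym (h T)) (s T k)) , λ H → trans (Z.∂-cong {offℤ ⊥} {offℤ ⊥} (λ _ → refl) (λ U → sym (h U)) H) (e H) }
        ; kill = kill
        }
        where
        row : ∀ T → W (A T)
        row T with row? T in e
        ... | true = W-unit (row-facet e)
        ... | false = (λ _ _ → refl) , λ H → Z.∂-0 {offℤ ⊥} {λ _ → + 0} {H} λ v _ _ → ℤₚ.*-zeroʳ (offℤ ⊥ v)

    integral-cycle : ¬ ¬ IntegralCycle
    integral-cycle = Elimination.span K sys >>= λ span → return (build (span (I T₀) (W-unit T₀-facet)))
      where
      build : Elimination.Spanned K A (I T₀) → IntegralCycle
      build (s , y , s≢0 , eq) = record
        { ε = ε
        ; support = λ T k → cong₂ (λ a b → a ℤ.+ ℤ.- b) (Z.unit-off {T₀} {s} {T} (λ { refl → k T₀-facet })) (Z.▹-0 (row? T) {y T} λ e → absurd (k (row-facet e)))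
        ; cycle = cyc
        ; T₀ = T₀
        ; T₀-facet = T₀-facet
        ; nonzero = λ e → ι-≢ s≢0 (trans (sym (trans (cong₂ (λ a b → a ℤ.+ ℤ.- b) (Z.unit-on T₀ {s}) (Z.▹-false {row? T₀} {y T₀} (trans (cong (λ b → does (facet? T₀) ∧ not b) (dec-true (T₀ Fₚ.≟ T₀) refl)) (Bₚ.∧-zeroʳ _)))) (ℤₚ.+-identityʳ s))) e)
        }
        where
        ε : Fin n → ℤ
        ε T = Z.unit T₀ s T ℤ.+ ℤ.- (row? T Z.▹ y T)
        cyc : ∀ H → Z.∂ (offℤ ⊥) ε H ≡ + 0
        cyc H = trans (Z.∂-inc (offℤ ⊥) ε H) (trans (Z.∑-cong λ T → trans (ℤₚ.*-distribʳ-+ (I T H) (Z.unit T₀ s T) (ℤ.- (row? T Z.▹ y T))) (cong (λ t → Z.unit T₀ s T ℤ.* I T H ℤ.+ t) (trans (sym (ℤₚ.neg-distribˡ-* (row? T Z.▹ y T) (I T H))) (cong ℤ.-_ (trans (Z.▹-*ʳ (row? T) (y T) (I T H)) (sym (Z.▹-*ˡ (row? T) (y T) (I T H))))))))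
          (trans (Z.∑-+ (λ T → Z.unit T₀ s T ℤ.* I T H) (λ T → ℤ.- (y T ℤ.* A T H))) (trans (cong₂ ℤ._+_ first (trans (Z.∑-neg (λ T → y T ℤ.* A T H)) (cong ℤ.-_ (sym (eq H))))) (ℤₚ.+-inverseʳ (s ℤ.* I T₀ H)))))
          where
          first : Z.∑ (λ T → Z.unit T₀ s T ℤ.* I T H) ≡ s ℤ.* I T₀ H
          first = trans (Z.∑-single T₀ λ T k → trans (cong (ℤ._* I T H) (Z.unit-off {T₀} {s} {T} k)) (ℤₚ.*-zeroˡ (I T H))) (cong (ℤ._* I T₀ H) (Z.unit-on T₀ {s}))

  record SignedCycle : Set where
    field
      ε : Fin n → ℤ
      support : ∀ T → rank T ≢ dim → ε T ≡ + 0
      cycle : ∀ H → Z.∂ (λ _ → + 1) ε H ≡ + 0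
      odd : ∀ T → rank T ≡ dim → ε T ≡ + 1 ⊎ ε T ≡ ℤ.- + 1

  ∑-two : ∀ {k} {f : Fin k → ℤ} {i j} → i ≢ j → (∀ l → l ≢ i → l ≢ j → f l ≡ + 0) → Z.∑ f ≡ f i ℤ.+ f j
  ∑-two {f = f} {i} {j} i≢j h = trans (Z.∑-cong term) (trans (Z.∑-+ (λ l → does (l Fₚ.≟ i) Z.▹ f i) (λ l → does (l Fₚ.≟ j) Z.▹ f j)) (cong₂ ℤ._+_ (one i) (one j)))
    where
    one : ∀ i → Z.∑ (λ l → does (l Fₚ.≟ i) Z.▹ f i) ≡ f i
    one i = trans (Z.∑-single i λ l k → Z.▹-false (dec-false (l Fₚ.≟ i) k)) (Z.▹-true (dec-true (i Fₚ.≟ i) refl))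
    term : ∀ l → f l ≡ (does (l Fₚ.≟ i) Z.▹ f i) ℤ.+ (does (l Fₚ.≟ j) Z.▹ f j)
    term l with l Fₚ.≟ i | l Fₚ.≟ j
    ... | yes refl | yes refl = absurd (i≢j refl)
    ... | yes refl | no _ = sym (ℤₚ.+-identityʳ (f l))
    ... | no _ | yes refl = sym (ℤₚ.+-identityˡ (f l))
    ... | no p | no q = h l p q

  ∣sgn*∣ : ∀ k x → ℤ.∣ Z.sgn k ℤ.* x ∣ ≡ ℤ.∣ x ∣
  ∣sgn*∣ k x = trans (ℤₚ.abs-* (Z.sgn k) x) (trans (cong (ℕ._* ℤ.∣ x ∣) (one k)) (ℕₚ.*-identityˡ ℤ.∣ x ∣))
    where
    one : ∀ k → ℤ.∣ Z.sgn k ∣ ≡ 1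
    one zero = refl
    one (suc k) = trans (ℤₚ.∣-i∣≡∣i∣ (Z.sgn k)) (one k)

  module _ (ic : IntegralCycle) where
    open IntegralCycle ic

    private
      g : Fin n → Fin n → ℤ
      g G V = Z.∑ (λ v → cov v G V Z.▹ Z.σ v (vt G) ℤ.* (offℤ ⊥ v ℤ.* ε V))

      ∣g∣ : ∀ {G V} → suc (rank G) ≡ dim → rank V ≡ dim → G ≼ V → ℤ.∣ g G V ∣ ≡ ℤ.∣ ε V ∣
      ∣g∣ {G} {V} rG rV p = trans (cong ℤ.∣_∣ single) (trans (∣sgn*∣ (cnt v (vt G)) (offℤ ⊥ v ℤ.* ε V)) (cong ℤ.∣_∣ (trans (cong (ℤ._* ε V) (all-weight v)) (ℤₚ.*-identityˡ (ε V)))))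
        where
        V≢G : V ≢ G
        V≢G refl = ℕₚ.1+n≢n (trans rG (sym rV))
        at = atom-between p V≢G
        v = proj₁ at
        A≡V : proj₁ (proj₂ at) ≡ V
        A≡V = ≼-rank (proj₂ (proj₂ (proj₂ at))) (ℕₚ.≤-reflexive (trans rV (trans (sym rG) (sym (Cover.rankT (proj₁ (proj₂ (proj₂ at))))))))
        cv : Cover v G V
        cv = subst (Cover v G) A≡V (proj₁ (proj₂ (proj₂ at)))
        single : g G V ≡ Z.σ v (vt G) ℤ.* (offℤ ⊥ v ℤ.* ε V)
        single = trans (Z.∑-single v λ u k → Z.▹-0 (cov u G V) λ e → absurd (true≢false (trans (sym (lookup-ins (vt G) k)) (subst (u ∈_) (Cover.vtT cv) (Cover.v∈T (cover e)))) (Cover.v∉H (cover e))))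
          (Z.▹-true (cov-ins (Cover.v∉H cv) (Cover.H≼T cv) (Cover.vtT cv)))

      open Constancy (λ T → ℤ.∣ ε T ∣)

      -- At most two facets meet in a ridge, by `ridge`. Their contributions to the boundary at the
      -- ridge cancel, so their coefficients agree up to sign.
      small : ∀ G → m G ≤ 1 → Const G
      small G s {T} {U} mT mU p q with T Fₚ.≟ G | U Fₚ.≟ G | T Fₚ.≟ U
      ... | yes refl | _ | _ = cong (λ V → ℤ.∣ ε V ∣) (sym (mT q))
      ... | no _ | yes refl | _ = cong (λ V → ℤ.∣ ε V ∣) (mU p)
      ... | no _ | no _ | yes refl = refl
      ... | no T≢G | no U≢G | no T≢U = trans (sym (∣g∣ rG (pure mT) p)) (trans same (∣g∣ rG (pure mU) q))
        where
        rG : suc (rank G) ≡ dim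
        rG = ℕₚ.≤-antisym (ℕₚ.≤-trans (ℕₚ.≰⇒> (λ t → T≢G (sym (≼-rank p t)))) (ℕₚ.≤-reflexive (pure mT)))
          (ℕₚ.≤-trans (dim≤ G) (ℕₚ.≤-trans (ℕₚ.+-monoʳ-≤ (rank G) s) (ℕₚ.≤-reflexive (ℕₚ.+-comm (rank G) 1))))
        m1 : m G ≡ 1
        m1 = ℕₚ.≤-antisym s (ℕₚ.+-cancelˡ-≤ (rank G) 1 (m G) (ℕₚ.≤-trans (ℕₚ.≤-reflexive (trans (ℕₚ.+-comm (rank G) 1) rG)) (dim≤ G)))
        total : g G T ℤ.+ g G U ≡ + 0
        total = trans (sym (∑-two {f = g G} T≢U λ V V≢T V≢U → Z.∑-0 λ v → Z.▹-0 (cov v G V) λ e → absurd (ridge m1 p T≢G q U≢G (Cover.H≼T (cover e)) (λ { refl → ℕₚ.1+n≢n (sym (Cover.rankT (cover e))) }) T≢U (V≢T ∘ sym) (V≢U ∘ sym))))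
          (trans (Z.∑-swap (λ V v → cov v G V Z.▹ Z.σ v (vt G) ℤ.* (offℤ ⊥ v ℤ.* ε V))) (cycle G))
        same : ℤ.∣ g G T ∣ ≡ ℤ.∣ g G U ∣
        same = trans (cong ℤ.∣_∣ (trans (sym (ℤₚ.+-identityʳ (g G T))) (trans (cong (λ t → g G T ℤ.+ t) (sym (ℤₚ.+-inverseʳ (g G U)))) (trans (sym (ℤₚ.+-assoc (g G T) (g G U) (ℤ.- g G U))) (trans (cong (λ t → t ℤ.+ ℤ.- g G U) total) (ℤₚ.+-identityˡ (ℤ.- g G U))))))) (ℤₚ.∣-i∣≡∣i∣ (g G U))

    signed-cycle : SignedCycle
    signed-cycle = record { ε = ε' ; support = λ T k → Z.▹-false (dec-false (facet? T) k) ; cycle = cyc ; odd = od }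
      where
      M : ℤ
      M = + ℤ.∣ ε T₀ ∣
      M≢0 : M ≢ + 0
      M≢0 e = nonzero (ℤₚ.∣i∣≡0⇒i≡0 (ℤₚ.+-injective e))
      same : ∀ T → rank T ≡ dim → ℤ.∣ ε T ∣ ≡ ℤ.∣ ε T₀ ∣
      same T r = constant small dim bot (ℕₚ.m≤m+n dim (rank bot)) (facet-maximal r) (facet-maximal T₀-facet) (bot-least T) (bot-least T₀)
      sg : ℤ → ℤ
      sg (+ _) = + 1
      sg -[1+ _ ] = ℤ.- + 1
      sg-abs : ∀ i → sg i ℤ.* + ℤ.∣ i ∣ ≡ i
      sg-abs (+ k) = ℤₚ.*-identityˡ (+ k)
      sg-abs -[1+ k ] = ℤₚ.-1*i≡-i (+ suc k)
      -- The quotient of `ε` by the common absolute value `M` of its coefficients.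
      ε' : Fin n → ℤ
      ε' T = does (facet? T) Z.▹ sg (ε T)
      scale : ∀ T → M ℤ.* ε' T ≡ ε T
      scale T with facet? T
      ... | yes r = trans (ℤₚ.*-comm M (sg (ε T))) (trans (cong (λ t → sg (ε T) ℤ.* + t) (sym (same T r))) (sg-abs (ε T)))
      ... | no r = trans (ℤₚ.*-zeroʳ M) (sym (support T r))
      cyc : ∀ H → Z.∂ (λ _ → + 1) ε' H ≡ + 0
      cyc H = ℤₚ.*-cancelˡ-≡ M (Z.∂ (λ _ → + 1) ε' H) (+ 0) ⦃ ℤ.≢-nonZero M≢0 ⦄ (trans (sym (Z.∂-* (λ _ → + 1) M ε' H))
        (trans (Z.∂-cong {λ _ → + 1} {offℤ ⊥} (λ v → sym (all-weight v)) scale H) (trans (cycle H) (sym (ℤₚ.*-zeroʳ M)))))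
      sg-odd : ∀ i → sg i ≡ + 1 ⊎ sg i ≡ ℤ.- + 1
      sg-odd (+ _) = inj₁ refl
      sg-odd -[1+ _ ] = inj₂ refl
      od : ∀ T → rank T ≡ dim → ε' T ≡ + 1 ⊎ ε' T ≡ ℤ.- + 1
      od T r with sg-odd (ε T)
      ... | inj₁ e = inj₁ (trans (Z.▹-true (dec-true (facet? T) r)) e)
      ... | inj₂ e = inj₂ (trans (Z.▹-true (dec-true (facet? T) r)) e)

  orientation : ¬ ¬ SignedCycle
  orientation = field-cycle >>= λ f → integral-cycle f >>= λ i → return (signed-cycle i)

-- Cochains with polynomial coefficients

#-disjoint : {p q r : Fin N → Bool} → (∀ x → p x ≡ true → q x ≡ false) → (∀ x → p x ≡ true → r x ≡ true) → (∀ x → q x ≡ true → r x ≡ true) → # p ℕ.+ # q ≤ # r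
#-disjoint {N = zero} d f g = z≤n
#-disjoint {N = suc N} {p} {q} {r} d f g = ℕₚ.≤-trans (ℕₚ.≤-reflexive (rearrange (b2n (p zero)) (# (p ∘ suc)) (b2n (q zero)) (# (q ∘ suc))))
  (ℕₚ.+-mono-≤ (head (p zero) (q zero) (r zero) (d zero) (f zero) (g zero)) (#-disjoint (d ∘ suc) (f ∘ suc) (g ∘ suc)))
  where
  rearrange : ∀ a b c d → a ℕ.+ b ℕ.+ (c ℕ.+ d) ≡ a ℕ.+ c ℕ.+ (b ℕ.+ d)
  rearrange a b c d = trans (ℕₚ.+-assoc a b (c ℕ.+ d)) (trans (cong (a ℕ.+_) (trans (sym (ℕₚ.+-assoc b c d)) (trans (cong (ℕ._+ d) (ℕₚ.+-comm b c)) (ℕₚ.+-assoc c b d)))) (sym (ℕₚ.+-assoc a c (b ℕ.+ d))))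
  head : ∀ x y z → (x ≡ true → y ≡ false) → (x ≡ true → z ≡ true) → (y ≡ true → z ≡ true) → b2n x ℕ.+ b2n y ≤ b2n z
  head true y z d f g rewrite d refl | f refl = ℕₚ.≤-refl
  head false true z d f g rewrite g refl = ℕₚ.≤-refl
  head false false z d f g = z≤n

Idx : ℕ → Set
Idx s = Vec ℕ s

tot : ∀ {s} → Idx s → ℕ
tot [] = 0
tot (i ∷ α) = i ℕ.+ tot α

bump : ∀ {s} → Fin s → Idx s → Idx s
bump t α = Data.Vec.updateAt α t suc

tot-bump : ∀ {s} (t : Fin s) α → tot (bump t α) ≡ suc (tot α)
tot-bump zero (i ∷ α) = refl
tot-bump (suc t) (i ∷ α) = trans (cong (i ℕ.+_) (tot-bump t α)) (ℕₚ.+-suc i (tot α))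

bump-comm : ∀ {s} (t t' : Fin s) α → bump t (bump t' α) ≡ bump t' (bump t α)
bump-comm zero zero (i ∷ α) = refl
bump-comm zero (suc t') (i ∷ α) = refl
bump-comm (suc t) zero (i ∷ α) = refl
bump-comm (suc t) (suc t') (i ∷ α) = cong (i ∷_) (bump-comm t t' α)

module Coefficients {c ℓ} (R : CommutativeRing c ℓ) where
  open RingTools R

  -- Divided-power coefficients in s variables: contraction by linear forms stands for the dual of multiplication.
  D : ℕ → Set c
  D s = Idx s → Carrier

  infix 4 _≋_
  _≋_ : ∀ {s} → D s → D s → Set ℓ
  f ≋ g = ∀ α → f α ≈ g α

  0D : ∀ {s} → D s
  0D α = 0#

  -- The transpose of multiplication by the linear form with coefficients `u 0`, `u 1`, and so on;
  -- in the divided-power convention no integer factors appear. Coefficients are indexed by `ℕ`, so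
  -- that dropping the first variable is composition with `suc`.
  contract : ∀ {s} → (ℕ → Carrier) → D s → D s
  contract u f α = ∑ λ t → u (toℕ t) * f (bump t α)

  contract-∷ : ∀ {s} u (f : D (suc s)) i α → contract u f (i ∷ α) ≈ u 0 * f (suc i ∷ α) + contract (u ∘ suc) (λ β → f (i ∷ β)) α
  contract-∷ u f i α = ∑-∷ _

  record Linear {s t} (Λ : D s → D t) : Set (c ⊔ ℓ) where
    field
      resp : ∀ {f g} → f ≋ g → Λ f ≋ Λ g
      add : ∀ f g α → Λ (λ β → f β + g β) α ≈ Λ f α + Λ g α
      scale : ∀ x f α → Λ (λ β → x * f β) α ≈ x * Λ f α

    zer : ∀ {f} → f ≋ 0D → Λ f ≋ 0D
    zer {f} h α = ≈-trans (resp (λ β → ≈-trans (h β) (≈-sym (zeroˡ 0#))) α) (≈-trans (scale 0# (λ _ → 0#) α) (zeroˡ _))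

    sub : ∀ f g α → Λ (λ β → f β - g β) α ≈ Λ f α - Λ g α
    sub f g α = ≈-trans (resp (λ β → +-congˡ (solve 1 (λ x → :- x := con (ℤ.- + 1) :* x) ≈-refl (g β))) α)
      (≈-trans (add f _ α) (+-congˡ (≈-trans (scale _ g α) (solve 1 (λ x → con (ℤ.- + 1) :* x := :- x) ≈-refl _))))

    combination : ∀ {m} (x : Fin m → Carrier) (h : Fin m → D s) α → Λ (λ β → ∑ (λ u → x u * h u β)) α ≈ ∑ (λ u → x u * Λ (h u) α)
    combination {zero} x h α = ≈-trans (zer (λ β → ∑-[] _) α) (≈-sym (∑-[] _))
    combination {suc m} x h α = ≈-trans (resp (λ β → ∑-∷ _) α) (≈-trans (add _ _ α) (≈-trans (+-cong (scale _ _ α) (combination (x ∘ suc) (h ∘ suc) α)) (≈-sym (∑-∷ _))))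

  id-linear : ∀ {s} → Linear {s} {s} (λ f → f)
  id-linear = record { resp = λ h → h ; add = λ _ _ _ → ≈-refl ; scale = λ _ _ _ → ≈-refl }

  contract-linear : ∀ {s} u → Linear {s} (contract u)
  contract-linear u = record
    { resp = λ h α → ∑-cong λ t → *-congˡ (h _)
    ; add = λ f g α → ≈-trans (∑-cong λ t → distribˡ _ _ _) (∑-+ _ _)
    ; scale = λ x f α → ≈-sym (≈-trans (∑-*ˡ x _) (∑-cong λ t → solve 3 (λ x u y → x :* (u :* y) := u :* (x :* y)) ≈-refl _ _ _))
    }

  contract-comm : ∀ {s} u w (f : D s) → contract u (contract w f) ≋ contract w (contract u f)
  contract-comm u w f α = begin
    ∑ (λ t → u (toℕ t) * ∑ (λ t' → w (toℕ t') * f (bump t' (bump t α))))  ≈⟨ (∑-cong λ t → ∑-*ˡ _ _) ⟩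
    ∑ (λ t → ∑ (λ t' → u (toℕ t) * (w (toℕ t') * f (bump t' (bump t α))))) ≈⟨ ∑-swap _ ⟩
    ∑ (λ t' → ∑ (λ t → u (toℕ t) * (w (toℕ t') * f (bump t' (bump t α))))) ≈⟨ (∑-cong λ t' → ≈-trans (∑-cong λ t → ≈-trans (*-congˡ (*-congˡ (≈-reflexive (cong f (bump-comm t' t α))))) (solve 3 (λ u w y → u :* (w :* y) := w :* (u :* y)) ≈-refl _ _ _)) (≈-sym (∑-*ˡ _ _))) ⟩
    ∑ (λ t' → w (toℕ t') * ∑ (λ t → u (toℕ t) * f (bump t (bump t' α)))) ∎

  contract-weights : ∀ {s} u w x (f : D s) α → contract (λ k → u k - x * w k) f α ≈ contract u f α - x * contract w f α
  contract-weights u w x f α = ≈-trans (∑-cong λ t → solve 4 (λ u x w y → (u :- x :* w) :* y := u :* y :+ (:- (x :* (w :* y)))) ≈-refl _ _ _ _)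
    (≈-trans (∑-+ _ _) (+-congˡ (≈-trans (∑-neg _) (-‿cong (≈-sym (∑-*ˡ x _))))))

  -- Homogeneous of degree `e - k`, written additively to avoid truncated subtraction.
  Hom : ∀ {s} → ℕ → ℕ → D s → Set ℓ
  Hom e k f = ∀ α → k ℕ.+ tot α ≢ e → f α ≈ 0#

  -- Contraction by w, whose leading coefficient has inverse x: a right inverse (preimage), its kernel (extend), and the form induced by u on the kernel (reduce).
  module Leading (w : ℕ → Carrier) (x : Carrier) (wx : w 0 * x ≈ 1#) where

    private
      -- Both `pre` and `ext` solve the equation at first exponent `i` for the coefficient at
      -- `suc i`; they differ in the start and in the right-hand side.
      pre : ∀ {s} → D (suc s) → ℕ → D s
      pre f zero α = 0#
      pre f (suc i) α = x * (f (i ∷ α) - contract (w ∘ suc) (pre f i) α)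

      ext : ∀ {s} → D s → ℕ → D s
      ext a zero = a
      ext a (suc i) α = - (x * contract (w ∘ suc) (ext a i) α)

    preimage : ∀ {s} → D (suc s) → D (suc s)
    preimage f (i ∷ α) = pre f i α

    extend : ∀ {s} → D s → D (suc s)
    extend a (i ∷ α) = ext a i α

    reduce : (ℕ → Carrier) → ℕ → Carrier
    reduce u k = u (suc k) - (u 0 * x) * w (suc k)

    contract-preimage : ∀ {s} (f : D (suc s)) → contract w (preimage f) ≋ f
    contract-preimage f (i ∷ α) = ≈-trans (contract-∷ w (preimage f) i α) (≈-trans (+-congʳ (≈-trans (≈-sym (*-assoc _ _ _)) (≈-trans (*-congʳ wx) (*-identityˡ _))))
      (solve 2 (λ a b → (a :- b) :+ b := a) ≈-refl _ _))

    preimage-hom : ∀ {s e k} {f : D (suc s)} → Hom e (suc k) f → Hom e k (preimage f)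
    preimage-hom {e = e} {k} {f} h (i ∷ α) = go i α
      where
      go : ∀ i α → k ℕ.+ (i ℕ.+ tot α) ≢ e → pre f i α ≈ 0#
      go zero α ne = ≈-refl
      go (suc i) α ne = ≈-trans (*-congˡ (≈-trans (+-cong (h (i ∷ α) λ q → ne (trans (ℕₚ.+-suc k (i ℕ.+ tot α)) q))
        (-‿cong (∑-0 λ t → ≈-trans (*-congˡ (go i (bump t α) λ q → ne (trans (cong (k ℕ.+_) (sym (trans (cong (i ℕ.+_) (tot-bump t α)) (ℕₚ.+-suc i (tot α))))) q))) (zeroʳ _)))) (-‿inverseʳ 0#))) (zeroʳ x)

    contract-extend : ∀ {s} (a : D s) → contract w (extend a) ≋ 0D
    contract-extend a (i ∷ α) = ≈-trans (contract-∷ w (extend a) i α) (≈-trans (+-congʳ (≈-trans (≈-sym (-‿distribʳ-* _ _)) (-‿cong (≈-trans (≈-sym (*-assoc _ _ _)) (≈-trans (*-congʳ wx) (*-identityˡ _)))))) (-‿inverseˡ _))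

    extend-unique : ∀ {s} (g : D (suc s)) → contract w g ≋ 0D → g ≋ extend (λ α → g (0 ∷ α))
    extend-unique g h (i ∷ α) = go i α
      where
      go : ∀ i α → g (i ∷ α) ≈ ext (λ α → g (0 ∷ α)) i α
      go zero α = ≈-refl
      go (suc i) α = begin
        g (suc i ∷ α)                      ≈⟨ ≈-sym (≈-trans (*-congʳ (≈-trans (*-comm _ _) wx)) (*-identityˡ _)) ⟩
        (x * w 0) * g (suc i ∷ α)          ≈⟨ solve 4 (λ x w g k → (x :* w) :* g := x :* (w :* g :+ k) :+ (:- (x :* k))) ≈-refl x (w 0) (g (suc i ∷ α)) (contract (w ∘ suc) (λ β → g (i ∷ β)) α) ⟩
        x * (w 0 * g (suc i ∷ α) + contract (w ∘ suc) (λ β → g (i ∷ β)) α) + - (x * contract (w ∘ suc) (λ β → g (i ∷ β)) α)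
          ≈⟨ +-cong (≈-trans (*-congˡ (≈-trans (≈-sym (contract-∷ w g i α)) (h (i ∷ α)))) (zeroʳ x)) (-‿cong (*-congˡ (Linear.resp (contract-linear (w ∘ suc)) (go i) α))) ⟩
        0# + - (x * contract (w ∘ suc) (ext (λ α → g (0 ∷ α)) i) α) ≈⟨ +-identityˡ _ ⟩
        - (x * contract (w ∘ suc) (ext (λ α → g (0 ∷ α)) i) α) ∎

    extend-hom : ∀ {s e k} {a : D s} → Hom e k a → Hom e k (extend a)
    extend-hom {e = e} {k} {a} h (i ∷ α) = go i α
      where
      go : ∀ i α → k ℕ.+ (i ℕ.+ tot α) ≢ e → ext a i α ≈ 0#
      go zero α = h α
      go (suc i) α ne = ≈-trans (-‿cong (≈-trans (*-congˡ (∑-0 λ t → ≈-trans (*-congˡ (go i (bump t α) λ q → ne (trans (cong (k ℕ.+_) (sym (trans (cong (i ℕ.+_) (tot-bump t α)) (ℕₚ.+-suc i (tot α))))) q))) (zeroʳ _))) (zeroʳ x))) -0#≈0#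

    extend-linear : ∀ {s} → Linear (extend {s})
    extend-linear {s} = record { resp = λ { h (i ∷ α) → rs h i α } ; add = λ { f g (i ∷ α) → ad f g i α } ; scale = λ { y f (i ∷ α) → sc y f i α } }
      where
      module W = Linear (contract-linear {s} (w ∘ suc))
      rs : ∀ {f g : D s} → f ≋ g → ∀ i α → ext f i α ≈ ext g i α
      rs h zero α = h α
      rs h (suc i) α = -‿cong (*-congˡ (W.resp (rs h i) α))
      ad : ∀ (f g : D s) i α → ext (λ β → f β + g β) i α ≈ ext f i α + ext g i α
      ad f g zero α = ≈-refl
      ad f g (suc i) α = ≈-trans (-‿cong (*-congˡ (≈-trans (W.resp (ad f g i) α) (W.add (ext f i) (ext g i) α)))) (solve 3 (λ x a b → :- (x :* (a :+ b)) := (:- (x :* a)) :+ (:- (x :* b))) ≈-refl _ _ _)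
      sc : ∀ y (f : D s) i α → ext (λ β → y * f β) i α ≈ y * ext f i α
      sc y f zero α = ≈-refl
      sc y f (suc i) α = ≈-trans (-‿cong (*-congˡ (≈-trans (W.resp (sc y f i) α) (W.scale y (ext f i) α)))) (solve 3 (λ x y a → :- (x :* (y :* a)) := y :* (:- (x :* a))) ≈-refl _ _ _)

    -- On the kernel of `contract w` a multiple of `w` may be subtracted from `u`. The one that
    -- cancels the leading coefficient leaves a form in the other variables, which commutes with the
    -- recursion.
    contract-of-extend : ∀ {s} u (a : D s) → contract u (extend a) ≋ extend (contract (reduce u) a)
    contract-of-extend u a (i ∷ α) = begin
      contract u (extend a) (i ∷ α)                                                      ≈⟨ contract-∷ u (extend a) i α ⟩
      u 0 * - (x * contract (w ∘ suc) (ext a i) α) + contract (u ∘ suc) (ext a i) α      ≈⟨ solve 4 (λ u x c d → u :* (:- (x :* c)) :+ d := d :- (u :* x) :* c) ≈-refl _ _ _ _ ⟩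
      contract (u ∘ suc) (ext a i) α - (u 0 * x) * contract (w ∘ suc) (ext a i) α        ≈⟨ ≈-sym (contract-weights (u ∘ suc) (w ∘ suc) (u 0 * x) (ext a i) α) ⟩
      contract (reduce u) (ext a i) α                                                    ≈⟨ swap i α ⟩
      ext (contract (reduce u) a) i α ∎
      where
      module U = Linear (contract-linear (reduce u))
      module W = Linear (contract-linear (w ∘ suc))
      swap : ∀ i α → contract (reduce u) (ext a i) α ≈ ext (contract (reduce u) a) i α
      swap zero α = ≈-refl
      swap (suc i) α = begin
        contract (reduce u) (λ α → - (x * contract (w ∘ suc) (ext a i) α)) α  ≈⟨ U.resp (λ β → solve 2 (λ x c → :- (x :* c) := (:- x) :* c) ≈-refl x (contract (w ∘ suc) (ext a i) β)) α ⟩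
        contract (reduce u) (λ α → (- x) * contract (w ∘ suc) (ext a i) α) α  ≈⟨ ≈-trans (U.scale (- x) (contract (w ∘ suc) (ext a i)) α) (*-congˡ (contract-comm (reduce u) (w ∘ suc) (ext a i) α)) ⟩
        (- x) * contract (w ∘ suc) (contract (reduce u) (ext a i)) α          ≈⟨ *-congˡ (W.resp (swap i) α) ⟩
        (- x) * contract (w ∘ suc) (ext (contract (reduce u) a) i) α          ≈⟨ ≈-sym (-‿distribˡ-* _ _) ⟩
        - (x * contract (w ∘ suc) (ext (contract (reduce u) a) i) α) ∎

module Weighted {c ℓ} (R : CommutativeRing c ℓ) (P : SimplicialPoset) where
  open Cells R P
  open Coefficients R

  coef : Subset n → Fin n → Fin n → Carrier
  coef Z T v = lookup (vt T) v ∧ not (lookup Z v) ▹ σ v (rem (vt T) v)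

  coef-0 : ∀ {Z T v x} → (v ∈ vt T → v ∉ Z → x ≈ 0#) → coef Z T v * x ≈ 0#
  coef-0 {Z} {T} {v} h with ∈-or-∉ v (vt T) | ∈-or-∉ v Z
  ... | inj₂ p | _ = ≈-trans (*-congʳ (▹-false (cong (_∧ not (lookup Z v)) p))) (zeroˡ _)
  ... | inj₁ p | inj₁ q = ≈-trans (*-congʳ (▹-false (trans (cong (λ b → lookup (vt T) v ∧ not b) q) (Bₚ.∧-zeroʳ _)))) (zeroˡ _)
  ... | inj₁ p | inj₂ q = ≈-trans (*-congˡ (h p q)) (zeroʳ _)

  coef-cong : ∀ {Z T v x y} → (v ∈ vt T → v ∉ Z → x ≈ y) → coef Z T v * x ≈ coef Z T v * y
  coef-cong {Z} {T} {v} {x} {y} h = x-y≈0⇒x≈y _ _ (≈-trans (≈-sym (x[y-z]≈xy-xz _ _ _)) (coef-0 {Z} {T} {v} λ p q → x≈y⇒x-y≈0 (h p q)))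

  Cochain : ℕ → Set c
  Cochain s = Fin n → D s

  module Differential {s} (Λ : Fin n → D s → D s) (lin : ∀ v → Linear (Λ v)) where
    Δ : Subset n → Cochain s → Cochain s
    Δ Z c T α = ∑ λ v → coef Z T v * Λ v (c (del T v)) α

    Δ-cong : ∀ Z {c c'} → (∀ T → c T ≋ c' T) → ∀ T → Δ Z c T ≋ Δ Z c' T
    Δ-cong Z h T α = ∑-cong λ v → *-congˡ (Linear.resp (lin v) (h (del T v)) α)

    Δ-sub : ∀ Z c c' T α → Δ Z (λ U β → c U β - c' U β) T α ≈ Δ Z c T α - Δ Z c' T α
    Δ-sub Z c c' T α = ≈-trans (∑-cong λ v → ≈-trans (*-congˡ (Linear.sub (lin v) (c (del T v)) (c' (del T v)) α)) (x[y-z]≈xy-xz _ _ _)) (≈-trans (∑-+ _ _) (+-congˡ (∑-neg _)))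

    module _ (comm : ∀ u v f → Λ u (Λ v f) ≋ Λ v (Λ u f)) where

      Δ-Δ : ∀ Z c T → Δ Z (Δ Z c) T ≋ 0D
      Δ-Δ Z c T α = ≈-trans (∑-cong λ v → ≈-trans (*-congˡ (Linear.combination (lin v) _ _ α)) (∑-*ˡ _ _)) (∑∑-anti f anti diag)
        where
        f : Fin n → Fin n → Carrier
        f v u = coef Z T v * (coef Z (del T v) u * Λ v (Λ u (c (del (del T v) u))) α)
        diag : ∀ v → f v v ≈ 0#
        diag v = coef-0 {Z} {T} {v} λ _ _ → coef-0 {Z} {del T v} {v} λ p _ → absurd (true≢false p (trans (cong (λ S → lookup S v) (vt-del T v)) (∉-rem (vt T) v)))
        both0 : ∀ {x y} → x ≈ 0# → y ≈ 0# → x ≈ - y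
        both0 p q = ≈-trans p (≈-sym (≈-trans (-‿cong q) -0#≈0#))
        gone : ∀ u v → u ≡ v ⊎ (u ∉ vt T ⊎ v ∉ vt T) ⊎ (u ∈ Z ⊎ v ∈ Z) → f v u ≈ 0#
        gone u v (inj₁ refl) = diag u
        gone u v (inj₂ (inj₁ (inj₂ q))) = coef-0 {Z} {T} {v} λ p _ → absurd (true≢false p q)
        gone u v (inj₂ (inj₁ (inj₁ q))) = coef-0 {Z} {T} {v} λ _ _ → coef-0 {Z} {del T v} {u} λ p _ → absurd (true≢false (into (vt-mono (del≼ T v)) p) q)
        gone u v (inj₂ (inj₂ (inj₁ q))) = coef-0 {Z} {T} {v} λ _ _ → coef-0 {Z} {del T v} {u} λ _ p → absurd (true≢false q p)
        gone u v (inj₂ (inj₂ (inj₂ q))) = coef-0 {Z} {T} {v} λ _ p → absurd (true≢false q p)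
        on : ∀ {T v} → v ∈ vt T → v ∉ Z → coef Z T v ≈ σ v (rem (vt T) v)
        on p q = ▹-true (∧-intro p (cong not q))
        anti : ∀ v u → f v u ≈ - f u v
        anti v u with u Fₚ.≟ v | ∈-or-∉ u (vt T) | ∈-or-∉ v (vt T) | ∈-or-∉ u Z | ∈-or-∉ v Z
        ... | yes refl | _ | _ | _ | _ = both0 (diag u) (diag u)
        ... | no k | inj₂ p | _ | _ | _ = both0 (gone u v (inj₂ (inj₁ (inj₁ p)))) (gone v u (inj₂ (inj₁ (inj₂ p))))
        ... | no k | inj₁ _ | inj₂ p | _ | _ = both0 (gone u v (inj₂ (inj₁ (inj₂ p)))) (gone v u (inj₂ (inj₁ (inj₁ p))))
        ... | no k | inj₁ _ | inj₁ _ | inj₁ p | _ = both0 (gone u v (inj₂ (inj₂ (inj₁ p)))) (gone v u (inj₂ (inj₂ (inj₂ p))))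
        ... | no k | inj₁ _ | inj₁ _ | inj₂ _ | inj₁ p = both0 (gone u v (inj₂ (inj₂ (inj₂ p)))) (gone v u (inj₂ (inj₂ (inj₁ p))))
        ... | no k | inj₁ u∈ | inj₁ v∈ | inj₂ u∉ | inj₂ v∉ = begin
          coef Z T v * (coef Z (del T v) u * Λ v (Λ u (c (del (del T v) u))) α)
            ≈⟨ ≈-sym (*-assoc _ _ _) ⟩
          (coef Z T v * coef Z (del T v) u) * Λ v (Λ u (c (del (del T v) u))) α
            ≈⟨ *-cong (two k u∈ v∈ u∉ v∉) (≈-trans (comm v u _ α) (Linear.resp (lin u) (Linear.resp (lin v) λ β → ≈-reflexive (cong (λ U → c U β) (del-comm T v u))) α)) ⟩
          (σ v (ins B u) * σ u B) * Λ u (Λ v (c (del (del T u) v))) α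
            ≈⟨ *-congʳ (≈-trans (*-comm _ _) (σ-anti B (k ∘ sym) v∉B u∉B)) ⟩
          - (σ v B * σ u (ins B v)) * Λ u (Λ v (c (del (del T u) v))) α
            ≈⟨ ≈-trans (*-congʳ (-‿cong (≈-trans (*-comm _ _) (≈-sym (≈-trans (two (k ∘ sym) v∈ u∈ v∉ u∉) (≈-reflexive (cong (λ S → σ u (ins S v) * σ v S) (rem-comm (vt T) u v)))))))) (≈-trans (≈-sym (-‿distribˡ-* _ _)) (-‿cong (*-assoc _ _ _))) ⟩
          - f u v ∎
          where
          B = rem (rem (vt T) v) u
          u∉B : u ∉ B
          u∉B = ∉-rem (rem (vt T) v) u
          v∉B : v ∉ B
          v∉B = trans (lookup-rem (rem (vt T) v) (k ∘ sym)) (∉-rem (vt T) v)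
          two : ∀ {u v} → u ≢ v → u ∈ vt T → v ∈ vt T → u ∉ Z → v ∉ Z → coef Z T v * coef Z (del T v) u ≈ σ v (ins (rem (rem (vt T) v) u) u) * σ u (rem (rem (vt T) v) u)
          two {u} {v} k u∈ v∈ u∉ v∉ = *-cong (≈-trans (on v∈ v∉) (≈-reflexive (cong (σ v) (sym (ins-rem (rem (vt T) v) (∈-rem (vt T) u∈ k))))))
            (≈-trans (on (subst (u ∈_) (sym (vt-del T v)) (∈-rem (vt T) u∈ k)) u∉) (≈-reflexive (cong (λ S → σ u (rem S u)) (vt-del T v))))

  -- Only vertices of index below `k` contract. This interpolates between constant coefficients,
  -- `k = 0`, and the complex that is wanted, `k = n`.
  L : ∀ {s} → (Fin n → ℕ → Carrier) → ℕ → Fin n → D s → D s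
  L form k v f = if toℕ v <ᵇ k then contract (form v) f else f

  L-linear : ∀ {s} form k v → Linear {s} (L form k v)
  L-linear form k v with toℕ v <ᵇ k
  ... | true = contract-linear (form v)
  ... | false = id-linear

  L-contract : ∀ {s} form k u w (f : D s) → L form k u (contract w f) ≋ contract w (L form k u f)
  L-contract form k u w f with toℕ u <ᵇ k
  ... | true = contract-comm (form u) w f
  ... | false = λ _ → ≈-refl

  L-comm : ∀ {s} form k u v (f : D s) → L form k u (L form k v f) ≋ L form k v (L form k u f)
  L-comm form k u v f with toℕ v <ᵇ k
  ... | true = L-contract form k u (form v) f
  ... | false = λ _ → ≈-refl

  module Δ {s} form k = Differential {s} (L form k) (L-linear form k)

  -- The number of vertices of T outside Z at which the coefficients have been contracted.
  κ : ℕ → Subset n → Fin n → ℕ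
  κ k Z T = # (λ v → lookup (vt T) v ∧ (not (lookup Z v) ∧ (toℕ v <ᵇ k)))

  κ-bound : ∀ {k Z T} → Z ⊆ vt T → κ k Z T ℕ.+ ∣ Z ∣ ≤ rank T
  κ-bound {k} {Z} {T} s = ℕₚ.≤-trans (ℕₚ.≤-reflexive (cong (κ k Z T ℕ.+_) (∣∣≡# Z))) (ℕₚ.≤-trans (#-disjoint {q = lookup Z}
    (λ x e → not-true (proj₁ (∧-true {not (lookup Z x)} (proj₂ (∧-true {lookup (vt T) x} e))))) (λ x e → proj₁ (∧-true {lookup (vt T) x} e)) (λ x → into s))
    (ℕₚ.≤-reflexive (sym (trans (rank≡ T) (∣∣≡# (vt T))))))

  -- The index j is one more than the rank of the faces carrying the cochain.
  record Graded {s} (e k : ℕ) (Z : Subset n) (j : ℕ) (f : Cochain s) : Set (c ⊔ ℓ) where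
    constructor graded
    field support : ∀ T α → ¬ (Z ⊆ vt T × suc (rank T) ≡ j × κ k Z T ℕ.+ tot α ≡ e) → f T α ≈ 0#
  open Graded public

  -- The minors formed by the first coordinates of distinct vertices outside `Z` are invertible, in
  -- the form in which elimination meets them: one pivot after another.
  Generic : ℕ → (Fin n → ℕ → Carrier) → Subset n → Set (c ⊔ ℓ)
  Generic zero form Z = Level.Lift (c ⊔ ℓ) ⊤
  Generic (suc s) form Z = ∀ w → w ∉ Z → ∃ λ x → form w 0 * x ≈ 1# × Generic s (λ v k → form v (suc k) - (form v 0 * x) * form w (suc k)) (ins Z w)

  -- Exactness at the faces of rank `j`. The primitive has index `j`, so it lives in rank `j - 1`,
  -- and for `j = 0` it is zero.
  Acyclic : ℕ → ℕ → ℕ → Subset n → (Fin n → ℕ → Carrier) → ℕ → Set (c ⊔ ℓ)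
  Acyclic e s k Z form j = ∀ c → Graded {s} e k Z (suc j) c → (∀ T → Δ.Δ form k Z c T ≋ 0D) →
    ∃ λ b → Graded e k Z j b × (∀ T → Δ.Δ form k Z b T ≋ c T)

  κ-del : ∀ {k Z T v} → v ∈ vt T → v ∉ Z → κ k Z T ≡ b2n (toℕ v <ᵇ k) ℕ.+ κ k Z (del T v)
  κ-del {k} {Z} {T} {v} v∈ v∉ with toℕ v <ᵇ k in eq
  ... | true = #-upd v (cong (_∧ (not (lookup Z v) ∧ (toℕ v <ᵇ k))) (trans (cong (λ S → lookup S v) (vt-del T v)) (∉-rem (vt T) v))) (∧-intro v∈ (∧-intro (cong not v∉) eq))
    λ y h → cong (_∧ (not (lookup Z y) ∧ (toℕ y <ᵇ k))) (trans (cong (λ S → lookup S y) (vt-del T v)) (lookup-rem (vt T) h))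
  ... | false = #-cong λ y → case y
    where
    case : ∀ y → lookup (vt T) y ∧ (not (lookup Z y) ∧ (toℕ y <ᵇ k)) ≡ lookup (vt (del T v)) y ∧ (not (lookup Z y) ∧ (toℕ y <ᵇ k))
    case y with y Fₚ.≟ v
    ... | no h = cong (_∧ (not (lookup Z y) ∧ (toℕ y <ᵇ k))) (sym (trans (cong (λ S → lookup S y) (vt-del T v)) (lookup-rem (vt T) h)))
    ... | yes refl rewrite eq | Bₚ.∧-zeroʳ (not (lookup Z y)) | Bₚ.∧-zeroʳ (lookup (vt T) y) | Bₚ.∧-zeroʳ (lookup (vt (del T y)) y) = refl

  Δ-graded : ∀ {s e k Z j form} {c : Cochain s} → Graded e k Z j c → Graded e k Z (suc j) (Δ.Δ form k Z c)
  Δ-graded {s} {e} {k} {Z} {j} {form} {c} g = graded λ T α ne → ∑-0 λ v → coef-0 {Z} {T} {v} λ v∈ v∉ → term T α v v∈ v∉ ne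
    where
    term : ∀ T α v → v ∈ vt T → v ∉ Z → ¬ (Z ⊆ vt T × suc (rank T) ≡ suc j × κ k Z T ℕ.+ tot α ≡ e) → L form k v (c (del T v)) α ≈ 0#
    term T α v v∈ v∉ ne with toℕ v <ᵇ k | κ-del {k} {Z} v∈ v∉
    ... | false | q = support g (del T v) α λ { (s , r , t) → ne (⊆-trans s (vt-mono (del≼ T v)) , cong suc (trans (rank-del v∈) r) , trans (cong (ℕ._+ tot α) q) t) }
    ... | true | q = ∑-0 λ t → ≈-trans (*-congˡ (support g (del T v) (bump t α) λ { (s , r , u) → ne (⊆-trans s (vt-mono (del≼ T v)) , cong suc (trans (rank-del v∈) r) ,
        trans (cong (ℕ._+ tot α) q) (trans (sym (trans (cong (κ k Z (del T v) ℕ.+_) (tot-bump t α)) (ℕₚ.+-suc (κ k Z (del T v)) (tot α)))) u)) })) (zeroʳ _)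

  ∉-del : ∀ T v → v ∉ vt (del T v)
  ∉-del T v = trans (cong (λ S → lookup S v) (vt-del T v)) (∉-rem (vt T) v)

  ∉-del′ : ∀ {T v w} → w ∉ vt T → w ∉ vt (del T v)
  ∉-del′ {T} {v} {w} p with ∈-or-∉ w (vt (del T v))
  ... | inj₂ q = q
  ... | inj₁ q = absurd (true≢false (into (vt-mono (del≼ T v)) q) p)

  ∈-del : ∀ {T v w} → w ∈ vt T → w ≢ v → w ∈ vt (del T v)
  ∈-del {T} {v} {w} p k = subst (w ∈_) (sym (vt-del T v)) (∈-rem (vt T) p k)

  -- The vertex `w` starts to contract. Contraction by `form w` on the faces containing `w` is a map
  -- `ρ` from the old complex onto the new one. Its kernel is the complex of `ins Z w` with one
  -- variable fewer and with the forms reduced by `form w`. The connecting argument of the long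
  -- exact sequence combines exactness of the old complex at `j` with that of the kernel at `suc j`.
  module Step {e s k j : ℕ} {Z : Subset n} (form : Fin n → ℕ → Carrier) (w : Fin n) (w≡k : toℕ w ≡ k) (w∉Z : w ∉ Z)
              (x : Carrier) (wx : form w 0 * x ≈ 1#)
              (inner : Acyclic e s k (ins Z w) (λ v → Coefficients.Leading.reduce R (form w) x wx (form v)) (suc j))
              (outer : Acyclic e (suc s) k Z form j) where
    open Leading (form w) x wx

    form′ : Fin n → ℕ → Carrier
    form′ v = reduce (form v)

    k≮k : (toℕ w <ᵇ k) ≡ false
    k≮k = <ᵇ-false (ℕₚ.<-irrefl w≡k)

    k<k+1 : (toℕ w <ᵇ suc k) ≡ true
    k<k+1 = <ᵇ-true (s≤s (ℕₚ.≤-reflexive w≡k))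

    same : ∀ {v} → v ≢ w → (toℕ v <ᵇ suc k) ≡ (toℕ v <ᵇ k)
    same {v} h = bool-ext (λ p → <ᵇ-true (ℕₚ.≤∧≢⇒< (ℕₚ.≤-pred (<ᵇ⇒< p)) λ q → h (Fₚ.toℕ-injective (trans q (sym w≡k))))) λ p → <ᵇ-true (ℕₚ.m≤n⇒m≤1+n (<ᵇ⇒< {toℕ v} p))

    L-w : ∀ {t} (form : Fin n → ℕ → Carrier) (f : D t) → L form k w f ≋ f
    L-w form f α rewrite k≮k = ≈-refl

    L-w′ : ∀ {t} (f : D t) → L form (suc k) w f ≋ contract (form w) f
    L-w′ f α rewrite k<k+1 = ≈-refl

    L-same : ∀ {t v} → v ≢ w → (f : D t) → L form (suc k) v f ≋ L form k v f
    L-same {v = v} h f α rewrite same h = ≈-refl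

    κ-suc-in : ∀ {T} → w ∈ vt T → κ (suc k) Z T ≡ suc (κ k Z T)
    κ-suc-in {T} p = #-upd w (trans (cong (λ b → lookup (vt T) w ∧ (not (lookup Z w) ∧ b)) k≮k) (trans (cong (lookup (vt T) w ∧_) (Bₚ.∧-zeroʳ _)) (Bₚ.∧-zeroʳ _)))
      (∧-intro p (∧-intro (cong not w∉Z) k<k+1)) λ y h → cong (λ b → lookup (vt T) y ∧ (not (lookup Z y) ∧ b)) (sym (same h))

    κ-suc-out : ∀ {T} → w ∉ vt T → κ (suc k) Z T ≡ κ k Z T
    κ-suc-out {T} p = #-cong λ y → case y
      where
      case : ∀ y → lookup (vt T) y ∧ (not (lookup Z y) ∧ (toℕ y <ᵇ suc k)) ≡ lookup (vt T) y ∧ (not (lookup Z y) ∧ (toℕ y <ᵇ k))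
      case y with y Fₚ.≟ w
      ... | no h = cong (λ b → lookup (vt T) y ∧ (not (lookup Z y) ∧ b)) (same h)
      ... | yes refl rewrite p = refl

    κ-ins : ∀ T → κ k (ins Z w) T ≡ κ k Z T
    κ-ins T = #-cong λ y → case y
      where
      case : ∀ y → lookup (vt T) y ∧ (not (lookup (ins Z w) y) ∧ (toℕ y <ᵇ k)) ≡ lookup (vt T) y ∧ (not (lookup Z y) ∧ (toℕ y <ᵇ k))
      case y with y Fₚ.≟ w
      ... | no h = cong (λ b → lookup (vt T) y ∧ (not b ∧ (toℕ y <ᵇ k))) (lookup-ins Z h)
      ... | yes refl = cong (lookup (vt T) y ∧_) (trans (trans (cong (not (lookup (ins Z y) y) ∧_) k≮k) (Bₚ.∧-zeroʳ _)) (sym (trans (cong (not (lookup Z y) ∧_) k≮k) (Bₚ.∧-zeroʳ _))))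

    choose : Bool → D (suc s) → D (suc s) → D (suc s)
    choose b f g = if b then f else g

    ρ : Cochain (suc s) → Cochain (suc s)
    ρ c T = choose (lookup (vt T) w) (contract (form w) (c T)) (c T)

    ρ-in : ∀ {c T} → w ∈ vt T → ρ c T ≋ contract (form w) (c T)
    ρ-in p α rewrite p = ≈-refl

    ρ-out : ∀ {c T} → w ∉ vt T → ρ c T ≋ c T
    ρ-out p α rewrite p = ≈-refl

    module Lo = Δ {suc s} form k
    module Hi = Δ {suc s} form (suc k)
    module In = Δ {s} form′ k
    module Cw = Linear (contract-linear {suc s} (form w))
    module Ext = Linear (extend-linear {s})

    -- At the summand `v = w` the facet no longer contains `w`, so `ρ` does nothing there; the
    -- contraction is done by the new differential instead.
    ρ-Δ : ∀ c T → ρ (Lo.Δ Z c) T ≋ Hi.Δ Z (ρ c) T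
    ρ-Δ c T α with ∈-or-∉ w (vt T)
    ... | inj₂ q = ≈-trans (ρ-out {Lo.Δ Z c} q α) (∑-cong λ v → coef-cong {Z} {T} {v} λ v∈ _ →
      ≈-sym (≈-trans (L-same (∈-≢ {S = vt T} v∈ q) (ρ c (del T v)) α) (Linear.resp (L-linear form k v) (ρ-out {c} (∉-del′ {T} {v} q)) α)))
    ... | inj₁ p = ≈-trans (ρ-in {Lo.Δ Z c} p α) (≈-trans (Cw.combination (coef Z T) (λ v → L form k v (c (del T v))) α) (∑-cong λ v → *-congˡ (case v)))
      where
      case : ∀ v → contract (form w) (L form k v (c (del T v))) α ≈ L form (suc k) v (ρ c (del T v)) α
      case v with v Fₚ.≟ w
      ... | yes refl = ≈-trans (Cw.resp (L-w form (c (del T w))) α) (≈-sym (≈-trans (L-w′ (ρ c (del T w)) α) (Cw.resp (ρ-out {c} (∉-del T w)) α)))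
      ... | no h = ≈-sym (≈-trans (L-same h (ρ c (del T v)) α) (≈-trans (Linear.resp (L-linear form k v) (ρ-in {c} (∈-del {T} {v} p (h ∘ sym))) α) (L-contract form k v (form w) (c (del T v)) α)))

    L-extend : ∀ v (a : D s) → L form k v (extend a) ≋ extend (L form′ k v a)
    L-extend v a α with toℕ v <ᵇ k
    ... | true = contract-of-extend (form v) a α
    ... | false = ≈-refl

    ρ-cong : ∀ {c c'} → (∀ T → c T ≋ c' T) → ∀ T → ρ c T ≋ ρ c' T
    ρ-cong {c} {c'} h T α with ∈-or-∉ w (vt T)
    ... | inj₁ p = ≈-trans (ρ-in {c} p α) (≈-trans (Cw.resp (h T) α) (≈-sym (ρ-in {c'} p α)))
    ... | inj₂ p = ≈-trans (ρ-out {c} p α) (≈-trans (h T α) (≈-sym (ρ-out {c'} p α)))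

    ρ-sub : ∀ c c' T α → ρ (λ U β → c U β - c' U β) T α ≈ ρ c T α - ρ c' T α
    ρ-sub c c' T α with ∈-or-∉ w (vt T)
    ... | inj₁ p = ≈-trans (ρ-in {λ U β → c U β - c' U β} p α) (≈-trans (Cw.sub (c T) (c' T) α) (≈-sym (+-cong (ρ-in {c} p α) (-‿cong (ρ-in {c'} p α)))))
    ... | inj₂ p = ≈-trans (ρ-out {λ U β → c U β - c' U β} p α) (≈-sym (+-cong (ρ-out {c} p α) (-‿cong (ρ-out {c'} p α))))

    ρ-graded : ∀ {i c} → Graded e k Z i c → Graded e (suc k) Z i (ρ c)
    ρ-graded {i} {c} g = graded case
      where
      case : ∀ T α → ¬ (Z ⊆ vt T × suc (rank T) ≡ i × κ (suc k) Z T ℕ.+ tot α ≡ e) → ρ c T α ≈ 0#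
      case T α ne with ∈-or-∉ w (vt T)
      ... | inj₂ p = ≈-trans (ρ-out {c} p α) (support g T α λ { (z , r , q) → ne (z , r , trans (cong (ℕ._+ tot α) (κ-suc-out p)) q) })
      ... | inj₁ p = ≈-trans (ρ-in {c} p α) (∑-0 λ t → ≈-trans (*-congˡ (support g T (bump t α) λ { (z , r , q) → ne (z , r , trans (cong (ℕ._+ tot α) (κ-suc-in p)) (trans (sym (trans (cong (κ k Z T ℕ.+_) (tot-bump t α)) (ℕₚ.+-suc (κ k Z T) (tot α)))) q)) })) (zeroʳ _))

    module _ (c : Cochain (suc s)) where
      lift : Cochain (suc s)
      lift T = choose (lookup (vt T) w) (preimage (c T)) (c T)

      lift-in : ∀ {T} → w ∈ vt T → lift T ≋ preimage (c T)
      lift-in p α rewrite p = ≈-refl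

      lift-out : ∀ {T} → w ∉ vt T → lift T ≋ c T
      lift-out p α rewrite p = ≈-refl

      ρ-lift : ∀ T → ρ lift T ≋ c T
      ρ-lift T α with ∈-or-∉ w (vt T)
      ... | inj₁ p = ≈-trans (ρ-in {lift} p α) (≈-trans (Cw.resp (lift-in p) α) (contract-preimage (c T) α))
      ... | inj₂ p = ≈-trans (ρ-out {lift} p α) (lift-out p α)

      -- Zero is homogeneous of every degree, in particular of one that `α` does not have.
      preimage-zero : ∀ {f : D (suc s)} → f ≋ 0D → preimage f ≋ 0D
      preimage-zero h α = preimage-hom {e = suc (tot α)} {k = 0} (λ β _ → h β) α (ℕₚ.<⇒≢ ℕₚ.≤-refl)

      lift-graded : ∀ {i} → Graded e (suc k) Z (suc i) c → Graded e k Z (suc i) lift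
      lift-graded {i} g = graded λ T α ne → case T α ne (∈-or-∉ w (vt T)) (Z ⊆? vt T) (rank T ℕₚ.≟ i)
        where
        case : ∀ T α → ¬ (Z ⊆ vt T × suc (rank T) ≡ suc i × κ k Z T ℕ.+ tot α ≡ e) → w ∈ vt T ⊎ w ∉ vt T → Dec (Z ⊆ vt T) → Dec (rank T ≡ i) → lift T α ≈ 0#
        case T α ne (inj₂ p) _ _ = ≈-trans (lift-out p α) (support g T α λ { (z , r , q) → ne (z , r , trans (cong (ℕ._+ tot α) (sym (κ-suc-out p))) q) })
        case T α ne (inj₁ p) (no z) _ = ≈-trans (lift-in p α) (preimage-zero (λ β → support g T β λ { (z' , _) → z z' }) α)
        case T α ne (inj₁ p) (yes _) (no r) = ≈-trans (lift-in p α) (preimage-zero (λ β → support g T β λ { (_ , r' , _) → r (ℕₚ.suc-injective r') }) α)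
        case T α ne (inj₁ p) (yes z) (yes r) = ≈-trans (lift-in p α) (preimage-hom {e = e} {k = κ k Z T} (λ β q → support g T β λ { (_ , _ , t) → q (trans (cong (ℕ._+ tot β) (sym (κ-suc-in p))) t) }) α λ q → ne (z , cong suc r , q))

    module Kernel (g : Cochain (suc s)) (ρg : ∀ T → ρ g T ≋ 0D) where
      g₀ : Cochain s
      g₀ T α = g T (0 ∷ α)

      g-out : ∀ T → w ∉ vt T → g T ≋ 0D
      g-out T p α = ≈-trans (≈-sym (ρ-out {g} p α)) (ρg T α)

      g-ext : ∀ T → g T ≋ extend (g₀ T)
      g-ext T with ∈-or-∉ w (vt T)
      ... | inj₁ p = extend-unique (g T) λ α → ≈-trans (≈-sym (ρ-in {g} p α)) (ρg T α)
      ... | inj₂ p = λ α → ≈-trans (g-out T p α) (≈-sym (Ext.zer (λ β → g-out T p (0 ∷ β)) α))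

      g₀-graded : ∀ {i} → Graded e k Z i g → Graded e k (ins Z w) i g₀
      g₀-graded {i} gg = graded λ T α ne → case T α ne (∈-or-∉ w (vt T))
        where
        case : ∀ T α → ¬ (ins Z w ⊆ vt T × suc (rank T) ≡ i × κ k (ins Z w) T ℕ.+ tot α ≡ e) → w ∈ vt T ⊎ w ∉ vt T → g T (0 ∷ α) ≈ 0#
        case T α ne (inj₂ p) = g-out T p (0 ∷ α)
        case T α ne (inj₁ p) = support gg T (0 ∷ α) λ { (z , r , q) → ne (ins-⊆ z p , r , trans (cong (ℕ._+ tot α) (κ-ins T)) q) }

    module _ (a : Cochain s) (out : ∀ T → w ∉ vt T → a T ≋ 0D) where
      ρ-extend : ∀ T → ρ (λ U → extend (a U)) T ≋ 0D
      ρ-extend T α with ∈-or-∉ w (vt T)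
      ... | inj₁ p = ≈-trans (ρ-in {λ U → extend (a U)} p α) (contract-extend (a T) α)
      ... | inj₂ p = ≈-trans (ρ-out {λ U → extend (a U)} p α) (Ext.zer (out T p) α)

      extend-graded : ∀ {i} → Graded e k (ins Z w) (suc i) a → Graded e k Z (suc i) (λ U → extend (a U))
      extend-graded {i} g = graded λ T α ne → case T α ne (Z ⊆? vt T) (rank T ℕₚ.≟ i)
        where
        case : ∀ T α → ¬ (Z ⊆ vt T × suc (rank T) ≡ suc i × κ k Z T ℕ.+ tot α ≡ e) → Dec (Z ⊆ vt T) → Dec (rank T ≡ i) → extend (a T) α ≈ 0#
        case T α ne (no z) _ = Ext.zer (λ β → support g T β λ { (z' , _) → z (⊆-trans (⊆-ins Z w) z') }) α
        case T α ne (yes _) (no r) = Ext.zer (λ β → support g T β λ { (_ , r' , _) → r (ℕₚ.suc-injective r') }) α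
        case T α ne (yes z) (yes r) = extend-hom {e = e} {k = κ k Z T} (λ β q → support g T β λ { (_ , _ , t) → q (trans (cong (ℕ._+ tot β) (sym (κ-ins T))) t) }) α λ q → ne (z , cong suc r , q)

      Δ-extend : ∀ T → Lo.Δ Z (λ U → extend (a U)) T ≋ extend (In.Δ (ins Z w) a T)
      Δ-extend T α = ≈-trans (∑-cong λ v → term v) (≈-sym (Ext.combination (coef (ins Z w) T) (λ v → L form′ k v (a (del T v))) α))
        where
        term : ∀ v → coef Z T v * L form k v (extend (a (del T v))) α ≈ coef (ins Z w) T v * extend (L form′ k v (a (del T v))) α
        term v with v Fₚ.≟ w
        ... | yes refl = ≈-trans (≈-trans (*-congˡ (≈-trans (L-extend v (a (del T v)) α) (Ext.zer (Linear.zer (L-linear form′ k v) (out (del T v) (∉-del T v))) α))) (zeroʳ _))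
          (≈-sym (coef-0 {ins Z v} {T} {v} λ _ p → absurd (true≢false (∈-ins Z v) p)))
        ... | no h = *-cong (▹-≡ (cong (λ b → lookup (vt T) v ∧ not b) (sym (lookup-ins Z h)))) (L-extend v (a (del T v)) α)

    module _ (c : Cochain (suc s)) (gc : Graded e (suc k) Z (suc j) c) (Δc : ∀ T → Hi.Δ Z c T ≋ 0D) where
      private
        -- The obstruction to `lift c` being a cocycle. As `c` is one, `ρ` kills it.
        g : Cochain (suc s)
        g = Lo.Δ Z (lift c)

        ρg : ∀ T → ρ g T ≋ 0D
        ρg T α = ≈-trans (ρ-Δ (lift c) T α) (≈-trans (Hi.Δ-cong Z (ρ-lift c) T α) (Δc T α))

        open Kernel g ρg

        Δg₀ : ∀ T → In.Δ (ins Z w) g₀ T ≋ 0D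
        Δg₀ T α = ≈-trans (≈-sym (Δ-extend g₀ (λ U p β → g-out U p (0 ∷ β)) T (0 ∷ α)))
          (≈-trans (Lo.Δ-cong Z {λ U → extend (g₀ U)} {g} (λ U β → ≈-sym (g-ext U β)) T (0 ∷ α)) (Lo.Δ-Δ (L-comm form k) Z (lift c) T (0 ∷ α)))

      filling : ∃ λ b → Graded e k (ins Z w) (suc j) b × (∀ T → In.Δ (ins Z w) b T ≋ g₀ T)
      filling = inner g₀ (g₀-graded (Δ-graded {form = form} (lift-graded c gc))) Δg₀

      -- Subtracting the filling of the obstruction turns the lift of `c` into a cocycle of the old
      -- complex, where it has a primitive.
      correct : (f : ∃ λ b → Graded e k (ins Z w) (suc j) b × (∀ T → In.Δ (ins Z w) b T ≋ g₀ T)) →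
                ∃ λ b → Graded e k Z j b × (∀ T α → Lo.Δ Z b T α ≈ lift c T α - extend (proj₁ f T) α)
      correct (a , ga , Δa) = outer (λ T α → lift c T α - extend (a T) α)
        (graded λ T α ne → ≈-trans (+-cong (support (lift-graded c gc) T α ne) (-‿cong (support (extend-graded a out ga) T α ne))) (-‿inverseʳ 0#))
        λ T α → ≈-trans (Lo.Δ-sub Z (lift c) (λ U → extend (a U)) T α) (x≈y⇒x-y≈0 (≈-sym (≈-trans (Δ-extend a out T α) (≈-trans (Ext.resp (Δa T) α) (≈-sym (g-ext T α))))))
        where
        out : ∀ T → w ∉ vt T → a T ≋ 0D
        out T p α = support ga T α λ { (z , _) → true≢false (into z (∈-ins Z w)) p }

      push : (f : ∃ λ b → Graded e k (ins Z w) (suc j) b × (∀ T → In.Δ (ins Z w) b T ≋ g₀ T)) →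
             (∃ λ b → Graded e k Z j b × (∀ T α → Lo.Δ Z b T α ≈ lift c T α - extend (proj₁ f T) α)) →
             ∃ λ b → Graded e (suc k) Z j b × (∀ T → Hi.Δ Z b T ≋ c T)
      push (a , ga , _) (b , gb , Δb) = ρ b , ρ-graded gb , λ T α → ≈-trans (≈-sym (ρ-Δ b T α)) (≈-trans (ρ-cong {Lo.Δ Z b} {λ U β → lift c U β - extend (a U) β} Δb T α)
          (≈-trans (ρ-sub (lift c) (λ U → extend (a U)) T α) (≈-trans (+-cong (ρ-lift c T α) (≈-trans (-‿cong (ρ-extend a out T α)) -0#≈0#)) (+-identityʳ _))))
        where
        out : ∀ T → w ∉ vt T → a T ≋ 0D
        out T p α = support ga T α λ { (z , _) → true≢false (into z (∈-ins Z w)) p }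

    step : Acyclic e (suc s) (suc k) Z form j
    step c gc Δc = push c gc Δc (filling c gc Δc) (correct c gc Δc (filling c gc Δc))

module WeightedAcyclic {c ℓ} (R : CommutativeRing c ℓ) (P : SimplicialPoset) (dim : ℕ) where
  open Cells R P
  open Coefficients R
  open Weighted R P

  offR : Subset n → Fin n → Carrier
  offR Z v = not (lookup Z v) ▹ 1#

  PlainExact : Set (c ⊔ ℓ)
  PlainExact = ∀ Z j → j < dim → ∀ (c : Fin n → Carrier) → (∀ T → ¬ (Z ⊆ vt T × rank T ≡ j) → c T ≈ 0#) → (∀ T → δ (offR Z) c T ≈ 0#) →
    ∃ λ (b : Fin n → Carrier) → (∀ H → ¬ (Z ⊆ vt H × suc (rank H) ≡ j) → b H ≈ 0#) × (∀ T → δ (offR Z) b T ≈ c T)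

  module _ (rank≤ : ∀ T → rank T ≤ dim) (plain : PlainExact) where

    -- Without variables only faces with `κ = e` carry anything, but `κ` is at most `dim - ∣ Z ∣`,
    -- which is less than `e`.
    no-variables : ∀ {e k Z form j} → dim < e ℕ.+ ∣ Z ∣ → Acyclic e 0 k Z form j
    no-variables {e} {k} {Z} {form} big c g Δc = (λ _ _ → 0#) , graded (λ _ _ _ → ≈-refl) , λ T α →
        ≈-trans (∑-0 λ v → ≈-trans (*-congˡ (Linear.zer (L-linear form k v) (λ _ → ≈-refl) α)) (zeroʳ _)) (≈-sym (zero′ T α))
      where
      zero′ : ∀ T α → c T α ≈ 0#
      zero′ T [] = support g T [] λ { (z , _ , q) → ℕₚ.<⇒≱ big (ℕₚ.≤-trans (ℕₚ.≤-reflexive (cong (ℕ._+ ∣ Z ∣) (sym (trans (sym (ℕₚ.+-identityʳ _)) q)))) (ℕₚ.≤-trans (κ-bound {k} z) (rank≤ T))) }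

    κ-0 : ∀ Z T → κ 0 Z T ≡ 0
    κ-0 Z T = #-none λ v → trans (cong (lookup (vt T) v ∧_) (Bₚ.∧-zeroʳ (not (lookup Z v)))) (Bₚ.∧-zeroʳ _)

    Δ-plain : ∀ {s} form Z (c : Cochain s) T α → Δ.Δ form 0 Z c T α ≈ δ (offR Z) (λ U → c U α) T
    Δ-plain form Z c T α = ∑-cong λ v → term (lookup (vt T) v) (not (lookup Z v)) (σ v (rem (vt T) v)) (c (del T v) α)
      where
      term : ∀ a b s x → (a ∧ b ▹ s) * x ≈ (a ▹ s * ((b ▹ 1#) * x))
      term true true s x = *-congˡ (≈-sym (*-identityˡ x))
      term true false s x = ≈-trans (zeroˡ x) (≈-sym (≈-trans (*-congˡ (zeroˡ x)) (zeroʳ s)))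
      term false b s x = zeroˡ x

    -- With nothing contracting the complex is a sum of copies of the plain one, one for each
    -- monomial of degree `e`.
    no-contraction : ∀ {e s Z form j} → j < dim → Acyclic e s 0 Z form j
    no-contraction {e} {s} {Z} {form} {j} lt c g Δc = (λ T α → proj₁ (fill α) T) , graded (λ T α ne → proj₁ (proj₂ (fill α)) T ne) ,
        λ T α → ≈-trans (Δ-plain form Z (λ T α → proj₁ (fill α) T) T α) (proj₂ (proj₂ (fill α)) T)
      where
      fill : ∀ α → ∃ λ (b : Fin n → Carrier) → (∀ T → ¬ (Z ⊆ vt T × suc (rank T) ≡ j × κ 0 Z T ℕ.+ tot α ≡ e) → b T ≈ 0#) × (∀ T → δ (offR Z) b T ≈ c T α)
      fill α with tot α ℕₚ.≟ e
      ... | yes q = let (b , sb , δb) = plain Z j lt (λ T → c T α) (λ T k → support g T α λ { (z , r , _) → k (z , ℕₚ.suc-injective r) }) (λ T → ≈-trans (≈-sym (Δ-plain form Z c T α)) (Δc T α))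
                    in b , (λ T k → sb T λ { (z , r) → k (z , r , trans (cong (ℕ._+ tot α) (κ-0 Z T)) q) }) , δb
      ... | no q = (λ _ → 0#) , (λ _ _ → ≈-refl) , λ T → ≈-trans (∑-0 λ v → ▹-0 (lookup (vt T) v) λ _ → ≈-trans (*-congˡ (zeroʳ _)) (zeroʳ _))
                      (≈-sym (support g T α λ { (_ , _ , r) → q (trans (cong (ℕ._+ tot α) (sym (κ-0 Z T))) r) }))

    -- A vertex of `Z` is never deleted, so whether it contracts makes no difference.
    skip : ∀ {e s k Z form j} (w : Fin n) → toℕ w ≡ k → w ∈ Z → Acyclic e s k Z form j → Acyclic e s (suc k) Z form j
    skip {e} {s} {k} {Z} {form} {j} w w≡k w∈ ac c g Δc = restate (ac c (graded λ T α ne → support g T α λ { (z , r , q) → ne (z , r , trans (cong (ℕ._+ tot α) (sym (κ≡ T))) q) })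
        (λ T α → ≈-trans (Δ≈ c T α) (Δc T α)))
      where
      same : ∀ {v} → v ∉ Z → (toℕ v <ᵇ suc k) ≡ (toℕ v <ᵇ k)
      same {v} h = bool-ext (λ p → <ᵇ-true (ℕₚ.≤∧≢⇒< (ℕₚ.≤-pred (<ᵇ⇒< p)) λ q → ∈-≢ {S = Z} w∈ h (Fₚ.toℕ-injective (trans w≡k (sym q))))) λ p → <ᵇ-true (ℕₚ.m≤n⇒m≤1+n (<ᵇ⇒< {toℕ v} p))
      κ≡ : ∀ T → κ (suc k) Z T ≡ κ k Z T
      κ≡ T = #-cong λ y → cong (lookup (vt T) y ∧_) (case y (∈-or-∉ y Z))
        where
        case : ∀ y → y ∈ Z ⊎ y ∉ Z → not (lookup Z y) ∧ (toℕ y <ᵇ suc k) ≡ not (lookup Z y) ∧ (toℕ y <ᵇ k)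
        case y (inj₁ p) rewrite p = refl
        case y (inj₂ p) = cong (not (lookup Z y) ∧_) (same p)
      Δ≈ : ∀ (c : Cochain s) T α → Δ.Δ form k Z c T α ≈ Δ.Δ form (suc k) Z c T α
      Δ≈ c T α = ∑-cong λ v → coef-cong {Z} {T} {v} λ _ v∉ → ≈-reflexive (cong (λ b → (if b then contract (form v) (c (del T v)) else c (del T v)) α) (sym (same v∉)))
      restate : (∃ λ b → Graded e k Z j b × (∀ T → Δ.Δ form k Z b T ≋ c T)) → ∃ λ b → Graded e (suc k) Z j b × (∀ T → Δ.Δ form (suc k) Z b T ≋ c T)
      restate (b , gb , Δb) = b , graded (λ T α ne → support gb T α λ { (z , r , q) → ne (z , r , trans (cong (ℕ._+ tot α) (κ≡ T)) q) }) , λ T α → ≈-trans (≈-sym (Δ≈ b T α)) (Δb T α)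

    -- Both inequalities survive the passage to the kernel, where `s` drops by one while `j` and the
    -- size of `Z` grow by one.
    acyclic : ∀ s k {e Z form j} → k ≤ n → Generic s form Z → j ℕ.+ s ≤ dim → dim < e ℕ.+ s ℕ.+ ∣ Z ∣ → Acyclic e s k Z form j
    acyclic zero k {e} {Z} {form} {j} _ _ _ big = no-variables {e} {k} {Z} {form} {j} (subst (λ t → dim < t ℕ.+ ∣ Z ∣) (ℕₚ.+-identityʳ e) big)
    acyclic (suc s) zero {e} {Z} {form} {j} _ _ small _ = no-contraction {e} {suc s} {Z} {form} {j} (ℕₚ.≤-trans (s≤s (ℕₚ.m≤m+n j s)) (ℕₚ.≤-trans (ℕₚ.≤-reflexive (sym (ℕₚ.+-suc j s))) small))
    acyclic (suc s) (suc k) {e} {Z} {form} {j} k<n gen small big = case (∈-or-∉ w Z)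
      where
      w : Fin n
      w = fromℕ< k<n
      w≡k : toℕ w ≡ k
      w≡k = Fₚ.toℕ-fromℕ< k<n
      case : w ∈ Z ⊎ w ∉ Z → Acyclic e (suc s) (suc k) Z form j
      case (inj₁ p) = skip {e} {suc s} {k} {Z} {form} {j} w w≡k p (acyclic (suc s) k {e} {Z} {form} {j} (ℕₚ.<⇒≤ k<n) gen small big)
      case (inj₂ p) = Step.step {e} {s} {k} {j} {Z} form w w≡k p (proj₁ (gen w p)) (proj₁ (proj₂ (gen w p)))
        (acyclic s k (ℕₚ.<⇒≤ k<n) (proj₂ (proj₂ (gen w p))) (ℕₚ.≤-trans (ℕₚ.≤-reflexive (sym (ℕₚ.+-suc j s))) small)
          (ℕₚ.≤-trans big (ℕₚ.≤-reflexive (trans (cong (ℕ._+ ∣ Z ∣) (ℕₚ.+-suc e s)) (trans (sym (ℕₚ.+-suc (e ℕ.+ s) ∣ Z ∣)) (cong (e ℕ.+ s ℕ.+_) (sym (∣ins∣ Z p))))))))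
        (acyclic (suc s) k {e} {Z} {form} {j} (ℕₚ.<⇒≤ k<n) gen small big)

-- A complex with vanishing Euler characteristic that is exact below its top degree is exact

enumerate : (p : Fin N → Bool) → ∃ λ (g : Fin (# p) → Fin N) → ∀ x → p x ≡ true → ∃ λ i → g i ≡ x
enumerate {N = zero} p = (λ ()) , λ ()
enumerate {N = suc N} p with p zero in e | enumerate (p ∘ suc)
... | false | g , h = (λ i → suc (g i)) , λ { zero q → absurd (true≢false q e) ; (suc x) q → proj₁ (h x q) , cong suc (proj₂ (h x q)) }
... | true | g , h = (λ { zero → zero ; (suc i) → suc (g i) }) , λ { zero q → zero , refl ; (suc x) q → suc (proj₁ (h x q)) , cong suc (proj₂ (h x q)) }

witness : (p : Fin N → Bool) → 0 < # p → ∃ λ x → p x ≡ true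
witness p h with Fₚ.any? (λ x → p x Bₚ.≟ true)
... | yes w = w
... | no none = absurd (ℕₚ.<⇒≢ h (sym (#-none λ x → case x (p x) refl)))
  where
  case : ∀ x b → p x ≡ b → b ≡ false
  case x true e = absurd (none (x , e))
  case x false e = refl

-- What is used of `ℚ` besides decidable equality; the later modules are stated for any field having
-- these properties.
module _ {c ℓ} (F : Field c ℓ) where
  open RingTools (Field.commutativeRing F)

  Anisotropic : Set (c ⊔ ℓ)
  Anisotropic = ∀ {m} (f : Fin m → Carrier) → ∑ (λ i → f i * f i) ≈ 0# → ∀ i → f i ≈ 0#

  CharacteristicZero : Set ℓ
  CharacteristicZero = ∀ {z} → ι z ≈ 0# → z ≡ + 0

  CommonDenominators : Set (c ⊔ ℓ)
  CommonDenominators = ∀ {k} (x : Fin k → Carrier) → ∃ λ s → ∃ λ (z : Fin k → ℤ) → s ≢ + 0 × (∀ i → ι s * x i ≈ ι (z i))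

module Hodge {c ℓ} (F : Field c ℓ) (_≟0 : ∀ x → Dec (Field._≈_ F x (Field.0# F)))
             (anisotropic : Anisotropic F) where
  open RingTools (Field.commutativeRing F)

  cancel : ∀ {u x} → ¬ u ≈ 0# → u * x ≈ 0# → x ≈ 0#
  cancel = Elimination.cancelˡ F {0} {0}

  -- Each equation is solved for an unknown in `U`, which then leaves `U`; the surplus of unknowns
  -- survives.
  underdetermined : ∀ {m} l (row : Fin l → Fin m → Carrier) (U : Fin m → Bool) → l < # U →
    ∃ λ (y : Fin m → Carrier) → (∀ x → U x ≡ false → y x ≈ 0#) × (∃ λ x → ¬ y x ≈ 0#) × (∀ i → ∑ (λ x → row i x * y x) ≈ 0#)
  underdetermined zero row U lt with witness U lt
  ... | u , u∈ = (λ x → does (x Fₚ.≟ u) ▹ 1#) , (λ x e → ▹-false (dec-false (x Fₚ.≟ u) λ { refl → true≢false u∈ e })) ,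
        (u , λ e → Field.0≉1 F (≈-sym (≈-trans (≈-sym (▹-true (dec-true (u Fₚ.≟ u) refl))) e))) , λ ()
  underdetermined {m} (suc l) row U lt with Fₚ.any? (λ u → (U u Bₚ.≟ true) ×-dec ¬? (row zero u ≟0))
  ... | no none = restate (underdetermined l (row ∘ suc) U (ℕₚ.<-trans (ℕₚ.n<1+n l) lt))
    where
    restate : (∃ λ (y : Fin m → Carrier) → (∀ x → U x ≡ false → y x ≈ 0#) × (∃ λ x → ¬ y x ≈ 0#) × (∀ i → ∑ (λ x → row (suc i) x * y x) ≈ 0#)) → _
    restate (y , sy , nz , k) = y , sy , nz , λ { zero → ∑-0 term ; (suc i) → k i }
      where
      term : ∀ x → row zero x * y x ≈ 0#
      term x with U x in e | row zero x ≟0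
      ... | false | _ = ≈-trans (*-congˡ (sy x e)) (zeroʳ _)
      ... | true | yes z = ≈-trans (*-congʳ z) (zeroˡ _)
      ... | true | no z = absurd (none (x , e , z))
  ... | yes (u , u∈ , r≢0) = restate (underdetermined l row' U' (ℕₚ.≤-pred (ℕₚ.≤-trans lt (ℕₚ.≤-reflexive (#-upd u U'u u∈ U'x)))))
    where
    U' : Fin m → Bool
    U' x = not (does (x Fₚ.≟ u)) ∧ U x
    U'u : U' u ≡ false
    U'u rewrite dec-true (u Fₚ.≟ u) refl = refl
    U'x : ∀ x → x ≢ u → U' x ≡ U x
    U'x x k rewrite dec-false (x Fₚ.≟ u) k = refl
    r : Carrier
    r = row zero u
    r⁻¹ = proj₁ (Field.inverse F r r≢0)
    rr : r * r⁻¹ ≈ 1#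
    rr = proj₂ (Field.inverse F r r≢0)
    row' : Fin l → Fin m → Carrier
    row' i x = row (suc i) x - (row (suc i) u * r⁻¹) * row zero x
    restate : (∃ λ (y : Fin m → Carrier) → (∀ x → U' x ≡ false → y x ≈ 0#) × (∃ λ x → ¬ y x ≈ 0#) × (∀ i → ∑ (λ x → row' i x * y x) ≈ 0#)) → _
    restate (y , sy , (x₁ , nz) , k) = ŷ , sŷ , (x₁ , nz') , λ { zero → first ; (suc i) → rest i }
      where
      Y : Carrier
      Y = ∑ (λ x → row zero x * y x)
      t : Carrier
      t = - (r⁻¹ * Y)
      ŷ : Fin m → Carrier
      ŷ x = y x + (does (x Fₚ.≟ u) ▹ t)
      sŷ : ∀ x → U x ≡ false → ŷ x ≈ 0#
      sŷ x e = ≈-trans (+-cong (sy x (trans (U'x x x≢u) e)) (▹-false (dec-false (x Fₚ.≟ u) x≢u))) (+-identityˡ 0#)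
        where
        x≢u : x ≢ u
        x≢u refl = true≢false u∈ e
      nz' : ¬ ŷ x₁ ≈ 0#
      nz' e with x₁ Fₚ.≟ u
      ... | yes refl = nz (sy u U'u)
      ... | no _ = nz (≈-trans (≈-sym (+-identityʳ _)) e)
      dot : ∀ (f : Fin m → Carrier) → ∑ (λ x → f x * ŷ x) ≈ ∑ (λ x → f x * y x) + f u * t
      dot f = ≈-trans (∑-cong λ x → distribˡ _ _ _) (≈-trans (∑-+ _ _) (+-congˡ (≈-trans (∑-single u λ x k → ≈-trans (*-congˡ (▹-false (dec-false (x Fₚ.≟ u) k))) (zeroʳ _)) (*-congˡ (▹-true (dec-true (u Fₚ.≟ u) refl))))))
      first : ∑ (λ x → row zero x * ŷ x) ≈ 0#
      first = ≈-trans (dot (row zero)) (≈-trans (solve 3 (λ Y r s → Y :+ r :* (:- (s :* Y)) := Y :* (con (+ 1) :- r :* s)) ≈-refl Y r r⁻¹) (≈-trans (*-congˡ (≈-trans (+-cong ι-1 (-‿cong rr)) (-‿inverseʳ 1#))) (zeroʳ Y)))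
      rest : ∀ i → ∑ (λ x → row (suc i) x * ŷ x) ≈ 0#
      rest i = ≈-trans (dot (row (suc i))) (≈-trans (≈-sym expand) (k i))
        where
        expand : ∑ (λ x → row' i x * y x) ≈ ∑ (λ x → row (suc i) x * y x) + row (suc i) u * t
        expand = ≈-trans (∑-cong λ x → solve 4 (λ a b z y → (a :- b :* z) :* y := a :* y :+ (:- b) :* (z :* y)) ≈-refl (row (suc i) x) (row (suc i) u * r⁻¹) (row zero x) (y x)) (≈-trans (∑-+ _ _) (+-congˡ (≈-trans (≈-sym (∑-*ˡ _ _)) (solve 3 (λ b s Y → (:- (b :* s)) :* Y := b :* (:- (s :* Y))) ≈-refl (row (suc i) u) r⁻¹ Y))))

  -- Suppose `a x₀` is nonzero. Ask of `y`, supported where `par` is false, that `(M + Mᵀ) y` vanish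
  -- at every `x` with `par x` true except `x₀`. By `balance` there is one equation fewer than there
  -- are unknowns, so a nonzero `y` exists. The omitted equation follows from `a`; hence `y` is
  -- harmonic, and exactness below the top makes it zero.
  module Complex {m} (deg : Fin m → ℕ) (e : ℕ) (M : Fin m → Fin m → Carrier)
    (shift : ∀ x' x → deg x' ≢ suc (deg x) → M x' x ≈ 0#)
    (square : ∀ x″ x → ∑ (λ x' → M x″ x' * M x' x) ≈ 0#)
    (deg≤ : ∀ x → deg x ≤ e)
    (exact : ∀ j → j < e → ∀ (y : Fin m → Carrier) → (∀ x → deg x ≢ j → y x ≈ 0#) → (∀ x' → ∑ (λ x → M x' x * y x) ≈ 0#) → ∃ λ (b : Fin m → Carrier) → ∀ x' → y x' ≈ ∑ (λ x → M x' x * b x))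
    (par : Fin m → Bool) (par-shift : ∀ x' x → deg x' ≡ suc (deg x) → par x' ≡ not (par x)) (par-top : ∀ x → deg x ≡ e → par x ≡ true)
    (balance : # par ≡ # (λ x → not (par x)))
    (a : Fin m → Carrier) (a-top : ∀ x → deg x ≢ e → a x ≈ 0#) (a-kernel : ∀ x → ∑ (λ x' → a x' * M x' x) ≈ 0#) where

    private
      swap : ∀ (f : Fin m → Carrier) (g : Fin m → Carrier) → ∑ (λ x → f x * ∑ (λ o → M o x * g o)) ≈ ∑ (λ o → g o * ∑ (λ x → M o x * f x))
      swap f g = ≈-trans (∑-cong λ x → ∑-*ˡ _ _) (≈-trans (∑-swap _) (∑-cong λ o → ≈-trans (∑-cong λ x → solve 3 (λ f m g → f :* (m :* g) := g :* (m :* f)) ≈-refl _ _ _) (≈-sym (∑-*ˡ _ _))))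

      swap′ : ∀ (f : Fin m → Carrier) (g : Fin m → Carrier) → ∑ (λ x → f x * ∑ (λ o → M x o * g o)) ≈ ∑ (λ o → g o * ∑ (λ x → M x o * f x))
      swap′ f g = ≈-trans (∑-cong λ x → ∑-*ˡ _ _) (≈-trans (∑-swap _) (∑-cong λ o → ≈-trans (∑-cong λ x → solve 3 (λ f m g → f :* (m :* g) := g :* (m :* f)) ≈-refl _ _ _) (≈-sym (∑-*ˡ _ _))))

    module _ (x₀ : Fin m) (a≢0 : ¬ a x₀ ≈ 0#) (y : Fin m → Carrier) (y-odd : ∀ x → par x ≡ true → y x ≈ 0#)
             (rows : ∀ x → par x ≡ true → x ≢ x₀ → ∑ (λ o → (M x o + M o x) * y o) ≈ 0#) where
      z z' : Fin m → Carrier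
      z x = ∑ (λ o → M x o * y o)
      z' x = ∑ (λ o → M o x * y o)

      split : ∀ x → ∑ (λ o → (M x o + M o x) * y o) ≈ z x + z' x
      split x = ≈-trans (∑-cong λ o → distribʳ _ _ _) (∑-+ _ _)

      M-y : ∀ {x o} → par x ≡ false → (deg x ≡ suc (deg o) ⊎ deg o ≡ suc (deg x)) → y o ≈ 0#
      M-y {x} {o} e (inj₁ d) = y-odd o (trans (sym (Bₚ.not-involutive (par o))) (cong not (trans (sym (par-shift x o d)) e)))
      M-y {x} {o} e (inj₂ d) = y-odd o (trans (par-shift o x d) (cong not e))

      even-0 : ∀ x → par x ≡ false → z x + z' x ≈ 0#
      even-0 x e = ≈-trans (+-cong (∑-0 one) (∑-0 two)) (+-identityˡ 0#)
        where
        one : ∀ o → M x o * y o ≈ 0#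
        one o with deg x ℕₚ.≟ suc (deg o)
        ... | yes d = ≈-trans (*-congˡ (M-y e (inj₁ d))) (zeroʳ _)
        ... | no d = ≈-trans (*-congʳ (shift x o d)) (zeroˡ _)
        two : ∀ o → M o x * y o ≈ 0#
        two o with deg o ℕₚ.≟ suc (deg x)
        ... | yes d = ≈-trans (*-congˡ (M-y e (inj₂ d))) (zeroʳ _)
        ... | no d = ≈-trans (*-congʳ (shift o x d)) (zeroˡ _)

      others : ∀ x → x ≢ x₀ → z x + z' x ≈ 0#
      others x k with par x in e
      ... | true = ≈-trans (≈-sym (split x)) (rows x e k)
      ... | false = even-0 x e

      -- Pair everything with `a`: it kills the image of `M` by hypothesis, and that of the
      -- transpose because `a` lives in the top degree.
      at-x₀ : z x₀ + z' x₀ ≈ 0#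
      at-x₀ = cancel a≢0 (≈-trans (≈-sym (∑-single x₀ λ x k → ≈-trans (*-congˡ (others x k)) (zeroʳ _)))
        (≈-trans (∑-cong λ x → distribˡ _ _ _) (≈-trans (∑-+ _ _) (≈-trans (+-cong
          (≈-trans (swap′ a y) (∑-0 λ o → ≈-trans (*-congˡ (≈-trans (∑-cong λ x → *-comm _ _) (a-kernel o))) (zeroʳ _)))
          (≈-trans (swap a y) (∑-0 λ o → ≈-trans (*-congˡ (∑-0 (top o))) (zeroʳ _)))) (+-identityˡ 0#)))))
        where
        top : ∀ o x → M o x * a x ≈ 0#
        top o x with deg x ℕₚ.≟ e
        ... | no d = ≈-trans (*-congˡ (a-top x d)) (zeroʳ _)
        ... | yes d = ≈-trans (*-congʳ (shift o x λ q → ℕₚ.1+n≰n (ℕₚ.≤-trans (ℕₚ.≤-reflexive (trans (cong suc (sym d)) (sym q))) (deg≤ o)))) (zeroˡ _)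

      harmonic : ∀ x → z x + z' x ≈ 0#
      harmonic x with x Fₚ.≟ x₀
      ... | yes refl = at-x₀
      ... | no k = others x k

      -- Since `z = - z'`, the square of `z` is minus its pairing with `z'`, which equals the
      -- pairing of `M z = M M y = 0` with `y`.
      z-0 : ∀ x → z x ≈ 0#
      z-0 = anisotropic z (begin
        ∑ (λ x → z x * z x)      ≈⟨ (∑-cong λ x → *-congˡ (≈-trans (≈-sym (+-identityʳ _)) (≈-trans (+-congˡ (≈-sym (-‿inverseʳ (z' x)))) (≈-trans (≈-sym (+-assoc _ _ _)) (≈-trans (+-congʳ (harmonic x)) (+-identityˡ _)))))) ⟩
        ∑ (λ x → z x * - z' x)   ≈⟨ ≈-trans (∑-cong λ x → ≈-sym (-‿distribʳ-* _ _)) (∑-neg _) ⟩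
        - ∑ (λ x → z x * z' x)   ≈⟨ -‿cong (≈-trans (swap z y) (∑-0 λ o → ≈-trans (*-congˡ (zz o)) (zeroʳ _))) ⟩
        - 0#                     ≈⟨ -0#≈0# ⟩
        0# ∎)
        where
        zz : ∀ o → ∑ (λ x → M o x * z x) ≈ 0#
        zz o = ≈-trans (∑-cong λ x → ∑-*ˡ _ _) (≈-trans (∑-swap _) (∑-0 λ u → ≈-trans (∑-cong λ x → ≈-sym (*-assoc _ _ _)) (≈-trans (≈-sym (∑-*ʳ (y u) _)) (≈-trans (*-congʳ (square o u)) (zeroˡ _)))))

      z'-0 : ∀ x → z' x ≈ 0#
      z'-0 x = ≈-trans (≈-sym (+-identityˡ _)) (≈-trans (+-congʳ (≈-sym (z-0 x))) (harmonic x))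

      -- The component of degree `j` is a cocycle, hence of the form `M b`, and it is killed by the
      -- transpose of `M`; so it is orthogonal to itself.
      component : ∀ j → j < e → ∀ x → deg x ≡ j → y x ≈ 0#
      component j j<e x d = ≈-trans (≈-sym (▹-true (≡ᵇ-true d))) (anisotropic yj (≈-trans (∑-cong λ x' → *-congˡ (proj₂ ex x')) (≈-trans (swap′ yj (proj₁ ex)) (∑-0 λ o → ≈-trans (*-congˡ (z'j o)) (zeroʳ _)))) x)
        where
        yj : Fin m → Carrier
        yj x = (deg x ≡ᵇ j) ▹ y x
        off : ∀ x → deg x ≢ j → yj x ≈ 0#
        off x k = ▹-0 (deg x ≡ᵇ j) λ q → absurd (k (≡ᵇ⇒≡ q))
        zj : ∀ x' → ∑ (λ x → M x' x * yj x) ≈ 0#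
        zj x' with deg x' ℕₚ.≟ suc j
        ... | no k = ∑-0 λ x → case x
          where
          case : ∀ x → M x' x * yj x ≈ 0#
          case x with deg x ℕₚ.≟ j
          ... | yes q = ≈-trans (*-congʳ (shift x' x λ q' → k (trans q' (cong suc q)))) (zeroˡ _)
          ... | no q = ≈-trans (*-congˡ (off x q)) (zeroʳ _)
        ... | yes d' = ≈-trans (∑-cong case) (z-0 x')
          where
          case : ∀ x → M x' x * yj x ≈ M x' x * y x
          case x with deg x ℕₚ.≟ j
          ... | yes q = *-congˡ (▹-true (≡ᵇ-true q))
          ... | no q = ≈-trans (≈-trans (*-congʳ vanish) (zeroˡ _)) (≈-sym (≈-trans (*-congʳ vanish) (zeroˡ _)))
            where
            vanish : M x' x ≈ 0#
            vanish = shift x' x λ q' → q (ℕₚ.suc-injective (trans (sym q') d'))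
        z'j : ∀ o → ∑ (λ x → M x o * yj x) ≈ 0#
        z'j o with suc (deg o) ℕₚ.≟ j
        ... | no k = ∑-0 λ x → case x
          where
          case : ∀ x → M x o * yj x ≈ 0#
          case x with deg x ℕₚ.≟ j
          ... | yes q = ≈-trans (*-congʳ (shift x o λ q' → k (trans (sym q') q))) (zeroˡ _)
          ... | no q = ≈-trans (*-congˡ (off x q)) (zeroʳ _)
        ... | yes d' = ≈-trans (∑-cong case) (z'-0 o)
          where
          case : ∀ x → M x o * yj x ≈ M x o * y x
          case x with deg x ℕₚ.≟ j
          ... | yes q = *-congˡ (▹-true (≡ᵇ-true q))
          ... | no q = ≈-trans (≈-trans (*-congʳ vanish) (zeroˡ _)) (≈-sym (≈-trans (*-congʳ vanish) (zeroˡ _)))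
            where
            vanish : M x o ≈ 0#
            vanish = shift x o λ q' → q (trans q' d')
        ex = exact j j<e yj off zj

      all-0 : ∀ x → y x ≈ 0#
      all-0 x with deg x ℕₚ.≟ e
      ... | yes d = y-odd x (par-top x d)
      ... | no d = component (deg x) (ℕₚ.≤∧≢⇒< (deg≤ x) d) x refl

    top-injective : ∀ x → a x ≈ 0#
    top-injective x₀ with a x₀ ≟0
    ... | yes e = e
    ... | no a≢0 = contradiction′ (underdetermined (# V) (λ i o → M (g i) o + M o (g i)) (λ x → not (par x)) (ℕₚ.≤-reflexive (trans (sym (#-upd x₀ Vx₀ x₀-even λ y k → Vx y k)) balance)))
      where
      V : Fin m → Bool
      V x = not (does (x Fₚ.≟ x₀)) ∧ par x
      Vx₀ : V x₀ ≡ false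
      Vx₀ rewrite dec-true (x₀ Fₚ.≟ x₀) refl = refl
      Vx : ∀ x → x ≢ x₀ → V x ≡ par x
      Vx x k rewrite dec-false (x Fₚ.≟ x₀) k = refl
      x₀-even : par x₀ ≡ true
      x₀-even with deg x₀ ℕₚ.≟ e
      ... | yes d = par-top x₀ d
      ... | no d = absurd (a≢0 (a-top x₀ d))
      g = proj₁ (enumerate V)
      contradiction′ : (∃ λ (y : Fin m → Carrier) → (∀ x → not (par x) ≡ false → y x ≈ 0#) × (∃ λ x → ¬ y x ≈ 0#) × (∀ i → ∑ (λ o → (M (g i) o + M o (g i)) * y o) ≈ 0#)) → a x₀ ≈ 0#
      contradiction′ (y , sy , (x₁ , nz) , k) = absurd (nz (all-0 x₀ a≢0 y (λ x e → sy x (cong not e)) rows x₁))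
        where
        rows : ∀ x → par x ≡ true → x ≢ x₀ → ∑ (λ o → (M x o + M o x) * y o) ≈ 0#
        rows x e k' with proj₂ (enumerate V) x (trans (Vx x k') e)
        ... | i , refl = k i

-- Monomials and the Euler characteristic

raise : ∀ {s} → Idx (suc s) → Idx (suc s)
raise (i ∷ α) = suc i ∷ α

mons : ∀ s → ℕ → List (Idx s)
mons zero zero = [] ∷ []
mons zero (suc m) = []
mons (suc s) zero = map (0 ∷_) (mons s 0)
mons (suc s) (suc m) = map (0 ∷_) (mons s (suc m)) ++ map raise (mons (suc s) m)

-- Pascal's rule: the monomials without the first variable and the multiples of the first variable.
length-mons : ∀ i m → length (mons (suc i) m) ≡ (m ℕ.+ i) C m
length-mons zero zero = refl
length-mons (suc i) zero = trans (Lₚ.length-map (0 ∷_) (mons (suc i) 0)) (length-mons i zero)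
length-mons i (suc m) = trans (Lₚ.length-++ (map (0 ∷_) (mons i (suc m)))) (trans (cong₂ ℕ._+_ (trans (Lₚ.length-map (0 ∷_) (mons i (suc m))) (first i)) (trans (Lₚ.length-map raise (mons (suc i) m)) (length-mons i m)))
  (trans (ℕₚ.+-comm ((m ℕ.+ i) C suc m) ((m ℕ.+ i) C m)) (nCk+nC[k+1]≡[n+1]C[k+1] (m ℕ.+ i) m)))
  where
  first : ∀ i → length (mons i (suc m)) ≡ (m ℕ.+ i) C suc m
  first zero = sym (k>n⇒nCk≡0 (ℕₚ.≤-reflexive (cong suc (ℕₚ.+-identityʳ m))))
  first (suc i) = trans (length-mons i (suc m)) (cong (_C suc m) (sym (ℕₚ.+-suc m i)))

mons-complete : ∀ {s m} (α : Idx s) → tot α ≡ m → α ∈ˡ mons s m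
mons-complete {zero} [] refl = here refl
mons-complete {suc s} {zero} (zero ∷ α) e = ∈-map⁺ (0 ∷_) (mons-complete α e)
mons-complete {suc s} {suc m} (zero ∷ α) e = ∈-++⁺ˡ (∈-map⁺ (0 ∷_) (mons-complete α e))
mons-complete {suc s} {suc m} (suc i ∷ α) e = ∈-++⁺ʳ (map (0 ∷_) (mons s (suc m))) (∈-map⁺ raise (mons-complete (i ∷ α) (ℕₚ.suc-injective e)))

mons-sound : ∀ s m {α : Idx s} → α ∈ˡ mons s m → tot α ≡ m
mons-sound zero zero (here refl) = refl
mons-sound (suc s) zero p with ∈-map⁻ (0 ∷_) p
... | β , q , refl = mons-sound s zero q
mons-sound (suc s) (suc m) p with ∈-++⁻ (map (0 ∷_) (mons s (suc m))) p
... | inj₁ q with ∈-map⁻ (0 ∷_) q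
...   | β , r , refl = mons-sound s (suc m) r
mons-sound (suc s) (suc m) p | inj₂ q with ∈-map⁻ raise q
... | (i ∷ β) , r , refl = cong suc (mons-sound (suc s) m r)

mons-unique : ∀ s m → Unique (mons s m)
mons-unique zero zero = [] ∷ []
mons-unique zero (suc m) = []
mons-unique (suc s) zero = Uniqueₚ.map⁺ (λ { refl → refl }) (mons-unique s 0)
mons-unique (suc s) (suc m) = Uniqueₚ.++⁺ (Uniqueₚ.map⁺ (λ { refl → refl }) (mons-unique s (suc m))) (Uniqueₚ.map⁺ (λ { {i ∷ α} {j ∷ β} refl → refl }) (mons-unique (suc s) m)) disjoint
  where
  disjoint : ∀ {α} → ¬ (α ∈ˡ map (0 ∷_) (mons s (suc m)) × α ∈ˡ map raise (mons (suc s) m))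
  disjoint (p , q) with ∈-map⁻ (0 ∷_) p | ∈-map⁻ raise q
  ... | β , _ , refl | (i ∷ γ) , _ , ()

lookup-injective : ∀ {xs : List 𝒜} → Unique xs → ∀ i j → L.lookup xs i ≡ L.lookup xs j → i ≡ j
lookup-injective (_ ∷ u) zero zero e = refl
lookup-injective (h ∷ u) zero (suc j) e = absurd (All.lookup h (∈-lookup j) e)
lookup-injective (h ∷ u) (suc i) zero e = absurd (All.lookup h (∈-lookup i) (sym e))
lookup-injective (_ ∷ u) (suc i) (suc j) e = cong suc (lookup-injective u i j e)

listSum : (𝒜 → ℤ) → List 𝒜 → ℤ
listSum g = foldr (λ x acc → g x ℤ.+ acc) (+ 0)

listSum-lookup : ∀ (g : 𝒜 → ℤ) xs → ℤr.∑ (λ i → g (L.lookup xs i)) ≡ listSum g xs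
listSum-lookup g [] = ℤr.∑-[] _
listSum-lookup g (x ∷ xs) = trans (ℤr.∑-∷ _) (cong (λ t → g x ℤ.+ t) (listSum-lookup g xs))

listSum-++ : ∀ (g : 𝒜 → ℤ) xs ys → listSum g (xs ++ ys) ≡ listSum g xs ℤ.+ listSum g ys
listSum-++ g [] ys = sym (ℤₚ.+-identityˡ _)
listSum-++ g (x ∷ xs) ys = trans (cong (λ t → g x ℤ.+ t) (listSum-++ g xs ys)) (sym (ℤₚ.+-assoc (g x) _ _))

listSum-concat : ∀ (g : 𝒜 → ℤ) {k} (f : Fin k → List 𝒜) → listSum g (L.concat (L.tabulate f)) ≡ ℤr.∑ (λ i → listSum g (f i))
listSum-concat g {zero} f = sym (ℤr.∑-[] _)
listSum-concat g {suc k} f = trans (listSum-++ g (f zero) _) (trans (cong (λ t → listSum g (f zero) ℤ.+ t) (listSum-concat g (f ∘ suc))) (sym (ℤr.∑-∷ _)))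

listSum-const : ∀ (g : 𝒜 → ℤ) z xs → (∀ x → g x ≡ z) → listSum g xs ≡ z ℤ.* + length xs
listSum-const g z [] h = sym (ℤₚ.*-zeroʳ z)
listSum-const g z (x ∷ xs) h = trans (cong₂ ℤ._+_ (h x) (listSum-const g z xs h)) (ℤr.solve 2 (λ z l → z ℤr.:+ z ℤr.:* l ℤr.:= z ℤr.:* (ℤr.con (+ 1) ℤr.:+ l)) refl z (+ length xs))

listSum-map : ∀ (g : ℬ → ℤ) (f : 𝒜 → ℬ) xs → listSum g (map f xs) ≡ listSum (g ∘ f) xs
listSum-map g f [] = refl
listSum-map g f (x ∷ xs) = cong (λ t → g (f x) ℤ.+ t) (listSum-map g f xs)

sumℤ-cong : ∀ B {f g : ℕ → ℤ} → (∀ j → j < B → f j ≡ g j) → sumℤ B f ≡ sumℤ B g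
sumℤ-cong zero h = refl
sumℤ-cong (suc B) h = cong₂ ℤ._+_ (sumℤ-cong B λ j p → h j (ℕₚ.m≤n⇒m≤1+n p)) (h B ℕₚ.≤-refl)

sumℤ-∑ : ∀ B {k} (f : Fin k → ℕ → ℤ) → ℤr.∑ (λ T → sumℤ B (f T)) ≡ sumℤ B (λ j → ℤr.∑ (λ T → f T j))
sumℤ-∑ zero f = ℤr.∑-0 λ _ → refl
sumℤ-∑ (suc B) f = trans (ℤr.∑-+ _ _) (cong (λ t → t ℤ.+ ℤr.∑ (λ T → f T B)) (sumℤ-∑ B f))

∑-indicator : ∀ {k} (p : Fin k → Bool) z → ℤr.∑ (λ T → p T ℤr.▹ z) ≡ z ℤ.* + # p
∑-indicator {zero} p z = trans (ℤr.∑-[] _) (sym (ℤₚ.*-zeroʳ z))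
∑-indicator {suc k} p z = trans (ℤr.∑-∷ _) (trans (cong (λ t → (p zero ℤr.▹ z) ℤ.+ t) (∑-indicator (p ∘ suc) z)) (head (p zero)))
  where
  head : ∀ b → (b ℤr.▹ z) ℤ.+ z ℤ.* + # (p ∘ suc) ≡ z ℤ.* + (b2n b ℕ.+ # (p ∘ suc))
  head true = ℤr.solve 2 (λ z l → z ℤr.:+ z ℤr.:* l ℤr.:= z ℤr.:* (ℤr.con (+ 1) ℤr.:+ l)) refl z (+ # (p ∘ suc))
  head false = ℤₚ.+-identityˡ _

sumℤ-pick : ∀ B r (G : ℕ → ℤ) → (B ≤ r → G r ≡ + 0) → sumℤ B (λ j → (r ≡ᵇ j) ℤr.▹ G j) ≡ G r
sumℤ-pick B r G h with r ℕₚ.<? B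
... | no k = trans (zeros B (ℕₚ.≮⇒≥ k)) (sym (h (ℕₚ.≮⇒≥ k)))
  where
  zeros : ∀ B → B ≤ r → sumℤ B (λ j → (r ≡ᵇ j) ℤr.▹ G j) ≡ + 0
  zeros zero _ = refl
  zeros (suc B) le = cong₂ ℤ._+_ (zeros B (ℕₚ.<⇒≤ le)) (ℤr.▹-0 (r ≡ᵇ B) λ e → absurd (ℕₚ.<⇒≢ le (sym (≡ᵇ⇒≡ e))))
... | yes lt = go B lt
  where
  zeros : ∀ B → B ≤ r → sumℤ B (λ j → (r ≡ᵇ j) ℤr.▹ G j) ≡ + 0
  zeros zero _ = refl
  zeros (suc B) le = cong₂ ℤ._+_ (zeros B (ℕₚ.<⇒≤ le)) (ℤr.▹-0 (r ≡ᵇ B) λ e → absurd (ℕₚ.<⇒≢ le (sym (≡ᵇ⇒≡ e))))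
  go : ∀ B → r < B → sumℤ B (λ j → (r ≡ᵇ j) ℤr.▹ G j) ≡ G r
  go (suc B) (s≤s le) with r ℕₚ.≟ B
  ... | yes refl = trans (cong₂ ℤ._+_ (zeros r ℕₚ.≤-refl) (ℤr.▹-true (≡ᵇ-true {r} refl))) (ℤₚ.+-identityˡ _)
  ... | no k = trans (cong₂ ℤ._+_ (go B (ℕₚ.≤∧≢⇒< le k)) (ℤr.▹-0 (r ≡ᵇ B) λ e → absurd (k (≡ᵇ⇒≡ e)))) (ℤₚ.+-identityʳ _)

sum-by-rank : ∀ P B (G : ℕ → ℤ) → (∀ r → B ≤ r → G r ≡ + 0) → ℤr.∑ (λ T → G (SimplicialPoset.rank P T)) ≡ sumℤ B (λ j → G j ℤ.* + fvec P j)
sum-by-rank P B G h = trans (ℤr.∑-cong λ T → sym (sumℤ-pick B (rank T) G (h (rank T)))) (trans (sumℤ-∑ B _)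
  (sumℤ-cong B λ j _ → trans (∑-indicator (λ T → rank T ≡ᵇ j) (G j)) (cong (λ k → G j ℤ.* + k) (sym (countℕ≡# (λ T → rank T ≡ᵇ j))))))
  where open SimplicialPoset P

even : ℕ → Bool
even zero = true
even (suc k) = not (even k)

signed-count : ∀ {k} (f : Fin k → ℕ) → ℤr.∑ (λ x → signℤ (f x)) ≡ + # (even ∘ f) ℤ.- + # (not ∘ even ∘ f)
signed-count {zero} f = ℤr.∑-[] _
signed-count {suc k} f = trans (ℤr.∑-∷ _) (trans (cong (λ t → signℤ (f zero) ℤ.+ t) (signed-count (f ∘ suc))) (trans (cong (λ t → t ℤ.+ (+ # (even ∘ f ∘ suc) ℤ.- + # (not ∘ even ∘ f ∘ suc))) (sign (f zero))) (head (even (f zero)) (# (even ∘ f ∘ suc)) (# (not ∘ even ∘ f ∘ suc)))))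
  where
  sign : ∀ k → signℤ k ≡ (if even k then + 1 else ℤ.- + 1)
  sign zero = refl
  sign (suc k) with even k | sign k
  ... | true | e = cong ℤ.-_ e
  ... | false | e = cong ℤ.-_ e
  head : ∀ b p q → (if b then + 1 else ℤ.- + 1) ℤ.+ (+ p ℤ.- + q) ≡ + (b2n b ℕ.+ p) ℤ.- + (b2n (not b) ℕ.+ q)
  head true p q = ℤr.solve 2 (λ p q → ℤr.con (+ 1) ℤr.:+ (p ℤr.:- q) ℤr.:= (ℤr.con (+ 1) ℤr.:+ p) ℤr.:- q) refl (+ p) (+ q)
  head false p q = ℤr.solve 2 (λ p q → ℤr.con (ℤ.- + 1) ℤr.:+ (p ℤr.:- q) ℤr.:= p ℤr.:- (ℤr.con (+ 1) ℤr.:+ q)) refl (+ p) (+ q)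

-- Pairs of a face and a monomial in `suc i` variables, of total degree `e`, index a basis of the
-- complex as a whole.
module Basis (P : SimplicialPoset) (e i : ℕ) where
  open Faces P

  cellsᵈ : ∀ T → Dec (rank T ≤ e) → List (Fin n × Idx (suc i))
  cellsᵈ T (yes _) = map (T ,_) (mons (suc i) (e ∸ rank T))
  cellsᵈ T (no _) = []

  cells : Fin n → List (Fin n × Idx (suc i))
  cells T = cellsᵈ T (rank T ℕₚ.≤? e)

  cells-sound : ∀ {T x} d → x ∈ˡ cellsᵈ T d → proj₁ x ≡ T × rank T ℕ.+ tot (proj₂ x) ≡ e
  cells-sound {T} (yes le) p with ∈-map⁻ (T ,_) p
  ... | α , q , refl = refl , trans (cong (rank T ℕ.+_) (mons-sound (suc i) (e ∸ rank T) q)) (ℕₚ.m+[n∸m]≡n le)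

  cells-complete : ∀ T α d → rank T ℕ.+ tot α ≡ e → (T , α) ∈ˡ cellsᵈ T d
  cells-complete T α (yes le) q = ∈-map⁺ (T ,_) (mons-complete α (ℕₚ.+-cancelˡ-≡ (rank T) _ _ (trans q (sym (ℕₚ.m+[n∸m]≡n le)))))
  cells-complete T α (no k) q = absurd (k (ℕₚ.≤-trans (ℕₚ.m≤m+n (rank T) (tot α)) (ℕₚ.≤-reflexive q)))

  cells-unique : ∀ T d → Unique (cellsᵈ T d)
  cells-unique T (yes le) = Uniqueₚ.map⁺ (λ { refl → refl }) (mons-unique (suc i) (e ∸ rank T))
  cells-unique T (no k) = []

  basis : List (Fin n × Idx (suc i))
  basis = L.concat (L.tabulate cells)

  basis-unique : Unique basis
  basis-unique = Uniqueₚ.concat⁺ (Allₚ.tabulate⁺ λ T → cells-unique T (rank T ℕₚ.≤? e)) (AllPairsₚ.tabulate⁺ λ { k (p , q) → k (trans (sym (proj₁ (cells-sound (_ ℕₚ.≤? e) p))) (proj₁ (cells-sound (_ ℕₚ.≤? e) q))) })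

  m : ℕ
  m = length basis

  abstract
    ix : Fin m → Fin n × Idx (suc i)
    ix = L.lookup basis

    ix-def : ∀ x → ix x ≡ L.lookup basis x
    ix-def x = refl

    ix-injective : ∀ {x y} → ix x ≡ ix y → x ≡ y
    ix-injective = lookup-injective basis-unique _ _

    ix-sound : ∀ x → rank (proj₁ (ix x)) ℕ.+ tot (proj₂ (ix x)) ≡ e
    ix-sound x with ∈-concat⁻′ (L.tabulate cells) (∈-lookup {xs = basis} x)
    ... | ys , p , q with ∈-tabulate⁻ {f = cells} q
    ... | T , refl with cells-sound {T} (rank T ℕₚ.≤? e) p
    ... | refl , r = r

    find : ∀ T α → rank T ℕ.+ tot α ≡ e → ∃ λ x → ix x ≡ (T , α)
    find T α q = Any.index mem , sym (Anyₚ.lookup-index mem)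
      where
      mem : (T , α) ∈ˡ basis
      mem = ∈-concat⁺′ (cells-complete T α (rank T ℕₚ.≤? e) q) (∈-tabulate⁺ {f = cells} T)

  deg : Fin m → ℕ
  deg x = rank (proj₁ (ix x))

  deg≤ : ∀ x → deg x ≤ e
  deg≤ x = ℕₚ.≤-trans (ℕₚ.m≤m+n (deg x) _) (ℕₚ.≤-reflexive (ix-sound x))

  par : Fin m → Bool
  par x = even (e ∸ deg x)

  par-shift : ∀ x' x → deg x' ≡ suc (deg x) → par x' ≡ not (par x)
  par-shift x' x q = sym (trans (cong (not ∘ even) eq) (Bₚ.not-involutive _))
    where
    eq : e ∸ deg x ≡ suc (e ∸ deg x')
    eq = trans (ℕₚ.+-∸-assoc 1 (ℕₚ.≤-trans (ℕₚ.≤-reflexive (sym q)) (deg≤ x'))) (cong (λ t → suc (e ∸ t)) (sym q))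

  par-top : ∀ x → deg x ≡ e → par x ≡ true
  par-top x q = cong even (trans (cong (e ∸_) q) (ℕₚ.n∸n≡0 e))

  module _ (dim : ℕ) (e+i : e ℕ.+ i ≡ dim) (h0 : hvec P dim e ≡ + 0) where
    private
      G : ℕ → ℤ
      G j = does (j ℕₚ.≤? e) ℤr.▹ signℤ (e ∸ j) ℤ.* + ((dim ∸ j) C (e ∸ j))

      cells-sum : ∀ T d → listSum (λ x → signℤ (e ∸ rank (proj₁ x))) (cellsᵈ T d) ≡ (does d ℤr.▹ signℤ (e ∸ rank T) ℤ.* + ((dim ∸ rank T) C (e ∸ rank T)))
      cells-sum T (no k) = refl
      cells-sum T (yes le) = trans (listSum-map (λ x → signℤ (e ∸ rank (proj₁ x))) (T ,_) (mons (suc i) (e ∸ rank T))) (trans (listSum-const (λ _ → signℤ (e ∸ rank T)) (signℤ (e ∸ rank T)) (mons (suc i) (e ∸ rank T)) (λ _ → refl))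
        (cong (λ k → signℤ (e ∸ rank T) ℤ.* + k) (trans (length-mons i (e ∸ rank T)) (cong (_C (e ∸ rank T)) (trans (sym (ℕₚ.+-∸-comm i le)) (cong (_∸ rank T) e+i))))))

      total : ℤr.∑ (λ x → signℤ (e ∸ deg x)) ≡ + 0
      total = trans (ℤr.∑-cong λ x → cong (λ y → signℤ (e ∸ rank (proj₁ y))) (ix-def x)) (trans (listSum-lookup (λ x → signℤ (e ∸ rank (proj₁ x))) basis)
        (trans (listSum-concat (λ x → signℤ (e ∸ rank (proj₁ x))) cells) (trans (ℤr.∑-cong λ T → cells-sum T (rank T ℕₚ.≤? e))
        (trans (sum-by-rank P (suc e) G (λ r lt → ℤr.▹-false (dec-false (r ℕₚ.≤? e) (ℕₚ.<⇒≱ lt))))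
        (trans (sumℤ-cong (suc e) λ j lt → cong (λ t → t ℤ.* + fvec P j) (ℤr.▹-true (dec-true (j ℕₚ.≤? e) (ℕₚ.≤-pred lt)))) h0)))))

    -- The Euler characteristic is `hvec P dim e`: a face of rank `r` carries binom(e - r + i, e -
    -- r) monomials, and `e + i = dim`.
    balance : # par ≡ # (λ x → not (par x))
    balance = ℤₚ.+-injective (ℤₚ.i-j≡0⇒i≡j _ _ (trans (sym (signed-count (λ x → e ∸ deg x))) total))

-- Rigidity: chains killed by sufficiently many weighted boundaries

module Rigidity {c ℓ} (F : Field c ℓ) (_≟0 : ∀ x → Dec (Field._≈_ F x (Field.0# F)))
  (anisotropic : Anisotropic F)
  (P : SimplicialPoset) (dim e i : ℕ) (e+i : e ℕ.+ i ≡ dim) (rank≤ : ∀ T → SimplicialPoset.rank P T ≤ dim)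
  (plain : WeightedAcyclic.PlainExact (Field.commutativeRing F) P dim) (h0 : hvec P dim e ≡ + 0) where
  open Cells (Field.commutativeRing F) P
  open Coefficients (Field.commutativeRing F)
  open Weighted (Field.commutativeRing F) P
  open Basis P e i

  s : ℕ
  s = suc i

  κ-all : ∀ T → κ n ⊥ T ≡ rank T
  κ-all T = trans (#-cong λ v → trans (cong₂ (λ b b' → lookup (vt T) v ∧ (not b ∧ b')) (lookup-⊥ v) (<ᵇ-true (Fₚ.toℕ<n v))) (Bₚ.∧-identityʳ _)) (sym (trans (rank≡ T) (∣∣≡# (vt T))))

  Top : ℕ → Cochain s → Set (c ⊔ ℓ)
  Top = Graded e n ⊥

  top-support : ∀ {j f} → Top j f → ∀ T α → (suc (rank T) ≡ j → rank T ℕ.+ tot α ≢ e) → f T α ≈ 0#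
  top-support g T α k = support g T α λ { (_ , r , q) → k r (trans (cong (ℕ._+ tot α) (sym (κ-all T))) q) }

  to-top : ∀ {j f} → (∀ T α → (suc (rank T) ≡ j → rank T ℕ.+ tot α ≢ e) → f T α ≈ 0#) → Top j f
  to-top h = graded λ T α k → h T α λ r q → k (⊥-⊆ , r , trans (cong (ℕ._+ tot α) (κ-all T)) q)

  abstract
    _≟ᴮ_ : (x y : Fin n × Idx s) → Dec (x ≡ y)
    (T , α) ≟ᴮ (U , β) with T Fₚ.≟ U | Vₚ.≡-dec ℕₚ._≟_ α β
    ... | yes refl | yes refl = yes refl
    ... | no k | _ = no λ { refl → k refl }
    ... | yes _ | no k = no λ { refl → k refl }

    monomial : Fin n × Idx s → Cochain s
    monomial y T α = does ((T , α) ≟ᴮ y) ▹ 1#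

    monomial-on : ∀ y → monomial y (proj₁ y) (proj₂ y) ≈ 1#
    monomial-on y = ▹-true (dec-true (y ≟ᴮ y) refl)

    monomial-off : ∀ {y T α} → (T , α) ≢ y → monomial y T α ≈ 0#
    monomial-off {y} {T} {α} k = ▹-false (dec-false ((T , α) ≟ᴮ y) k)

  combine : (Fin m → Carrier) → Cochain s
  combine y T α = ∑ λ x → y x * monomial (ix x) T α

  combine-at : ∀ y x → combine y (proj₁ (ix x)) (proj₂ (ix x)) ≈ y x
  combine-at y x = ≈-trans (∑-single x λ x' k → ≈-trans (*-congˡ (monomial-off λ q → k (sym (ix-injective q)))) (zeroʳ _)) (≈-trans (*-congˡ (monomial-on (ix x))) (*-identityʳ _))

  combine-off : ∀ y {T α} → rank T ℕ.+ tot α ≢ e → combine y T α ≈ 0#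
  combine-off y {T} {α} k = ∑-0 λ x → ≈-trans (*-congˡ (monomial-off λ q → k (subst (λ z → rank (proj₁ z) ℕ.+ tot (proj₂ z) ≡ e) (sym q) (ix-sound x)))) (zeroʳ _)

  values : Cochain s → Fin m → Carrier
  values f x = f (proj₁ (ix x)) (proj₂ (ix x))

  expand : ∀ {f} → (∀ T α → rank T ℕ.+ tot α ≢ e → f T α ≈ 0#) → ∀ T → f T ≋ combine (values f) T
  expand {f} h T α with rank T ℕ.+ tot α ℕₚ.≟ e
  ... | no k = ≈-trans (h T α k) (≈-sym (combine-off (values f) k))
  ... | yes q with find T α q
  ... | x , refl′ = ≈-trans (≈-reflexive (cong (λ z → f (proj₁ z) (proj₂ z)) (sym refl′))) (≈-trans (≈-sym (combine-at (values f) x)) (≈-reflexive (cong (λ z → combine (values f) (proj₁ z) (proj₂ z)) refl′)))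

  module _ (form : Fin n → ℕ → Carrier) (generic : Generic s form ⊥) where
    open Δ {s} form n

    M : Fin m → Fin m → Carrier
    M x' x = values (Δ ⊥ (monomial (ix x))) x'

    monomial-top : ∀ x → Top (suc (deg x)) (monomial (ix x))
    monomial-top x = to-top λ T α k → monomial-off λ q → k (cong (λ z → suc (rank (proj₁ z))) q) (subst (λ z → rank (proj₁ z) ℕ.+ tot (proj₂ z) ≡ e) (sym q) (ix-sound x))

    shift : ∀ x' x → deg x' ≢ suc (deg x) → M x' x ≈ 0#
    shift x' x k = top-support (Δ-graded {form = form} (monomial-top x)) _ _ λ r _ → k (ℕₚ.suc-injective r)

    Δ-combine : ∀ y T α → Δ ⊥ (combine y) T α ≈ ∑ (λ x → y x * Δ ⊥ (monomial (ix x)) T α)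
    Δ-combine y T α = ≈-trans (∑-cong λ v → ≈-trans (*-congˡ (Linear.combination (L-linear form n v) y (λ x → monomial (ix x) (del T v)) α)) (∑-*ˡ _ _))
      (≈-trans (∑-swap _) (∑-cong λ x → ≈-trans (∑-cong λ v → solve 3 (λ c y l → c :* (y :* l) := y :* (c :* l)) ≈-refl _ _ _) (≈-sym (∑-*ˡ (y x) _))))

    Δ-values : ∀ {f} → (∀ T α → rank T ℕ.+ tot α ≢ e → f T α ≈ 0#) → ∀ x' → values (Δ ⊥ f) x' ≈ ∑ (λ x → M x' x * values f x)
    Δ-values {f} h x' = ≈-trans (Δ-cong ⊥ (expand h) _ _) (≈-trans (Δ-combine (values f) _ _) (∑-cong λ x → *-comm _ _))

    graded-off : ∀ {j f} → Top j f → ∀ T α → rank T ℕ.+ tot α ≢ e → f T α ≈ 0#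
    graded-off g T α k = top-support g T α λ _ → k

    square : ∀ x″ x → ∑ (λ x' → M x″ x' * M x' x) ≈ 0#
    square x″ x = ≈-trans (≈-sym (Δ-values (graded-off (Δ-graded {form = form} (monomial-top x))) x″)) (Δ-Δ (L-comm form n) ⊥ (monomial (ix x)) _ _)

    -- The number `s = suc i` fits exactly: `j < e` becomes `j + s ≤ dim`, and `dim < e + s` holds
    -- with nothing to spare.
    exact : ∀ j → j < e → ∀ (y : Fin m → Carrier) → (∀ x → deg x ≢ j → y x ≈ 0#) → (∀ x' → ∑ (λ x → M x' x * y x) ≈ 0#) → ∃ λ (b : Fin m → Carrier) → ∀ x' → y x' ≈ ∑ (λ x → M x' x * b x)
    exact j j<e y sy My = restate (WeightedAcyclic.acyclic (Field.commutativeRing F) P dim rank≤ plain s n {e} {⊥} {form} {j} ℕₚ.≤-refl generic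
        (ℕₚ.≤-trans (ℕₚ.≤-reflexive (ℕₚ.+-suc j i)) (ℕₚ.≤-trans (ℕₚ.+-monoˡ-≤ i j<e) (ℕₚ.≤-reflexive e+i)))
        (ℕₚ.≤-reflexive (trans (cong suc (sym e+i)) (trans (sym (ℕₚ.+-suc e i)) (trans (sym (ℕₚ.+-identityʳ _)) (cong (e ℕ.+ s ℕ.+_) (sym (Subₚ.∣⊥∣≡0 n)))))))
        (combine y) top cocycle)
      where
      top : Top (suc j) (combine y)
      top = to-top λ T α k → ∑-0 λ x → term T α k x (deg x ℕₚ.≟ j)
        where
        term : ∀ T α → (suc (rank T) ≡ suc j → rank T ℕ.+ tot α ≢ e) → ∀ x → Dec (deg x ≡ j) → y x * monomial (ix x) T α ≈ 0#
        term T α k x (no d) = ≈-trans (*-congʳ (sy x d)) (zeroˡ _)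
        term T α k x (yes d) = ≈-trans (*-congˡ (monomial-off λ q → k (cong suc (trans (cong (λ z → rank (proj₁ z)) q) d)) (subst (λ z → rank (proj₁ z) ℕ.+ tot (proj₂ z) ≡ e) (sym q) (ix-sound x)))) (zeroʳ _)
      cocycle : ∀ T → Δ ⊥ (combine y) T ≋ 0D
      cocycle T α with rank T ℕ.+ tot α ℕₚ.≟ e
      ... | no k = graded-off (Δ-graded {form = form} top) T α k
      ... | yes q with find T α q
      ... | x , r = ≈-trans (≈-reflexive (cong (λ z → Δ ⊥ (combine y) (proj₁ z) (proj₂ z)) (sym r))) (≈-trans (Δ-values (graded-off top) x) (≈-trans (∑-cong λ x' → *-congˡ (combine-at y x')) (My x)))
      restate : (∃ λ b → Graded e n ⊥ j b × (∀ T → Δ ⊥ b T ≋ combine y T)) → ∃ λ (b : Fin m → Carrier) → ∀ x' → y x' ≈ ∑ (λ x → M x' x * b x)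
      restate (b , gb , Δb) = values b , λ x' → ≈-trans (≈-sym (combine-at y x')) (≈-trans (≈-sym (Δb _ _)) (Δ-values (graded-off gb) x'))

    module _ (a : Fin n → Carrier) (a-support : ∀ T → rank T ≢ e → a T ≈ 0#)
             (a-kernel : ∀ k → k < s → ∀ H → ∂ (λ v → form v k) a H ≈ 0#) where

      origin : Idx s
      origin = Data.Vec.replicate s 0

      tot-origin : ∀ s → tot (Data.Vec.replicate s 0) ≡ 0
      tot-origin zero = refl
      tot-origin (suc s) = tot-origin s

      tot-0 : ∀ {s} (α : Idx s) → tot α ≡ 0 → α ≡ Data.Vec.replicate s 0
      tot-0 [] _ = refl
      tot-0 (zero ∷ α) q = cong (0 ∷_) (tot-0 α q)

      -- The chain `a` as a functional on the top degree, where the faces of rank `e` carry only the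
      -- constant monomial.
      A : Fin m → Carrier
      A x = (deg x ≡ᵇ e) ▹ a (proj₁ (ix x))

      A≈ : ∀ x → ∑ (λ T → a T * monomial (ix x) T origin) ≈ A x
      A≈ x with deg x ℕₚ.≟ e
      ... | yes d = ≈-trans (∑-single (proj₁ (ix x)) λ T k → ≈-trans (*-congˡ (monomial-off λ q → k (cong proj₁ q))) (zeroʳ _))
          (≈-trans (≈-trans (*-congˡ (≈-trans (≈-reflexive (cong (monomial (ix x) (proj₁ (ix x))) (sym α≡))) (monomial-on (ix x)))) (*-identityʳ _)) (≈-sym (▹-true (≡ᵇ-true d))))
        where
        α≡ : proj₂ (ix x) ≡ origin
        α≡ = tot-0 (proj₂ (ix x)) (ℕₚ.+-cancelˡ-≡ (deg x) _ 0 (trans (ix-sound x) (trans (sym d) (sym (ℕₚ.+-identityʳ _)))))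
      ... | no d = ≈-trans (∑-0 λ T → ≈-trans (*-congˡ (monomial-off λ q → d (trans (sym (ℕₚ.+-identityʳ _)) (trans (cong (deg x ℕ.+_) (sym (trans (cong (λ z → tot (proj₂ z)) (sym q)) (tot-origin s)))) (ix-sound x))))) (zeroʳ _)) (≈-sym (▹-0 (deg x ≡ᵇ e) λ p → absurd (d (≡ᵇ⇒≡ p))))

      pairing : ∀ {f} → (∀ T α → rank T ℕ.+ tot α ≢ e → f T α ≈ 0#) → ∑ (λ x → A x * values f x) ≈ ∑ (λ T → a T * f T origin)
      pairing {f} h = begin
        ∑ (λ x → A x * values f x)                                            ≈⟨ (∑-cong λ x → ≈-trans (*-congʳ (≈-sym (A≈ x))) (∑-*ʳ _ _)) ⟩
        ∑ (λ x → ∑ (λ T → (a T * monomial (ix x) T origin) * values f x))     ≈⟨ ∑-swap _ ⟩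
        ∑ (λ T → ∑ (λ x → (a T * monomial (ix x) T origin) * values f x))     ≈⟨ (∑-cong λ T → ≈-trans (∑-cong λ x → solve 3 (λ a e v → (a :* e) :* v := a :* (v :* e)) ≈-refl _ _ _) (≈-sym (∑-*ˡ (a T) _))) ⟩
        ∑ (λ T → a T * combine (values f) T origin)                           ≈⟨ (∑-cong λ T → *-congˡ (≈-sym (expand h T origin))) ⟩
        ∑ (λ T → a T * f T origin) ∎

      -- At the constant monomial the differential is the sum over all forms of weighted
      -- coboundaries of linear coefficients. By adjointness the functional of a chain killed by
      -- every weighted boundary therefore kills the image.
      Δ-origin : ∀ f T → Δ ⊥ f T origin ≈ ∑ (λ (t : Fin s) → δ (λ v → form v (toℕ t)) (λ H → f H (bump t origin)) T)
      Δ-origin f T = ≈-trans (∑-cong λ v → term v) (∑-swap _)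
        where
        term : ∀ v → coef ⊥ T v * L form n v (f (del T v)) origin ≈ ∑ (λ (t : Fin s) → lookup (vt T) v ▹ σ v (rem (vt T) v) * (form v (toℕ t) * f (del T v) (bump t origin)))
        term v = ≈-trans (*-cong (▹-≡ (trans (cong (λ b → lookup (vt T) v ∧ not b) (lookup-⊥ v)) (Bₚ.∧-identityʳ _))) (≈-reflexive (cong (λ b → (if b then contract (form v) (f (del T v)) else f (del T v)) origin) (<ᵇ-true (Fₚ.toℕ<n v)))))
          (≈-trans (∑-*ˡ _ _) (∑-cong λ t → ▹-*ʳ (lookup (vt T) v) _ _))

      A-kernel : ∀ x → ∑ (λ x' → A x' * M x' x) ≈ 0#
      A-kernel x = begin
        ∑ (λ x' → A x' * M x' x)                            ≈⟨ pairing (graded-off (Δ-graded {form = form} (monomial-top x))) ⟩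
        ∑ (λ T → a T * Δ ⊥ (monomial (ix x)) T origin)      ≈⟨ (∑-cong λ T → ≈-trans (*-congˡ (Δ-origin (monomial (ix x)) T)) (∑-*ˡ (a T) _)) ⟩
        ∑ (λ T → ∑ (λ (t : Fin s) → a T * δ (λ v → form v (toℕ t)) (E t) T)) ≈⟨ ∑-swap _ ⟩
        ∑ (λ (t : Fin s) → ⟨ a , δ (λ v → form v (toℕ t)) (E t) ⟩)       ≈⟨ (∑-0 λ t → ≈-trans (≈-sym (adjoint (λ v → form v (toℕ t)) a (E t))) (∑-0 λ H → ≈-trans (*-congʳ (a-kernel (toℕ t) (Fₚ.toℕ<n t) H)) (zeroˡ _))) ⟩
        0# ∎
        where
        E : Fin s → Fin n → Carrier
        E t H = monomial (ix x) H (bump t origin)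

      rigid : ∀ T → a T ≈ 0#
      rigid T with rank T ℕₚ.≟ e
      ... | no k = a-support T k
      ... | yes q with find T origin (trans (cong (rank T ℕ.+_) (tot-origin s)) (trans (ℕₚ.+-identityʳ _) q))
      ... | x , r = ≈-trans (≈-sym (≈-trans (▹-true (≡ᵇ-true (trans (cong (λ z → rank (proj₁ z)) r) q))) (≈-reflexive (cong (λ z → a (proj₁ z)) r))))
        (Hodge.Complex.top-injective F _≟0 anisotropic deg e M shift square deg≤ exact par par-shift par-top (balance dim e+i h0) A (λ x k → ▹-0 (deg x ≡ᵇ e) λ p → absurd (k (≡ᵇ⇒≡ p))) A-kernel x)

-- Rational coefficients

ℚ-field : Field 0ℓ 0ℓ
ℚ-field = record
  { commutativeRing = ℚₚ.+-*-commutativeRing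
  ; 0≉1 = λ ()
  ; inverse = λ x x≢0 → ℚ.1/_ x ⦃ ℚ.≢-nonZero x≢0 ⦄ , ℚₚ.*-inverseʳ x ⦃ ℚ.≢-nonZero x≢0 ⦄
  }

module ℚr = RingTools ℚₚ.+-*-commutativeRing

square-nonneg : ∀ x → ℚ.0ℚ ℚ.≤ x ℚ.* x
square-nonneg x with ℚₚ.≤-total ℚ.0ℚ x
... | inj₁ p = nonneg x p
  where
  nonneg : ∀ x → ℚ.0ℚ ℚ.≤ x → ℚ.0ℚ ℚ.≤ x ℚ.* x
  nonneg x p = ℚₚ.nonNegative⁻¹ (x ℚ.* x) ⦃ ℚₚ.nonNeg*nonNeg⇒nonNeg x ⦃ ℚ.nonNegative p ⦄ x ⦃ ℚ.nonNegative p ⦄ ⦄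
... | inj₂ p = subst (ℚ.0ℚ ℚ.≤_) (ℚr.solve 1 (λ x → (ℚr.:- x) ℚr.:* (ℚr.:- x) ℚr.:= x ℚr.:* x) refl x) (nonneg (ℚ.- x) (ℚₚ.neg-antimono-≤ p))
  where
  nonneg : ∀ x → ℚ.0ℚ ℚ.≤ x → ℚ.0ℚ ℚ.≤ x ℚ.* x
  nonneg x p = ℚₚ.nonNegative⁻¹ (x ℚ.* x) ⦃ ℚₚ.nonNeg*nonNeg⇒nonNeg x ⦃ ℚ.nonNegative p ⦄ x ⦃ ℚ.nonNegative p ⦄ ⦄

sum-of-squares : ∀ {m} (f : Fin m → ℚ) → ℚ.0ℚ ℚ.≤ ℚr.∑ (λ i → f i ℚ.* f i)
sum-of-squares {zero} f = ℚₚ.≤-reflexive (sym (ℚr.∑-[] _))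
sum-of-squares {suc m} f = subst (ℚ.0ℚ ℚ.≤_) (sym (ℚr.∑-∷ _)) (ℚₚ.+-mono-≤ (square-nonneg (f zero)) (sum-of-squares (f ∘ suc)))

ℚ-anisotropic : ∀ {m} (f : Fin m → ℚ) → ℚr.∑ (λ i → f i ℚ.* f i) ≡ ℚ.0ℚ → ∀ i → f i ≡ ℚ.0ℚ
ℚ-anisotropic {suc m} f e = λ { zero → head ; (suc i) → ℚ-anisotropic (f ∘ suc) tail i }
  where
  a = f zero ℚ.* f zero
  b = ℚr.∑ (λ i → f (suc i) ℚ.* f (suc i))
  total : a ℚ.+ b ≡ ℚ.0ℚ
  total = trans (sym (ℚr.∑-∷ _)) e
  first : a ≡ ℚ.0ℚ
  first = ℚₚ.≤-antisym (subst (a ℚ.≤_) total (subst (ℚ._≤ a ℚ.+ b) (ℚₚ.+-identityʳ a) (ℚₚ.+-monoʳ-≤ a (sum-of-squares (f ∘ suc))))) (square-nonneg (f zero))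
  tail : b ≡ ℚ.0ℚ
  tail = trans (sym (ℚₚ.+-identityˡ b)) (trans (cong (ℚ._+ b) (sym first)) total)
  head : f zero ≡ ℚ.0ℚ
  head with f zero ℚ.≟ ℚ.0ℚ
  ... | yes z = z
  ... | no z = Elimination.cancelˡ ℚ-field {0} {0} z first

private
  ι-nat : ∀ k → ℚ.toℚᵘ (ℚr.ι (+ k)) ℚᵘ.≃ ℚᵘ.mkℚᵘ (+ k) 0
  ι-nat zero = ℚᵘₚ.≃-refl
  ι-nat (suc k) = ℚᵘₚ.≃-trans (ℚₚ.toℚᵘ-homo-+ ℚ.1ℚ (ℚr.ι (+ k))) (ℚᵘₚ.≃-trans (ℚᵘₚ.+-congʳ (ℚ.toℚᵘ ℚ.1ℚ) (ι-nat k))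
    (ℚᵘ.*≡* (ℤr.solve 1 (λ k → (ℤr.con (+ 1) ℤr.:* ℤr.con (+ 1) ℤr.:+ k ℤr.:* ℤr.con (+ 1)) ℤr.:* ℤr.con (+ 1) ℤr.:= (ℤr.con (+ 1) ℤr.:+ k) ℤr.:* ℤr.con (+ 1)) refl (+ k))))

ι-unnormalised : ∀ z → ℚ.toℚᵘ (ℚr.ι z) ℚᵘ.≃ ℚᵘ.mkℚᵘ z 0
ι-unnormalised (+ k) = ι-nat k
ι-unnormalised -[1+ k ] = ℚᵘₚ.≃-trans (ℚₚ.toℚᵘ-homo‿- (ℚr.ι (+ suc k))) (ℚᵘₚ.-‿cong (ι-nat (suc k)))

ι-injective : ∀ {z} → ℚr.ι z ≡ ℚ.0ℚ → z ≡ + 0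
ι-injective {z} e with ℚᵘₚ.≃-trans (ℚᵘₚ.≃-sym (ι-unnormalised z)) (ℚᵘₚ.≃-reflexive (cong ℚ.toℚᵘ e))
... | ℚᵘ.*≡* q = trans (sym (ℤₚ.*-identityʳ z)) q

clear : ∀ x → ∃ λ s → ∃ λ z → s ≢ + 0 × ℚr.ι s ℚ.* x ≡ ℚr.ι z
clear x@(ℚ.mkℚ u d _) = + suc d , u , (λ ()) , ℚₚ.toℚᵘ-injective (ℚᵘₚ.≃-trans (ℚₚ.toℚᵘ-homo-* (ℚr.ι (+ suc d)) x)
    (ℚᵘₚ.≃-trans (ℚᵘₚ.*-congʳ {ℚ.toℚᵘ x} (ι-unnormalised (+ suc d))) (ℚᵘₚ.≃-trans (ℚᵘ.*≡* product) (ℚᵘₚ.≃-sym (ι-unnormalised u)))))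
  where
  product : (+ suc d) ℤ.* u ℤ.* + 1 ≡ u ℤ.* + suc (d ℕ.+ 0)
  product = trans (ℤₚ.*-identityʳ _) (trans (ℤₚ.*-comm (+ suc d) u) (cong (λ k → u ℤ.* + suc k) (sym (ℕₚ.+-identityʳ d))))

clear-all : ∀ {k} (x : Fin k → ℚ) → ∃ λ s → ∃ λ (z : Fin k → ℤ) → s ≢ + 0 × (∀ i → ℚr.ι s ℚ.* x i ≡ ℚr.ι (z i))
clear-all {zero} x = + 1 , (λ ()) , (λ ()) , λ ()
clear-all {suc k} x with clear (x zero) | clear-all (x ∘ suc)
... | s , z , s≢0 , e | s' , z' , s'≢0 , e' = s ℤ.* s' , (λ { zero → s' ℤ.* z ; (suc i) → s ℤ.* z' i }) , nz ,
    λ { zero → trans (cong (ℚ._* x zero) (ℚr.ι-* s s')) (trans (ℚr.solve 3 (λ a b x → (a ℚr.:* b) ℚr.:* x ℚr.:= b ℚr.:* (a ℚr.:* x)) refl (ℚr.ι s) (ℚr.ι s') (x zero)) (trans (cong (ℚr.ι s' ℚ.*_) e) (sym (ℚr.ι-* s' z))))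
      ; (suc i) → trans (cong (ℚ._* x (suc i)) (ℚr.ι-* s s')) (trans (ℚₚ.*-assoc (ℚr.ι s) (ℚr.ι s') (x (suc i))) (trans (cong (ℚr.ι s ℚ.*_) (e' i)) (sym (ℚr.ι-* s (z' i))))) }
  where
  nz : s ℤ.* s' ≢ + 0
  nz q with ℤₚ.i*j≡0⇒i≡0∨j≡0 s q
  ... | inj₁ p = s≢0 p
  ... | inj₂ p = s'≢0 p

module FractionCohomology {c ℓ} (F : Field c ℓ) (ι-injective : CharacteristicZero F) (clear-all : CommonDenominators F) (P : SimplicialPoset) (dim : ℕ) where
  open RingTools (Field.commutativeRing F)
  open Cells (Field.commutativeRing F) P using (n; vt; rank; δ; δ-cong; δ-*)
  private module I = Cells ℤₚ.+-*-commutativeRing P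
  open Integral (Field.commutativeRing F)
  open WeightedAcyclic (Field.commutativeRing F) P dim using (offR; PlainExact)

  offI : Subset n → Fin n → ℤ
  offI Z v = not (lookup Z v) I.▹ + 1

  IntegralExact : Set
  IntegralExact = ∀ Z (j : Fin dim) (c : Fin n → ℤ) → (∀ T → ¬ (Z ⊆ vt T × rank T ≡ toℕ j) → c T ≡ + 0) → (∀ T → I.δ (offI Z) c T ≡ + 0) →
    ∃ λ s → ∃ λ (b : Fin n → ℤ) → s ≢ + 0 × (∀ H → ¬ (Z ⊆ vt H × suc (rank H) ≡ toℕ j) → b H ≡ + 0) × (∀ T → I.δ (offI Z) b T ≡ s ℤ.* c T)

  ι-off : ∀ Z v → ι (offI Z v) ≈ offR Z v
  ι-off Z v with lookup Z v
  ... | true = ≈-refl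
  ... | false = ι-1

  product-≢0 : ∀ {s t} → s ≢ + 0 → t ≢ + 0 → ¬ ι (s ℤ.* t) ≈ 0#
  product-≢0 {s} p q e with ℤₚ.i*j≡0⇒i≡0∨j≡0 s (ι-injective e)
  ... | inj₁ r = p r
  ... | inj₂ r = q r

  module _ (integral : IntegralExact) (Z : Subset n) (j : ℕ) (lt : j < dim) (c : Fin n → Carrier)
           (sc : ∀ T → ¬ (Z ⊆ vt T × rank T ≡ j) → c T ≈ 0#) (δc : ∀ T → δ (offR Z) c T ≈ 0#) where
    private
      j≡ : toℕ (fromℕ< lt) ≡ j
      j≡ = Fₚ.toℕ-fromℕ< lt

      s : ℤ
      s = proj₁ (clear-all c)
      z : Fin n → ℤ
      z = proj₁ (proj₂ (clear-all c))
      s≢0 : s ≢ + 0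
      s≢0 = proj₁ (proj₂ (proj₂ (clear-all c)))
      cleared : ∀ T → ι s * c T ≈ ι (z T)
      cleared = proj₂ (proj₂ (proj₂ (clear-all c)))

      cocycle : ∀ T → I.δ (offI Z) z T ≡ + 0
      cocycle T = ι-injective (≈-trans (ι-δ P (offI Z) z T) (≈-trans (δ-cong (ι-off Z) (λ U → ≈-sym (cleared U)) T) (≈-trans (δ-* (offR Z) (ι s) c T) (≈-trans (*-congˡ (δc T)) (zeroʳ _)))))

      Solution : Set
      Solution = ∃ λ s' → ∃ λ (b : Fin n → ℤ) → s' ≢ + 0 × (∀ H → ¬ (Z ⊆ vt H × suc (rank H) ≡ toℕ (fromℕ< lt)) → b H ≡ + 0) × (∀ T → I.δ (offI Z) b T ≡ s' ℤ.* z T)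

      solution : Solution
      solution = integral Z (fromℕ< lt) z (λ T k → ι-injective (≈-trans (≈-sym (cleared T)) (≈-trans (*-congˡ (sc T λ { (a , r) → k (a , trans r (sym j≡)) })) (zeroʳ _)))) cocycle

      divide : Solution → ∃ λ (b : Fin n → Carrier) → (∀ H → ¬ (Z ⊆ vt H × suc (rank H) ≡ j) → b H ≈ 0#) × (∀ T → δ (offR Z) b T ≈ c T)
      divide (s' , b , s'≢0 , sb , δb) = (λ H → w * ι (b H)) , (λ H k → ≈-trans (*-congˡ (≈-reflexive (cong ι (sb H λ { (a , r) → k (a , trans r j≡) })))) (zeroʳ w)) ,
          λ T → ≈-trans (δ-* (offR Z) w (λ U → ι (b U)) T) (≈-trans (*-congˡ (≈-trans (δ-cong {c = λ U → ι (b U)} {λ U → ι (b U)} (λ v → ≈-sym (ι-off Z v)) (λ _ → ≈-refl) T) (≈-trans (≈-sym (ι-δ P (offI Z) b T)) (≈-reflexive (cong ι (δb T))))))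
            (≈-trans (*-congˡ (≈-trans (ι-* s' (z T)) (*-congˡ (≈-sym (cleared T))))) (≈-trans (solve 4 (λ w a b c → w :* (a :* (b :* c)) := ((a :* b) :* w) :* c) ≈-refl w (ι s') (ι s) (c T)) (≈-trans (*-congʳ tw) (*-identityˡ (c T))))))
        where
        inv = Field.inverse F (ι (s' ℤ.* s)) (product-≢0 s'≢0 s≢0)
        w = proj₁ inv
        tw : (ι s' * ι s) * w ≈ 1#
        tw = ≈-trans (*-congʳ (≈-sym (ι-* s' s))) (proj₂ inv)

    -- Clear denominators, solve over the integers up to a factor, and divide by both factors.
    fraction-exact : ∃ λ (b : Fin n → Carrier) → (∀ H → ¬ (Z ⊆ vt H × suc (rank H) ≡ j) → b H ≈ 0#) × (∀ T → δ (offR Z) b T ≈ c T)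
    fraction-exact = divide solution

-- Linear forms in general position with prescribed residues modulo 2

-- Closed under divided differences, which is what elimination does to a column of values.
IsMonic : ℕ → (ℤ → ℤ) → Set
IsMonic zero f = ∀ t → f t ≡ + 1
IsMonic (suc k) f = ∀ τ → ∃ λ g → IsMonic k g × (∀ t → f t ℤ.- f τ ≡ (t ℤ.- τ) ℤ.* g t)

monic-add : ∀ k {f g} c → IsMonic (suc k) f → IsMonic k g → IsMonic (suc k) (λ t → f t ℤ.+ c ℤ.* g t)
monic-add zero {f} {g} c mf mg τ with mf τ
... | f' , mf' , e = f' , mf' , λ t → trans (cong₂ (λ a b → f t ℤ.+ c ℤ.* a ℤ.- (f τ ℤ.+ c ℤ.* b)) (mg t) (mg τ))
  (trans (ℤr.solve 3 (λ a b c → a ℤr.:+ c ℤr.:* ℤr.con (+ 1) ℤr.:- (b ℤr.:+ c ℤr.:* ℤr.con (+ 1)) ℤr.:= a ℤr.:- b) refl (f t) (f τ) c) (e t))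
monic-add (suc k) {f} {g} c mf mg τ with mf τ | mg τ
... | f' , mf' , e | g' , mg' , e' = (λ t → f' t ℤ.+ c ℤ.* g' t) , monic-add k {f'} {g'} c mf' mg' , λ t →
  trans (ℤr.solve 5 (λ a b c d e → a ℤr.:+ c ℤr.:* d ℤr.:- (b ℤr.:+ c ℤr.:* e) ℤr.:= (a ℤr.:- b) ℤr.:+ c ℤr.:* (d ℤr.:- e)) refl (f t) (f τ) c (g t) (g τ))
  (trans (cong₂ (λ a b → a ℤ.+ c ℤ.* b) (e t) (e' t)) (ℤr.solve 4 (λ d a c b → d ℤr.:* a ℤr.:+ c ℤr.:* (d ℤr.:* b) ℤr.:= d ℤr.:* (a ℤr.:+ c ℤr.:* b)) refl (t ℤ.- τ) (f' t) c (g' t)))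

-- Product rule for divided differences: `t f(t) - τ f(τ) = (t - τ) (f(t) + τ
-- g(t))`, where `g` is the divided difference of `f` at `τ`.
monic-shift : ∀ k {f} → IsMonic k f → IsMonic (suc k) (λ t → t ℤ.* f t)
monic-shift zero {f} mf τ = f , mf , λ t → trans (cong₂ (λ a b → t ℤ.* a ℤ.- τ ℤ.* b) (mf t) (mf τ)) (trans (ℤr.solve 2 (λ t τ → t ℤr.:* ℤr.con (+ 1) ℤr.:- τ ℤr.:* ℤr.con (+ 1) ℤr.:= (t ℤr.:- τ) ℤr.:* ℤr.con (+ 1)) refl t τ) (cong ((t ℤ.- τ) ℤ.*_) (sym (mf t))))
monic-shift (suc k) {f} mf τ with mf τ
... | g , mg , e = (λ t → f t ℤ.+ τ ℤ.* g t) , monic-add k {f} {g} τ mf mg , λ t →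
  trans (ℤr.solve 4 (λ t τ a b → t ℤr.:* a ℤr.:- τ ℤr.:* b ℤr.:= (t ℤr.:- τ) ℤr.:* a ℤr.:+ τ ℤr.:* (a ℤr.:- b)) refl t τ (f t) (f τ))
  (trans (cong (λ x → (t ℤ.- τ) ℤ.* f t ℤ.+ τ ℤ.* x) (e t)) (ℤr.solve 4 (λ d a τ g → d ℤr.:* a ℤr.:+ τ ℤr.:* (d ℤr.:* g) ℤr.:= d ℤr.:* (a ℤr.:+ τ ℤr.:* g)) refl (t ℤ.- τ) (f t) τ (g t)))

monic-power : ∀ k → IsMonic k (λ t → t ℤ.^ k)
monic-power zero t = refl
monic-power (suc k) = monic-shift k (monic-power k)

module Residues (M : ℤ) (M≢1 : ∀ r → + 1 ≢ r ℤ.* M) where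
  infix 4 _≡ₘ_
  _≡ₘ_ : ℤ → ℤ → Set
  a ≡ₘ b = ∃ λ r → a ≡ b ℤ.+ r ℤ.* M

  record Unit (a : ℤ) : Set where
    constructor ⟪_⟫
    field inverted : ∃ λ b → a ℤ.* b ≡ₘ + 1

  unit-* : ∀ {a b} → Unit a → Unit b → Unit (a ℤ.* b)
  unit-* {a} {b} ⟪ a' , r , e ⟫ ⟪ b' , r' , e' ⟫ = ⟪_⟫ $ a' ℤ.* b' , r ℤ.+ r' ℤ.+ r ℤ.* r' ℤ.* M ,
    trans (ℤr.solve 4 (λ a b a' b' → (a ℤr.:* b) ℤr.:* (a' ℤr.:* b') ℤr.:= (a ℤr.:* a') ℤr.:* (b ℤr.:* b')) refl a b a' b')
    (trans (cong₂ ℤ._*_ e e') (ℤr.solve 3 (λ r s m → (ℤr.con (+ 1) ℤr.:+ r ℤr.:* m) ℤr.:* (ℤr.con (+ 1) ℤr.:+ s ℤr.:* m) ℤr.:= ℤr.con (+ 1) ℤr.:+ (r ℤr.:+ s ℤr.:+ r ℤr.:* s ℤr.:* m) ℤr.:* m) refl r r' M))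

  unit-resp : ∀ {a b} → a ≡ₘ b → Unit b → Unit a
  unit-resp {a} {b} (r , e) ⟪ c , s , f ⟫ = ⟪_⟫ $ c , s ℤ.+ r ℤ.* c , trans (cong (ℤ._* c) e) (trans (ℤr.solve 4 (λ b r m c → (b ℤr.:+ r ℤr.:* m) ℤr.:* c ℤr.:= b ℤr.:* c ℤr.:+ (r ℤr.:* c) ℤr.:* m) refl b r M c)
    (trans (cong (ℤ._+ r ℤ.* c ℤ.* M) f) (ℤr.solve 4 (λ s m r c → ℤr.con (+ 1) ℤr.:+ s ℤr.:* m ℤr.:+ r ℤr.:* c ℤr.:* m ℤr.:= ℤr.con (+ 1) ℤr.:+ (s ℤr.:+ r ℤr.:* c) ℤr.:* m) refl s M r c)))

  unit-≢0 : ∀ {a} → Unit a → a ≢ + 0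
  unit-≢0 ⟪ b , r , e ⟫ refl = M≢1 (ℤ.- r) (trans (ℤr.solve 2 (λ r m → ℤr.con (+ 1) ℤr.:= (ℤr.con (+ 1) ℤr.:+ r ℤr.:* m) ℤr.:+ (ℤr.:- r) ℤr.:* m) refl r M)
    (trans (cong (ℤ._+ ℤ.- r ℤ.* M) (trans (sym e) (ℤₚ.*-zeroˡ b))) (ℤₚ.+-identityˡ _)))

  -- `Generic` with cleared denominators, so that nonvanishing can be tested by residues modulo `M`.
  GenericZ : ∀ {k} → ℕ → (Fin k → ℕ → ℤ) → Subset k → Set
  GenericZ zero form Z = ⊤
  GenericZ (suc s) form Z = ∀ w → w ∉ Z → form w 0 ≢ + 0 × GenericZ s (λ v k → form w 0 ℤ.* form v (suc k) ℤ.- form v 0 ℤ.* form w (suc k)) (ins Z w)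

  -- If column `k` is `γ v f_k(t v)` modulo `M`, eliminating `w` replaces each polynomial by its
  -- divided difference at `t w`, one degree lower, and `γ v` by `γ v γ w (t v - t w)`, which is
  -- again a unit.
  monic-generic : ∀ {k} s (t : Fin k → ℤ) → (∀ {v w} → v ≢ w → Unit (t v ℤ.- t w)) → (form : Fin k → ℕ → ℤ) (Z : Subset k) (γ : Fin k → ℤ) → (∀ v → v ∉ Z → Unit (γ v)) →
    (f : ℕ → ℤ → ℤ) → (∀ k → IsMonic k (f k)) → (∀ v k → form v k ≡ₘ γ v ℤ.* f k (t v)) → GenericZ s form Z
  monic-generic zero t ut form Z γ uγ f mf e = tt
  monic-generic (suc s) t ut form Z γ uγ f mf e w w∉ = unit-≢0 (unit-resp {form w 0} {γ w ℤ.* f 0 (t w)} (e w 0) (subst Unit (sym (trans (cong (γ w ℤ.*_) (mf 0 (t w))) (ℤₚ.*-identityʳ (γ w)))) (uγ w w∉))) ,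
    monic-generic s t ut _ (ins Z w) (λ v → γ v ℤ.* γ w ℤ.* (t v ℤ.- t w)) uγ' (λ k → proj₁ (mf (suc k) (t w))) (λ k → proj₁ (proj₂ (mf (suc k) (t w)))) e'
    where
    uγ' : ∀ v → v ∉ ins Z w → Unit (γ v ℤ.* γ w ℤ.* (t v ℤ.- t w))
    uγ' v v∉ = unit-* (unit-* (uγ v (trans (sym (lookup-ins Z v≢w)) v∉)) (uγ w w∉)) (ut v≢w)
      where
      v≢w : v ≢ w
      v≢w refl = true≢false (∈-ins Z v) v∉
    e' : ∀ v k → form w 0 ℤ.* form v (suc k) ℤ.- form v 0 ℤ.* form w (suc k) ≡ₘ (γ v ℤ.* γ w ℤ.* (t v ℤ.- t w)) ℤ.* proj₁ (mf (suc k) (t w)) (t v)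
    e' v k with e w 0 | e v (suc k) | e v 0 | e w (suc k)
    ... | r₁ , e₁ | r₂ , e₂ | r₃ , e₃ | r₄ , e₄ = R , trans (cong₂ (λ a b → a ℤ.* form v (suc k) ℤ.- b ℤ.* form w (suc k)) (one w r₁ e₁) (one v r₃ e₃)) (trans (cong₂ (λ a b → (γ w ℤ.+ r₁ ℤ.* M) ℤ.* a ℤ.- (γ v ℤ.+ r₃ ℤ.* M) ℤ.* b) e₂ e₄)
        (trans (ℤr.solve 9 (λ gw gv r₁ r₂ r₃ r₄ m fv fw →
            (gw ℤr.:+ r₁ ℤr.:* m) ℤr.:* (gv ℤr.:* fv ℤr.:+ r₂ ℤr.:* m) ℤr.:- (gv ℤr.:+ r₃ ℤr.:* m) ℤr.:* (gw ℤr.:* fw ℤr.:+ r₄ ℤr.:* m) ℤr.:=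
            gv ℤr.:* gw ℤr.:* (fv ℤr.:- fw) ℤr.:+ (gw ℤr.:* r₂ ℤr.:+ r₁ ℤr.:* (gv ℤr.:* fv ℤr.:+ r₂ ℤr.:* m) ℤr.:- (gv ℤr.:* r₄ ℤr.:+ r₃ ℤr.:* (gw ℤr.:* fw ℤr.:+ r₄ ℤr.:* m))) ℤr.:* m)
          refl (γ w) (γ v) r₁ r₂ r₃ r₄ M (f (suc k) (t v)) (f (suc k) (t w)))
        (cong (ℤ._+ R ℤ.* M) (trans (cong (γ v ℤ.* γ w ℤ.*_) (proj₂ (proj₂ (mf (suc k) (t w))) (t v))) (sym (ℤₚ.*-assoc (γ v ℤ.* γ w) (t v ℤ.- t w) _))))))
      where
      R : ℤ
      R = γ w ℤ.* r₂ ℤ.+ r₁ ℤ.* (γ v ℤ.* f (suc k) (t v) ℤ.+ r₂ ℤ.* M) ℤ.- (γ v ℤ.* r₄ ℤ.+ r₃ ℤ.* (γ w ℤ.* f (suc k) (t w) ℤ.+ r₄ ℤ.* M))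
      one : ∀ w r → form w 0 ≡ γ w ℤ.* f 0 (t w) ℤ.+ r ℤ.* M → form w 0 ≡ γ w ℤ.+ r ℤ.* M
      one w r q = trans q (cong (ℤ._+ r ℤ.* M) (trans (cong (γ w ℤ.*_) (mf 0 (t w))) (ℤₚ.*-identityʳ (γ w))))

module Forms (N : ℕ) where

  -- `M` is odd, and it is 1 modulo every divisor of `F`; in particular each nonzero difference of
  -- two points, which divides `F`, is a unit modulo `M`.
  F M : ℤ
  F = + (N !)
  M = + 1 ℤ.+ + 2 ℤ.* F

  M≢1 : ∀ r → + 1 ≢ r ℤ.* M
  M≢1 r e = case (ℕₚ.m*n≡1⇒n≡1 ℤ.∣ r ∣ ℤ.∣ M ∣ (trans (sym (ℤₚ.abs-* r M)) (cong ℤ.∣_∣ (sym e))))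
    where
    abs : ℤ.∣ M ∣ ≡ suc (2 ℕ.* N !)
    abs = cong ℤ.∣_∣ (cong (λ x → + 1 ℤ.+ x) (sym (ℤₚ.pos-* 2 (N !))))
    case : ℤ.∣ M ∣ ≡ 1 → Void
    case q = ℕ.≢-nonZero⁻¹ (2 ℕ.* N !) ⦃ ℕₚ.m*n≢0 2 (N !) ⦃ _ ⦄ ⦃ N ℕₚ.!≢0 ⦄ ⦄ (ℕₚ.suc-injective (trans (sym abs) q))

  open Residues M M≢1

  -- If `q d = N !`, then `d (- 2 q) = 1 - M`.
  small-unit : ∀ d → 0 < d → d ≤ N → Unit (+ d)
  small-unit (suc d) _ le with ℕᵈ.∣-trans (ℕᵈ.m∣m*n {suc d} (d !)) (ℕᵈ.m≤n⇒m!∣n! le)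
  ... | ℕᵈ.divides q e = ⟪_⟫ $ ℤ.- (+ 2 ℤ.* + q) , ℤ.- + 1 , trans (ℤr.solve 2 (λ d q → d ℤr.:* (ℤr.:- (ℤr.con (+ 2) ℤr.:* q)) ℤr.:= ℤr.:- (ℤr.con (+ 2) ℤr.:* (q ℤr.:* d))) refl (+ suc d) (+ q))
    (trans (cong (λ x → ℤ.- (+ 2 ℤ.* x)) (trans (sym (ℤₚ.pos-* q (suc d))) (cong +_ (sym e)))) (ℤr.solve 1 (λ f → ℤr.:- (ℤr.con (+ 2) ℤr.:* f) ℤr.:= ℤr.con (+ 1) ℤr.:+ ℤr.con (ℤ.- + 1) ℤr.:* (ℤr.con (+ 1) ℤr.:+ ℤr.con (+ 2) ℤr.:* f)) refl F))

  unit-neg : ∀ {a} → Unit a → Unit (ℤ.- a)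
  unit-neg {a} ⟪ b , r , e ⟫ = ⟪_⟫ $ ℤ.- b , r , trans (ℤr.solve 2 (λ a b → (ℤr.:- a) ℤr.:* (ℤr.:- b) ℤr.:= a ℤr.:* b) refl a b) e

  point : Fin N → ℤ
  point v = + toℕ v

  difference-unit : ∀ {v w : Fin N} → v ≢ w → Unit (point v ℤ.- point w)
  difference-unit {v} {w} k with ℕₚ.<-cmp (toℕ v) (toℕ w)
  ... | tri≈ _ e _ = absurd (k (Fₚ.toℕ-injective e))
  ... | tri> _ _ gt = subst Unit (sym (trans (ℤₚ.[+m]-[+n]≡m⊖n (toℕ v) (toℕ w)) (ℤₚ.⊖-≥ (ℕₚ.<⇒≤ gt)))) (small-unit (toℕ v ∸ toℕ w) (ℕₚ.m<n⇒0<n∸m gt) (ℕₚ.≤-trans (ℕₚ.m∸n≤m (toℕ v) (toℕ w)) (ℕₚ.<⇒≤ (Fₚ.toℕ<n v))))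
  ... | tri< lt _ _ = subst Unit (sym (trans (ℤₚ.[+m]-[+n]≡m⊖n (toℕ v) (toℕ w)) (ℤₚ.⊖-< lt))) (unit-neg (small-unit (toℕ w ∸ toℕ v) (ℕₚ.m<n⇒0<n∸m lt) (ℕₚ.≤-trans (ℕₚ.m∸n≤m (toℕ w) (toℕ v)) (ℕₚ.<⇒≤ (Fₚ.toℕ<n w)))))

  -- Modulo the odd number M this is the moment curve, modulo 2 it is the indicator of W k.
  form : (ℕ → Fin N) → Fin N → ℕ → ℤ
  form W v zero = + 1
  form W v (suc k) = M ℤ.* (does (v Fₚ.≟ W k) ℤr.▹ + 1) ℤ.+ (+ 1 ℤ.+ M) ℤ.* point v ℤ.^ suc k

  form-generic : ∀ s W → GenericZ s (form W) ⊥
  form-generic s W = monic-generic s point difference-unit (form W) ⊥ (λ _ → + 1) (λ _ _ → ⟪ + 1 , + 0 , refl ⟫) (λ k t → t ℤ.^ k) monic-power residue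
    where
    residue : ∀ v k → form W v k ≡ₘ + 1 ℤ.* point v ℤ.^ k
    residue v zero = + 0 , refl
    residue v (suc k) = (does (v Fₚ.≟ W k) ℤr.▹ + 1) ℤ.+ point v ℤ.^ suc k , ℤr.solve 3 (λ m d p → m ℤr.:* d ℤr.:+ (ℤr.con (+ 1) ℤr.:+ m) ℤr.:* p ℤr.:= ℤr.con (+ 1) ℤr.:* p ℤr.:+ (d ℤr.:+ p) ℤr.:* m) refl M (does (v Fₚ.≟ W k) ℤr.▹ + 1) (point v ℤ.^ suc k)

module FormsOver {c ℓ} (K : Field c ℓ) (ι-injective : CharacteristicZero K) (P : SimplicialPoset) (M : ℤ) (M≢1 : ∀ r → + 1 ≢ r ℤ.* M) where
  open RingTools (Field.commutativeRing K)
  open Faces P using (n)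
  open Residues M M≢1
  open Weighted (Field.commutativeRing K) P using (Generic)

  -- Normalising the pivots and clearing denominators differ by a nonzero factor for each vertex;
  -- `scale` keeps track of it through the elimination.
  generic-scaled : ∀ s (intForm : Fin n → ℕ → ℤ) (Z : Subset n) (form : Fin n → ℕ → Carrier) (scale : Fin n → Carrier) → (∀ v → ¬ scale v ≈ 0#) →
    (∀ v k → form v k ≈ scale v * ι (intForm v k)) → GenericZ s intForm Z → Generic s form Z
  generic-scaled zero intForm Z form scale nz e g = Level.lift tt
  generic-scaled (suc s) intForm Z form scale nz e g w w∉ = y * z , inverse ,
      generic-scaled s _ (ins Z w) _ (λ v → scale v * y) (λ v q → nz v (cancel q)) e' (proj₂ (g w w∉))
    where
    lead : ¬ ι (intForm w 0) ≈ 0#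
    lead q = proj₁ (g w w∉) (ι-injective q)
    y z : Carrier
    y = proj₁ (Field.inverse K (ι (intForm w 0)) lead)
    z = proj₁ (Field.inverse K (scale w) (nz w))
    yy : ι (intForm w 0) * y ≈ 1#
    yy = proj₂ (Field.inverse K (ι (intForm w 0)) lead)
    zz : scale w * z ≈ 1#
    zz = proj₂ (Field.inverse K (scale w) (nz w))
    inverse : form w 0 * (y * z) ≈ 1#
    inverse = ≈-trans (*-congʳ (e w 0)) (≈-trans (solve 4 (λ s a y z → (s :* a) :* (y :* z) := (a :* y) :* (s :* z)) ≈-refl (scale w) (ι (intForm w 0)) y z) (≈-trans (*-cong yy zz) (*-identityˡ 1#)))
    cancel : ∀ {x} → x * y ≈ 0# → x ≈ 0#
    cancel {x} q = ≈-trans (≈-sym (*-identityʳ x)) (≈-trans (*-congˡ (≈-sym yy)) (≈-trans (solve 3 (λ x a y → x :* (a :* y) := a :* (x :* y)) ≈-refl x (ι (intForm w 0)) y) (≈-trans (*-congˡ q) (zeroʳ _))))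
    e' : ∀ v k → form v (suc k) - (form v 0 * (y * z)) * form w (suc k) ≈ (scale v * y) * ι (intForm w 0 ℤ.* intForm v (suc k) ℤ.- intForm v 0 ℤ.* intForm w (suc k))
    e' v k = begin
      form v (suc k) - (form v 0 * (y * z)) * form w (suc k)
        ≈⟨ +-cong (e v (suc k)) (-‿cong (*-cong (*-congʳ (e v 0)) (e w (suc k)))) ⟩
      scale v * a - ((scale v * b) * (y * z)) * (scale w * d)
        ≈⟨ solve 7 (λ s a b y z t d → s :* a :- ((s :* b) :* (y :* z)) :* (t :* d) := s :* a :- ((s :* b) :* (y :* d)) :* (t :* z)) ≈-refl (scale v) a b y z (scale w) d ⟩
      scale v * a - ((scale v * b) * (y * d)) * (scale w * z)
        ≈⟨ +-cong (≈-sym (*-identityʳ _)) (-‿cong (*-congˡ zz)) ⟩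
      (scale v * a) * 1# - ((scale v * b) * (y * d)) * 1#
        ≈⟨ +-cong (*-congˡ (≈-sym yy)) (-‿cong (*-identityʳ _)) ⟩
      (scale v * a) * (ι (intForm w 0) * y) - (scale v * b) * (y * d)
        ≈⟨ solve 6 (λ s a c y b d → (s :* a) :* (c :* y) :- (s :* b) :* (y :* d) := (s :* y) :* (c :* a :+ (:- (b :* d)))) ≈-refl (scale v) a (ι (intForm w 0)) y b d ⟩
      (scale v * y) * (ι (intForm w 0) * a + - (b * d))
        ≈⟨ *-congˡ (≈-sym (≈-trans (ι-+ (intForm w 0 ℤ.* intForm v (suc k)) (ℤ.- (intForm v 0 ℤ.* intForm w (suc k)))) (+-cong (ι-* (intForm w 0) (intForm v (suc k))) (≈-trans (ι-neg (intForm v 0 ℤ.* intForm w (suc k))) (-‿cong (ι-* (intForm v 0) (intForm w (suc k)))))))) ⟩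
      (scale v * y) * ι (intForm w 0 ℤ.* intForm v (suc k) ℤ.- intForm v 0 ℤ.* intForm w (suc k)) ∎
      where
      a = ι (intForm v (suc k))
      b = ι (intForm v 0)
      d = ι (intForm w (suc k))

-- Iterated contractions and parity

maximum : (S : Subset N) → (∀ y → y ∉ S) ⊎ (∃ λ x → x ∈ S × (∀ y → y ∈ S → toℕ y ≤ toℕ x))
maximum [] = inj₁ λ ()
maximum (b ∷ S) with maximum S
... | inj₂ (x , x∈ , h) = inj₂ (suc x , x∈ , λ { zero _ → z≤n ; (suc y) p → s≤s (h y p) })
maximum (false ∷ S) | inj₁ h = inj₁ λ { zero → refl ; (suc y) → h y }
maximum (true ∷ S) | inj₁ h = inj₂ (zero , refl , λ { zero _ → z≤n ; (suc y) p → absurd (true≢false p (h y)) })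

module Links {c ℓ} (R : CommutativeRing c ℓ) (P : SimplicialPoset) where
  open Cells R P

  link : Fin n → (Fin n → Carrier) → Fin n → Carrier
  link w c H = ∑ λ T → cov w H T ▹ c T

  links : (ℕ → Fin n) → ℕ → (Fin n → Carrier) → Fin n → Carrier
  links W zero c = c
  links W (suc k) c = link (W k) (links W k c)

  link-cong : ∀ w {c c'} → (∀ T → c T ≈ c' T) → ∀ H → link w c H ≈ link w c' H
  link-cong w h H = ∑-cong λ T → ▹-cong (cov w H T) λ _ → h T

  links-front : ∀ W k c → links W (suc k) c ≡ links (W ∘ suc) k (link (W 0) c)
  links-front W zero c = refl
  links-front W (suc k) c = cong (link (W (suc k))) (links-front W k c)

  Below : Fin n → Fin n → Set
  Below w H = ∀ v → v ∈ vt H → toℕ v < toℕ w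

  abstract
    below : Fin n → Fin n → Bool
    below w H = does (Fₚ.all? (λ v → implies v (lookup (vt H) v) refl))
      where
      implies : ∀ v b → lookup (vt H) v ≡ b → Dec (v ∈ vt H → toℕ v < toℕ w)
      implies v false e = yes λ p → absurd (true≢false p e)
      implies v true e with toℕ v ℕₚ.<? toℕ w
      ... | yes p = yes λ _ → p
      ... | no k = no λ h → k (h e)

    below⇒ : ∀ {w H} → below w H ≡ true → Below w H
    below⇒ = does-true (Fₚ.all? _)

    ⇒below : ∀ {w H} → Below w H → below w H ≡ true
    ⇒below = dec-true (Fₚ.all? _)

  below-cover : ∀ {w u H T} → Cover u H T → below w T ≡ (toℕ u <ᵇ toℕ w) ∧ below w H
  below-cover {w} {u} {H} {T} cv = bool-ext
    (λ p → ∧-intro (<ᵇ-true (below⇒ p u (Cover.v∈T cv))) (⇒below λ v q → below⇒ p v (into (vt-mono (Cover.H≼T cv)) q)))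
    (λ p → ⇒below λ v q → case v q (∧-true {toℕ u <ᵇ toℕ w} p))
    where
    case : ∀ v → v ∈ vt T → (toℕ u <ᵇ toℕ w) ≡ true × below w H ≡ true → toℕ v < toℕ w
    case v q (a , b) with v Fₚ.≟ u
    ... | yes refl = <ᵇ⇒< a
    ... | no k = below⇒ b v (trans (sym (lookup-ins (vt H) k)) (trans (cong (λ S → lookup S v) (sym (Cover.vtT cv))) q))

  restrict : Fin n → (Fin n → Carrier) → Fin n → Carrier
  restrict w c H = below w H ▹ c H

  -- Adjoining `u` keeps all vertices before `w` if `u` precedes `w`, and violates the restriction
  -- otherwise; the outcome does not depend on the face.
  link-restrict : ∀ w u q c H → link u (λ T → q ▹ restrict w c T) H ≈ (q ∧ (toℕ u <ᵇ toℕ w)) ▹ restrict w (link u c) H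
  link-restrict w u q c H = ≈-trans (∑-cong λ T → ≈-trans (▹-cong (cov u H T) λ e → ≈-trans (▹-cong q λ _ → ≈-trans (▹-≡ (below-cover (cover e))) (▹-∧ (toℕ u <ᵇ toℕ w) _)) (≈-sym (▹-∧ q _)))
      (commute (cov u H T) (q ∧ (toℕ u <ᵇ toℕ w)) (below w H)))
    (≈-sym (≈-trans (▹-cong (q ∧ (toℕ u <ᵇ toℕ w)) λ _ → ▹-∑ (below w H) _) (▹-∑ (q ∧ (toℕ u <ᵇ toℕ w)) _)))
    where
    commute : ∀ a b d {x} → a ▹ (b ▹ (d ▹ x)) ≈ b ▹ (d ▹ (a ▹ x))
    commute true b d = ≈-refl
    commute false b d = ≈-sym (▹-0 b λ _ → ▹-0 d λ _ → ≈-refl)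

  links-restrict : ∀ w W k c → ∃ λ q → ∀ H → links W k (restrict w c) H ≈ q ▹ restrict w (links W k c) H
  links-restrict w W zero c = true , λ H → ≈-refl
  links-restrict w W (suc k) c with links-restrict w W k c
  ... | q , h = q ∧ (toℕ (W k) <ᵇ toℕ w) , λ H → ≈-trans (link-cong (W k) h H) (link-restrict w (W k) q (links W k c) H)

  -- After exchanging the sums, `T` contributes for those of its vertices that exceed all the
  -- others, that is, once, at its maximum.
  by-maximum : ∀ c → (∀ T → rank T ≡ 0 → c T ≈ 0#) → ∑ (λ w → ∑ (restrict w (link w c))) ≈ ∑ c
  by-maximum c c0 = begin
    ∑ (λ w → ∑ λ H → below w H ▹ (∑ λ T → cov w H T ▹ c T))
      ≈⟨ (∑-cong λ w → ≈-trans (∑-cong λ H → ▹-∑ (below w H) _) (∑-swap _)) ⟩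
    ∑ (λ w → ∑ λ T → ∑ λ H → below w H ▹ (cov w H T ▹ c T))
      ≈⟨ ≈-trans (∑-swap _) (∑-cong λ T → ∑-cong λ w → face-opposite w T) ⟩
    ∑ (λ T → ∑ λ w → below w (del T w) ▹ (lookup (vt T) w ▹ c T))
      ≈⟨ ∑-cong (λ T → pick T (maximum (vt T))) ⟩
    ∑ c ∎
    where
    face-opposite : ∀ w T → ∑ (λ H → below w H ▹ (cov w H T ▹ c T)) ≈ below w (del T w) ▹ (lookup (vt T) w ▹ c T)
    face-opposite w T = ≈-trans (∑-single (del T w) λ H k → ▹-0 (below w H) λ _ → ▹-false (cov-off k)) (▹-cong (below w (del T w)) λ _ → ▹-≡ cov-on)
    pick : ∀ T → (∀ y → y ∉ vt T) ⊎ (∃ λ x → x ∈ vt T × (∀ y → y ∈ vt T → toℕ y ≤ toℕ x)) →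
      ∑ (λ w → below w (del T w) ▹ (lookup (vt T) w ▹ c T)) ≈ c T
    pick T (inj₁ h) = ≈-trans (∑-0 λ w → ▹-0 (below w (del T w)) λ _ → ▹-false (h w)) (≈-sym (c0 T (trans (rank≡ T) (trans (∣∣≡# (vt T)) (#-none h)))))
    pick T (inj₂ (x , x∈ , h)) = ≈-trans (∑-single x λ w k → ▹-0 (below w (del T w)) λ b → ▹-0 (lookup (vt T) w) λ w∈ → absurd (off w k (below⇒ b) w∈))
        (≈-trans (▹-true (⇒below on)) (▹-true x∈))
      where
      off : ∀ w → w ≢ x → Below w (del T w) → w ∈ vt T → Void
      off w k b w∈ = ℕₚ.<⇒≱ (b x (subst (x ∈_) (sym (vt-del T w)) (∈-rem (vt T) x∈ (k ∘ sym)))) (h w w∈)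
      on : Below x (del T x)
      on v v∈ = ℕₚ.≤∧≢⇒< (h v (into (rem-⊆ (vt T) x) v∈′)) λ e → true≢false v∈′ (trans (cong (lookup (rem (vt T) x)) (Fₚ.toℕ-injective e)) (∉-rem (vt T) x))
        where
        v∈′ : v ∈ rem (vt T) x
        v∈′ = subst (v ∈_) (vt-del T x) v∈

  -- Each face is counted once, by deleting its k largest vertices in decreasing order.
  links-zero⇒sum-zero : ∀ k c → (∀ T → rank T < k → c T ≈ 0#) → (∀ W H → links W k c H ≈ 0#) → ∑ c ≈ 0#
  links-zero⇒sum-zero zero c low z = ∑-0 λ T → z (λ _ → bot) T
  links-zero⇒sum-zero (suc k) c low z = ≈-trans (≈-sym (by-maximum c λ T r → low T (subst (_< suc k) (sym r) (s≤s z≤n))))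
    (∑-0 λ w → links-zero⇒sum-zero k (restrict w (link w c)) (low' w) (z' w))
    where
    low' : ∀ w H → rank H < k → restrict w (link w c) H ≈ 0#
    low' w H lt = ▹-0 (below w H) λ _ → ∑-0 λ T → ▹-0 (cov w H T) λ e → low T (subst (_< suc k) (sym (Cover.rankT (cover e))) (s≤s lt))
    z' : ∀ w W H → links W k (restrict w (link w c)) H ≈ 0#
    z' w W H with links-restrict w W k (link w c)
    ... | q , h = ≈-trans (h H) (▹-0 q λ _ → ▹-0 (below w H) λ _ → ≈-trans (≈-reflexive (sym (cong (λ f → f H) (links-front W' k c)))) (z W' H))
      where
      W' : ℕ → Fin n
      W' zero = w
      W' (suc l) = W l

module Contraction {c ℓ} (R : CommutativeRing c ℓ) (P : SimplicialPoset) where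
  open Cells R P

  -- Form 0 is left out: in the application it is the constant 1, whose boundary kills the starting
  -- cycle.
  contracted : (Fin n → ℕ → Carrier) → ℕ → (Fin n → Carrier) → Fin n → Carrier
  contracted form zero c = c
  contracted form (suc k) c = ∂ (λ v → form v (suc k)) (contracted form k c)

  contracted-support : ∀ {form d c} → (∀ T → rank T ≢ d → c T ≈ 0#) → ∀ k T → rank T ℕ.+ k ≢ d → contracted form k c T ≈ 0#
  contracted-support h zero T r = h T λ e → r (trans (ℕₚ.+-identityʳ _) e)
  contracted-support {form} {c = c} h (suc k) H r = ∂-0 λ v T e → ≈-trans (*-congˡ (contracted-support {form} {c = c} h k T λ q →
    r (trans (ℕₚ.+-suc (rank H) k) (trans (cong (ℕ._+ k) (sym (Cover.rankT (cover e)))) q)))) (zeroʳ _)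

  -- The form applied last is killed by `∂∂`; every earlier one passes the last boundary by
  -- anticommutation.
  contracted-kernel : ∀ {form c} → (∀ H → ∂ (λ v → form v 0) c H ≈ 0#) → ∀ k j → j ≤ k → ∀ H → ∂ (λ v → form v j) (contracted form k c) H ≈ 0#
  contracted-kernel h zero .zero z≤n H = h H
  contracted-kernel {form} {c} h (suc k) j le H with j ℕₚ.≟ suc k
  ... | yes refl = ∂∂ (λ v → form v (suc k)) (contracted form k c) H
  ... | no j≢ = ≈-trans (≈-sym (≈-trans (+-congˡ (∂-0 λ v T _ → ≈-trans (*-congˡ (contracted-kernel {form} {c} h k j (ℕₚ.≤-pred (ℕₚ.≤∧≢⇒< le j≢)) T)) (zeroʳ _))) (+-identityʳ _)))
    (∂-anticomm (λ v → form v j) (λ v → form v (suc k)) (contracted form k c) H)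

module ContractionReduction {c ℓ} (R : CommutativeRing c ℓ) (P : SimplicialPoset) where
  open Cells R P
  open Integral R
  open Links R P
  open Contraction R P
  open Forms n using (form; M; F; point)
  private module Zc = Contraction ℤₚ.+-*-commutativeRing P

  ι-contracted : ∀ g k c H → ι (Zc.contracted g k c H) ≈ contracted (λ v j → ι (g v j)) k (λ T → ι (c T)) H
  ι-contracted g zero c H = ≈-refl
  ι-contracted g (suc k) c H = ≈-trans (ι-∂ P (λ v → g v (suc k)) (Zc.contracted g k c) H) (∂-cong (λ _ → ≈-refl) (ι-contracted g k c) H)

  module Characteristic2 (two : 1# + 1# ≈ 0#) where

    sgn-1 : ∀ k → sgn k ≈ 1#
    sgn-1 zero = ≈-refl
    sgn-1 (suc k) = ≈-trans (-‿cong (sgn-1 k)) (≈-trans (solve 1 (λ x → :- x := x :- (x :+ x)) ≈-refl 1#) (≈-trans (+-congˡ (≈-trans (-‿cong two) -0#≈0#)) (+-identityʳ _)))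

    ι-2 : ι (+ 2) ≈ 0#
    ι-2 = ≈-trans (+-congˡ ι-1) two

    ι-M : ι M ≈ 1#
    ι-M = ≈-trans (ι-+ (+ 1) (+ 2 ℤ.* F)) (≈-trans (+-cong ι-1 (≈-trans (ι-* (+ 2) F) (≈-trans (*-congʳ ι-2) (zeroˡ _)))) (+-identityʳ _))

    ι-form : ∀ W v k → ι (form W v (suc k)) ≈ (does (v Fₚ.≟ W k) ▹ 1#)
    ι-form W v k = ≈-trans (ι-+ (M ℤ.* (does (v Fₚ.≟ W k) ℤr.▹ + 1)) ((+ 1 ℤ.+ M) ℤ.* point v ℤ.^ suc k)) (≈-trans (+-cong
        (≈-trans (ι-* M (does (v Fₚ.≟ W k) ℤr.▹ + 1)) (≈-trans (*-congʳ ι-M) (≈-trans (*-identityˡ _) (≈-trans (ι-▹ (does (v Fₚ.≟ W k)) (+ 1)) (▹-cong (does (v Fₚ.≟ W k)) λ _ → ι-1)))))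
        (≈-trans (ι-* (+ 1 ℤ.+ M) (point v ℤ.^ suc k)) (≈-trans (*-congʳ (≈-trans (ι-+ (+ 1) M) (≈-trans (+-cong ι-1 ι-M) two))) (zeroˡ _))))
      (+-identityʳ _))

    ∂-indicator : ∀ w c H → ∂ (λ v → does (v Fₚ.≟ w) ▹ 1#) c H ≈ link w c H
    ∂-indicator w c H = ≈-trans (∑-single w λ v k → ∑-0 λ T → ▹-0 (cov v H T) λ _ → ≈-trans (*-congˡ (≈-trans (*-congʳ (▹-false (dec-false (v Fₚ.≟ w) k))) (zeroˡ _))) (zeroʳ _))
      (∑-cong λ T → ▹-cong (cov w H T) λ _ → ≈-trans (*-cong (sgn-1 (cnt w (vt H))) (≈-trans (*-congʳ (▹-true (dec-true (w Fₚ.≟ w) refl))) (*-identityˡ _))) (*-identityˡ _))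

    contracted-links : ∀ W k c H → contracted (λ v j → ι (form W v j)) k c H ≈ links W k c H
    contracted-links W zero c H = ≈-refl
    contracted-links W (suc k) c H = ≈-trans (∂-cong (λ v → ι-form W v k) (contracted-links W k c) H) (∂-indicator (W k) (links W k c) H)

-- Parity of counts and the sum of the h-vector

module 𝔹 = RingTools Bₚ.xor-∧-commutativeRing

parity : ∀ {m} (p : Fin m → Bool) → ∃ λ q → # p ≡ b2n (𝔹.∑ p) ℕ.+ q ℕ.* 2
parity {zero} p = 0 , cong (λ b → b2n b ℕ.+ 0) (sym (𝔹.∑-[] p))
parity {suc m} p with parity (p ∘ suc) | 𝔹.∑-∷ p
... | q , h | e with p zero | 𝔹.∑ (p ∘ suc)
... | false | s = q , trans h (cong (λ b → b2n b ℕ.+ q ℕ.* 2) (sym e))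
... | true | false = q , trans (cong suc h) (cong (λ b → b2n b ℕ.+ q ℕ.* 2) (sym e))
... | true | true = suc q , trans (cong suc h) (cong (λ b → b2n b ℕ.+ suc q ℕ.* 2) (sym e))

sumℤ-+ : ∀ B (f g : ℕ → ℤ) → sumℤ B (λ j → f j ℤ.+ g j) ≡ sumℤ B f ℤ.+ sumℤ B g
sumℤ-+ zero f g = refl
sumℤ-+ (suc B) f g = trans (cong (λ t → t ℤ.+ (f B ℤ.+ g B)) (sumℤ-+ B f g))
  (ℤr.solve 4 (λ a b c d → (a ℤr.:+ b) ℤr.:+ (c ℤr.:+ d) ℤr.:= (a ℤr.:+ c) ℤr.:+ (b ℤr.:+ d)) refl (sumℤ B f) (sumℤ B g) (f B) (g B))

sumℤ-0 : ∀ B {f : ℕ → ℤ} → (∀ j → j < B → f j ≡ + 0) → sumℤ B f ≡ + 0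
sumℤ-0 zero h = refl
sumℤ-0 (suc B) h = cong₂ ℤ._+_ (sumℤ-0 B λ j p → h j (ℕₚ.m≤n⇒m≤1+n p)) (h B ℕₚ.≤-refl)

sumℤ-*ʳ : ∀ B (f : ℕ → ℤ) z → sumℤ B (λ j → f j ℤ.* z) ≡ sumℤ B f ℤ.* z
sumℤ-*ʳ zero f z = refl
sumℤ-*ʳ (suc B) f z = trans (cong (λ t → t ℤ.+ f B ℤ.* z) (sumℤ-*ʳ B f z)) (sym (ℤₚ.*-distribʳ-+ z (sumℤ B f) (f B)))

sumℤ-triangle : ∀ D (G : ℕ → ℕ → ℤ) → sumℤ D (λ i → sumℤ (suc i) (λ j → G j (i ∸ j))) ≡ sumℤ D (λ j → sumℤ (D ∸ j) (G j))
sumℤ-triangle zero G = refl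
sumℤ-triangle (suc D) G = begin
  sumℤ D (λ i → sumℤ (suc i) (λ j → G j (i ∸ j))) ℤ.+ sumℤ (suc D) (λ j → G j (D ∸ j))
    ≡⟨ cong (λ t → t ℤ.+ sumℤ (suc D) (λ j → G j (D ∸ j))) (sumℤ-triangle D G) ⟩
  sumℤ D (λ j → sumℤ (D ∸ j) (G j)) ℤ.+ sumℤ (suc D) (λ j → G j (D ∸ j))
    ≡⟨ cong (λ t → t ℤ.+ sumℤ (suc D) (λ j → G j (D ∸ j))) (sym (trans (cong (λ k → sumℤ D (λ j → sumℤ (D ∸ j) (G j)) ℤ.+ sumℤ k (G D)) (ℕₚ.n∸n≡0 D)) (ℤₚ.+-identityʳ (sumℤ D (λ j → sumℤ (D ∸ j) (G j)))))) ⟩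
  sumℤ (suc D) (λ j → sumℤ (D ∸ j) (G j)) ℤ.+ sumℤ (suc D) (λ j → G j (D ∸ j))
    ≡⟨ sumℤ-+ (suc D) (λ j → sumℤ (D ∸ j) (G j)) (λ j → G j (D ∸ j)) ⟨
  sumℤ (suc D) (λ j → sumℤ (suc (D ∸ j)) (G j))
    ≡⟨ sumℤ-cong (suc D) (λ j lt → cong (λ k → sumℤ k (G j)) (sym (ℕₚ.+-∸-assoc 1 (ℕₚ.≤-pred lt)))) ⟩
  sumℤ (suc D) (λ j → sumℤ (suc D ∸ j) (G j)) ∎
  where open ≡-Reasoning

-- The partial alternating sums of a row of binomial coefficients telescope by Pascal's rule.
alternating : ∀ m t → sumℤ (suc t) (λ k → signℤ k ℤ.* + (suc m C k)) ≡ signℤ t ℤ.* + (m C t)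
alternating m zero = refl
alternating m (suc t) = trans (cong₂ (λ a b → a ℤ.+ ℤ.- signℤ t ℤ.* + b) (alternating m t) (sym (nCk+nC[k+1]≡[n+1]C[k+1] m t)))
  (trans (cong (λ z → signℤ t ℤ.* + (m C t) ℤ.+ ℤ.- signℤ t ℤ.* z) (ℤₚ.pos-+ (m C t) (m C suc t)))
    (ℤr.solve 3 (λ s a b → s ℤr.:* a ℤr.:+ (ℤr.:- s) ℤr.:* (a ℤr.:+ b) ℤr.:= (ℤr.:- s) ℤr.:* b) refl (signℤ t) (+ (m C t)) (+ (m C suc t))))

-- Substitution of `t = 1`: after exchanging the sums, each `j < d` is multiplied by a full
-- alternating sum of a row of binomial coefficients, which is 0, and only `j = d` remains.
sum-hvec : ∀ P d → sumℤ (suc d) (hvec P d) ≡ + fvec P d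
sum-hvec P d = trans (sumℤ-triangle (suc d) G) (trans (cong₂ ℤ._+_ (sumℤ-0 d λ j lt → low j lt) last) (ℤₚ.+-identityˡ _))
  where
  G : ℕ → ℕ → ℤ
  G j k = signℤ k ℤ.* + ((d ∸ j) C k) ℤ.* + fvec P j
  vanishing : ∀ m → 0 < m → sumℤ (suc m) (λ k → signℤ k ℤ.* + (m C k)) ≡ + 0
  vanishing (suc m) _ = trans (alternating m (suc m)) (trans (cong (λ k → signℤ (suc m) ℤ.* + k) (k>n⇒nCk≡0 {m} ℕₚ.≤-refl)) (ℤₚ.*-zeroʳ (signℤ (suc m))))
  low : ∀ j → j < d → sumℤ (suc d ∸ j) (G j) ≡ + 0
  low j lt = trans (cong (λ k → sumℤ k (G j)) (ℕₚ.+-∸-assoc 1 (ℕₚ.<⇒≤ lt)))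
    (trans (sumℤ-*ʳ (suc (d ∸ j)) (λ k → signℤ k ℤ.* + ((d ∸ j) C k)) (+ fvec P j)) (cong (λ t → t ℤ.* + fvec P j) (vanishing (d ∸ j) (ℕₚ.m<n⇒0<n∸m lt))))
  last : sumℤ (suc d ∸ d) (G d) ≡ + fvec P d
  last = trans (cong (λ k → sumℤ k (G d)) (ℕₚ.m+n∸n≡m 1 d)) (trans (ℤₚ.+-identityˡ _) (trans (cong (λ m → + 1 ℤ.* + (m C 0) ℤ.* + fvec P d) (ℕₚ.n∸n≡0 d)) (ℤₚ.*-identityˡ _)))

-- Evenness of the number of facets

module FacetParity {c ℓ} (F : Field c ℓ) (_≟0 : ∀ x → Dec (Field._≈_ F x (Field.0# F))) (anisotropic : Anisotropic F) (ι-injective : CharacteristicZero F)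
  (P : SimplicialPoset) (dim e i : ℕ) (e+i : e ℕ.+ i ≡ dim) (rank≤ : ∀ T → SimplicialPoset.rank P T ≤ dim)
  (plain : WeightedAcyclic.PlainExact (Field.commutativeRing F) P dim) (h0 : hvec P dim e ≡ + 0) where
  open RingTools (Field.commutativeRing F)
  open Cells (Field.commutativeRing F) P using (n; rank)
  open Integral (Field.commutativeRing F)
  open Contraction (Field.commutativeRing F) P
  private
    module Zc = Contraction ℤₚ.+-*-commutativeRing P
    module I = Cells ℤₚ.+-*-commutativeRing P
    module Bl = Links Bₚ.xor-∧-commutativeRing P
    module Bc = ContractionReduction Bₚ.xor-∧-commutativeRing P
  open Forms n using (form; form-generic; M; M≢1)

  module _ (ε : Fin n → ℤ) (support : ∀ T → rank T ≢ dim → ε T ≡ + 0) (cycle : ∀ H → I.∂ (λ _ → + 1) ε H ≡ + 0)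
           (odd : ∀ T → rank T ≡ dim → ε T ≡ + 1 ⊎ ε T ≡ ℤ.- + 1) where

    -- Rigidity holds over the field, but characteristic zero brings the vanishing back to the
    -- integers, where it can be reduced modulo 2.
    contracted-zero : ∀ W T → Zc.contracted (form W) i ε T ≡ + 0
    contracted-zero W T = ι-injective (≈-trans (ContractionReduction.ι-contracted (Field.commutativeRing F) P (form W) i ε T)
      (Rigidity.rigid F _≟0 anisotropic P dim e i e+i rank≤ plain h0 formF
        (FormsOver.generic-scaled F ι-injective P M M≢1 (suc i) (form W) ⊥ formF (λ _ → 1#) (λ _ q → Field.0≉1 F (≈-sym q)) (λ v k → ≈-sym (*-identityˡ _)) (form-generic (suc i) W))
        (contracted formF i εF)
        (λ U k → contracted-support {formF} {dim} {εF} (λ U r → ≈-reflexive (cong ι (support U r))) i U λ q → k (ℕₚ.+-cancelʳ-≡ i (rank U) e (trans q (sym e+i))))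
        (λ k lt → contracted-kernel {formF} {εF} (λ H → ≈-trans (≈-sym (ι-∂ P (λ _ → + 1) ε H)) (≈-reflexive (cong ι (cycle H)))) i k (ℕₚ.≤-pred lt))
        T))
      where
      formF : Fin n → ℕ → Carrier
      formF v k = ι (form W v k)
      εF : Fin n → Carrier
      εF U = ι (ε U)

    facet-indicator : ∀ T → 𝔹.ι (ε T) ≡ (rank T ≡ᵇ dim)
    facet-indicator T with rank T ℕₚ.≟ dim
    ... | yes r = trans (case (odd T r)) (sym (≡ᵇ-true r))
      where
      case : ε T ≡ + 1 ⊎ ε T ≡ ℤ.- + 1 → 𝔹.ι (ε T) ≡ true
      case (inj₁ q) = cong 𝔹.ι q
      case (inj₂ q) = cong 𝔹.ι q
    ... | no r = trans (cong 𝔹.ι (support T r)) (sym (Bₚ.¬-not λ q → r (≡ᵇ⇒≡ q)))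

    even-sum : 𝔹.∑ (λ T → 𝔹.ι (ε T)) ≡ false
    even-sum = Bl.links-zero⇒sum-zero i (λ T → 𝔹.ι (ε T))
      -- Facets have rank `e + i`, so they have `i` vertices to delete.
      (λ T lt → cong 𝔹.ι (support T λ r → ℕₚ.<⇒≱ lt (subst (i ≤_) (trans e+i (sym r)) (ℕₚ.m≤n+m i e))))
      (λ W H → trans (sym (Bc.Characteristic2.contracted-links refl W i (λ T → 𝔹.ι (ε T)) H)) (trans (sym (Bc.ι-contracted (form W) i ε H)) (cong 𝔹.ι (contracted-zero W H))))

    facets-even : 2 ℕᵈ.∣ fvec P dim
    facets-even with parity (λ T → rank T ≡ᵇ dim)
    ... | q , h = ℕᵈ.divides q (trans (countℕ≡# (λ T → rank T ≡ᵇ dim)) (trans h (cong (λ b → b2n b ℕ.+ q ℕ.* 2) (trans (𝔹.∑-cong λ T → sym (facet-indicator T)) even-sum))))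

theorem1p1 : ∀ {c ℓ} (K : Field c ℓ) (P : SimplicialPoset) (d : ℕ) →
    IsRank P d → IsGorensteinStarPoset K P →
    (∃ λ i → i ≤ d × hvec P d i ≡ + 0) →
    (+ 2) ∣ sumℤ (suc d) (hvec P d)
-- Divisibility by 2 is decidable, so the double negation around the cohomology and the cycle can be
-- discharged.
theorem1p1 K P d isRank gor (e , e≤d , h0) = subst ((+ 2) ∣_) (sym (sum-hvec P d)) (decidable-stable (2 ℕᵈ.∣? fvec P d)
  (Transfer.cohomology-all K P gor d isRank >>= λ cohomology → FundamentalCycle.orientation K P gor d isRank >>= λ cycle → return (conclude cohomology cycle)))
  where
  conclude : (∀ Z (j : Fin d) → Transfer.Cohomology K P gor d isRank Z (toℕ j)) → FundamentalCycle.SignedCycle K P gor d isRank → 2 ℕᵈ.∣ fvec P d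
  conclude cohomology cycle = FacetParity.facets-even ℚ-field (ℚ._≟ ℚ.0ℚ) ℚ-anisotropic ι-injective P d e (d ∸ e) (ℕₚ.m+[n∸m]≡n e≤d) (proj₂ isRank)
      (FractionCohomology.fraction-exact ℚ-field ι-injective clear-all P d cohomology) h0 C.ε C.support C.cycle C.odd
    where module C = FundamentalCycle.SignedCycle cycle
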